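{- Let $r \in \mathbb{N}$, let $\tau$ be a partition with $r$-quotient ${\boldsymbol\tau} = (\tau(0),\ldots,\tau(r-1))$, and let $\lambda/\mu$ be a skew partition of $n$. Then \[ s_\tau\,(s_{\lambda/\mu} \circ p_r) \;=\; \sum_{{\boldsymbol\nu}} \operatorname{sgn}_r\!\bigl(({\boldsymbol\nu}/{\boldsymbol\tau},\tau)^\star \big/ \tau\bigr)\; c^{\lambda}_{{\boldsymbol\nu}/{\boldsymbol\tau}\,:\,\mu}\; s_{({\boldsymbol\nu}/{\boldsymbol\tau},\tau)^\star}, \] where the sum is over all $r$-multipartitions ${\boldsymbol\nu}=(\nu(0),\ldots,\nu(r-1))$ such that ${\boldsymbol\nu}/{\boldsymbol\tau}$ is a skew $r$-multipartition of $n$, and ${\boldsymbol\nu}/{\boldsymbol\tau}:\mu$ denotes the skew $(r+1)$-multipartition $(\nu(0)/\tau(0),\ldots,\nu(r-1)/\tau(r-1),\mu/\varnothing)$.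
   Context: $s_\alpha$ and $s_{\lambda/\mu}$ are Schur and skew Schur functions, $p_r=\sum_i x_i^r$ is the power sum symmetric function, and for a symmetric function $f$ the plethysm $f\circ p_r$ is obtained by writing $f$ as a formal power series in $x_1,x_2,\ldots$ and substituting $x_i^r$ for each $x_i$. Abacus and $r$-quotients: for a partition $\alpha$ and an integer $N$ that is a multiple of $r$ with $N$ at least the number of parts of $\alpha$, the $\beta$-set of $\alpha$ is $X=\{\alpha_i+N-i: 1\le i\le N\}$ (with $\alpha_i=0$ for $i$ beyond the length); positions $p\ge 0$ are placed on runner $p \bmod r$, and $X$ is the set of positions holding beads. For runner $j$ let $\{m\ge 0: j+rm\in X\}=\{b_1>\cdots>b_{c_j}\}$; then $\alpha(j)$ is the partition with parts $b_i-(c_j-i)$. The $r$-quotient of $\alpha$ is $(\alpha(0),\ldots,\alpha(r-1))$ (independent of the choice of $N$ subject to $N$ a multiple of $r$). A skew $r$-multipartition ${\boldsymbol\nu}/{\boldsymbol\tau}$ of $n$ is a pair of $r$-tuples of partitions with $\tau(i)\subseteq\nu(i)$ for all $i$ and $\sum_i(|\nu(i)|-|\tau(i)|)=n$. The partition $({\boldsymbol\nu}/{\boldsymbol\tau},\tau)^\star$: choose $N$ a multiple of $r$ so large that, in the abacus of $\tau$ with $N$ beads, runner $j$ has $c_j$ beads with $c_j\ge$ the number of parts of $\nu(j)$ for every $j$. Then $({\boldsymbol\nu}/{\boldsymbol\tau},\tau)^\star$ is the partition whose $\beta$-set (with $N$ beads) is $\bigcup_j\{j+r(\nu(j)_i+c_j-i):1\le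 i\le c_j\}$; equivalently it is the unique partition $\nu\supseteq\tau$ with $|\nu/\tau|=rn$ obtained from the abacus of $\tau$ by moving beads down their runners so that runner $j$ represents $\nu(j)$. Sign: a border strip is a connected skew shape containing no $2\times 2$ square; an $r$-border strip is one with $r$ boxes; its height is one less than the number of rows it meets. A skew partition $\nu/\tau$ of $rn$ is $r$-decomposable if there are partitions $\tau=\sigma^{(0)}\subset\cdots\subset\sigma^{(n)}=\nu$ with each $\sigma^{(j)}/\sigma^{(j-1)}$ an $r$-border strip; then $\operatorname{sgn}_r(\nu/\tau)=\prod_j(-1)^{\mathrm{height}(\sigma^{(j)}/\sigma^{(j-1)})}$, which is independent of the choice of the $\sigma^{(j)}$; otherwise $\operatorname{sgn}_r(\nu/\tau)=0$. Generalized Littlewood--Richardson coefficients: the word of a semistandard skew tableau is obtained by reading its rows left to right, starting with the highest-numbered (lowest) row and ending with row 1; the word of an $m$-tuple of skew tableaux is the concatenation of their words in order. A word $w$ with entries in $\mathbb{N}$ is latticed if for every $k\ge1$ and every suffix of $w$, the suffix contains at least as many entries $k$ as entries $k+1$. For a skew $m$-multipartition ${\boldsymbol\sigma}/{\boldsymbol\rho}=(\sigma(1)/\rho(1),\ldots,\sigma(m)/\rho(m))$ of $n$ and a partition $\lambda$ of $n$, $c^\lambda_{{\boldsymbol\sigma}/{\boldsymbol\rho}}$ is the number of $m$-tuples $(t(1),\ldots,t(m))$ of semistandard skew tableaux with $t(i)$ of shape $\sigma(i)/\rho(i)$, total content $\sum_i\mathrm{cont}(t(i))=\lambda$, and latticed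 word. -}

module Defs where

open import Data.Nat using (ℕ; zero; suc; _+_; _*_; _∸_; _≤_; _<_; _≤ᵇ_; _<ᵇ_; _≡ᵇ_; _⊔_; NonZero)
open import Data.Nat.DivMod using (_/_; _%_)
open import Data.Bool using (Bool; true; false; _∧_; _∨_; not; if_then_else_)
open import Data.List using (List; []; _∷_; _++_; map; concatMap; length; reverse; replicate; foldr; zipWith; upTo)
open import Data.List.Relation.Unary.All using (All)
open import Data.List.Relation.Unary.Linked using (Linked)
open import Data.Product using (_×_; _,_; proj₁; proj₂)
open import Data.Fin using (Fin; toℕ)
open import Data.Vec using (Vec; tabulate; toList; lookup)
import Data.Vec as V
open import Data.Integer using (ℤ; +_; 0ℤ; 1ℤ)
import Data.Integer as Z

allᵇ : {A : Set} → (A → Bool) → List A → Bool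
allᵇ p []       = true
allᵇ p (x ∷ xs) = p x ∧ allᵇ p xs

anyᵇ : {A : Set} → (A → Bool) → List A → Bool
anyᵇ p []       = false
anyᵇ p (x ∷ xs) = p x ∨ anyᵇ p xs

filt : {A : Set} → (A → Bool) → List A → List A
filt p []       = []
filt p (x ∷ xs) = if p x then x ∷ filt p xs else filt p xs

countᵇ : {A : Set} → (A → Bool) → List A → ℕ
countᵇ p xs = length (filt p xs)

range : ℕ → List ℕ
range = upTo

rangeFromTo : ℕ → ℕ → List ℕ
rangeFromTo a b = map (λ x → a + x) (range (b ∸ a))

sumℕ : List ℕ → ℕ
sumℕ = foldr _+_ 0

sumℤ : List ℤ → ℤ
sumℤ = foldr Z._+_ 0ℤ

maxL : List ℕ → ℕ
maxL = foldr _⊔_ 0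

-- i-th entry (0-based), 0 beyond the end (partitions padded by zeros)
nth : List ℕ → ℕ → ℕ
nth []       i       = 0
nth (x ∷ xs) zero    = x
nth (x ∷ xs) (suc i) = nth xs i

eqL : List ℕ → List ℕ → Bool
eqL []       []       = true
eqL (x ∷ xs) (y ∷ ys) = (x ≡ᵇ y) ∧ eqL xs ys
eqL _        _        = false

memℕ : ℕ → List ℕ → Bool
memℕ x = anyᵇ (x ≡ᵇ_)

suffixes : {A : Set} → List A → List (List A)
suffixes []       = [] ∷ []
suffixes (x ∷ xs) = (x ∷ xs) ∷ suffixes xs

listProduct : {A : Set} → List (List A) → List (List A)
listProduct []         = [] ∷ []
listProduct (xs ∷ xss) = concatMap (λ x → map (x ∷_) (listProduct xss)) xs

vecProduct : {A : Set} {k : ℕ} → Vec (List A) k → List (Vec A k)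
vecProduct V.[]         = V.[] ∷ []
vecProduct (xs V.∷ xss) = concatMap (λ x → map (x V.∷_) (vecProduct xss)) xs

firstOr0 : List ℤ → ℤ
firstOr0 []      = 0ℤ
firstOr0 (x ∷ _) = x

negOnePow : ℕ → ℤ
negOnePow zero    = 1ℤ
negOnePow (suc k) = Z.- negOnePow k

IsPartition : List ℕ → Set
IsPartition p = Linked (λ a b → b ≤ a) p × All (λ a → 0 < a) p

size : List ℕ → ℕ
size = sumℕ

_⊆P_ : List ℕ → List ℕ → Set
μ ⊆P lam = (i : ℕ) → nth μ i ≤ nth lam i

_⊆ᵇ_ : List ℕ → List ℕ → Bool
ρ ⊆ᵇ σ = allᵇ (λ i → nth ρ i ≤ᵇ nth σ i) (range (length ρ))

decreasingᵇ : List ℕ → Bool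
decreasingᵇ []           = true
decreasingᵇ (x ∷ [])     = true
decreasingᵇ (x ∷ y ∷ xs) = (y ≤ᵇ x) ∧ decreasingᵇ (y ∷ xs)

dropZeros : List ℕ → List ℕ
dropZeros = filt (0 <ᵇ_)

subPartitions : List ℕ → List (List ℕ)
subPartitions ν =
  map dropZeros (filt decreasingᵇ (listProduct (map (λ x → range (suc x)) ν)))

-- all partitions σ ⊇ ρ with σ fitting in a box large enough to contain
-- every σ ⊇ ρ with |σ/ρ| ≤ n  (each exactly once)
supersOf : List ℕ → ℕ → List (List ℕ)
supersOf ρ n =
  filt (λ σ → (ρ ⊆ᵇ σ) ∧ (size σ ≤ᵇ size ρ + n))
       (subPartitions (replicate (length ρ + n) (nth ρ 0 + n)))

-- Cells of skew shapes and (semistandard) tableaux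
-- cell (i , j) : row i, column j, both 0-based

Cell : Set
Cell = ℕ × ℕ

cells : List ℕ → List ℕ → List Cell
cells lam μ = concatMap (λ i → map (λ j → (i , j)) (rangeFromTo (nth μ i) (nth lam i)))
                        (range (length lam))

cellEq : Cell → Cell → Bool
cellEq (i , j) (i' , j') = (i ≡ᵇ i') ∧ (j ≡ᵇ j')

memCell : Cell → List Cell → Bool
memCell c = anyᵇ (cellEq c)

Tableau : Set
Tableau = List (Cell × ℕ)

fillings : ℕ → List Cell → List Tableau
fillings k []       = [] ∷ []
fillings k (c ∷ cs) = concatMap (λ e → map ((c , e) ∷_) (fillings k cs)) (map suc (range k))

isSSYT : Tableau → Bool
isSSYT t = allᵇ (λ p → allᵇ (λ q → ok p q) t) t
  where
  ok : Cell × ℕ → Cell × ℕ → Bool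
  ok ((i , j) , e) ((i' , j') , e') =
    (not ((i ≡ᵇ i') ∧ (j <ᵇ j')) ∨ (e ≤ᵇ e')) ∧
    (not ((j ≡ᵇ j') ∧ (i <ᵇ i')) ∨ (e <ᵇ e'))

ssyts : ℕ → List ℕ → List ℕ → List Tableau
ssyts k lam μ = filt isSSYT (fillings k (cells lam μ))

content : ℕ → Tableau → List ℕ
content k t = map (λ v → countᵇ (λ c → proj₂ c ≡ᵇ v) t) (map suc (range k))

-- word: rows read left to right, from the highest-numbered row to row 1;
-- R = number of rows of the outer shape
word : ℕ → Tableau → List ℕ
word R t = concatMap (λ i → map proj₂ (filt (λ c → proj₁ (proj₁ c) ≡ᵇ i) t))
                     (reverse (range R))

-- every suffix has at least as many k's as (k+1)'s, for every k ≥ 1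
-- (checking k ≤ max entry suffices: larger k+1 never occur)
latticed : List ℕ → Bool
latticed w = allᵇ (λ s → allᵇ (λ k → countᵇ (_≡ᵇ suc (suc k)) s ≤ᵇ countᵇ (_≡ᵇ suc k) s)
                               (range (maxL w)))
                  (suffixes w)

kostka : (k : ℕ) → List ℕ → List ℕ → Vec ℕ k → ℕ
kostka k lam μ a = countᵇ (λ t → eqL (content k t) (toList a)) (ssyts k lam μ)

-- generalized Littlewood–Richardson coefficient c^λ_{σ/ρ} for the skew
-- multipartition given as a list of pairs (σ(i) , ρ(i))
lrCoeff : List ℕ → List (List ℕ × List ℕ) → ℕ
lrCoeff lam shapes = countᵇ ok tuples
  where
  ℓ : ℕ
  ℓ = length lam
  tuples : List (List (ℕ × Tableau))
  tuples = listProduct (map (λ s → map (λ t → (length (proj₁ s) , t))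
                                       (ssyts ℓ (proj₁ s) (proj₂ s))) shapes)
  totalContent : List (ℕ × Tableau) → List ℕ
  totalContent tup = foldr (zipWith _+_) (replicate ℓ 0) (map (λ p → content ℓ (proj₂ p)) tup)
  ok : List (ℕ × Tableau) → Bool
  ok tup = eqL (totalContent tup) lam ∧ latticed (concatMap (λ p → word (proj₁ p) (proj₂ p)) tup)

adjacent : Cell → Cell → Bool
adjacent (i , j) (i' , j') =
  ((i ≡ᵇ i') ∧ ((j' ≡ᵇ suc j) ∨ (j ≡ᵇ suc j'))) ∨
  ((j ≡ᵇ j') ∧ ((i' ≡ᵇ suc i) ∨ (i ≡ᵇ suc i')))

connected : List Cell → Bool
connected []       = true
connected (c ∷ cs) = allᵇ (λ d → memCell d (grow (length cs) (c ∷ []))) (c ∷ cs)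
  where
  grow : ℕ → List Cell → List Cell
  grow zero    R = R
  grow (suc k) R = grow k (filt (λ d → memCell d R ∨ anyᵇ (adjacent d) R) (c ∷ cs))

no2x2 : List Cell → Bool
no2x2 cs = not (anyᵇ (λ c → memCell (proj₁ c , suc (proj₂ c)) cs ∧
                            memCell (suc (proj₁ c) , proj₂ c) cs ∧
                            memCell (suc (proj₁ c) , suc (proj₂ c)) cs) cs)

isStrip : ℕ → List ℕ → List ℕ → Bool
isStrip r σ σ' = (σ ⊆ᵇ σ') ∧ (size σ' ≡ᵇ size σ + r) ∧ connected cs ∧ no2x2 cs
  where
  cs : List Cell
  cs = cells σ' σ

height : List Cell → ℕ
height cs = countᵇ (λ i → anyᵇ (λ c → proj₁ c ≡ᵇ i) cs) (range (suc (maxL (map proj₁ cs)))) ∸ 1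

chainSigns : ℕ → List ℕ → ℕ → List ℕ → List ℤ
chainSigns r ν zero    σ = if eqL σ ν then 1ℤ ∷ [] else []
chainSigns r ν (suc k) σ =
  concatMap (λ σ' → if isStrip r σ σ'
                      then map (Z._*_ (negOnePow (height (cells σ' σ)))) (chainSigns r ν k σ')
                      else [])
            (subPartitions ν)

-- sgn_r(ν/τ): the sign of (the first found) decomposition into r-border
-- strips, or 0 if ν/τ is not r-decomposable
sgnR : (r : ℕ) .{{_ : NonZero r}} → List ℕ → List ℕ → ℤ
sgnR r ν τ = firstOr0 (chainSigns r ν ((size ν ∸ size τ) / r) τ)

beta : List ℕ → ℕ → List ℕ
beta α N = map (λ i → nth α i + N ∸ suc i) (range N)

runner : (r : ℕ) .{{_ : NonZero r}} → ℕ → List ℕ → List ℕ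
runner r j X = map (_/ r) (filt (λ x → x % r ≡ᵇ j) X)

-- the partition of a finite set B of naturals (β-set):
-- elements b₁ > ⋯ > b_c give parts b_i - (c - i) = b_i - #{b ∈ B : b < b_i}
fromBeta : List ℕ → List ℕ
fromBeta B = dropZeros (concatMap (λ p → if memℕ p B then (p ∸ countᵇ (_<ᵇ p) B) ∷ [] else [])
                                  (reverse (range (suc (maxL B)))))

quotient : (r : ℕ) .{{_ : NonZero r}} → List ℕ → Vec (List ℕ) r
quotient r α = tabulate (λ j → fromBeta (runner r (toℕ j) (beta α (r * length α))))

-- (ν/τ, τ)⋆, computed with N = r · (ℓ(τ) + Σⱼ ℓ(ν(j))) beads, which
-- guarantees c_j ≥ ℓ(ν(j)) on every runner j
star : (r : ℕ) .{{_ : NonZero r}} → List ℕ → Vec (List ℕ) r → List ℕ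
star r τ ν = fromBeta (concat′ (tabulate pos))
  where
  N : ℕ
  N = r * (length τ + sumℕ (toList (V.map length ν)))
  X : List ℕ
  X = beta τ N
  pos : Fin r → List ℕ
  pos j = let c = length (runner r (toℕ j) X) in
          map (λ i → toℕ j + r * (nth (lookup ν j) i + c ∸ suc i)) (range c)
  concat′ : {k : ℕ} → Vec (List ℕ) k → List ℕ
  concat′ V.[]       = []
  concat′ (x V.∷ xs) = x ++ concat′ xs

multiSupers : {k : ℕ} → Vec (List ℕ) k → ℕ → List (Vec (List ℕ) k)
multiSupers τs n =
  filt (λ ν → sumℕ (toList (V.zipWith (λ a b → size a ∸ size b) ν τs)) ≡ᵇ n)
       (vecProduct (V.map (λ t → supersOf t n) τs))

-- Polynomials in m variables x₁..x_m over ℤ, as coefficient functions: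
-- f a = coefficient of x^a.  A symmetric-function identity holds iff
-- it holds in m variables for every m.

Poly : ℕ → Set
Poly m = Vec ℕ m → ℤ

belowVec : {m : ℕ} → Vec ℕ m → List (Vec ℕ m)
belowVec V.[]       = V.[] ∷ []
belowVec (x V.∷ xs) = concatMap (λ b → map (b V.∷_) (belowVec xs)) (range (suc x))

_*P_ : {m : ℕ} → Poly m → Poly m → Poly m
(f *P g) a = sumℤ (map (λ b → f b Z.* g (V.zipWith _∸_ a b)) (belowVec a))

-- f ∘ p_r : substitute x_i^r for x_i
plethP : {m : ℕ} (r : ℕ) .{{_ : NonZero r}} → Poly m → Poly m
plethP r f a = if allᵇ (λ x → x % r ≡ᵇ 0) (toList a) then f (V.map (_/ r) a) else 0ℤ

schurP : (m : ℕ) → List ℕ → List ℕ → Poly m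
schurP m lam μ a = + kostka m lam μ a

rhsP : (m : ℕ) (r : ℕ) .{{_ : NonZero r}} → List ℕ → List ℕ → List ℕ → ℕ → Poly m
rhsP m r τ lam μ n a =
  sumℤ (map (λ ν → let s = star r τ ν in
                   sgnR r s τ Z.*
                   ((+ lrCoeff lam (toList (V.zipWith _,_ ν τs) ++ ((μ , []) ∷ []))) Z.*
                    schurP m s [] a))
            (multiSupers τs n))
  where
  τs : Vec (List ℕ) r
  τs = quotient r τ

module Submission where

-- Multiply both sides by the alternant a_δ in M variables, M a large multiple of r. By the bialternant formula a_δ s_τ is the alternant
-- of the β-set of τ with M beads; sorting the beads by runners costs the sign of a permutation. The product of an alternant a_e and
-- s_{λ/μ} ∘ p_r is the sum of a_{e + r · content t} over the semistandard tableaux t of shape λ/μ, that is, the content of t moves beads along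
-- their runners. Stembridge's involution cancels the tableaux for which two neighbouring beads of a runner collide on the way. The
-- matrix of row–letter multiplicities of a remaining t, transposed, is a tuple of tableaux of shapes ν(j)/τ(j), and the inequalities
-- between the rows of t say that its word, followed by that of the tableau of shape μ and content μ, is latticed; so there are c^λ_{ν/τ:μ}
-- of them for each ν. An r-border strip moves one bead by r positions and its height is the number of beads passed, so
-- the two permutation signs multiply to sgn_r. Finally a_δ is cancelled, and the variables beyond the first m get exponent 0.

-- Two definitions shape the proof. `sgnR` takes the head of a list of signs of chains and is 0 when
-- the list is empty, so it must be shown both that all chains have the same sign and that one
-- exists. The first holds because a sign is a product of two sorting signs, the second by moving
-- beads one at a time. `lrCoeff` counts words, whereas the cancellation yields inequalities between
-- row contents. Both become interlacing inequalities of Gelfand-Tsetlin patterns: a matrix of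
-- multiplicities gives a tableau of shape λ/μ by partial sums in one direction and a tuple of shape
-- ν/τ by partial sums in the other, and semistandardness of each is the condition imposed on the
-- other. Patterns also make the involutions simple. Two columns confine the entries of the column
-- between them to independent intervals, in which these can be reflected. This single reflection
-- gives the symmetry of Schur functions and Stembridge's cancellation, hence also, for r = 1 and τ
-- empty, the bialternant formula. The number of beads must be a multiple of r for the runners to
-- show the r-quotient, and so large that it serves all ν at once.

open import Defs
open import Data.Nat
open import Data.Nat.Properties
open import Data.Nat.DivMod using (_/_; _%_)
import Data.Nat.DivMod as DM
open import Data.Integer using (ℤ; -[1+_]; 0ℤ; 1ℤ) renaming (+_ to pos; _+_ to _+ᶻ_; _*_ to _*ᶻ_; -_ to -ᶻ_)
import Data.Integer.Properties as ℤ
open import Data.Bool using (Bool; true; false; _∧_; _∨_; not; if_then_else_; T)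
open import Data.List using (List; []; _∷_; _++_; map; concatMap; length; foldr; reverse; replicate; zipWith; upTo; applyUpTo)
open import Data.List.Properties using (∷-injectiveˡ; ∷-injectiveʳ; map-++; ++-assoc; ++-identityʳ; length-map; length-++; map-∘; map-cong; map-id; map-upTo; length-applyUpTo; map-applyUpTo; length-upTo; length-replicate; unfold-reverse; reverse-++; reverse-involutive)
open import Data.List.Membership.Propositional using (_∈_)
import Data.List.Membership.Propositional.Properties as Membership
open Membership using (∈-++⁺ˡ; ∈-++⁺ʳ; ∈-++⁻; ∈-map⁺; ∈-applyUpTo⁺)
open import Data.List.Relation.Unary.Any using (here; there)
open import Data.List.Relation.Unary.All as All using (All; []; _∷_) renaming (lookup to All-∈)
open import Data.List.Relation.Unary.AllPairs using (AllPairs; []; _∷_)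
open import Data.List.Relation.Unary.AllPairs.Properties using () renaming (applyUpTo⁺₁ to AllPairs-applyUpTo)
open import Data.List.Relation.Unary.Linked using (Linked; []; [-]; _∷_)
open import Data.Product using (_×_; _,_; proj₁; proj₂; ∃-syntax; Σ-syntax)
open import Data.Sum using (_⊎_; inj₁; inj₂)
open import Data.Empty using (⊥; ⊥-elim)
open import Data.Unit using (⊤; tt)
open import Data.Fin as Fin using (Fin; toℕ)
open import Data.Vec using (Vec; lookup; tabulate; toList)
import Data.Vec as V
import Data.Vec.Properties as VP
open import Data.Nat.Solver using (module +-*-Solver)
open import Data.Integer.Solver renaming (module +-*-Solver to ℤ-Solver)
open import Relation.Nullary using (¬_; Dec; yes; no)
open import Relation.Binary.Definitions using (tri<; tri≈; tri>)
open import Relation.Binary.PropositionalEquality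
open import Function using (_∘_; id; case_of_)
open +-*-Solver using () renaming (solve to solveₙ; _:=_ to _:=ₙ_; _:+_ to _:+ₙ_; _:*_ to _:*ₙ_)
open ℤ-Solver using () renaming (solve to solveᶻ; _:=_ to _:=ᶻ_; _:+_ to _:+ᶻ_; _:*_ to _:*ᶻ_; :-_ to :-ᶻ_)

-- Linear arithmetic over ℕ

infixl 6 _:+_
infixl 7 _:*_
infix 4 _:≤_ _:≡_ _:<_
infix 3 ⊢_
infixr 2 _⇒_

data LExp : Set where
  # : ℕ → LExp
  atom : ℕ → LExp
  _:+_ : LExp → LExp → LExp
  _:*_ : ℕ → LExp → LExp

data Fact : Set where
  _:≤_ _:≡_ : LExp → LExp → Fact
  absurd : Fact

_:<_ : LExp → LExp → Fact
a :< b = # 1 :+ a :≤ b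

data Problem : Set where
  ⊢_  : Fact → Problem
  _⇒_ : Fact → Problem → Problem

Env : Set
Env = List ℕ

var : ℕ → Env → ℕ
var i       []      = 0
var zero    (x ∷ _) = x
var (suc i) (_ ∷ ρ) = var i ρ

⟦_⟧ : LExp → Env → ℕ
⟦ # k ⟧    ρ = k
⟦ atom i ⟧ ρ = var i ρ
⟦ e :+ f ⟧ ρ = ⟦ e ⟧ ρ + ⟦ f ⟧ ρ
⟦ k :* e ⟧ ρ = k * ⟦ e ⟧ ρ

Holds : Fact → Env → Set
Holds (e :≤ f) ρ = ⟦ e ⟧ ρ ≤ ⟦ f ⟧ ρ
Holds (e :≡ f) ρ = ⟦ e ⟧ ρ ≡ ⟦ f ⟧ ρ
Holds absurd   ρ = ⊥

Solves : Problem → Env → Set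
Solves (⊢ f)   ρ = Holds f ρ
Solves (f ⇒ p) ρ = Holds f ρ → Solves p ρ

-- A linear form with natural coefficients, constant term first.
Lin : Set
Lin = List ℕ

dot : List ℕ → Env → ℕ
dot (c ∷ cs) (x ∷ ρ) = c * x + dot cs ρ
dot _        _       = 0

eval : Lin → Env → ℕ
eval l ρ = dot l (1 ∷ ρ)

addL : List ℕ → List ℕ → List ℕ
addL []       l        = l
addL (c ∷ cs) []       = c ∷ cs
addL (c ∷ cs) (d ∷ ds) = c + d ∷ addL cs ds

scaleL : ℕ → List ℕ → List ℕ
scaleL k = map (k *_)

unitL : ℕ → List ℕ
unitL zero    = 1 ∷ []
unitL (suc i) = 0 ∷ unitL i

norm : LExp → Lin
norm (# k)    = k ∷ []
norm (atom i)    = 0 ∷ unitL i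
norm (e :+ f) = addL (norm e) (norm f)
norm (k :* e) = scaleL k (norm e)

dot-add : ∀ l l′ ρ → dot (addL l l′) ρ ≡ dot l ρ + dot l′ ρ
dot-add []       l′       ρ       = refl
dot-add (c ∷ cs) []       []      = refl
dot-add (c ∷ cs) []       (x ∷ ρ) = sym (+-identityʳ _)
dot-add (c ∷ cs) (d ∷ ds) []      = refl
dot-add (c ∷ cs) (d ∷ ds) (x ∷ ρ) rewrite dot-add cs ds ρ = eq c d x (dot cs ρ) (dot ds ρ)
  where eq : ∀ c d x p q → (c + d) * x + (p + q) ≡ c * x + p + (d * x + q)
        eq = solveₙ 5 (λ c d x p q → (c :+ₙ d) :*ₙ x :+ₙ (p :+ₙ q) :=ₙ c :*ₙ x :+ₙ p :+ₙ (d :*ₙ x :+ₙ q)) refl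

dot-scale : ∀ k l ρ → dot (scaleL k l) ρ ≡ k * dot l ρ
dot-scale k []       ρ       = sym (*-zeroʳ k)
dot-scale k (c ∷ cs) []      = sym (*-zeroʳ k)
dot-scale k (c ∷ cs) (x ∷ ρ) rewrite dot-scale k cs ρ = eq k c x (dot cs ρ)
  where eq : ∀ k c x p → k * c * x + k * p ≡ k * (c * x + p)
        eq = solveₙ 4 (λ k c x p → k :*ₙ c :*ₙ x :+ₙ k :*ₙ p :=ₙ k :*ₙ (c :*ₙ x :+ₙ p)) refl

dot-unit : ∀ i ρ → dot (unitL i) ρ ≡ var i ρ
dot-unit zero    []      = refl
dot-unit zero    (x ∷ ρ) = trans (+-identityʳ _) (+-identityʳ _)
dot-unit (suc i) []      = refl
dot-unit (suc i) (x ∷ ρ) = dot-unit i ρ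

norm-sound : ∀ e ρ → eval (norm e) ρ ≡ ⟦ e ⟧ ρ
norm-sound (# k)    ρ = trans (+-identityʳ _) (*-identityʳ k)
norm-sound (atom i)    ρ = dot-unit i ρ
norm-sound (e :+ f) ρ = trans (dot-add (norm e) (norm f) (1 ∷ ρ)) (cong₂ _+_ (norm-sound e ρ) (norm-sound f ρ))
norm-sound (k :* e) ρ = trans (dot-scale k (norm e) (1 ∷ ρ)) (cong (k *_) (norm-sound e ρ))

Ineq : Set
Ineq = Lin × Lin

Sat : Env → List Ineq → Set
Sat ρ []             = ⊤
Sat ρ ((l , r) ∷ is) = (eval l ρ ≤ eval r ρ) × Sat ρ is

combine : List ℕ → List Ineq → Ineq
combine (k ∷ ks) ((l , r) ∷ is) with combine ks is
... | l′ , r′ = addL (scaleL k l) l′ , addL (scaleL k r) r′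
combine _ _ = [] , []

combine-sound : ∀ ρ ks is → Sat ρ is → eval (proj₁ (combine ks is)) ρ ≤ eval (proj₂ (combine ks is)) ρ
combine-sound ρ []       is             s = z≤n
combine-sound ρ (k ∷ ks) []             s = z≤n
combine-sound ρ (k ∷ ks) ((l , r) ∷ is) (h , s) = begin
  eval (addL (scaleL k l) l′) ρ     ≡⟨ trans (dot-add (scaleL k l) l′ (1 ∷ ρ)) (cong (_+ eval l′ ρ) (dot-scale k l (1 ∷ ρ))) ⟩
  k * eval l ρ + eval l′ ρ          ≤⟨ +-mono-≤ (*-monoʳ-≤ k h) (combine-sound ρ ks is s) ⟩
  k * eval r ρ + eval r′ ρ          ≡⟨ sym (trans (dot-add (scaleL k r) r′ (1 ∷ ρ)) (cong (_+ eval r′ ρ) (dot-scale k r (1 ∷ ρ)))) ⟩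
  eval (addL (scaleL k r) r′) ρ     ∎
  where open ≤-Reasoning
        l′ = proj₁ (combine ks is)
        r′ = proj₂ (combine ks is)

dominates : List ℕ → List ℕ → Bool
dominates _        []       = true
dominates []       (d ∷ ds) = (d ≤ᵇ 0) ∧ dominates [] ds
dominates (c ∷ cs) (d ∷ ds) = (d ≤ᵇ c) ∧ dominates cs ds

T-∧ : ∀ a b → T (a ∧ b) → T a × T b
T-∧ true b t = tt , t

dominates-sound : ∀ l r ρ → T (dominates l r) → dot r ρ ≤ dot l ρ
dominates-sound l        []       ρ       t = z≤n
dominates-sound []       (d ∷ ds) []      t = z≤n
dominates-sound []       (d ∷ ds) (x ∷ ρ) t with T-∧ (d ≤ᵇ 0) _ t
... | t₁ , t₂ with ≤ᵇ⇒≤ d 0 t₁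
... | z≤n = dominates-sound [] ds ρ t₂
dominates-sound (c ∷ cs) (d ∷ ds) []      t = z≤n
dominates-sound (c ∷ cs) (d ∷ ds) (x ∷ ρ) t with T-∧ (d ≤ᵇ c) _ t
... | t₁ , t₂ = +-mono-≤ (*-monoˡ-≤ x (≤ᵇ⇒≤ d c t₁)) (dominates-sound cs ds ρ t₂)

-- Atoms stand for natural numbers, so `l ≤ r` is impossible as soon as every coefficient of `l` is
-- at least that of `1 + r`. A surplus on the left is harmless.
contradictory : Ineq → Bool
contradictory ([]    , r) = false
contradictory (c ∷ l , r) = dominates (c ∷ l) (addL (1 ∷ []) r)

contradictory-sound : ∀ i ρ → T (contradictory i) → eval (proj₁ i) ρ ≤ eval (proj₂ i) ρ → ⊥
contradictory-sound (c ∷ l , r) ρ t h = <-irrefl refl (≤-trans step h)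
  where step : suc (eval r ρ) ≤ eval (c ∷ l) ρ
        step = subst (_≤ eval (c ∷ l) ρ) (dot-add (1 ∷ []) r (1 ∷ ρ)) (dominates-sound (c ∷ l) (addL (1 ∷ []) r) (1 ∷ ρ) t)

-- The multipliers of a Farkas certificate are searched for by Fourier–Motzkin elimination;
-- only the certificate is verified.
record Row : Set where
  constructor mkRow
  field coeffs : List ℤ
        const  : ℤ
        mults  : List ℕ

-- The inequality `l ≤ r` is searched in the form `r - l ≥ 0`; a row therefore stands for a form
-- that is at least 0.
diffL : List ℕ → List ℕ → List ℤ
diffL []       []       = []
diffL []       (d ∷ ds) = pos d ∷ diffL [] ds
diffL (c ∷ cs) []       = (-ᶻ (pos c)) ∷ diffL cs []
diffL (c ∷ cs) (d ∷ ds) = (pos d +ᶻ (-ᶻ (pos c))) ∷ diffL cs ds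

addZ : List ℤ → List ℤ → List ℤ
addZ []       l        = l
addZ (c ∷ cs) []       = c ∷ cs
addZ (c ∷ cs) (d ∷ ds) = (c +ᶻ d) ∷ addZ cs ds

toRow : Ineq → List ℕ → Row
toRow (l , r) ms with diffL l r
... | []     = mkRow [] (pos 0) ms
... | c ∷ cs = mkRow cs c ms

toRows : List ℕ → List Ineq → List Row
toRows pre []       = []
toRows pre (i ∷ is) = toRow i (pre ++ 1 ∷ []) ∷ toRows (pre ++ 0 ∷ []) is

nonNeg : ℤ → Bool
nonNeg (pos _)  = true
nonNeg -[1+ _ ] = false

isZero : ℤ → Bool
isZero (pos 0) = true
isZero _       = false

absℕ : ℤ → ℕ
absℕ (pos n)  = n
absℕ -[1+ n ] = suc n

headZ : List ℤ → ℤ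
headZ []      = pos 0
headZ (x ∷ _) = x

tailZ : List ℤ → List ℤ
tailZ []       = []
tailZ (_ ∷ xs) = xs

dropHead : Row → Row
dropHead (mkRow cs c ms) = mkRow (tailZ cs) c ms

resolve : Row → Row → Row
resolve (mkRow ps p ms) (mkRow qs q ns) =
  let a = absℕ (headZ qs) ; b = absℕ (headZ ps) in
  mkRow (tailZ (addZ (map (pos a *ᶻ_) ps) (map (pos b *ᶻ_) qs))) ((pos a *ᶻ p) +ᶻ (pos b *ᶻ q)) (addL (scaleL a ms) (scaleL b ns))

coeff : Row → ℤ
coeff r = headZ (Row.coeffs r)

-- Over ℕ a form without negative coefficients is at least 0 anyway, so its row carries no
-- information. The opposite extreme is `closed`: a form that is negative for all values of the
-- atoms.
useful : Row → Bool
useful (mkRow cs c _) = not (nonNeg c ∧ allᵇ nonNeg cs)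

closed : Row → Bool
closed (mkRow cs c _) = not (nonNeg c) ∧ allᵇ (λ z → isZero z ∨ not (nonNeg z)) cs

search : ℕ → List Row → List ℕ
search fuel rs with filt closed rs
... | mkRow _ _ ms ∷ _ = ms
search zero       rs | [] = []
search (suc fuel) rs | [] = search fuel (filt useful
  -- A row in which the eliminated atom has a coefficient at most 0 stays true without it, because
  -- the atom is a natural number. This accounts for resolution with `0 ≤ x`.
  (map dropHead (filt (λ r → isZero (coeff r) ∨ not (nonNeg (coeff r))) rs) ++
   concatMap (λ p → map (resolve p) (filt (λ r → not (nonNeg (coeff r))) rs))
             (filt (λ r → nonNeg (coeff r) ∧ not (isZero (coeff r))) rs)))

refutes : ℕ → List Ineq → Bool
refutes n is = contradictory (combine (search n (toRows [] is)) is)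

refutes-sound : ∀ n is ρ → T (refutes n is) → Sat ρ is → ⊥
refutes-sound n is ρ t s = contradictory-sound (combine (search n (toRows [] is)) is) ρ t (combine-sound ρ (search n (toRows [] is)) is s)

decide : ℕ → List Ineq → Problem → Bool
decide n is (⊢ (e :≤ f))   = refutes n ((norm (# 1 :+ f) , norm e) ∷ is)
decide n is (⊢ (e :≡ f))   = refutes n ((norm (# 1 :+ f) , norm e) ∷ is) ∧ refutes n ((norm (# 1 :+ e) , norm f) ∷ is)
decide n is (⊢ absurd)     = refutes n is
decide n is (e :≤ f ⇒ p)   = decide n ((norm e , norm f) ∷ is) p
decide n is (e :≡ f ⇒ p)   = decide n ((norm e , norm f) ∷ (norm f , norm e) ∷ is) p
decide n is (absurd ⇒ p)   = true

norm-≤ : ∀ e f ρ → ⟦ e ⟧ ρ ≤ ⟦ f ⟧ ρ → eval (norm e) ρ ≤ eval (norm f) ρ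
norm-≤ e f ρ h = subst₂ _≤_ (sym (norm-sound e ρ)) (sym (norm-sound f ρ)) h

refute-≤ : ∀ n is e f ρ → T (refutes n ((norm (# 1 :+ f) , norm e) ∷ is)) → Sat ρ is → ⟦ e ⟧ ρ ≤ ⟦ f ⟧ ρ
refute-≤ n is e f ρ t s = ≮⇒≥ λ lt → refutes-sound n ((norm (# 1 :+ f) , norm e) ∷ is) ρ t (norm-≤ (# 1 :+ f) e ρ lt , s)

decide-sound : ∀ n is p ρ → T (decide n is p) → Sat ρ is → Solves p ρ
decide-sound n is (⊢ (e :≤ f)) ρ t s = refute-≤ n is e f ρ t s
decide-sound n is (⊢ (e :≡ f)) ρ t s with T-∧ (refutes n ((norm (# 1 :+ f) , norm e) ∷ is)) _ t
... | t₁ , t₂ = ≤-antisym (refute-≤ n is e f ρ t₁ s) (refute-≤ n is f e ρ t₂ s)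
decide-sound n is (⊢ absurd)   ρ t s = refutes-sound n is ρ t s
decide-sound n is (e :≤ f ⇒ p) ρ t s h = decide-sound n ((norm e , norm f) ∷ is) p ρ t (norm-≤ e f ρ h , s)
decide-sound n is (e :≡ f ⇒ p) ρ t s h =
  decide-sound n ((norm e , norm f) ∷ (norm f , norm e) ∷ is) p ρ t (norm-≤ e f ρ (≤-reflexive h) , norm-≤ f e ρ (≤-reflexive (sym h)) , s)
decide-sound n is (absurd ⇒ p) ρ t s ()

Arrows : Set → ℕ → Set → Set
Arrows A zero    B = B
Arrows A (suc n) B = A → Arrows A n B

applyVars : ∀ n → ℕ → Arrows LExp n Problem → Problem
applyVars zero    i p = p
applyVars (suc n) i p = applyVars n (suc i) (p (atom i))

ForAll : (n : ℕ) → (Env → Set) → Set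
ForAll zero    P = P []
ForAll (suc n) P = ∀ x → ForAll n (λ ρ → P (x ∷ ρ))

introduce : (n : ℕ) {P : Env → Set} → (∀ ρ → P ρ) → ForAll n P
introduce zero    h = h []
introduce (suc n) h x = introduce n (λ ρ → h (x ∷ ρ))

-- Each round of elimination removes one variable, so the number `n` of quantified variables is also
-- the fuel of the search. The implicit argument reduces to the unit type once the certificates
-- check, and is then filled in automatically.
lia : ∀ n (p : Arrows LExp n Problem) → {T (decide n [] (applyVars n 0 p))} → ForAll n (Solves (applyVars n 0 p))
lia n p {t} = introduce n λ ρ → decide-sound n [] (applyVars n 0 p) ρ t tt

-- Finite sums and lists without repetitions

𝟙 : Bool → ℤ
𝟙 true  = 1ℤ
𝟙 false = 0ℤ

≡→T : ∀ {b} → b ≡ true → T b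
≡→T refl = tt

T→≡ : ∀ {b} → T b → b ≡ true
T→≡ {true} _ = refl

¬true : ∀ {b} → ¬ b ≡ true → b ≡ false
¬true {true}  n = ⊥-elim (n refl)
¬true {false} n = refl

∧-elim : ∀ {a b} → a ∧ b ≡ true → a ≡ true × b ≡ true
∧-elim {true} {true} _ = refl , refl

∧-intro : ∀ {a b} → a ≡ true → b ≡ true → a ∧ b ≡ true
∧-intro refl refl = refl

∨-elim : ∀ {a b} → a ∨ b ≡ true → a ≡ true ⊎ b ≡ true
∨-elim {true}  _ = inj₁ refl
∨-elim {false} e = inj₂ e

∨-introʳ : ∀ a {b} → b ≡ true → a ∨ b ≡ true
∨-introʳ true  _ = refl
∨-introʳ false e = e

∨-introˡ : ∀ {a b} → a ≡ true → a ∨ b ≡ true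
∨-introˡ refl = refl

not-elim : ∀ {a} → not a ≡ true → ¬ a ≡ true
not-elim {false} _ ()

bool-ext : ∀ {a b} → (a ≡ true → b ≡ true) → (b ≡ true → a ≡ true) → a ≡ b
bool-ext {true}  {b}     f g = sym (f refl)
bool-ext {false} {true}  f g = g refl
bool-ext {false} {false} f g = refl

true-or-false : ∀ b → b ≡ true ⊎ b ≡ false
true-or-false true  = inj₁ refl
true-or-false false = inj₂ refl

≤ᵇ-true : ∀ {m n} → m ≤ n → (m ≤ᵇ n) ≡ true
≤ᵇ-true h = T→≡ (≤⇒≤ᵇ h)

≤ᵇ-sound : ∀ {m n} → (m ≤ᵇ n) ≡ true → m ≤ n
≤ᵇ-sound {m} {n} e = ≤ᵇ⇒≤ m n (≡→T e)

<ᵇ-true : ∀ {m n} → m < n → (m <ᵇ n) ≡ true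
<ᵇ-true h = T→≡ (<⇒<ᵇ h)

<ᵇ-sound : ∀ {m n} → (m <ᵇ n) ≡ true → m < n
<ᵇ-sound {m} {n} e = <ᵇ⇒< m n (≡→T e)

<ᵇ-false : ∀ {m n} → n ≤ m → (m <ᵇ n) ≡ false
<ᵇ-false h = ¬true (λ e → <⇒≱ (<ᵇ-sound e) h)

≡ᵇ-refl : ∀ m → (m ≡ᵇ m) ≡ true
≡ᵇ-refl m = T→≡ (≡⇒≡ᵇ m m refl)

≡ᵇ-sound : ∀ {m n} → (m ≡ᵇ n) ≡ true → m ≡ n
≡ᵇ-sound {m} {n} e = ≡ᵇ⇒≡ m n (≡→T e)

≡ᵇ-false : ∀ {m n} → ¬ m ≡ n → (m ≡ᵇ n) ≡ false
≡ᵇ-false h = ¬true (λ e → h (≡ᵇ-sound e))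

eqL-refl : ∀ l → eqL l l ≡ true
eqL-refl []      = refl
eqL-refl (x ∷ l) = ∧-intro (≡ᵇ-refl x) (eqL-refl l)

eqL-sound : ∀ l l′ → eqL l l′ ≡ true → l ≡ l′
eqL-sound []      []        e = refl
eqL-sound (x ∷ l) (y ∷ l′) e with ∧-elim {x ≡ᵇ y} e
... | p , q = cong₂ _∷_ (≡ᵇ-sound p) (eqL-sound l l′ q)

eqL-false : ∀ {l l′} → ¬ l ≡ l′ → eqL l l′ ≡ false
eqL-false h = ¬true (λ e → h (eqL-sound _ _ e))

∈-map⁻ : {A B : Set} (f : A → B) {y : B} (xs : List A) → y ∈ map f xs → ∃[ x ] (x ∈ xs × y ≡ f x)
∈-map⁻ f xs = Membership.∈-map⁻ f

∈-concatMap⁺ : {A B : Set} (f : A → List B) {x : A} {y : B} {xs : List A} → x ∈ xs → y ∈ f x → y ∈ concatMap f xs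
∈-concatMap⁺ f {xs = x ∷ xs} (here refl) j = ∈-++⁺ˡ j
∈-concatMap⁺ f {xs = x ∷ xs} (there i)   j = ∈-++⁺ʳ (f x) (∈-concatMap⁺ f i j)

∈-concatMap⁻ : {A B : Set} (f : A → List B) {y : B} (xs : List A) → y ∈ concatMap f xs → ∃[ x ] (x ∈ xs × y ∈ f x)
∈-concatMap⁻ f (x ∷ xs) i with ∈-++⁻ (f x) i
... | inj₁ j = x , here refl , j
... | inj₂ j with ∈-concatMap⁻ f xs j
... | z , k , l = z , there k , l

∈-filt⁺ : {A : Set} (p : A → Bool) {x : A} {xs : List A} → x ∈ xs → p x ≡ true → x ∈ filt p xs
∈-filt⁺ p {xs = x ∷ xs} (here refl) e rewrite e = here refl
∈-filt⁺ p {xs = y ∷ xs} (there i)   e with p y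
... | true  = there (∈-filt⁺ p i e)
... | false = ∈-filt⁺ p i e

∈-filt⁻ : {A : Set} (p : A → Bool) {x : A} (xs : List A) → x ∈ filt p xs → x ∈ xs × p x ≡ true
∈-filt⁻ p (y ∷ xs) i with p y in e
∈-filt⁻ p (y ∷ xs) (here refl) | true = here refl , e
∈-filt⁻ p (y ∷ xs) (there i)   | true with ∈-filt⁻ p xs i
... | j , q = there j , q
∈-filt⁻ p (y ∷ xs) i           | false with ∈-filt⁻ p xs i
... | j , q = there j , q

∈-applyUpTo⁻ : {A : Set} (f : ℕ → A) {x : A} (n : ℕ) → x ∈ applyUpTo f n → ∃[ i ] (i < n × x ≡ f i)
∈-applyUpTo⁻ f n = Membership.∈-applyUpTo⁻ f

∈-range⁺ : ∀ {i n} → i < n → i ∈ range n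
∈-range⁺ = ∈-applyUpTo⁺ id

∈-range⁻ : ∀ {i} n → i ∈ range n → i < n
∈-range⁻ n = Membership.∈-upTo⁻

allᵇ-sound : {A : Set} (p : A → Bool) (xs : List A) → allᵇ p xs ≡ true → ∀ {x} → x ∈ xs → p x ≡ true
allᵇ-sound p (x ∷ xs) e (here refl) = proj₁ (∧-elim e)
allᵇ-sound p (x ∷ xs) e (there i)   = allᵇ-sound p xs (proj₂ (∧-elim {p x} e)) i

allᵇ-true : {A : Set} (p : A → Bool) (xs : List A) → (∀ {x} → x ∈ xs → p x ≡ true) → allᵇ p xs ≡ true
allᵇ-true p []       h = refl
allᵇ-true p (x ∷ xs) h = ∧-intro (h (here refl)) (allᵇ-true p xs (h ∘ there))

anyᵇ-sound : {A : Set} (p : A → Bool) (xs : List A) → anyᵇ p xs ≡ true → ∃[ x ] (x ∈ xs × p x ≡ true)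
anyᵇ-sound p (x ∷ xs) e with ∨-elim {p x} e
... | inj₁ q = x , here refl , q
... | inj₂ q with anyᵇ-sound p xs q
... | y , i , q′ = y , there i , q′

anyᵇ-true : {A : Set} (p : A → Bool) {x : A} {xs : List A} → x ∈ xs → p x ≡ true → anyᵇ p xs ≡ true
anyᵇ-true p {xs = x ∷ xs} (here refl) e = ∨-introˡ e
anyᵇ-true p {xs = x ∷ xs} (there i)   e = ∨-introʳ (p x) (anyᵇ-true p i e)

∑ : {A : Set} → List A → (A → ℤ) → ℤ
∑ xs f = sumℤ (map f xs)

∑-cong : {A : Set} (xs : List A) {f g : A → ℤ} → (∀ {x} → x ∈ xs → f x ≡ g x) → ∑ xs f ≡ ∑ xs g
∑-cong []       h = refl
∑-cong (x ∷ xs) h = cong₂ _+ᶻ_ (h (here refl)) (∑-cong xs (h ∘ there))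

∑-0 : {A : Set} (xs : List A) → ∑ xs (λ _ → 0ℤ) ≡ 0ℤ
∑-0 []       = refl
∑-0 (x ∷ xs) = trans (ℤ.+-identityˡ _) (∑-0 xs)

∑-zero : {A : Set} (xs : List A) {f : A → ℤ} → (∀ {x} → x ∈ xs → f x ≡ 0ℤ) → ∑ xs f ≡ 0ℤ
∑-zero xs h = trans (∑-cong xs h) (∑-0 xs)

interchange : ∀ a b c d → (a +ᶻ b) +ᶻ (c +ᶻ d) ≡ (a +ᶻ c) +ᶻ (b +ᶻ d)
interchange = solveᶻ 4 (λ a b c d → (a :+ᶻ b) :+ᶻ (c :+ᶻ d) :=ᶻ (a :+ᶻ c) :+ᶻ (b :+ᶻ d)) refl

∑-+ : {A : Set} (xs : List A) (f g : A → ℤ) → ∑ xs (λ x → f x +ᶻ g x) ≡ ∑ xs f +ᶻ ∑ xs g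
∑-+ []       f g = refl
∑-+ (x ∷ xs) f g = trans (cong ((f x +ᶻ g x) +ᶻ_) (∑-+ xs f g)) (interchange (f x) (g x) (∑ xs f) (∑ xs g))

∑-* : {A : Set} (c : ℤ) (xs : List A) (f : A → ℤ) → ∑ xs (λ x → c *ᶻ f x) ≡ c *ᶻ ∑ xs f
∑-* c []       f = sym (ℤ.*-zeroʳ c)
∑-* c (x ∷ xs) f = trans (cong ((c *ᶻ f x) +ᶻ_) (∑-* c xs f)) (sym (ℤ.*-distribˡ-+ c (f x) (∑ xs f)))

∑-*ʳ : {A : Set} (c : ℤ) (xs : List A) (f : A → ℤ) → ∑ xs (λ x → f x *ᶻ c) ≡ ∑ xs f *ᶻ c
∑-*ʳ c xs f = trans (∑-cong xs (λ {x} _ → ℤ.*-comm (f x) c)) (trans (∑-* c xs f) (ℤ.*-comm c _))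

∑-neg : {A : Set} (xs : List A) (f : A → ℤ) → ∑ xs (λ x → -ᶻ f x) ≡ -ᶻ ∑ xs f
∑-neg []       f = refl
∑-neg (x ∷ xs) f = trans (cong ((-ᶻ f x) +ᶻ_) (∑-neg xs f)) (sym (ℤ.neg-distrib-+ (f x) (∑ xs f)))

∑-swap : {A B : Set} (xs : List A) (ys : List B) (f : A → B → ℤ) →
         ∑ xs (λ x → ∑ ys (f x)) ≡ ∑ ys (λ y → ∑ xs (λ x → f x y))
∑-swap []       ys f = sym (∑-0 ys)
∑-swap (x ∷ xs) ys f = trans (cong (∑ ys (f x) +ᶻ_) (∑-swap xs ys f)) (sym (∑-+ ys (f x) _))

∑-map : {A B : Set} (h : A → B) (xs : List A) (f : B → ℤ) → ∑ (map h xs) f ≡ ∑ xs (f ∘ h)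
∑-map h []       f = refl
∑-map h (x ∷ xs) f = cong (f (h x) +ᶻ_) (∑-map h xs f)

∑-++ : {A : Set} (xs ys : List A) (f : A → ℤ) → ∑ (xs ++ ys) f ≡ ∑ xs f +ᶻ ∑ ys f
∑-++ []       ys f = sym (ℤ.+-identityˡ _)
∑-++ (x ∷ xs) ys f = trans (cong (f x +ᶻ_) (∑-++ xs ys f)) (sym (ℤ.+-assoc (f x) _ _))

∑-concatMap : {A B : Set} (h : A → List B) (xs : List A) (f : B → ℤ) → ∑ (concatMap h xs) f ≡ ∑ xs (λ x → ∑ (h x) f)
∑-concatMap h []       f = refl
∑-concatMap h (x ∷ xs) f = trans (∑-++ (h x) (concatMap h xs) f) (cong (∑ (h x) f +ᶻ_) (∑-concatMap h xs f))

∑-filt : {A : Set} (p : A → Bool) (xs : List A) (f : A → ℤ) → ∑ (filt p xs) f ≡ ∑ xs (λ x → 𝟙 (p x) *ᶻ f x)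
∑-filt p []       f = refl
∑-filt p (x ∷ xs) f with p x
... | true  = cong₂ _+ᶻ_ (sym (ℤ.*-identityˡ (f x))) (∑-filt p xs f)
... | false = trans (∑-filt p xs f) (sym (ℤ.+-identityˡ (∑ xs (λ x → 𝟙 (p x) *ᶻ f x))))

∑-count : {A : Set} (p : A → Bool) (xs : List A) → pos (countᵇ p xs) ≡ ∑ xs (λ x → 𝟙 (p x))
∑-count p []       = refl
∑-count p (x ∷ xs) with p x
... | true  = trans (ℤ.pos-+ 1 (countᵇ p xs)) (cong (1ℤ +ᶻ_) (∑-count p xs))
... | false = trans (∑-count p xs) (sym (ℤ.+-identityˡ _))

Unique : {A : Set} → List A → Set
Unique = AllPairs (λ x y → ¬ x ≡ y)

∈-All : {A : Set} {P : A → Set} (xs : List A) → (∀ {x} → x ∈ xs → P x) → All P xs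
∈-All xs = All.tabulate

Unique-++ : {A : Set} {xs ys : List A} → Unique xs → Unique ys → (∀ {x} → x ∈ xs → x ∈ ys → ⊥) → Unique (xs ++ ys)
Unique-++ []       v d = v
Unique-++ {xs = x ∷ xs} {ys} (p ∷ u) v d =
  ∈-All (xs ++ ys) (λ {y} i e → case ∈-++⁻ xs i of λ where
    (inj₁ j) → All-∈ p j e
    (inj₂ j) → d (here refl) (subst (_∈ ys) (sym e) j))
  ∷ Unique-++ u v (λ i j → d (there i) j)

Unique-map : {A B : Set} (f : A → B) {xs : List A} → (∀ {x y} → x ∈ xs → y ∈ xs → f x ≡ f y → x ≡ y) → Unique xs → Unique (map f xs)
Unique-map f {[]}     inj []      = []
Unique-map f {x ∷ xs} inj (p ∷ u) =
  ∈-All (map f xs) (λ i e → case ∈-map⁻ f xs i of λ where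
    (z , j , refl) → All-∈ p j (inj (here refl) (there j) e))
  ∷ Unique-map f (λ i j → inj (there i) (there j)) u

Unique-filt : {A : Set} (p : A → Bool) {xs : List A} → Unique xs → Unique (filt p xs)
Unique-filt p []      = []
Unique-filt p {x ∷ xs} (q ∷ u) with p x
... | true  = ∈-All (filt p xs) (λ i → All-∈ q (proj₁ (∈-filt⁻ p xs i))) ∷ Unique-filt p u
... | false = Unique-filt p u

Unique-concatMap : {A B : Set} (f : A → List B) {xs : List A} → Unique xs → (∀ {x} → x ∈ xs → Unique (f x)) →
                   (∀ {x y z} → z ∈ f x → z ∈ f y → x ≡ y) → Unique (concatMap f xs)
Unique-concatMap f {[]}     []      h d = []
Unique-concatMap f {x ∷ xs} (p ∷ u) h d =
  Unique-++ (h (here refl)) (Unique-concatMap f u (h ∘ there) d)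
    (λ i j → case ∈-concatMap⁻ f xs j of λ where (y , k , l) → All-∈ p k (d i l))

Unique-applyUpTo : {A : Set} (f : ℕ → A) (n : ℕ) → (∀ {i j} → f i ≡ f j → i ≡ j) → Unique (applyUpTo f n)
Unique-applyUpTo f zero    inj = []
Unique-applyUpTo f (suc n) inj =
  ∈-All (applyUpTo (f ∘ suc) n) (λ i e → case ∈-applyUpTo⁻ (f ∘ suc) n i of λ where
    (j , _ , refl) → case inj e of λ ())
  ∷ Unique-applyUpTo (f ∘ suc) n (suc-injective ∘ inj)

Unique-range : ∀ n → Unique (range n)
Unique-range n = Unique-applyUpTo id n id

∈-split : {A : Set} {x : A} {xs : List A} → x ∈ xs → ∃[ as ] ∃[ bs ] xs ≡ as ++ x ∷ bs
∈-split {xs = _ ∷ xs} (here refl) = [] , xs , refl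
∈-split {xs = y ∷ _}  (there i) with ∈-split i
... | as , bs , refl = y ∷ as , bs , refl

∑-middle : {A : Set} (as : List A) (x : A) (bs : List A) (g : A → ℤ) → ∑ (as ++ x ∷ bs) g ≡ g x +ᶻ ∑ (as ++ bs) g
∑-middle []       x bs g = refl
∑-middle (a ∷ as) x bs g = trans (cong (g a +ᶻ_) (∑-middle as x bs g)) (swap₃ (g a) (g x) _)
  where swap₃ : ∀ a b c → a +ᶻ (b +ᶻ c) ≡ b +ᶻ (a +ᶻ c)
        swap₃ = solveᶻ 3 (λ a b c → a :+ᶻ (b :+ᶻ c) :=ᶻ b :+ᶻ (a :+ᶻ c)) refl

Unique-remove : {A : Set} (as : List A) {x : A} {bs : List A} → Unique (as ++ x ∷ bs) →
                Unique (as ++ bs) × (∀ {y} → y ∈ as ++ bs → ¬ y ≡ x)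
Unique-remove []       (p ∷ u) = u , λ i e → All-∈ p i (sym e)
Unique-remove (a ∷ as) {x} {bs} (p ∷ u) with Unique-remove as u
... | u′ , n = (∈-All (as ++ bs) (λ i → All-∈ p (weaken i)) ∷ u′)
             , λ where (here refl) e → All-∈ p (∈-++⁺ʳ as (here refl)) e
                       (there i)   e → n i e
  where weaken : ∀ {y} → y ∈ as ++ bs → y ∈ as ++ x ∷ bs
        weaken i with ∈-++⁻ as i
        ... | inj₁ j = ∈-++⁺ˡ j
        ... | inj₂ j = ∈-++⁺ʳ as (there j)

∑-bij : {A B : Set} (xs : List A) (ys : List B) (φ : A → B) {f : A → ℤ} {g : B → ℤ} → Unique xs → Unique ys →
        (∀ {x} → x ∈ xs → φ x ∈ ys) →
        (∀ {x y} → x ∈ xs → y ∈ xs → φ x ≡ φ y → x ≡ y) →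
        (∀ {y} → y ∈ ys → ∃[ x ] (x ∈ xs × φ x ≡ y)) →
        (∀ {x} → x ∈ xs → f x ≡ g (φ x)) → ∑ xs f ≡ ∑ ys g
∑-bij []       []       φ u w m i s e = refl
∑-bij []       (y ∷ ys) φ u w m i s e with s (here refl)
... | _ , () , _
∑-bij (x ∷ xs) ys       φ {f} {g} (p ∷ u) w m i s e with ∈-split (m (here refl))
... | as , bs , refl with Unique-remove as w
... | w′ , n = trans (cong₂ _+ᶻ_ (e (here refl))
        (∑-bij xs (as ++ bs) φ u w′ m′ (λ a b → i (there a) (there b)) s′ (e ∘ there)))
        (sym (∑-middle as (φ x) bs g))
  where
  m′ : ∀ {z} → z ∈ xs → φ z ∈ as ++ bs
  m′ j with ∈-++⁻ as (m (there j))
  ... | inj₁ k         = ∈-++⁺ˡ k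
  ... | inj₂ (there k) = ∈-++⁺ʳ as k
  ... | inj₂ (here q)  = ⊥-elim (All-∈ p j (i (here refl) (there j) (sym q)))
  s′ : ∀ {y} → y ∈ as ++ bs → ∃[ z ] (z ∈ xs × φ z ≡ y)
  s′ {y} j with s {y} (case ∈-++⁻ as j of λ where
                         (inj₁ k) → ∈-++⁺ˡ k
                         (inj₂ k) → ∈-++⁺ʳ as (there k))
  ... | z , here refl , q = ⊥-elim (n j (sym q))
  ... | z , there k   , q = z , k , q

∑-involution : {A : Set} (xs : List A) (φ : A → A) {f g : A → ℤ} → Unique xs → (∀ {x} → x ∈ xs → φ x ∈ xs) →
               (∀ {x} → x ∈ xs → φ (φ x) ≡ x) → (∀ {x} → x ∈ xs → f x ≡ g (φ x)) → ∑ xs f ≡ ∑ xs g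
∑-involution xs φ u m inv e = ∑-bij xs xs φ u u m
  (λ i j q → trans (sym (inv i)) (trans (cong φ q) (inv j))) (λ {y} i → φ y , m i , inv i) e

x≡-x⇒x≡0 : ∀ z → z ≡ -ᶻ z → z ≡ 0ℤ
x≡-x⇒x≡0 (pos zero)  e = refl

-- The sum equals its own negative, and ℤ has no 2-torsion. Fixed points of `φ` are covered: their
-- terms are their own negatives.
∑-antisymmetric : {A : Set} (xs : List A) (φ : A → A) {f : A → ℤ} → Unique xs → (∀ {x} → x ∈ xs → φ x ∈ xs) →
                  (∀ {x} → x ∈ xs → φ (φ x) ≡ x) → (∀ {x} → x ∈ xs → f x ≡ -ᶻ f (φ x)) → ∑ xs f ≡ 0ℤ
∑-antisymmetric xs φ {f} u m inv e =
  x≡-x⇒x≡0 (∑ xs f) (trans (∑-involution xs φ u m inv e) (∑-neg xs f))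

∑-single : {A : Set} (xs : List A) (c : A) (f : A → ℤ) → Unique xs → c ∈ xs → (∀ {x} → x ∈ xs → ¬ x ≡ c → f x ≡ 0ℤ) → ∑ xs f ≡ f c
∑-single xs c f u i h with ∈-split i
... | as , bs , refl with Unique-remove as u
... | _ , n = trans (∑-middle as c bs f) (trans (cong (f c +ᶻ_) (∑-zero (as ++ bs) (λ j → h (weaken j) (n j)))) (ℤ.+-identityʳ _))
  where weaken : ∀ {y} → y ∈ as ++ bs → y ∈ as ++ c ∷ bs
        weaken i with ∈-++⁻ as i
        ... | inj₁ j = ∈-++⁺ˡ j
        ... | inj₂ j = ∈-++⁺ʳ as (there j)

sumTo : ℕ → (ℕ → ℕ) → ℕ
sumTo zero    f = 0
sumTo (suc n) f = sumTo n f + f n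

sumTo-cong : ∀ n {f g : ℕ → ℕ} → (∀ k → k < n → f k ≡ g k) → sumTo n f ≡ sumTo n g
sumTo-cong zero    h = refl
sumTo-cong (suc n) h = cong₂ _+_ (sumTo-cong n (λ k l → h k (m<n⇒m<1+n l))) (h n ≤-refl)

sumTo-+ : ∀ n (f g : ℕ → ℕ) → sumTo n (λ k → f k + g k) ≡ sumTo n f + sumTo n g
sumTo-+ zero    f g = refl
sumTo-+ (suc n) f g = lia 5 (λ s sf sg a b → s :≡ sf :+ sg ⇒ ⊢ s :+ (a :+ b) :≡ sf :+ a :+ (sg :+ b)) _ (sumTo n f) (sumTo n g) (f n) (g n) (sumTo-+ n f g)

sumTo-0 : ∀ n → sumTo n (λ _ → 0) ≡ 0
sumTo-0 zero    = refl
sumTo-0 (suc n) = trans (+-identityʳ _) (sumTo-0 n)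

sumTo-suc : ∀ n (f : ℕ → ℕ) → sumTo (suc n) f ≡ f 0 + sumTo n (f ∘ suc)
sumTo-suc zero    f = +-comm 0 (f 0)
sumTo-suc (suc n) f = trans (cong (_+ f (suc n)) (sumTo-suc n f)) (+-assoc (f 0) _ _)

sumTo-mono : ∀ n {f g : ℕ → ℕ} → (∀ k → k < n → f k ≤ g k) → sumTo n f ≤ sumTo n g
sumTo-mono zero    h = z≤n
sumTo-mono (suc n) h = +-mono-≤ (sumTo-mono n (λ k l → h k (m<n⇒m<1+n l))) (h n ≤-refl)

-- Alternants

pairs : ℕ → List (ℕ × ℕ)
pairs zero    = (0 , 0) ∷ []
pairs (suc n) = (0 , suc n) ∷ map (λ p → suc (proj₁ p) , proj₂ p) (pairs n)

∈-pairs⁻ : ∀ n {p} → p ∈ pairs n → proj₁ p + proj₂ p ≡ n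
∈-pairs⁻ zero    (here refl) = refl
∈-pairs⁻ (suc n) (here refl) = refl
∈-pairs⁻ (suc n) (there i) with ∈-map⁻ _ (pairs n) i
... | q , j , refl = cong suc (∈-pairs⁻ n j)

∈-pairs⁺ : ∀ a b → (a , b) ∈ pairs (a + b)
∈-pairs⁺ zero    zero    = here refl
∈-pairs⁺ zero    (suc b) = here refl
∈-pairs⁺ (suc a) b       = there (∈-map⁺ _ (∈-pairs⁺ a b))

Unique-pairs : ∀ n → Unique (pairs n)
Unique-pairs zero    = [] ∷ []
Unique-pairs (suc n) =
  ∈-All _ (λ i e → case ∈-map⁻ _ (pairs n) i of λ where (q , _ , refl) → case e of λ ())
  ∷ Unique-map _ (λ { _ _ refl → refl }) (Unique-pairs n)

-- The product of two power series given by their coefficient functions.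
conv : (List ℕ → ℤ) → (List ℕ → ℤ) → List ℕ → ℤ
conv f g []      = f [] *ᶻ g []
conv f g (x ∷ v) = ∑ (pairs x) λ p → conv (λ u → f (proj₁ p ∷ u)) (λ u → g (proj₂ p ∷ u)) v

conv-cong : ∀ {f f′ g g′} v → (∀ u → length u ≡ length v → f u ≡ f′ u) → (∀ u → length u ≡ length v → g u ≡ g′ u) →
            conv f g v ≡ conv f′ g′ v
conv-cong []      hf hg = cong₂ _*ᶻ_ (hf [] refl) (hg [] refl)
conv-cong (x ∷ v) hf hg = ∑-cong (pairs x) λ _ →
  conv-cong v (λ u e → hf _ (cong suc e)) (λ u e → hg _ (cong suc e))

conv-zeroˡ : ∀ {f g} v → (∀ u → length u ≡ length v → f u ≡ 0ℤ) → conv f g v ≡ 0ℤ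
conv-zeroˡ []      h rewrite h [] refl = refl
conv-zeroˡ (x ∷ v) h = ∑-zero (pairs x) λ _ → conv-zeroˡ v (λ u e → h _ (cong suc e))

conv-zeroʳ : ∀ {f g} v → (∀ u → length u ≡ length v → g u ≡ 0ℤ) → conv f g v ≡ 0ℤ
conv-zeroʳ {f} [] h rewrite h [] refl = ℤ.*-zeroʳ (f [])
conv-zeroʳ (x ∷ v) h = ∑-zero (pairs x) λ _ → conv-zeroʳ v (λ u e → h _ (cong suc e))

conv-∑ˡ : {X : Set} (xs : List X) (f : X → List ℕ → ℤ) (g : List ℕ → ℤ) (v : List ℕ) →
          conv (λ u → ∑ xs (λ x → f x u)) g v ≡ ∑ xs (λ x → conv (f x) g v)
conv-∑ˡ xs f g []      = sym (∑-*ʳ (g []) xs (λ x → f x []))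
conv-∑ˡ xs f g (y ∷ v) = trans (∑-cong (pairs y) (λ _ → conv-∑ˡ xs _ _ v)) (∑-swap (pairs y) xs _)

conv-∑ʳ : {X : Set} (xs : List X) (f : List ℕ → ℤ) (g : X → List ℕ → ℤ) (v : List ℕ) →
          conv f (λ u → ∑ xs (λ x → g x u)) v ≡ ∑ xs (λ x → conv f (g x) v)
conv-∑ʳ xs f g []      = sym (∑-* (f []) xs (λ x → g x []))
conv-∑ʳ xs f g (y ∷ v) = trans (∑-cong (pairs y) (λ _ → conv-∑ʳ xs _ _ v)) (∑-swap (pairs y) xs _)

conv-*ˡ : ∀ c f g v → conv (λ u → c *ᶻ f u) g v ≡ c *ᶻ conv f g v
conv-*ˡ c f g []      = ℤ.*-assoc c (f []) (g [])
conv-*ˡ c f g (y ∷ v) = trans (∑-cong (pairs y) (λ _ → conv-*ˡ c _ _ v)) (∑-* c (pairs y) _)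

conv-*ʳ : ∀ c f g v → conv f (λ u → c *ᶻ g u) v ≡ c *ᶻ conv f g v
conv-*ʳ c f g []      = solveᶻ 3 (λ c x y → x :*ᶻ (c :*ᶻ y) :=ᶻ c :*ᶻ (x :*ᶻ y)) refl c (f []) (g [])
conv-*ʳ c f g (y ∷ v) = trans (∑-cong (pairs y) (λ _ → conv-*ʳ c _ _ v)) (∑-* c (pairs y) _)

infixl 6 _⊝_
_⊝_ : ℤ → ℤ → ℤ
a ⊝ b = a +ᶻ (-ᶻ b)

∑-- : {X : Set} (xs : List X) (f g : X → ℤ) → ∑ xs (λ x → f x ⊝ g x) ≡ ∑ xs f ⊝ ∑ xs g
∑-- xs f g = trans (∑-+ xs f _) (cong (∑ xs f +ᶻ_) (∑-neg xs g))

conv-subˡ : ∀ f f′ g v → conv (λ u → f u ⊝ f′ u) g v ≡ conv f g v ⊝ conv f′ g v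
conv-subˡ f f′ g []      = solveᶻ 3 (λ a b c → (a :+ᶻ :-ᶻ b) :*ᶻ c :=ᶻ a :*ᶻ c :+ᶻ :-ᶻ (b :*ᶻ c)) refl (f []) (f′ []) (g [])
conv-subˡ f f′ g (y ∷ v) = trans (∑-cong (pairs y) (λ _ → conv-subˡ _ _ _ v)) (∑-- (pairs y) _ _)

conv-subʳ : ∀ f g g′ v → conv f (λ u → g u ⊝ g′ u) v ≡ conv f g v ⊝ conv f g′ v
conv-subʳ f g g′ []      = solveᶻ 3 (λ a b c → c :*ᶻ (a :+ᶻ :-ᶻ b) :=ᶻ c :*ᶻ a :+ᶻ :-ᶻ (c :*ᶻ b)) refl (g []) (g′ []) (f [])
conv-subʳ f g g′ (y ∷ v) = trans (∑-cong (pairs y) (λ _ → conv-subʳ _ _ _ v)) (∑-- (pairs y) _ _)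

-- Both sides run over the triples with sum `n`. Splitting off those with first entry 0 leaves the
-- same identity for `n - 1`.
∑-pairs-assoc : ∀ n (f : ℕ → ℕ → ℕ → ℤ) →
  ∑ (pairs n) (λ p → ∑ (pairs (proj₁ p)) (λ q → f (proj₁ q) (proj₂ q) (proj₂ p))) ≡
  ∑ (pairs n) (λ p → ∑ (pairs (proj₂ p)) (λ q → f (proj₁ p) (proj₁ q) (proj₂ q)))
∑-pairs-assoc zero    f = refl
∑-pairs-assoc (suc n) f = begin
  (a +ᶻ 0ℤ) +ᶻ ∑ (map shift (pairs n)) (λ p → ∑ (pairs (proj₁ p)) (λ q → f (proj₁ q) (proj₂ q) (proj₂ p)))
    ≡⟨ cong₂ _+ᶻ_ (ℤ.+-identityʳ a) (∑-map shift (pairs n) _) ⟩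
  a +ᶻ ∑ (pairs n) (λ p → f 0 (suc (proj₁ p)) (proj₂ p) +ᶻ
                     ∑ (map shift (pairs (proj₁ p))) (λ q → f (proj₁ q) (proj₂ q) (proj₂ p)))
    ≡⟨ cong (a +ᶻ_) (trans (∑-cong (pairs n) (λ {p} _ → cong (f 0 (suc (proj₁ p)) (proj₂ p) +ᶻ_) (∑-map shift (pairs (proj₁ p)) _))) (∑-+ (pairs n) _ _)) ⟩
  a +ᶻ (s +ᶻ ∑ (pairs n) (λ p → ∑ (pairs (proj₁ p)) (λ q → f (suc (proj₁ q)) (proj₂ q) (proj₂ p))))
    ≡⟨ cong (λ z → a +ᶻ (s +ᶻ z)) (∑-pairs-assoc n (λ x → f (suc x))) ⟩
  a +ᶻ (s +ᶻ ∑ (pairs n) (λ p → ∑ (pairs (proj₂ p)) (λ q → f (suc (proj₁ p)) (proj₁ q) (proj₂ q))))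
    ≡⟨ sym (ℤ.+-assoc a s _) ⟩
  (a +ᶻ s) +ᶻ ∑ (pairs n) (λ p → ∑ (pairs (proj₂ p)) (λ q → f (suc (proj₁ p)) (proj₁ q) (proj₂ q)))
    ≡⟨ sym (cong₂ _+ᶻ_ (cong (a +ᶻ_) (∑-map shift (pairs n) _)) (∑-map shift (pairs n) _)) ⟩
  ∑ (pairs (suc n)) (λ p → ∑ (pairs (proj₂ p)) (λ q → f (proj₁ p) (proj₁ q) (proj₂ q))) ∎
  where open ≡-Reasoning
        shift : ℕ × ℕ → ℕ × ℕ
        shift p = suc (proj₁ p) , proj₂ p
        a = f 0 0 (suc n)
        s = ∑ (pairs n) (λ p → f 0 (suc (proj₁ p)) (proj₂ p))

conv-assoc : ∀ f g h v → conv (conv f g) h v ≡ conv f (conv g h) v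
conv-assoc f g h []      = ℤ.*-assoc (f []) (g []) (h [])
conv-assoc f g h (x ∷ v) = begin
  ∑ (pairs x) (λ p → conv (λ u → ∑ (pairs (proj₁ p)) (λ q → conv (f at proj₁ q) (g at proj₂ q) u)) (h at proj₂ p) v)
    ≡⟨ ∑-cong (pairs x) (λ {p} _ → trans (conv-∑ˡ (pairs (proj₁ p)) _ _ v) (∑-cong (pairs (proj₁ p)) (λ _ → conv-assoc _ _ _ v))) ⟩
  ∑ (pairs x) (λ p → ∑ (pairs (proj₁ p)) (λ q → conv (f at proj₁ q) (conv (g at proj₂ q) (h at proj₂ p)) v))
    ≡⟨ ∑-pairs-assoc x (λ i j k → conv (f at i) (conv (g at j) (h at k)) v) ⟩
  ∑ (pairs x) (λ p → ∑ (pairs (proj₂ p)) (λ q → conv (f at proj₁ p) (conv (g at proj₁ q) (h at proj₂ q)) v))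
    ≡⟨ ∑-cong (pairs x) (λ {p} _ → sym (conv-∑ʳ (pairs (proj₂ p)) _ _ v)) ⟩
  ∑ (pairs x) (λ p → conv (f at proj₁ p) (λ u → ∑ (pairs (proj₂ p)) (λ q → conv (g at proj₁ q) (h at proj₂ q) u)) v) ∎
  where open ≡-Reasoning
        _at_ : (List ℕ → ℤ) → ℕ → List ℕ → ℤ
        (k at i) u = k (i ∷ u)

-- Laplace expansion along a row: each entry of the list is removed in turn, with alternating sign,
-- and `f` receives it together with the remaining entries in their order.
alt : List ℕ → (ℕ → List ℕ → ℤ) → ℤ
alt []      f = 0ℤ
alt (x ∷ e) f = f x e ⊝ alt e (λ y e′ → f y (x ∷ e′))

-- alternant e v is the coefficient of x^v in det (x_i ^ e_j), expanded along the first variable.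
alternant : List ℕ → List ℕ → ℤ
alternant []      []      = 1ℤ
alternant (_ ∷ _) []      = 0ℤ
alternant e       (y ∷ v) = alt e (λ z e′ → 𝟙 (z ≡ᵇ y) *ᶻ alternant e′ v)

alt-cong : ∀ e {f g} → (∀ {z} → z ∈ e → ∀ e′ → f z e′ ≡ g z e′) → alt e f ≡ alt e g
alt-cong []      h = refl
alt-cong (x ∷ e) h = cong₂ _⊝_ (h (here refl) e) (alt-cong e (λ i e′ → h (there i) (x ∷ e′)))

alt-zero : ∀ e {f} → (∀ {z} → z ∈ e → ∀ e′ → f z e′ ≡ 0ℤ) → alt e f ≡ 0ℤ
alt-zero []      h = refl
alt-zero (x ∷ e) h rewrite h (here refl) e | alt-zero e (λ i e′ → h (there i) (x ∷ e′)) = refl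

alt-∑ : {X : Set} (xs : List X) (e : List ℕ) (f : X → ℕ → List ℕ → ℤ) →
        alt e (λ y e′ → ∑ xs (λ x → f x y e′)) ≡ ∑ xs (λ x → alt e (f x))
alt-∑ xs []      f = sym (∑-0 xs)
alt-∑ xs (z ∷ e) f = trans (cong (∑ xs (λ x → f x z e) ⊝_) (alt-∑ xs e (λ x y e′ → f x y (z ∷ e′)))) (sym (∑-- xs _ _))

conv-alt : ∀ e (f : ℕ → List ℕ → List ℕ → ℤ) g v →
           conv (λ u → alt e (λ y e′ → f y e′ u)) g v ≡ alt e (λ y e′ → conv (f y e′) g v)
conv-alt []      f g v = conv-zeroˡ v (λ _ _ → refl)
conv-alt (x ∷ e) f g v = trans (conv-subˡ _ _ g v) (cong (conv (f x e) g v ⊝_) (conv-alt e (λ y e′ → f y (x ∷ e′)) g v))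

-- The terms that remove `x` or `y` trade places, and their signs differ because the removed entry
-- sits one position further on. In all other terms both entries remain, and the hypothesis on `f`
-- applies.
alt-swap : ∀ p x y q {f} → (∀ z p′ q′ → f z (p′ ++ x ∷ y ∷ q′) ≡ -ᶻ f z (p′ ++ y ∷ x ∷ q′)) →
           alt (p ++ x ∷ y ∷ q) f ≡ -ᶻ alt (p ++ y ∷ x ∷ q) f
alt-swap []      x y q {f} h =
  trans (cong (λ t → f x (y ∷ q) ⊝ (f y (x ∷ q) ⊝ t)) (trans (alt-cong q (λ {z} _ e′ → h z [] e′)) (alt-neg q)))
        (solveᶻ 3 (λ a b t → a :+ᶻ :-ᶻ (b :+ᶻ :-ᶻ (:-ᶻ t)) :=ᶻ :-ᶻ (b :+ᶻ :-ᶻ (a :+ᶻ :-ᶻ t))) refl (f x (y ∷ q)) (f y (x ∷ q)) _)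
  where alt-neg : ∀ e {g} → alt e (λ z e′ → -ᶻ g z e′) ≡ -ᶻ alt e g
        alt-neg []      = refl
        alt-neg (z ∷ e) {g} = trans (cong ((-ᶻ g z e) ⊝_) (alt-neg e))
          (solveᶻ 2 (λ a b → :-ᶻ a :+ᶻ :-ᶻ (:-ᶻ b) :=ᶻ :-ᶻ (a :+ᶻ :-ᶻ b)) refl (g z e) _)
alt-swap (w ∷ p) x y q {f} h =
  trans (cong₂ _⊝_ (h w p q) (alt-swap p x y q (λ z p′ q′ → h z (w ∷ p′) q′)))
        (solveᶻ 2 (λ a b → :-ᶻ a :+ᶻ :-ᶻ (:-ᶻ b) :=ᶻ :-ᶻ (a :+ᶻ :-ᶻ b)) refl (f w (p ++ y ∷ x ∷ q)) _)

alternant-swap : ∀ p x y q v → alternant (p ++ x ∷ y ∷ q) v ≡ -ᶻ alternant (p ++ y ∷ x ∷ q) v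
alternant-swap []      x y q []      = refl
alternant-swap (_ ∷ p) x y q []      = refl
alternant-swap p       x y q (w ∷ v) = trans (alternant-∷ (p ++ x ∷ y ∷ q)) (trans
  (alt-swap p x y q (λ z p′ q′ → trans (cong (𝟙 (z ≡ᵇ w) *ᶻ_) (alternant-swap p′ x y q′ v)) (sym (ℤ.neg-distribʳ-* (𝟙 (z ≡ᵇ w)) _))))
  (cong -ᶻ_ (sym (alternant-∷ (p ++ y ∷ x ∷ q)))))
  where alternant-∷ : ∀ e → alternant e (w ∷ v) ≡ alt e (λ z e′ → 𝟙 (z ≡ᵇ w) *ᶻ alternant e′ v)
        alternant-∷ []      = refl
        alternant-∷ (_ ∷ _) = refl

alternant-∷ : ∀ e y v → alternant e (y ∷ v) ≡ alt e (λ z e′ → 𝟙 (z ≡ᵇ y) *ᶻ alternant e′ v)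
alternant-∷ []      y v = refl
alternant-∷ (_ ∷ _) y v = refl

-- Products of alternants with symmetric power series

infixl 6 _⊕_
_⊕_ : List ℕ → List ℕ → List ℕ
_⊕_ = zipWith _+_

Symmetric : (List ℕ → ℤ) → Set
Symmetric F = ∀ p x y q → F (p ++ x ∷ y ∷ q) ≡ F (p ++ y ∷ x ∷ q)

∑box : List ℕ → ℕ → (List ℕ → ℤ) → ℤ
∑box R zero    g = g []
∑box R (suc n) g = ∑ R (λ b → ∑box R n (λ β → g (b ∷ β)))

∑box-cong : ∀ R n {f g : List ℕ → ℤ} → (∀ β → f β ≡ g β) → ∑box R n f ≡ ∑box R n g
∑box-cong R zero    h = h []
∑box-cong R (suc n) h = ∑-cong R (λ _ → ∑box-cong R n (λ β → h _))

∑box-sub : ∀ R n (f g : List ℕ → ℤ) → ∑box R n (λ β → f β ⊝ g β) ≡ ∑box R n f ⊝ ∑box R n g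
∑box-sub R zero    f g = refl
∑box-sub R (suc n) f g = trans (∑-cong R (λ {b} _ → ∑box-sub R n (f ∘ (b ∷_)) (g ∘ (b ∷_)))) (∑-- R _ _)

∑box-* : ∀ R n (c : ℤ) (f : List ℕ → ℤ) → ∑box R n (λ β → c *ᶻ f β) ≡ c *ᶻ ∑box R n f
∑box-* R zero    c f = refl
∑box-* R (suc n) c f = trans (∑-cong R (λ {b} _ → ∑box-* R n c (f ∘ (b ∷_)))) (∑-* c R _)

∑box-∑ : {X : Set} (xs : List X) → ∀ R n (f : X → List ℕ → ℤ) → ∑box R n (λ β → ∑ xs (λ x → f x β)) ≡ ∑ xs (λ x → ∑box R n (f x))
∑box-∑ xs R zero    f = refl
∑box-∑ xs R (suc n) f = trans (∑-cong R (λ {b} _ → ∑box-∑ xs R n (λ x → f x ∘ (b ∷_)))) (∑-swap R xs _)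

∑box-zero : ∀ R n {f : List ℕ → ℤ} → (∀ b β → f (b ∷ β) ≡ 0ℤ) → ∑box R (suc n) f ≡ 0ℤ
∑box-zero R zero    h = ∑-zero R (λ _ → h _ [])
∑box-zero R (suc n) {f} h = ∑-zero R (λ {b} _ → ∑box-zero R n {f ∘ (b ∷_)} (λ c β → h b (c ∷ β)))

∑box-single : ∀ {R} → Unique R → ∀ n l (g : List ℕ → ℤ) → length l ≡ n → All (_∈ R) l → ∑box R n (λ β → 𝟙 (eqL l β) *ᶻ g β) ≡ g l
∑box-single u zero    []      g refl []      = ℤ.*-identityˡ (g [])
∑box-single {R} u (suc n) (x ∷ l) g refl (h ∷ a) = trans
  (∑-single R x (λ b → ∑box R n (λ β → 𝟙 ((x ≡ᵇ b) ∧ eqL l β) *ᶻ g (b ∷ β))) u h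
    (λ {b} _ ne → trans (∑box-cong R n {_} {λ β → 0ℤ *ᶻ g (b ∷ β)} (λ β → cong (λ t → 𝟙 (t ∧ eqL l β) *ᶻ g (b ∷ β)) (≡ᵇ-false (ne ∘ sym))))
                         (∑box-* R n 0ℤ (λ β → g (b ∷ β)))))
  (trans (∑box-cong R n {_} {λ β → 𝟙 (eqL l β) *ᶻ g (x ∷ β)} (λ β → cong (λ t → 𝟙 (t ∧ eqL l β) *ᶻ g (x ∷ β)) (≡ᵇ-refl x)))
         (∑box-single u n l (λ β → g (x ∷ β)) refl a))

-- Expanding the alternating sum of `e ⊕ β` picks an entry `y + b`. Symmetry of `F` moves this `b`
-- to the front of `β`, so that the sum over `β` separates into a sum over `b` for the chosen entry
-- and a box sum for the others.
∑box-alt : ∀ R e F f → Symmetric F →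
  ∑box R (length e) (λ β → F β *ᶻ alt (e ⊕ β) f) ≡
  alt e (λ y e′ → ∑ R (λ b → ∑box R (length e′) (λ β → F (b ∷ β) *ᶻ f (y + b) (e′ ⊕ β))))
∑box-alt R []      F f sy = ℤ.*-zeroʳ (F [])
∑box-alt R (x ∷ e) F f sy = begin
  ∑ R (λ b → ∑box R n (λ β → F (b ∷ β) *ᶻ (f (x + b) (e ⊕ β) ⊝ alt (e ⊕ β) (fb b))))
    ≡⟨ ∑-cong R (λ {b} _ → trans (∑box-cong R n (λ β → distrib (F (b ∷ β)) (f (x + b) (e ⊕ β)) (alt (e ⊕ β) (fb b))))
         (∑box-sub R n (λ β → F (b ∷ β) *ᶻ f (x + b) (e ⊕ β)) (λ β → F (b ∷ β) *ᶻ alt (e ⊕ β) (fb b)))) ⟩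
  ∑ R (λ b → h b ⊝ k b) ≡⟨ ∑-- R h k ⟩
  ∑ R h ⊝ ∑ R k
    ≡⟨ cong (∑ R h ⊝_) (∑-cong R (λ {b} _ → ∑box-alt R e (λ β → F (b ∷ β)) (fb b) (λ p → sy (b ∷ p)))) ⟩
  ∑ R h ⊝ ∑ R (λ b → alt e (λ y e′ → ∑ R (λ b′ → G y e′ b b′)))
    ≡⟨ cong (∑ R h ⊝_) (trans (sym (alt-∑ R e (λ b y e′ → ∑ R (λ b′ → G y e′ b b′)))) (alt-cong e (λ {y} _ e′ → trans (∑-swap R R (G y e′))
         (∑-cong R (λ {b′} _ → ∑-cong R (λ {b} _ → ∑box-cong R (length e′) (λ β → cong (_*ᶻ f (y + b′) (x + b ∷ e′ ⊕ β)) (sy [] b b′ β)))))))) ⟩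
  ∑ R h ⊝ alt e (λ y e′ → ∑ R (λ b′ → ∑ R (λ b → ∑box R (length e′) (λ β → F (b′ ∷ b ∷ β) *ᶻ f (y + b′) (x + b ∷ e′ ⊕ β))))) ∎
  where
  open ≡-Reasoning
  n = length e
  fb : ℕ → ℕ → List ℕ → ℤ
  fb b y e′ = f y (x + b ∷ e′)
  h k : ℕ → ℤ
  h b = ∑box R n (λ β → F (b ∷ β) *ᶻ f (x + b) (e ⊕ β))
  k b = ∑box R n (λ β → F (b ∷ β) *ᶻ alt (e ⊕ β) (fb b))
  G : ℕ → List ℕ → ℕ → ℕ → ℤ
  G y e′ b b′ = ∑box R (length e′) (λ β → F (b ∷ b′ ∷ β) *ᶻ f (y + b′) (x + b ∷ e′ ⊕ β))
  distrib : ∀ a b c → a *ᶻ (b ⊝ c) ≡ a *ᶻ b ⊝ a *ᶻ c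
  distrib = solveᶻ 3 (λ a b c → a :*ᶻ (b :+ᶻ :-ᶻ c) :=ᶻ a :*ᶻ b :+ᶻ :-ᶻ (a :*ᶻ c)) refl

-- On either side only `b = n ∸ z` survives, and nothing if `z > n`. This turns the splittings of an
-- exponent in a convolution into the range of a box.
∑-pairs-range : ∀ {R} → Unique R → ∀ z n (h : ℕ → ℤ) → (∀ {b} → b ≤ n → b ∈ R) →
  ∑ (pairs n) (λ p → 𝟙 (z ≡ᵇ proj₁ p) *ᶻ h (proj₂ p)) ≡ ∑ R (λ b → 𝟙 (z + b ≡ᵇ n) *ᶻ h b)
∑-pairs-range {R} u z n h inR with z ≤? n
... | no z≰n = trans
  (∑-zero (pairs n) (λ {p} i → cong (λ t → 𝟙 t *ᶻ h (proj₂ p)) (≡ᵇ-false {z} {proj₁ p} (λ e → z≰n (subst₂ _≤_ (sym e) (∈-pairs⁻ n i) (m≤m+n (proj₁ p) (proj₂ p)))))))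
  (sym (∑-zero R (λ {b} i → cong (λ t → 𝟙 t *ᶻ h b) (≡ᵇ-false {z + b} {n} (λ e → z≰n (subst (z ≤_) e (m≤m+n z b)))))))
... | yes zn = trans
  (trans (∑-single (pairs n) (z , n ∸ z) (λ p → 𝟙 (z ≡ᵇ proj₁ p) *ᶻ h (proj₂ p)) (Unique-pairs n) (subst (λ t → (z , n ∸ z) ∈ pairs t) (m+[n∸m]≡n zn) (∈-pairs⁺ z (n ∸ z)))
    (λ {p} i ne → cong (λ t → 𝟙 t *ᶻ h (proj₂ p)) (≡ᵇ-false {z} {proj₁ p} (λ where refl → ne (cong (z ,_) (+-cancelˡ-≡ z _ _ (trans (∈-pairs⁻ n i) (sym (m+[n∸m]≡n zn)))))))))
    (cong (λ t → 𝟙 t *ᶻ h (n ∸ z)) (≡ᵇ-refl z)))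
  (sym (trans (∑-single R (n ∸ z) (λ b → 𝟙 (z + b ≡ᵇ n) *ᶻ h b) u (inR (m∸n≤m n z))
    (λ {b} i ne → cong (λ t → 𝟙 t *ᶻ h b) (≡ᵇ-false {z + b} {n} (λ e → ne (+-cancelˡ-≡ z _ _ (trans e (sym (m+[n∸m]≡n zn))))))))
    (cong (λ t → 𝟙 t *ᶻ h (n ∸ z)) (trans (cong (_≡ᵇ n) (m+[n∸m]≡n zn)) (≡ᵇ-refl n)))))

-- The expansion of a product with a symmetric series into alternants of `e ⊕ β`, by induction on
-- the number of variables. A finite box is enough because a coefficient of a product involves only
-- exponents up to its own.
conv-alternant-box : ∀ {R} → Unique R → ∀ e F v → Symmetric F → All (λ y → ∀ {b} → b ≤ y → b ∈ R) v →
  conv (alternant e) F v ≡ ∑box R (length e) (λ β → F β *ᶻ alternant (e ⊕ β) v)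
conv-alternant-box {R} u []      F []      sy a = ℤ.*-comm 1ℤ (F [])
conv-alternant-box {R} u (x ∷ e) F []      sy a = sym (∑box-zero R (length e) {λ β → F β *ᶻ alternant ((x ∷ e) ⊕ β) []} (λ b β → ℤ.*-zeroʳ (F (b ∷ β))))
conv-alternant-box {R} u e       F (y ∷ v) sy (hy ∷ a) = begin
  ∑ (pairs y) (λ p → conv (λ w → alternant e (proj₁ p ∷ w)) (F₁ (proj₂ p)) v)
    ≡⟨ ∑-cong (pairs y) (λ {p} _ → trans (conv-cong v (λ w _ → alternant-∷ e (proj₁ p) w) (λ _ _ → refl))
         (trans (conv-alt e (λ z e′ w → 𝟙 (z ≡ᵇ proj₁ p) *ᶻ alternant e′ w) (F₁ (proj₂ p)) v)
                (alt-cong e (λ {z} _ e′ → trans (conv-*ˡ (𝟙 (z ≡ᵇ proj₁ p)) (alternant e′) (F₁ (proj₂ p)) v)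
                   (cong (𝟙 (z ≡ᵇ proj₁ p) *ᶻ_) (conv-alternant-box u e′ (F₁ (proj₂ p)) v (λ q → sy (proj₂ p ∷ q)) a)))))) ⟩
  ∑ (pairs y) (λ p → alt e (λ z e′ → 𝟙 (z ≡ᵇ proj₁ p) *ᶻ H e′ (proj₂ p)))
    ≡⟨ sym (alt-∑ (pairs y) e _) ⟩
  alt e (λ z e′ → ∑ (pairs y) (λ p → 𝟙 (z ≡ᵇ proj₁ p) *ᶻ H e′ (proj₂ p)))
    ≡⟨ alt-cong e (λ {z} _ e′ → trans (∑-pairs-range u z y (H e′) hy) (∑-cong (R) (λ {b} _ →
         trans (sym (∑box-* R (length e′) (𝟙 (z + b ≡ᵇ y)) (λ β → F (b ∷ β) *ᶻ alternant (e′ ⊕ β) v))) (∑box-cong R (length e′) (λ β → rot (𝟙 (z + b ≡ᵇ y)) (F (b ∷ β)) (alternant (e′ ⊕ β) v)))))) ⟩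
  alt e (λ z e′ → ∑ (R) (λ b → ∑box R (length e′) (λ β → F (b ∷ β) *ᶻ (𝟙 (z + b ≡ᵇ y) *ᶻ alternant (e′ ⊕ β) v))))
    ≡⟨ sym (∑box-alt R e F (λ z e′ → 𝟙 (z ≡ᵇ y) *ᶻ alternant e′ v) sy) ⟩
  ∑box R (length e) (λ β → F β *ᶻ alt (e ⊕ β) (λ z e′ → 𝟙 (z ≡ᵇ y) *ᶻ alternant e′ v))
    ≡⟨ ∑box-cong R (length e) (λ β → cong (F β *ᶻ_) (sym (alternant-∷ (e ⊕ β) y v))) ⟩
  ∑box R (length e) (λ β → F β *ᶻ alternant (e ⊕ β) (y ∷ v)) ∎
  where
  open ≡-Reasoning
  F₁ : ℕ → List ℕ → ℤ
  F₁ b w = F (b ∷ w)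
  H : List ℕ → ℕ → ℤ
  H e′ b = ∑box R (length e′) (λ β → F (b ∷ β) *ᶻ alternant (e′ ⊕ β) v)
  rot : ∀ a b c → a *ᶻ (b *ᶻ c) ≡ b *ᶻ (a *ᶻ c)
  rot = solveᶻ 3 (λ a b c → a :*ᶻ (b :*ᶻ c) :=ᶻ b :*ᶻ (a :*ᶻ c)) refl

bound-exists : {X : Set} (ts : List X) (w : X → List ℕ) (v : List ℕ) →
               ∃[ B ] (All (_≤ B) v × (∀ {t} → t ∈ ts → All (_≤ B) (w t)))
bound-exists []       w v = maxL v , max-bounds v , λ ()
  where max-bounds : ∀ l → All (_≤ maxL l) l
        max-bounds l = ∈-All l (λ i → go l i)
          where go : ∀ l {x} → x ∈ l → x ≤ maxL l
                go (y ∷ l) (here refl) = m≤m⊔n y (maxL l)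
                go (y ∷ l) (there i)   = ≤-trans (go l i) (m≤n⊔m y (maxL l))
bound-exists (t ∷ ts) w v with bound-exists ts w v | bound-exists ts w (w t)
... | B , a , b | C , c , _ = B ⊔ C , raise (m≤m⊔n B C) a , λ where
    (here refl) → raise (m≤n⊔m B C) c
    (there i)   → raise (m≤m⊔n B C) (b i)
  where raise : ∀ {B C l} → B ≤ C → All (_≤ B) l → All (_≤ C) l
        raise h []      = []
        raise h (x ∷ a) = ≤-trans x h ∷ raise h a

-- Here `F` is the generating function of the weights `w t`, so each `t` contributes to the box sum
-- only at `β = w t`. The bound `B` makes the box contain all weights and all exponents below `v`.
alternant-times-symmetric : {X : Set} (ts : List X) (w : X → List ℕ) (F : List ℕ → ℤ) (e v : List ℕ) →
  (∀ β → F β ≡ ∑ ts (λ t → 𝟙 (eqL (w t) β))) → Symmetric F → (∀ {t} → t ∈ ts → length (w t) ≡ length e) →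
  conv (alternant e) F v ≡ ∑ ts (λ t → alternant (e ⊕ w t) v)
alternant-times-symmetric ts w F e v hF sy len with bound-exists ts w v
... | B , a , b = begin
  conv (alternant e) F v ≡⟨ conv-alternant-box (Unique-range (suc B)) e F v sy (∈-All v (λ i h → ∈-range⁺ (s≤s (≤-trans h (All-∈ a i))))) ⟩
  ∑box R n (λ β → F β *ᶻ alternant (e ⊕ β) v)
    ≡⟨ ∑box-cong R n (λ β → trans (cong (_*ᶻ alternant (e ⊕ β) v) (hF β)) (sym (∑-*ʳ (alternant (e ⊕ β) v) ts (λ t → 𝟙 (eqL (w t) β))))) ⟩
  ∑box R n (λ β → ∑ ts (λ t → 𝟙 (eqL (w t) β) *ᶻ alternant (e ⊕ β) v)) ≡⟨ ∑box-∑ ts R n (λ t β → 𝟙 (eqL (w t) β) *ᶻ alternant (e ⊕ β) v) ⟩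
  ∑ ts (λ t → ∑box R n (λ β → 𝟙 (eqL (w t) β) *ᶻ alternant (e ⊕ β) v))
    ≡⟨ ∑-cong ts (λ {t} i → ∑box-single (Unique-range (suc B)) n (w t) (λ β → alternant (e ⊕ β) v) (len i) (∈-All (w t) (λ j → ∈-range⁺ (s≤s (All-∈ (b i) j))))) ⟩
  ∑ ts (λ t → alternant (e ⊕ w t) v) ∎
  where open ≡-Reasoning
        n = length e
        R = range (suc B)

-- The lowest power of the first variable in the alternant of an increasing e is isolated, so that
-- the first exponent of a coefficient of D, and then the remaining ones, can be handled in turn.
alternant-cancel : ∀ e → AllPairs _<_ e → ∀ D → (∀ v → length v ≡ length e → conv (alternant e) D v ≡ 0ℤ) →
                   ∀ a → length a ≡ length e → D a ≡ 0ℤ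
alternant-cancel []      []      D h []      refl = trans (sym (ℤ.*-identityˡ (D []))) (h [] refl)
alternant-cancel (x ∷ e) (p ∷ u) D h (a₀ ∷ a) len = below (suc a₀) a₀ ≤-refl a (suc-injective len)
  where
  lowest : ∀ w → alternant (x ∷ e) (x ∷ w) ≡ alternant e w
  lowest w rewrite ≡ᵇ-refl x
    | alt-zero e {λ z e′ → 𝟙 (z ≡ᵇ x) *ᶻ alternant (x ∷ e′) w}
        (λ {z} i e′ → cong (λ t → 𝟙 t *ᶻ alternant (x ∷ e′) w) (≡ᵇ-false (λ q → <⇒≢ (All-∈ p i) (sym q))))
    = trans (ℤ.+-identityʳ _) (ℤ.*-identityˡ _)
  lower : ∀ y w → y < x → alternant (x ∷ e) (y ∷ w) ≡ 0ℤ
  lower y w y<x = alt-zero (x ∷ e) (λ {z} i e′ → cong (λ t → 𝟙 t *ᶻ alternant e′ w) (≡ᵇ-false (λ q → <⇒≱ y<x (subst (x ≤_) q (x≤ i)))))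
    where x≤ : ∀ {z} → z ∈ x ∷ e → x ≤ z
          x≤ (here refl) = ≤-refl
          x≤ (there i)   = <⇒≤ (All-∈ p i)
  below : ∀ n b → b < n → ∀ a → length a ≡ length e → D (b ∷ a) ≡ 0ℤ
  below (suc n) b (s≤s b≤n) = alternant-cancel e u (λ w → D (b ∷ w)) λ v lv → begin
    conv (alternant e) (λ w → D (b ∷ w)) v
      ≡⟨ conv-cong v (λ w _ → sym (lowest w)) (λ _ _ → refl) ⟩
    conv (λ w → alternant (x ∷ e) (x ∷ w)) (λ w → D (b ∷ w)) v
      ≡⟨ sym (∑-single (pairs (x + b)) (x , b) _ (Unique-pairs (x + b)) (∈-pairs⁺ x b) (λ {q} i ne → others v lv q (∈-pairs⁻ (x + b) i) ne)) ⟩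
    conv (alternant (x ∷ e)) D (x + b ∷ v)
      ≡⟨ h (x + b ∷ v) (cong suc lv) ⟩
    0ℤ ∎
    where
    open ≡-Reasoning
    -- If `y < x`, the alternant has no monomial with first exponent `y`. If `y > x`, then `c < b`,
    -- and the coefficients of `D` with first exponent `c` are already known to vanish.
    others : ∀ v → length v ≡ length e → ∀ q → proj₁ q + proj₂ q ≡ x + b → ¬ q ≡ (x , b) →
             conv (λ w → alternant (x ∷ e) (proj₁ q ∷ w)) (λ w → D (proj₂ q ∷ w)) v ≡ 0ℤ
    others v lv (y , c) s ne with <-cmp y x
    ... | tri< y<x _ _ = conv-zeroˡ v (λ w _ → lower y w y<x)
    ... | tri≈ _ refl _ = ⊥-elim (ne (cong (y ,_) (+-cancelˡ-≡ y _ _ s)))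
    ... | tri> _ _ x<y = conv-zeroʳ v (λ w lw → below n c
            (≤-trans (lia 4 (λ x y b c → y :+ c :≡ x :+ b ⇒ x :< y ⇒ ⊢ c :< b) x y b c s x<y) b≤n) w (trans lw lv))

negOnePow-+ : ∀ m n → negOnePow (m + n) ≡ negOnePow m *ᶻ negOnePow n
negOnePow-+ zero    n = sym (ℤ.*-identityˡ _)
negOnePow-+ (suc m) n = trans (cong -ᶻ_ (negOnePow-+ m n)) (ℤ.neg-distribˡ-* (negOnePow m) (negOnePow n))

alternant-move : ∀ p q x s v → alternant (p ++ q ++ x ∷ s) v ≡ negOnePow (length q) *ᶻ alternant (p ++ x ∷ q ++ s) v
alternant-move p []      x s v = sym (ℤ.*-identityˡ _)
alternant-move p (y ∷ q) x s v = begin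
  alternant (p ++ y ∷ q ++ x ∷ s) v                        ≡⟨ cong (λ l → alternant l v) (sym (++-assoc p (y ∷ []) _)) ⟩
  alternant ((p ++ y ∷ []) ++ q ++ x ∷ s) v                ≡⟨ alternant-move (p ++ y ∷ []) q x s v ⟩
  negOnePow n *ᶻ alternant ((p ++ y ∷ []) ++ x ∷ q ++ s) v ≡⟨ cong (λ l → negOnePow n *ᶻ alternant l v) (++-assoc p (y ∷ []) _) ⟩
  negOnePow n *ᶻ alternant (p ++ y ∷ x ∷ q ++ s) v         ≡⟨ cong (negOnePow n *ᶻ_) (alternant-swap p y x (q ++ s) v) ⟩
  negOnePow n *ᶻ (-ᶻ alternant (p ++ x ∷ y ∷ q ++ s) v)
    ≡⟨ solveᶻ 2 (λ a b → a :*ᶻ (:-ᶻ b) :=ᶻ (:-ᶻ a) :*ᶻ b) refl (negOnePow n) (alternant (p ++ x ∷ y ∷ q ++ s) v) ⟩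
  (-ᶻ negOnePow n) *ᶻ alternant (p ++ x ∷ y ∷ q ++ s) v ∎
  where open ≡-Reasoning
        n = length q

-- Links the descending staircase of the bialternant formula with the increasing exponents of
-- `alternant-cancel`. Only the existence of a common sign matters.
alternant-reverse : ∀ e → ∃[ k ] (∀ p v → alternant (p ++ reverse e) v ≡ negOnePow k *ᶻ alternant (p ++ e) v)
alternant-reverse []      = 0 , λ p v → sym (ℤ.*-identityˡ _)
alternant-reverse (x ∷ e) with alternant-reverse e
... | k , h = length (reverse e) + k , λ p v → begin
  alternant (p ++ reverse (x ∷ e)) v                ≡⟨ cong (λ l → alternant (p ++ l) v) (unfold-reverse x e) ⟩
  alternant (p ++ reverse e ++ x ∷ []) v            ≡⟨ alternant-move p (reverse e) x [] v ⟩
  negOnePow n *ᶻ alternant (p ++ x ∷ reverse e ++ []) v ≡⟨ cong (λ l → negOnePow n *ᶻ alternant l v) (trans (cong (λ l → p ++ x ∷ l) (++-identityʳ (reverse e))) (sym (++-assoc p (x ∷ []) (reverse e)))) ⟩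
  negOnePow n *ᶻ alternant ((p ++ x ∷ []) ++ reverse e) v ≡⟨ cong (negOnePow n *ᶻ_) (h (p ++ x ∷ []) v) ⟩
  negOnePow n *ᶻ (negOnePow k *ᶻ alternant ((p ++ x ∷ []) ++ e) v)
    ≡⟨ trans (sym (ℤ.*-assoc (negOnePow n) (negOnePow k) _)) (cong₂ _*ᶻ_ (sym (negOnePow-+ n k)) (cong (λ l → alternant l v) (++-assoc p (x ∷ []) e))) ⟩
  negOnePow (n + k) *ᶻ alternant (p ++ x ∷ e) v ∎
  where open ≡-Reasoning
        n = length (reverse e)

-- Tableaux and Gelfand–Tsetlin patterns

b2n : Bool → ℕ
b2n true  = 1
b2n false = 0

b2n≤1 : ∀ b → b2n b ≤ 1
b2n≤1 true  = ≤-refl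
b2n≤1 false = z≤n

≤ᵇ-refl : ∀ m → (m ≤ᵇ m) ≡ true
≤ᵇ-refl m = ≤ᵇ-true {m} ≤-refl

countᵇ-∷ : {A : Set} (p : A → Bool) (x : A) (xs : List A) → countᵇ p (x ∷ xs) ≡ b2n (p x) + countᵇ p xs
countᵇ-∷ p x xs with p x
... | true  = refl
... | false = refl

countᵇ-++ : {A : Set} (p : A → Bool) (xs ys : List A) → countᵇ p (xs ++ ys) ≡ countᵇ p xs + countᵇ p ys
countᵇ-++ p []       ys = refl
countᵇ-++ p (x ∷ xs) ys = trans (countᵇ-∷ p x (xs ++ ys)) (trans (cong (b2n (p x) +_) (countᵇ-++ p xs ys))
  (trans (sym (+-assoc (b2n (p x)) _ _)) (cong (_+ countᵇ p ys) (sym (countᵇ-∷ p x xs)))))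

countᵇ-cong : {A : Set} {p q : A → Bool} (xs : List A) → (∀ {x} → x ∈ xs → p x ≡ q x) → countᵇ p xs ≡ countᵇ q xs
countᵇ-cong []       h = refl
countᵇ-cong {p = p} {q} (x ∷ xs) h = trans (countᵇ-∷ p x xs) (trans
  (cong₂ _+_ (cong b2n (h (here refl))) (countᵇ-cong xs (h ∘ there))) (sym (countᵇ-∷ q x xs)))

countᵇ-map : {A B : Set} (p : B → Bool) (f : A → B) (xs : List A) → countᵇ p (map f xs) ≡ countᵇ (p ∘ f) xs
countᵇ-map p f []       = refl
countᵇ-map p f (x ∷ xs) = trans (countᵇ-∷ p (f x) (map f xs)) (trans (cong (b2n (p (f x)) +_) (countᵇ-map p f xs)) (sym (countᵇ-∷ (p ∘ f) x xs)))

countᵇ-split : {A : Set} {p q s : A → Bool} (xs : List A) → (∀ {x} → x ∈ xs → b2n (p x) + b2n (q x) ≡ b2n (s x)) →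
               countᵇ p xs + countᵇ q xs ≡ countᵇ s xs
countᵇ-split []       h = refl
countᵇ-split {p = p} {q} {s} (x ∷ xs) h rewrite countᵇ-∷ p x xs | countᵇ-∷ q x xs | countᵇ-∷ s x xs =
  lia 6 (λ a b c d e f → a :+ b :≡ c ⇒ d :+ e :≡ f ⇒ ⊢ a :+ d :+ (b :+ e) :≡ c :+ f)
    (b2n (p x)) (b2n (q x)) (b2n (s x)) (countᵇ p xs) (countᵇ q xs) (countᵇ s xs) (h (here refl)) (countᵇ-split xs (h ∘ there))

countᵇ-zero : {A : Set} {p : A → Bool} (xs : List A) → (∀ {x} → x ∈ xs → p x ≡ false) → countᵇ p xs ≡ 0
countᵇ-zero []       h = refl
countᵇ-zero {p = p} (x ∷ xs) h rewrite h (here refl) = countᵇ-zero xs (h ∘ there)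

countᵇ-applyUpTo : {A : Set} (p : A → Bool) (f : ℕ → A) (n : ℕ) → countᵇ p (applyUpTo f n) ≡ sumTo n (λ i → b2n (p (f i)))
countᵇ-applyUpTo p f zero    = refl
countᵇ-applyUpTo p f (suc n) = trans (countᵇ-∷ p (f 0) (applyUpTo (f ∘ suc) n)) (trans (cong (b2n (p (f 0)) +_) (countᵇ-applyUpTo p (f ∘ suc) n)) (sym (sumTo-suc n (λ i → b2n (p (f i))))))

countᵇ-concatMap : {A B : Set} (p : B → Bool) (g : A → List B) (f : ℕ → A) (n : ℕ) →
                   countᵇ p (concatMap g (applyUpTo f n)) ≡ sumTo n (λ i → countᵇ p (g (f i)))
countᵇ-concatMap p g f zero    = refl
countᵇ-concatMap p g f (suc n) = trans (countᵇ-++ p (g (f 0)) (concatMap g (applyUpTo (f ∘ suc) n))) (trans (cong (countᵇ p (g (f 0)) +_) (countᵇ-concatMap p g (f ∘ suc) n)) (sym (sumTo-suc n (λ i → countᵇ p (g (f i))))))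

sumTo-zero : ∀ n {f : ℕ → ℕ} → (∀ k → k < n → f k ≡ 0) → sumTo n f ≡ 0
sumTo-zero n h = trans (sumTo-cong n h) (sumTo-0 n)

sumTo-single : ∀ n k {f : ℕ → ℕ} → k < n → (∀ j → j < n → ¬ j ≡ k → f j ≡ 0) → sumTo n f ≡ f k
sumTo-single (suc n) k {f} k<n h with k ≟ n
... | yes refl = cong (_+ f n) (sumTo-zero n (λ j j<n → h j (m<n⇒m<1+n j<n) (<⇒≢ j<n)))
... | no  k≢n  = trans (cong₂ _+_ (sumTo-single n k (≤∧≢⇒< (s≤s⁻¹ k<n) k≢n) (λ j j<n → h j (m<n⇒m<1+n j<n))) (h n ≤-refl (k≢n ∘ sym))) (+-identityʳ _)

sumTo-initial : ∀ n c → c ≤ n → sumTo n (λ x → b2n (x <ᵇ c)) ≡ c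
sumTo-initial zero    zero c≤n = refl
sumTo-initial (suc n) c c≤n with c ≟ suc n
... | yes refl = trans (cong₂ _+_ (sumTo-cong n (λ k k<n → cong b2n (trans (<ᵇ-true (m<n⇒m<1+n k<n)) (sym (<ᵇ-true k<n))))) (cong b2n (<ᵇ-true (n<1+n n))))
                       (trans (cong (_+ 1) (sumTo-initial n n ≤-refl)) (+-comm n 1))
... | no  c≢   = trans (cong₂ _+_ (sumTo-initial n c c≤n′) (cong b2n (<ᵇ-false c≤n′))) (+-identityʳ c)
  where c≤n′ = s≤s⁻¹ (≤∧≢⇒< c≤n c≢)

sumTo-b2n≤ : ∀ n (P : ℕ → Bool) → sumTo n (b2n ∘ P) ≤ n
sumTo-b2n≤ zero    P = z≤n
sumTo-b2n≤ (suc n) P = ≤-trans (+-mono-≤ (sumTo-b2n≤ n P) (b2n≤1 (P n))) (≤-reflexive (+-comm n 1))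

-- A downward closed set of numbers below `n` is an initial segment, given by its size. This is what
-- translates between the entries of a row and the counts of entries up to `i`.
threshold : ∀ n (P : ℕ → Bool) → (∀ x y → x < y → y < n → P y ≡ true → P x ≡ true) →
            ∀ x → x < n → P x ≡ (x <ᵇ sumTo n (b2n ∘ P))
threshold (suc n) P h x x<n with P n in e
... | true = trans (Px x x<n) (sym (<ᵇ-true (subst (x <_) (sym total) x<n)))
  where
  Px : ∀ y → y < suc n → P y ≡ true
  Px y y<n with y ≟ n
  ... | yes refl = e
  ... | no  y≢n  = h y n (≤∧≢⇒< (s≤s⁻¹ y<n) y≢n) ≤-refl e
  total : sumTo n (b2n ∘ P) + 1 ≡ suc n
  total = trans (cong (_+ 1) (trans (sumTo-cong n (λ k k<n → cong b2n (trans (Px k (m<n⇒m<1+n k<n)) (sym (<ᵇ-true k<n))))) (sumTo-initial n n ≤-refl))) (+-comm n 1)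
... | false rewrite +-identityʳ (sumTo n (b2n ∘ P)) with x ≟ n
... | yes refl = trans e (sym (<ᵇ-false (sumTo-b2n≤ n P)))
... | no  x≢n  = threshold n P (λ y z y<z z<n → h y z y<z (m<n⇒m<1+n z<n)) x (≤∧≢⇒< (s≤s⁻¹ x<n) x≢n)

nth-beyond : ∀ l {i} → length l ≤ i → nth l i ≡ 0
nth-beyond []      h = refl
nth-beyond (x ∷ l) {suc i} (s≤s h) = nth-beyond l h

nth-pos⇒< : ∀ l {i j} → j < nth l i → i < length l
nth-pos⇒< l {i} h with i <? length l
... | yes p = p
... | no  n = case subst (_ <_) (nth-beyond l (≮⇒≥ n)) h of λ ()

nth-applyUpTo : ∀ (f : ℕ → ℕ) n {i} → i < n → nth (applyUpTo f n) i ≡ f i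
nth-applyUpTo f (suc n) {zero}  h       = refl
nth-applyUpTo f (suc n) {suc i} (s≤s h) = nth-applyUpTo (f ∘ suc) n h

list-ext : ∀ (l l′ : List ℕ) → length l ≡ length l′ → (∀ i → i < length l → nth l i ≡ nth l′ i) → l ≡ l′
list-ext []      []       e h = refl
list-ext (x ∷ l) (y ∷ l′) e h = cong₂ _∷_ (h 0 (s≤s z≤n)) (list-ext l l′ (suc-injective e) (λ i p → h (suc i) (s≤s p)))

Decreasing : (ℕ → ℕ) → Set
Decreasing f = ∀ k → f (suc k) ≤ f k

Decreasing-≤ : ∀ {f} → Decreasing f → ∀ {j k} → j ≤ k → f k ≤ f j
Decreasing-≤ {f} d {j} {k} j≤k with m≤n⇒∃[o]m+o≡n j≤k
... | o , refl = go o
  where go : ∀ o → f (j + o) ≤ f j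
        go zero    = ≤-reflexive (cong f (+-identityʳ j))
        go (suc o) = ≤-trans (≤-reflexive (cong f (+-suc j o))) (≤-trans (d (j + o)) (go o))

IsPartition⇒Decreasing : ∀ {p} → IsPartition p → Decreasing (nth p)
IsPartition⇒Decreasing (l , _) = go l
  where go : ∀ {p} → Linked (λ a b → b ≤ a) p → Decreasing (nth p)
        go []      k       = z≤n
        go [-]     k       = z≤n
        go (h ∷ l) zero    = h
        go (h ∷ l) (suc k) = go l k

record Skew (lam μ : List ℕ) : Set where
  field outer : Decreasing (nth lam)
        inner : Decreasing (nth μ)
        sub   : ∀ k → nth μ k ≤ nth lam k

cellRow : List ℕ → List ℕ → ℕ → List Cell
cellRow lam μ i = map (λ j → (i , j)) (rangeFromTo (nth μ i) (nth lam i))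

∈-cellRow⁻ : ∀ lam μ i {c} → c ∈ cellRow lam μ i → proj₁ c ≡ i × nth μ i ≤ proj₂ c × proj₂ c < nth lam i
∈-cellRow⁻ lam μ i p with ∈-map⁻ _ (rangeFromTo (nth μ i) (nth lam i)) p
... | j , q , refl with ∈-map⁻ (nth μ i +_) (range (nth lam i ∸ nth μ i)) q
... | x , x∈ , refl = refl , m≤m+n _ x , lia′ {nth μ i} {nth lam i} (∈-range⁻ (nth lam i ∸ nth μ i) x∈)
  where lia′ : ∀ {a b x} → x < b ∸ a → a + x < b
        lia′ {a} {b} {x} h = subst (_≤ b) (+-suc a x) (≤-trans (+-monoʳ-≤ a h) (≤-reflexive (m+[n∸m]≡n {a} {b} (<⇒≤ (m∸n≢0⇒n<m {b} {a} λ e → case subst (x <_) e h of λ ())))))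

∈-cells⁻ : ∀ lam μ {i j} → (i , j) ∈ cells lam μ → nth μ i ≤ j × j < nth lam i
∈-cells⁻ lam μ {i} {j} p with ∈-concatMap⁻ (cellRow lam μ) (range (length lam)) p
... | i′ , _ , q with ∈-cellRow⁻ lam μ i′ q
... | refl , a , b = a , b

∈-cells⁺ : ∀ lam μ {i j} → nth μ i ≤ j → j < nth lam i → (i , j) ∈ cells lam μ
∈-cells⁺ lam μ {i} {j} a b = ∈-concatMap⁺ (cellRow lam μ) (∈-range⁺ (nth-pos⇒< lam b))
  (subst (λ x → (i , x) ∈ cellRow lam μ i) (m+[n∸m]≡n a) (∈-map⁺ (i ,_) (∈-map⁺ (nth μ i +_) (∈-range⁺ (∸-monoˡ-< b a)))))

Unique-cells : ∀ lam μ → Unique (cells lam μ)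
Unique-cells lam μ = Unique-concatMap (cellRow lam μ) (Unique-range (length lam))
  (λ {i} _ → Unique-map (i ,_) (λ { _ _ refl → refl }) (Unique-map (nth μ i +_) (λ _ _ → +-cancelˡ-≡ (nth μ i) _ _) (Unique-range (nth lam i ∸ nth μ i))))
  (λ {i} {j} p q → trans (sym (proj₁ (∈-cellRow⁻ lam μ i p))) (proj₁ (∈-cellRow⁻ lam μ j q)))

rowOf : Cell × ℕ → ℕ
rowOf q = proj₁ (proj₁ q)

graph : (Cell → ℕ) → List Cell → Tableau
graph E = map (λ c → c , E c)

countᵇ-graph : ∀ E lam μ (P : Cell × ℕ → Bool) → countᵇ P (graph E (cells lam μ)) ≡
  sumTo (length lam) (λ k → sumTo (nth lam k ∸ nth μ k) (λ x → b2n (P ((k , nth μ k + x) , E (k , nth μ k + x)))))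
countᵇ-graph E lam μ P = trans (countᵇ-map P _ (cells lam μ)) (trans (countᵇ-concatMap _ (cellRow lam μ) id (length lam))
  (sumTo-cong (length lam) (λ k _ → trans (countᵇ-map _ (k ,_) (rangeFromTo (nth μ k) (nth lam k)))
    (trans (countᵇ-map _ (nth μ k +_) (range (nth lam k ∸ nth μ k))) (countᵇ-applyUpTo _ id (nth lam k ∸ nth μ k))))))

countᵇ-graph-row : ∀ E lam μ k (p : ℕ → Bool) → countᵇ (λ q → (rowOf q ≡ᵇ k) ∧ p (proj₂ q)) (graph E (cells lam μ)) ≡
  sumTo (nth lam k ∸ nth μ k) (λ x → b2n (p (E (k , nth μ k + x))))
countᵇ-graph-row E lam μ k p = trans (countᵇ-graph E lam μ _) (case k <? length lam of λ where
    (yes k<) → trans (sumTo-single (length lam) k {term} k< (λ j _ ne → vanish j ne))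
                     (sumTo-cong (width k) (λ x _ → cong (λ t → b2n (t ∧ p (E (k , nth μ k + x)))) (≡ᵇ-refl k)))
    (no k≮)  → trans (sumTo-zero (length lam) {term} (λ j j< → vanish j (λ where refl → k≮ j<)))
                     (sym (cong (λ n → sumTo n (λ x → b2n (p (E (k , nth μ k + x))))) (trans (cong (_∸ nth μ k) (nth-beyond lam (≮⇒≥ k≮))) (0∸n≡0 (nth μ k))))))
  where
  width : ℕ → ℕ
  width j = nth lam j ∸ nth μ j
  term : ℕ → ℕ
  term j = sumTo (width j) (λ x → b2n ((j ≡ᵇ k) ∧ p (E (j , nth μ j + x))))
  vanish : ∀ j → ¬ j ≡ k → term j ≡ 0
  vanish j ne = sumTo-zero (width j) {λ x → b2n ((j ≡ᵇ k) ∧ p (E (j , nth μ j + x)))} (λ x _ → cong (λ t → b2n (t ∧ p (E (j , nth μ j + x)))) (≡ᵇ-false ne))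

entry : Tableau → Cell → ℕ
entry []            c = 0
entry ((d , e) ∷ t) c = if cellEq d c then e else entry t c

cellEq-sound : ∀ {c d} → cellEq c d ≡ true → c ≡ d
cellEq-sound {i , j} {i′ , j′} e with ∧-elim {i ≡ᵇ i′} e
... | p , q = cong₂ _,_ (≡ᵇ-sound p) (≡ᵇ-sound q)

cellEq-refl : ∀ c → cellEq c c ≡ true
cellEq-refl (i , j) = ∧-intro (≡ᵇ-refl i) (≡ᵇ-refl j)

-- No cell is listed twice, so the first hit found by `entry` is the only one. From here on a
-- tableau can be treated as a function on cells.
graph-entry : ∀ t → Unique (map proj₁ t) → t ≡ graph (entry t) (map proj₁ t)
graph-entry t u = go t (λ c → refl) u
  where
  map-cong-∈ : {A B : Set} {f g : A → B} (xs : List A) → (∀ {x} → x ∈ xs → f x ≡ g x) → map f xs ≡ map g xs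
  map-cong-∈ []       h = refl
  map-cong-∈ (x ∷ xs) h = cong₂ _∷_ (h (here refl)) (map-cong-∈ xs (h ∘ there))
  go : ∀ t {E} → (∀ c → E c ≡ entry t c) → Unique (map proj₁ t) → t ≡ graph E (map proj₁ t)
  go []            h u       = refl
  go ((d , e) ∷ t) h (p ∷ u) = cong₂ _∷_ (cong (d ,_) (sym (trans (h d) (cong (if_then e else entry t d) (cellEq-refl d)))))
    (trans (go t (λ c → refl) u) (map-cong-∈ (map proj₁ t) (λ {c} i → cong (c ,_)
      (sym (trans (h c) (cong (if_then e else entry t c) (¬true (λ q → All-∈ p i (cellEq-sound q)))))))))

∈-graph⁻ : ∀ E cs {c e} → (c , e) ∈ graph E cs → c ∈ cs × e ≡ E c
∈-graph⁻ E cs p with ∈-map⁻ _ cs p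
... | c , i , refl = i , refl

∈-fillings⁻ : ∀ K cs {t} → t ∈ fillings K cs → map proj₁ t ≡ cs × (∀ {c e} → (c , e) ∈ t → 1 ≤ e × e ≤ K)
∈-fillings⁻ K []       (here refl) = refl , λ ()
∈-fillings⁻ K (c ∷ cs) p with ∈-concatMap⁻ _ (map suc (range K)) p
... | e , e∈ , q with ∈-map⁻ _ (fillings K cs) q | ∈-map⁻ suc (range K) e∈
... | t , t∈ , refl | x , x∈ , refl with ∈-fillings⁻ K cs t∈
... | h , b = cong (c ∷_) h , λ where
  (here refl) → s≤s z≤n , ∈-range⁻ K x∈
  (there i)   → b i

∈-fillings⁺ : ∀ K cs E → (∀ {c} → c ∈ cs → 1 ≤ E c × E c ≤ K) → graph E cs ∈ fillings K cs
∈-fillings⁺ K []       E b = here refl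
∈-fillings⁺ K (c ∷ cs) E b with E c | b (here refl)
... | suc x | _ , h = ∈-concatMap⁺ _ (∈-map⁺ suc (∈-range⁺ h)) (∈-map⁺ _ (∈-fillings⁺ K cs E (b ∘ there)))

Unique-fillings : ∀ K cs → Unique (fillings K cs)
Unique-fillings K []       = [] ∷ []
Unique-fillings K (c ∷ cs) = Unique-concatMap _ (Unique-map suc (λ _ _ → suc-injective) (Unique-range K))
  (λ _ → Unique-map _ (λ { _ _ refl → refl }) (Unique-fillings K cs))
  (λ p q → case ∈-map⁻ _ (fillings K cs) p of λ where
     (_ , _ , refl) → case ∈-map⁻ _ (fillings K cs) q of λ where (_ , _ , refl) → refl)

Unique-ssyts : ∀ K lam μ → Unique (ssyts K lam μ)
Unique-ssyts K lam μ = Unique-filt isSSYT (Unique-fillings K (cells lam μ))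

okᵇ : Cell × ℕ → Cell × ℕ → Bool
okᵇ ((i , j) , e) ((i′ , j′) , e′) =
  (not ((i ≡ᵇ i′) ∧ (j <ᵇ j′)) ∨ (e ≤ᵇ e′)) ∧ (not ((j ≡ᵇ j′) ∧ (i <ᵇ i′)) ∨ (e <ᵇ e′))

implies-true : ∀ {a b c} → (a ≡ true → b ≡ true → c ≡ true) → not (a ∧ b) ∨ c ≡ true
implies-true {true}  {true}  h = h refl refl
implies-true {true}  {false} h = refl
implies-true {false}         h = refl

implies-sound : ∀ {a b c} → not (a ∧ b) ∨ c ≡ true → a ≡ true → b ≡ true → c ≡ true
implies-sound h refl refl = h

record SemiStandard (K : ℕ) (lam μ : List ℕ) (E : Cell → ℕ) : Set where
  field
    bounds : ∀ {k j} → nth μ k ≤ j → j < nth lam k → 1 ≤ E (k , j) × E (k , j) ≤ K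
    rows   : ∀ {k j j′} → nth μ k ≤ j → j < j′ → j′ < nth lam k → E (k , j) ≤ E (k , j′)
    cols   : ∀ {k k′ j} → k < k′ → nth μ k ≤ j → j < nth lam k → nth μ k′ ≤ j → j < nth lam k′ → E (k , j) < E (k′ , j)

∈-ssyts⁻ : ∀ K lam μ {t} → t ∈ ssyts K lam μ → t ≡ graph (entry t) (cells lam μ) × SemiStandard K lam μ (entry t)
∈-ssyts⁻ K lam μ {t} t∈ with ∈-filt⁻ isSSYT (fillings K (cells lam μ)) t∈
... | f , s with ∈-fillings⁻ K (cells lam μ) f
... | cs , b = eq , record
  { bounds = λ p q → b (inT p q)
  ; rows   = λ {k} {j} {j′} p j<j′ q → ≤ᵇ-sound (implies-sound {k ≡ᵇ k} {j <ᵇ j′} (proj₁ (∧-elim (ok (inT p (<-trans j<j′ q)) (inT (≤-trans p (<⇒≤ j<j′)) q)))) (≡ᵇ-refl k) (<ᵇ-true j<j′))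
  ; cols   = λ {k} {k′} {j} k<k′ p q p′ q′ → <ᵇ-sound (implies-sound {j ≡ᵇ j} {k <ᵇ k′} (proj₂ (∧-elim {not ((k ≡ᵇ k′) ∧ (j <ᵇ j)) ∨ _} (ok (inT p q) (inT p′ q′)))) (≡ᵇ-refl j) (<ᵇ-true k<k′)) }
  where
  eq : t ≡ graph (entry t) (cells lam μ)
  eq = trans (graph-entry t (subst Unique (sym cs) (Unique-cells lam μ))) (cong (graph (entry t)) cs)
  inT : ∀ {k j} → nth μ k ≤ j → j < nth lam k → ((k , j) , entry t (k , j)) ∈ t
  inT p q = subst (_ ∈_) (sym eq) (∈-map⁺ _ (∈-cells⁺ lam μ p q))
  ok : ∀ {p q} → p ∈ t → q ∈ t → okᵇ p q ≡ true
  ok {p} p∈ q∈ = allᵇ-sound (okᵇ p) t (allᵇ-sound (λ p → allᵇ (okᵇ p) t) t s p∈) q∈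

∈-ssyts⁺ : ∀ K lam μ {E} → SemiStandard K lam μ E → graph E (cells lam μ) ∈ ssyts K lam μ
∈-ssyts⁺ K lam μ {E} S = ∈-filt⁺ isSSYT
  (∈-fillings⁺ K (cells lam μ) E (λ { {k , j} i → let p , q = ∈-cells⁻ lam μ i in bounds p q }))
  (allᵇ-true _ (graph E (cells lam μ)) (λ {p} p∈ → allᵇ-true (okᵇ p) (graph E (cells lam μ)) (λ {q} q∈ → ok p q (∈-graph⁻ E _ p∈) (∈-graph⁻ E _ q∈))))
  where
  open SemiStandard S
  ok : ∀ p q → proj₁ p ∈ cells lam μ × proj₂ p ≡ E (proj₁ p) → proj₁ q ∈ cells lam μ × proj₂ q ≡ E (proj₁ q) → okᵇ p q ≡ true
  ok ((i , j) , _) ((i′ , j′) , _) (p∈ , refl) (q∈ , refl) with ∈-cells⁻ lam μ p∈ | ∈-cells⁻ lam μ q∈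
  ... | a , b | a′ , b′ = ∧-intro
    (implies-true {i ≡ᵇ i′} λ x y → ≤ᵇ-true (row (≡ᵇ-sound {i} x) (<ᵇ-sound {j} y)))
    (implies-true {j ≡ᵇ j′} λ x y → <ᵇ-true (col (≡ᵇ-sound {j} x) (<ᵇ-sound {i} y)))
    where
    row : i ≡ i′ → j < j′ → E (i , j) ≤ E (i′ , j′)
    row refl y = rows a y b′
    col : j ≡ j′ → i < i′ → E (i , j) < E (i′ , j′)
    col refl y = cols y a b a′ b′

-- N k i is the number of boxes of row k of the shape formed by the inner shape and the entries ≤ i.
record GT (M : ℕ) (lam μ : ℕ → ℕ) (N : ℕ → ℕ → ℕ) : Set where
  field
    start : ∀ k → N k 0 ≡ μ k
    end   : ∀ k → N k M ≡ lam k
    mono  : ∀ k i → i < M → N k i ≤ N k (suc i)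
    inter : ∀ k i → i < M → N (suc k) (suc i) ≤ N k i

  mono* : ∀ k {i j} → i ≤ j → j ≤ M → N k i ≤ N k j
  mono* k {i} {j} i≤j j≤M with m≤n⇒∃[o]m+o≡n i≤j
  ... | o , refl = go o j≤M
    where go : ∀ o → i + o ≤ M → N k i ≤ N k (i + o)
          go zero    _ = ≤-reflexive (cong (N k) (sym (+-identityʳ i)))
          go (suc o) h = let h′ = subst (_≤ M) (+-suc i o) h in
            ≤-trans (go o (<⇒≤ h′)) (≤-trans (mono k (i + o) h′) (≤-reflexive (cong (N k) (sym (+-suc i o)))))

  lower : ∀ k {i} → i ≤ M → μ k ≤ N k i
  lower k h = subst (_≤ _) (start k) (mono* k z≤n h)

  upper : ∀ k {i} → i ≤ M → N k i ≤ lam k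
  upper k h = subst (_ ≤_) (end k) (mono* k h ≤-refl)

  inter* : ∀ {k k′} i → i < M → k < k′ → N k′ (suc i) ≤ N k i
  inter* {k} {k′} i i<M k<k′ with m≤n⇒∃[o]m+o≡n k<k′
  ... | o , refl = go o
    where go : ∀ o → N (suc k + o) (suc i) ≤ N k i
          go zero    = subst (λ x → N (suc x) (suc i) ≤ N k i) (sym (+-identityʳ k)) (inter k i i<M)
          go (suc o) = subst (λ x → N (suc x) (suc i) ≤ N k i) (sym (+-suc k o))
            (≤-trans (inter (suc (k + o)) i i<M) (≤-trans (mono (suc (k + o)) i i<M) (go o)))

gtEntries : List ℕ → List ℕ → (Cell → ℕ) → ℕ → ℕ → ℕ
gtEntries lam μ E k i = nth μ k + sumTo (nth lam k ∸ nth μ k) (λ x → b2n (E (k , nth μ k + x) ≤ᵇ i))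

gt : List ℕ → Tableau → ℕ → ℕ → ℕ
gt μ t k i = nth μ k + countᵇ (λ q → (rowOf q ≡ᵇ k) ∧ (proj₂ q ≤ᵇ i)) t

gt-graph : ∀ lam μ E k i → gt μ (graph E (cells lam μ)) k i ≡ gtEntries lam μ E k i
gt-graph lam μ E k i = cong (nth μ k +_) (countᵇ-graph-row E lam μ k (_≤ᵇ i))

module _ {M : ℕ} {lam μ : List ℕ} {E : Cell → ℕ} (skew : Skew lam μ) (S : SemiStandard M lam μ E) where
  open Skew skew
  open SemiStandard S

  private
    N : ℕ → ℕ → ℕ
    N = gtEntries lam μ E

    offset : ∀ {k j} → nth μ k ≤ j → j < nth lam k → j ∸ nth μ k < nth lam k ∸ nth μ k
    offset p q = ∸-monoˡ-< q p

    inside : ∀ k {x} → x < nth lam k ∸ nth μ k → nth μ k + x < nth lam k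
    inside k {x} h = subst (_≤ nth lam k) (+-suc (nth μ k) x) (≤-trans (+-monoʳ-≤ (nth μ k) h) (≤-reflexive (m+[n∸m]≡n (sub k))))

  entry≤⇔ : ∀ {k j} i → nth μ k ≤ j → j < nth lam k → (E (k , j) ≤ᵇ i) ≡ (j <ᵇ N k i)
  entry≤⇔ {k} {j} i p q = trans (trans (cong (λ j → E (k , j) ≤ᵇ i) (sym (m+[n∸m]≡n p)))
      (threshold (nth lam k ∸ nth μ k) (λ x → E (k , nth μ k + x) ≤ᵇ i)
         (λ x y x<y y<n e → ≤ᵇ-true (≤-trans (rows (m≤m+n _ x) (+-monoʳ-< (nth μ k) x<y) (inside k y<n)) (≤ᵇ-sound e)))
         (j ∸ nth μ k) (offset p q)))
    (bool-ext (λ e → <ᵇ-true (subst (_< N k i) (m+[n∸m]≡n p) (+-monoʳ-< (nth μ k) (<ᵇ-sound e))))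
              (λ e → <ᵇ-true (+-cancelˡ-< (nth μ k) _ _ (subst (_< N k i) (sym (m+[n∸m]≡n p)) (<ᵇ-sound e)))))

  gtEntries-GT : GT M (nth lam) (nth μ) (gtEntries lam μ E)
  gtEntries-GT = record
    { start = λ k → trans (cong (nth μ k +_) (sumTo-zero _ (λ x h → cong b2n (¬true (λ e → <⇒≱ (proj₁ (bounds (m≤m+n _ x) (inside k h))) (≤ᵇ-sound e)))))) (+-identityʳ _)
    ; end   = λ k → trans (cong (nth μ k +_) (trans (sumTo-cong (nth lam k ∸ nth μ k) (λ x h → cong b2n (trans (≤ᵇ-true (proj₂ (bounds (m≤m+n _ x) (inside k h)))) (sym (<ᵇ-true h))))) (sumTo-initial _ _ ≤-refl))) (m+[n∸m]≡n (sub k))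
    ; mono  = λ k i _ → +-monoʳ-≤ (nth μ k) (sumTo-mono (nth lam k ∸ nth μ k) (λ x _ → weaken (E (k , nth μ k + x)) i))
    ; inter = λ k i _ → ≮⇒≥ (λ h → below k i h) }
    where
    weaken : ∀ e i → b2n (e ≤ᵇ i) ≤ b2n (e ≤ᵇ suc i)
    weaken e i with e ≤ᵇ i in q
    ... | false = z≤n
    ... | true  rewrite ≤ᵇ-true {e} {suc i} (m≤n⇒m≤1+n (≤ᵇ-sound q)) = ≤-refl
    -- With `j = N k i`, the cell in row `k + 1` and column `j` would have an entry at most `i + 1`.
    -- The cell above it then has an entry at most `i`, which puts column `j` among the first
    -- `N k i` columns.
    below : ∀ k i → N k i < N (suc k) (suc i) → ⊥
    below k i h = case ≤ᵇ-sound {E (k , j)} {i} (≤ᵇ-true (s≤s⁻¹ (≤-trans (cols (n<1+n k) p q p′ q′) Esuc≤))) of λ le →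
        <-irrefl refl (<ᵇ-sound {j} (trans (sym (entry≤⇔ i p q)) (≤ᵇ-true le)))
      where
      j = N k i
      p : nth μ k ≤ j
      p = m≤m+n _ _
      p′ : nth μ (suc k) ≤ j
      p′ = ≤-trans (inner k) p
      q′ : j < nth lam (suc k)
      q′ = ≤-trans h (≤-trans (+-monoʳ-≤ (nth μ (suc k)) (sumTo-b2n≤ _ _)) (≤-reflexive (m+[n∸m]≡n (sub (suc k)))))
      q : j < nth lam k
      q = ≤-trans q′ (outer k)
      Esuc≤ : E (suc k , j) ≤ suc i
      Esuc≤ = ≤ᵇ-sound (trans (entry≤⇔ (suc i) p′ q′) (<ᵇ-true h))

-- The entry is the least `e` with `j < N k e`. Since `N k` increases, it is found by counting the
-- positive indices at which `N k` has not yet exceeded `j`.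
gtEntry : ℕ → (ℕ → ℕ → ℕ) → Cell → ℕ
gtEntry M N (k , j) = suc (sumTo M (λ i → b2n (N k (suc i) ≤ᵇ j)))

fromGT : ℕ → List ℕ → List ℕ → (ℕ → ℕ → ℕ) → Tableau
fromGT M lam μ N = graph (gtEntry M N) (cells lam μ)

module _ {M : ℕ} {lam μ : List ℕ} {N : ℕ → ℕ → ℕ} (skew : Skew lam μ) (G : GT M (nth lam) (nth μ) N) where
  open Skew skew
  open GT G

  gtEntry≤⇔ : ∀ {k j i} → nth μ k ≤ j → i ≤ M → (gtEntry M N (k , j) ≤ᵇ i) ≡ (j <ᵇ N k i)
  gtEntry≤⇔ {k} {j} {zero}  p h = sym (<ᵇ-false (subst (_≤ j) (sym (start k)) p))
  gtEntry≤⇔ {k} {j} {suc i} p h = bool-ext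
      (λ e → <ᵇ-true {j} {N k (suc i)} (≰⇒> (λ le → <⇒≱ (<ᵇ-sound {i} {smaller} (trans (sym thr) (≤ᵇ-true le))) (s≤s⁻¹ (≤ᵇ-sound {suc smaller} {suc i} e)))))
      (λ e → ≤ᵇ-true {suc smaller} {suc i} (s≤s (≮⇒≥ (λ lt → <⇒≱ (<ᵇ-sound {j} e) (≤ᵇ-sound {N k (suc i)} {j} (trans thr (<ᵇ-true lt)))))))
    where smaller = sumTo M (λ i → b2n (N k (suc i) ≤ᵇ j))
          thr : (N k (suc i) ≤ᵇ j) ≡ (i <ᵇ smaller)
          thr = threshold M (λ i → N k (suc i) ≤ᵇ j) (λ x y x<y y<M e → ≤ᵇ-true (≤-trans (mono* k (s≤s (<⇒≤ x<y)) y<M) (≤ᵇ-sound e))) i h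

  gtEntry-SemiStandard : SemiStandard M lam μ (gtEntry M N)
  gtEntry-SemiStandard = record { bounds = λ p q → s≤s z≤n , bound p q ; rows = row ; cols = col }
    where
    bound : ∀ {k j} → nth μ k ≤ j → j < nth lam k → gtEntry M N (k , j) ≤ M
    bound {k} p q = ≤ᵇ-sound (trans (gtEntry≤⇔ {k} p ≤-refl) (<ᵇ-true (subst (_ <_) (sym (end k)) q)))
    row : ∀ {k j j′} → nth μ k ≤ j → j < j′ → j′ < nth lam k → gtEntry M N (k , j) ≤ gtEntry M N (k , j′)
    row {k} {j} {j′} p j<j′ q = ≤ᵇ-sound (trans (gtEntry≤⇔ {k} p b) (<ᵇ-true {j} {N k e} (<-trans j<j′ (<ᵇ-sound {j′} {N k e} (trans (sym (gtEntry≤⇔ {k} p′ b)) (≤ᵇ-refl e))))))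
      where e = gtEntry M N (k , j′)
            p′ = ≤-trans p (<⇒≤ j<j′)
            b  = bound p′ q
    col : ∀ {k k′ j} → k < k′ → nth μ k ≤ j → j < nth lam k → nth μ k′ ≤ j → j < nth lam k′ → gtEntry M N (k , j) < gtEntry M N (k′ , j)
    col {k} {k′} {j} k<k′ p q p′ q′ = s≤s (≤ᵇ-sound (trans (gtEntry≤⇔ {k} p (<⇒≤ b)) (<ᵇ-true (≤-trans
        (<ᵇ-sound {j} (trans (sym (gtEntry≤⇔ {k′} p′ b)) (≤ᵇ-refl (gtEntry M N (k′ , j))))) (inter* _ b k<k′)))))
      where b = bound p′ q′

  fromGT-∈ : fromGT M lam μ N ∈ ssyts M lam μ
  fromGT-∈ = ∈-ssyts⁺ M lam μ gtEntry-SemiStandard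

  gt-fromGT : ∀ k {i} → i ≤ M → gt μ (fromGT M lam μ N) k i ≡ N k i
  gt-fromGT k {i} h = trans (gt-graph lam μ (gtEntry M N) k i) (trans (cong (nth μ k +_) (trans
      (sumTo-cong (nth lam k ∸ nth μ k) (λ x _ → cong b2n (trans (gtEntry≤⇔ (m≤m+n _ x) h)
         (bool-ext (λ e → <ᵇ-true (+-cancelˡ-< (nth μ k) _ _ (subst (nth μ k + x <_) (sym (m+[n∸m]≡n lo)) (<ᵇ-sound e))))
                   (λ e → <ᵇ-true (subst (nth μ k + x <_) (m+[n∸m]≡n lo) (+-monoʳ-< (nth μ k) (<ᵇ-sound e))))))))
      (sumTo-initial _ (N k i ∸ nth μ k) (∸-monoˡ-≤ (nth μ k) (upper k h))))) (m+[n∸m]≡n lo))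
    where lo : nth μ k ≤ N k i
          lo = lower k h

gt-GT : ∀ {M lam μ t} → Skew lam μ → t ∈ ssyts M lam μ → GT M (nth lam) (nth μ) (gt μ t)
gt-GT {M} {lam} {μ} {t} skew t∈ with ∈-ssyts⁻ M lam μ t∈
... | eq , S = record
  { start = λ k → trans (e k 0) (start k)
  ; end   = λ k → trans (e k M) (end k)
  ; mono  = λ k i h → subst₂ _≤_ (sym (e k i)) (sym (e k (suc i))) (mono k i h)
  ; inter = λ k i h → subst₂ _≤_ (sym (e (suc k) (suc i))) (sym (e k i)) (inter k i h) }
  where open GT (gtEntries-GT skew S)
        e : ∀ k i → gt μ t k i ≡ gtEntries lam μ (entry t) k i
        e k i = trans (cong (λ t → gt μ t k i) eq) (gt-graph lam μ (entry t) k i)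

gt-injective : ∀ {M lam μ t t′} → Skew lam μ → t ∈ ssyts M lam μ → t′ ∈ ssyts M lam μ →
               (∀ k i → i ≤ M → gt μ t k i ≡ gt μ t′ k i) → t ≡ t′
gt-injective {M} {lam} {μ} {t} {t′} skew t∈ t′∈ h with ∈-ssyts⁻ M lam μ t∈ | ∈-ssyts⁻ M lam μ t′∈
... | eq , S | eq′ , S′ = trans eq (trans (map-cong-cells (cells lam μ) (λ c → c)) (sym eq′))
  where
  same : ∀ k i → i ≤ M → gtEntries lam μ (entry t) k i ≡ gtEntries lam μ (entry t′) k i
  same k i i≤M = trans (sym (trans (cong (λ t → gt μ t k i) eq) (gt-graph lam μ (entry t) k i)))
    (trans (h k i i≤M) (trans (cong (λ t → gt μ t k i) eq′) (gt-graph lam μ (entry t′) k i)))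
  agree : ∀ {k j} → nth μ k ≤ j → j < nth lam k → entry t (k , j) ≡ entry t′ (k , j)
  agree {k} {j} p q = ≤-antisym
    (≤ᵇ-sound (trans (entry≤⇔ skew S _ p q) (trans (cong (j <ᵇ_) (same k _ b′)) (trans (sym (entry≤⇔ skew S′ (entry t′ (k , j)) p q)) (≤ᵇ-refl (entry t′ (k , j)))))))
    (≤ᵇ-sound (trans (entry≤⇔ skew S′ _ p q) (trans (cong (j <ᵇ_) (sym (same k _ b))) (trans (sym (entry≤⇔ skew S (entry t (k , j)) p q)) (≤ᵇ-refl (entry t (k , j)))))))
    where b  = proj₂ (SemiStandard.bounds S p q)
          b′ = proj₂ (SemiStandard.bounds S′ p q)
  map-cong-cells : ∀ cs → (∀ {c} → c ∈ cs → c ∈ cells lam μ) → graph (entry t) cs ≡ graph (entry t′) cs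
  map-cong-cells []             h = refl
  map-cong-cells ((k , j) ∷ cs) h = cong₂ _∷_ (cong ((k , j) ,_) (let p , q = ∈-cells⁻ lam μ (h (here refl)) in agree p q)) (map-cong-cells cs (h ∘ there))

-- Letters are indexed from 0: index `i` belongs to the entry `i + 1`, whose number in a row is the
-- step of the pattern from column `i` to column `i + 1`.
contentAt : Tableau → ℕ → ℕ
contentAt t i = countᵇ (λ q → proj₂ q ≡ᵇ suc i) t

rowContent : Tableau → ℕ → ℕ → ℕ
rowContent t k i = countᵇ (λ q → (rowOf q ≡ᵇ k) ∧ (proj₂ q ≡ᵇ suc i)) t

rowContent-gt : ∀ μ t k i → gt μ t k i + rowContent t k i ≡ gt μ t k (suc i)
rowContent-gt μ t k i = trans (+-assoc (nth μ k) _ _) (cong (nth μ k +_) (countᵇ-split t (λ {q} _ → pw (rowOf q ≡ᵇ k) (proj₂ q))))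
  where
  pw : ∀ b e → b2n (b ∧ (e ≤ᵇ i)) + b2n (b ∧ (e ≡ᵇ suc i)) ≡ b2n (b ∧ (e ≤ᵇ suc i))
  pw false e = refl
  pw true  e with <-cmp e (suc i)
  ... | tri< a _ _ rewrite ≤ᵇ-true {e} {i} (s≤s⁻¹ a) | ≡ᵇ-false {e} {suc i} (<⇒≢ a) | ≤ᵇ-true {e} {suc i} (<⇒≤ a) = refl
  ... | tri≈ _ refl _ rewrite ≡ᵇ-refl i | ≤ᵇ-true {suc i} {suc i} ≤-refl | <ᵇ-false {i} {i} ≤-refl = refl
  ... | tri> _ _ c rewrite ≡ᵇ-false {e} {suc i} (>⇒≢ c)
        | ¬true {e ≤ᵇ i} (λ q → <⇒≱ c (m≤n⇒m≤1+n (≤ᵇ-sound q))) | ¬true {e ≤ᵇ suc i} (λ q → <⇒≱ c (≤ᵇ-sound q)) = refl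

countᵇ-by-rows : ∀ ℓ t (P : Cell × ℕ → Bool) → (∀ {q} → q ∈ t → rowOf q < ℓ) →
                 countᵇ P t ≡ sumTo ℓ (λ k → countᵇ (λ q → (rowOf q ≡ᵇ k) ∧ P q) t)
countᵇ-by-rows ℓ []      P h = sym (sumTo-0 ℓ)
countᵇ-by-rows ℓ (q ∷ t) P h = trans (countᵇ-∷ P q t) (trans
  (cong₂ _+_ (sym (trans (sumTo-single ℓ (rowOf q) (h (here refl)) (λ j _ ne → cong (λ b → b2n (b ∧ P q)) (≡ᵇ-false (ne ∘ sym)))) (cong (λ b → b2n (b ∧ P q)) (≡ᵇ-refl (rowOf q)))))
             (countᵇ-by-rows ℓ t P (h ∘ there)))
  (trans (sym (sumTo-+ ℓ _ _)) (sumTo-cong ℓ (λ k _ → sym (countᵇ-∷ (λ q → (rowOf q ≡ᵇ k) ∧ P q) q t)))))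

ssyts-rows : ∀ M lam μ {t} → t ∈ ssyts M lam μ → ∀ {q} → q ∈ t → rowOf q < length lam
ssyts-rows M lam μ {t} t∈ {(i , j) , e} q∈ with ∈-ssyts⁻ M lam μ t∈
... | eq , _ = nth-pos⇒< lam (proj₂ (∈-cells⁻ lam μ (proj₁ (∈-graph⁻ (entry t) _ (subst (_ ∈_) eq q∈)))))

contentAt-gt : ∀ ℓ μ t i → (∀ {q} → q ∈ t → rowOf q < ℓ) →
               sumTo ℓ (λ k → gt μ t k i) + contentAt t i ≡ sumTo ℓ (λ k → gt μ t k (suc i))
contentAt-gt ℓ μ t i h = trans (cong (sumTo ℓ _ +_) (countᵇ-by-rows ℓ t _ h))
  (trans (sym (sumTo-+ ℓ (λ k → gt μ t k i) (λ k → rowContent t k i))) (sumTo-cong ℓ (λ k _ → rowContent-gt μ t k i)))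

map-suc-range : {A : Set} (f : ℕ → A) (n : ℕ) → map f (map suc (range n)) ≡ applyUpTo (f ∘ suc) n
map-suc-range f n = go id n
  where go : ∀ g n → map f (map suc (applyUpTo g n)) ≡ applyUpTo (f ∘ suc ∘ g) n
        go g zero    = refl
        go g (suc n) = cong (f (suc (g 0)) ∷_) (go (g ∘ suc) n)

content≡ : ∀ K t → content K t ≡ applyUpTo (contentAt t) K
content≡ K t = map-suc-range _ K

length-content : ∀ K t → length (content K t) ≡ K
length-content K t = trans (cong length (content≡ K t)) (length-applyUpTo _ K)

nth-content : ∀ K t {i} → i < K → nth (content K t) i ≡ contentAt t i
nth-content K t h = trans (cong (λ l → nth l _) (content≡ K t)) (nth-applyUpTo _ K h)

-- Reflections of patterns and the symmetry of Schur functions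

⊓-⊔-sum : ∀ m n → (m ⊔ n) + (n ⊓ m) ≡ m + n
⊓-⊔-sum m n with ≤-total m n
... | inj₁ h rewrite m≤n⇒m⊔n≡n h | m≥n⇒m⊓n≡n h = +-comm n m
... | inj₂ h rewrite m≥n⇒m⊔n≡m h | m≤n⇒m⊓n≡m h = refl

ceiling : (a c : ℕ → ℕ) → ℕ → ℕ
ceiling a c zero    = c 0
ceiling a c (suc k) = c (suc k) ⊓ a k

-- Consecutive columns a, b, c of a Gelfand–Tsetlin pattern constrain each b k to an interval whose ends depend on a
-- and c only. From row k₀ on b is reflected in these intervals, the one of row k₀ being cut at cap.
reflectColumn : (a c : ℕ → ℕ) → ℕ → ℕ → (ℕ → ℕ) → ℕ → ℕ
reflectColumn a c k₀ cap b k = if k <ᵇ k₀ then b k else (a k ⊔ c (suc k)) + (if k ≡ᵇ k₀ then cap else ceiling a c k) ∸ b k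

record Columns (a b c : ℕ → ℕ) : Set where
  constructor columns
  field
    a≤b : ∀ k → a k ≤ b k
    b≤c : ∀ k → b k ≤ c k
    b≤a : ∀ k → b (suc k) ≤ a k
    c≤b : ∀ k → c (suc k) ≤ b k

-- The conditions on `cap` say that the cut interval of row `k₀` still contains `b k₀` and respects
-- both upper bounds imposed by the neighbouring columns. Hence the reflected column interlaces with
-- `a` and `c` as `b` does.
module Reflection {a b c : ℕ → ℕ} (C : Columns a b c) (k₀ cap : ℕ)
                  (b≤cap : b k₀ ≤ cap) (cap≤c : cap ≤ c k₀) (cap≤a : ∀ k → k₀ ≡ suc k → cap ≤ a k) where
  open Columns C

  lo hi top b′ : ℕ → ℕ
  lo k = a k ⊔ c (suc k)
  top  = ceiling a c
  hi k = if k ≡ᵇ k₀ then cap else top k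
  b′ = reflectColumn a c k₀ cap b

  before : ∀ {k} b → k < k₀ → reflectColumn a c k₀ cap b k ≡ b k
  before b h rewrite <ᵇ-true h = refl

  after : ∀ {k} b → k₀ ≤ k → reflectColumn a c k₀ cap b k ≡ lo k + hi k ∸ b k
  after b h rewrite <ᵇ-false h = refl

  b′-before : ∀ {k} → k < k₀ → b′ k ≡ b k
  b′-before = before b

  hi-k₀ : hi k₀ ≡ cap
  hi-k₀ rewrite ≡ᵇ-refl k₀ = refl

  hi-other : ∀ {k} → ¬ k ≡ k₀ → hi k ≡ top k
  hi-other ne rewrite ≡ᵇ-false ne = refl

  lo≤b : ∀ k → lo k ≤ b k
  lo≤b k = ⊔-lub (a≤b k) (c≤b k)

  b≤top : ∀ k → b k ≤ top k
  b≤top zero    = b≤c 0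
  b≤top (suc k) = ⊓-glb (b≤c (suc k)) (b≤a k)

  b≤hi : ∀ k → b k ≤ hi k
  b≤hi k with k ≟ k₀
  ... | yes refl = subst (b k ≤_) (sym hi-k₀) b≤cap
  ... | no ne    = subst (b k ≤_) (sym (hi-other ne)) (b≤top k)

  hi≤c : ∀ k → hi k ≤ c k
  hi≤c k with k ≟ k₀
  ... | yes refl = subst (_≤ c k) (sym hi-k₀) cap≤c
  ... | no ne    = subst (_≤ c k) (sym (hi-other ne)) (top≤c k)
    where top≤c : ∀ k → top k ≤ c k
          top≤c zero    = ≤-refl
          top≤c (suc k) = m⊓n≤m _ _

  hi≤a : ∀ k → hi (suc k) ≤ a k
  hi≤a k with suc k ≟ k₀
  ... | yes refl = subst (_≤ a k) (sym hi-k₀) (cap≤a k refl)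
  ... | no ne    = subst (_≤ a k) (sym (hi-other ne)) (m⊓n≤n _ _)

  b′+b : ∀ {k} → k₀ ≤ k → b′ k + b k ≡ lo k + hi k
  b′+b {k} h = trans (cong (_+ b k) (after b h)) (m∸n+n≡m (≤-trans (b≤hi k) (m≤n+m (hi k) (lo k))))

  lo≤b′ : ∀ {k} → k₀ ≤ k → lo k ≤ b′ k
  lo≤b′ {k} h = lia 4 (λ l b b′ h → b′ :+ b :≡ l :+ h ⇒ b :≤ h ⇒ ⊢ l :≤ b′) (lo k) (b k) (b′ k) (hi k) (b′+b h) (b≤hi k)

  b′≤hi : ∀ {k} → k₀ ≤ k → b′ k ≤ hi k
  b′≤hi {k} h = lia 4 (λ l b b′ h → b′ :+ b :≡ l :+ h ⇒ l :≤ b ⇒ ⊢ b′ :≤ h) (lo k) (b k) (b′ k) (hi k) (b′+b h) (lo≤b k)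

  cases : {P : ℕ → ℕ → Set} → (∀ {k} → k < k₀ → P k (b k)) → (∀ {k} → k₀ ≤ k → P k (b′ k)) → ∀ k → P k (b′ k)
  cases {P} f g k with k <? k₀
  ... | yes h = subst (P k) (sym (b′-before h)) (f h)
  ... | no  h = g (≮⇒≥ h)

  reflected : Columns a b′ c
  reflected = columns
    (cases {λ k x → a k ≤ x} (λ _ → a≤b _) (λ h → ≤-trans (m≤m⊔n _ _) (lo≤b′ h)))
    (cases {λ k x → x ≤ c k} (λ _ → b≤c _) (λ {k} h → ≤-trans (b′≤hi h) (hi≤c k)))
    (λ k → cases {λ j x → ∀ k → j ≡ suc k → x ≤ a k} (λ { _ k refl → b≤a k }) (λ { h k refl → ≤-trans (b′≤hi h) (hi≤a k) }) (suc k) k refl)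
    (cases {λ k x → c (suc k) ≤ x} (λ _ → c≤b _) (λ h → ≤-trans (m≤n⊔m _ _) (lo≤b′ h)))

  b′≤cap : b′ k₀ ≤ cap
  b′≤cap = subst (b′ k₀ ≤_) hi-k₀ (b′≤hi ≤-refl)

  involutive : ∀ k → reflectColumn a c k₀ cap b′ k ≡ b k
  involutive k with k <? k₀
  ... | yes h = trans (before b′ h) (b′-before h)
  ... | no  h = trans (after b′ (≮⇒≥ h)) (trans (cong (_∸ b′ k) (sym (b′+b (≮⇒≥ h)))) (m+n∸m≡n (b′ k) (b k)))

  -- Each reflected row gives `b′ k + b k = lo k + hi k`. As `lo k` and `top (k + 1)` are maximum
  -- and minimum of the same two numbers, they add up to `a k + c (k + 1)`; the sum telescopes, with
  -- `top n` left over at the lower end. It vanishes in `columnSums`.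
  partialSums : ∀ d → let n = suc (k₀ + d) in
    sumTo n b′ + sumTo n b + c k₀ + sumTo k₀ a + sumTo k₀ c + top n ≡ cap + sumTo k₀ b + sumTo k₀ b + sumTo n a + sumTo n c + c n
  partialSums zero rewrite +-identityʳ k₀ = lia 14
    (λ Pb′ Pb Pa Pc b′ b a c c′ lo hi top cap z → Pb′ :≡ Pb ⇒ b′ :+ b :≡ lo :+ hi ⇒ hi :≡ cap ⇒ lo :+ top :≡ a :+ c′ ⇒
       ⊢ Pb′ :+ b′ :+ (Pb :+ b) :+ c :+ Pa :+ Pc :+ top :≡ cap :+ Pb :+ Pb :+ (Pa :+ a) :+ (Pc :+ c) :+ c′)
    (sumTo k₀ b′) (sumTo k₀ b) (sumTo k₀ a) (sumTo k₀ c) (b′ k₀) (b k₀) (a k₀) (c k₀) (c (suc k₀)) (lo k₀) (hi k₀) (top (suc k₀)) cap 0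
    (sumTo-cong k₀ (λ k h → b′-before h)) (b′+b ≤-refl) hi-k₀ (⊓-⊔-sum (a k₀) (c (suc k₀)))
  partialSums (suc d) rewrite +-suc k₀ d = step (partialSums d) (b′+b (≤-trans (m≤m+n k₀ d) (n≤1+n _)))
      (hi-other (λ e → m≢1+m+n k₀ (sym e))) (⊓-⊔-sum (a n) (c (suc n)))
    where
    n = suc (k₀ + d)
    step : sumTo n b′ + sumTo n b + c k₀ + sumTo k₀ a + sumTo k₀ c + top n ≡ cap + sumTo k₀ b + sumTo k₀ b + sumTo n a + sumTo n c + c n →
           b′ n + b n ≡ lo n + hi n → hi n ≡ top n → lo n + top (suc n) ≡ a n + c (suc n) →
           sumTo (suc n) b′ + sumTo (suc n) b + c k₀ + sumTo k₀ a + sumTo k₀ c + top (suc n) ≡ cap + sumTo k₀ b + sumTo k₀ b + sumTo (suc n) a + sumTo (suc n) c + c (suc n)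
    step = lia 18 (λ Sb′ Sb ck₀ Pa Pc topn cap Pb Sa Sc cn b′ b a lo hi top c′ →
             Sb′ :+ Sb :+ ck₀ :+ Pa :+ Pc :+ topn :≡ cap :+ Pb :+ Pb :+ Sa :+ Sc :+ cn ⇒
             b′ :+ b :≡ lo :+ hi ⇒ hi :≡ topn ⇒ lo :+ top :≡ a :+ c′ ⇒
             ⊢ Sb′ :+ b′ :+ (Sb :+ b) :+ ck₀ :+ Pa :+ Pc :+ top :≡ cap :+ Pb :+ Pb :+ (Sa :+ a) :+ (Sc :+ cn) :+ c′)
      (sumTo n b′) (sumTo n b) (c k₀) (sumTo k₀ a) (sumTo k₀ c) (top n) cap (sumTo k₀ b) (sumTo n a) (sumTo n c) (c n) (b′ n) (b n) (a n) (lo n) (hi n) (top (suc n)) (c (suc n))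

  columnSums : ∀ ℓ → k₀ < ℓ → c ℓ ≡ 0 →
    sumTo ℓ b′ + sumTo ℓ b + c k₀ + sumTo k₀ a + sumTo k₀ c ≡ cap + sumTo k₀ b + sumTo k₀ b + sumTo ℓ a + sumTo ℓ c
  columnSums ℓ k₀<ℓ cℓ≡0 with m≤n⇒∃[o]m+o≡n k₀<ℓ
  ... | d , refl = lia 4 (λ x y t z → x :+ t :≡ y :+ z ⇒ z :≡ # 0 ⇒ t :≤ z ⇒ ⊢ x :≡ y) _ _ (top ℓ) (c ℓ) (partialSums d) cℓ≡0 (m⊓n≤m (c ℓ) _)

reflectGT : (ℕ → ℕ → ℕ) → ℕ → ℕ → ℕ → ℕ → ℕ → ℕ
reflectGT N i k₀ cap k j =
  if j ≡ᵇ suc i then reflectColumn (λ k → N k i) (λ k → N k (suc (suc i))) k₀ cap (λ k → N k (suc i)) k else N k j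

reflectTab : ℕ → List ℕ → List ℕ → ℕ → ℕ → ℕ → Tableau → Tableau
reflectTab M lam μ i k₀ cap t = fromGT M lam μ (reflectGT (gt μ t) i k₀ cap)

reflectColumn-cong : ∀ {a a′ c c′ b b′ : ℕ → ℕ} k₀ cap → (∀ k → a k ≡ a′ k) → (∀ k → c k ≡ c′ k) → (∀ k → b k ≡ b′ k) →
                     ∀ k → reflectColumn a c k₀ cap b k ≡ reflectColumn a′ c′ k₀ cap b′ k
reflectColumn-cong k₀ cap ea ec eb zero    rewrite ea 0 | ec 0 | ec 1 | eb 0 = refl
reflectColumn-cong k₀ cap ea ec eb (suc k) rewrite ea (suc k) | ea k | ec (suc k) | ec (suc (suc k)) | eb (suc k) = refl

record CapOK (N : ℕ → ℕ → ℕ) (i k₀ cap : ℕ) : Set where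
  constructor capOK
  field
    b≤cap : N k₀ (suc i) ≤ cap
    cap≤c : cap ≤ N k₀ (suc (suc i))
    cap≤a : ∀ k → k₀ ≡ suc k → cap ≤ N k i

columnSum : ℕ → (ℕ → ℕ → ℕ) → ℕ → ℕ
columnSum n N i = sumTo n (λ k → N k i)

module ReflectTab {M : ℕ} {lam μ : List ℕ} (skew : Skew lam μ) {t : Tableau} (t∈ : t ∈ ssyts M lam μ)
                  {i : ℕ} (i<M : suc i < M) (k₀ cap : ℕ) (ok : CapOK (gt μ t) i k₀ cap) where
  open CapOK ok
  N N′ : ℕ → ℕ → ℕ
  N  = gt μ t
  N′ = reflectGT N i k₀ cap

  G : GT M (nth lam) (nth μ) N
  G = gt-GT skew t∈
  open GT G

  open Reflection {λ k → N k i} {λ k → N k (suc i)} {λ k → N k (suc (suc i))}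
    (columns (λ k → mono k i (<⇒≤ i<M)) (λ k → mono k (suc i) i<M) (λ k → inter k i (<⇒≤ i<M)) (λ k → inter k (suc i) i<M))
    k₀ cap b≤cap cap≤c cap≤a public using (b′; b′≤cap; b′-before; involutive; columnSums; reflected)
  open Columns reflected

  N′-at : ∀ k → N′ k (suc i) ≡ b′ k
  N′-at k rewrite ≡ᵇ-refl i = refl

  N′-other : ∀ k {j} → ¬ j ≡ suc i → N′ k j ≡ N k j
  N′-other k ne rewrite ≡ᵇ-false ne = refl

  N′-before : ∀ {k} j → k < k₀ → N′ k j ≡ N k j
  N′-before {k} j h with j ≟ suc i
  ... | yes refl = trans (N′-at k) (b′-before h)
  ... | no  ne   = N′-other k ne

  i≢ : ¬ i ≡ suc i
  i≢ = <⇒≢ (n<1+n i)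
  ii≢ : ¬ suc (suc i) ≡ suc i
  ii≢ = >⇒≢ (n<1+n (suc i))

  G′ : GT M (nth lam) (nth μ) N′
  G′ = record
    { start = start
    ; end   = λ k → trans (N′-other k (>⇒≢ i<M)) (end k)
    ; mono  = mono′
    ; inter = inter′ }
    where
    mono′ : ∀ k j → j < M → N′ k j ≤ N′ k (suc j)
    mono′ k j j<M with j ≟ i | j ≟ suc i
    ... | yes refl | _        = subst₂ _≤_ (sym (N′-other k i≢)) (sym (N′-at k)) (a≤b k)
    ... | no _     | yes refl = subst₂ _≤_ (sym (N′-at k)) (sym (N′-other k ii≢)) (b≤c k)
    ... | no j≢i   | no j≢si  = subst₂ _≤_ (sym (N′-other k j≢si)) (sym (N′-other k (j≢i ∘ suc-injective))) (mono k j j<M)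
    inter′ : ∀ k j → j < M → N′ (suc k) (suc j) ≤ N′ k j
    inter′ k j j<M with j ≟ i | j ≟ suc i
    ... | yes refl | _        = subst₂ _≤_ (sym (N′-at (suc k))) (sym (N′-other k i≢)) (b≤a k)
    ... | no _     | yes refl = subst₂ _≤_ (sym (N′-other (suc k) ii≢)) (sym (N′-at k)) (c≤b k)
    ... | no j≢i   | no j≢si  = subst₂ _≤_ (sym (N′-other (suc k) (j≢i ∘ suc-injective))) (sym (N′-other k j≢si)) (inter k j j<M)

  t′ : Tableau
  t′ = reflectTab M lam μ i k₀ cap t

  t′∈ : t′ ∈ ssyts M lam μ
  t′∈ = fromGT-∈ skew G′

  gt-t′ : ∀ k {j} → j ≤ M → gt μ t′ k j ≡ N′ k j
  gt-t′ k h = gt-fromGT skew G′ k h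

  gt-t′-at : ∀ k → gt μ t′ k (suc i) ≡ b′ k
  gt-t′-at k = trans (gt-t′ k (<⇒≤ i<M)) (N′-at k)

  gt-t′-other : ∀ k {j} → j ≤ M → ¬ j ≡ suc i → gt μ t′ k j ≡ N k j
  gt-t′-other k h ne = trans (gt-t′ k h) (N′-other k ne)

  gt-t′-a : ∀ k → gt μ t′ k i ≡ N k i
  gt-t′-a k = gt-t′-other k (<⇒≤ (<⇒≤ i<M)) i≢

  gt-t′-c : ∀ k → gt μ t′ k (suc (suc i)) ≡ N k (suc (suc i))
  gt-t′-c k = gt-t′-other k i<M ii≢

  ok′ : CapOK (gt μ t′) i k₀ cap
  ok′ = capOK (subst (_≤ cap) (sym (gt-t′-at k₀)) b′≤cap) (subst (cap ≤_) (sym (gt-t′-c k₀)) cap≤c)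
              (λ k e → subst (cap ≤_) (sym (gt-t′-a k)) (cap≤a k e))

  module Sums (ℓ : ℕ) (k₀<ℓ : k₀ < ℓ) (rows : length lam ≤ ℓ) where
    private
      zeroRow : N ℓ (suc (suc i)) ≡ 0
      zeroRow = n≤0⇒n≡0 (≤-trans (upper ℓ i<M) (≤-reflexive (nth-beyond lam rows)))
      sa  = columnSum ℓ N i
      sb  = columnSum ℓ N (suc i)
      sc  = columnSum ℓ N (suc (suc i))
      sb′ = sumTo ℓ b′
      Ci : sa + contentAt t i ≡ sb
      Ci = contentAt-gt ℓ μ t i (λ q → ≤-trans (ssyts-rows M lam μ t∈ q) rows)
      Csi : sb + contentAt t (suc i) ≡ sc
      Csi = contentAt-gt ℓ μ t (suc i) (λ q → ≤-trans (ssyts-rows M lam μ t∈ q) rows)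
      Ci′ : sa + contentAt t′ i ≡ sb′
      Ci′ = trans (cong (_+ contentAt t′ i) (sumTo-cong ℓ (λ k _ → sym (gt-t′-a k)))) (trans
        (contentAt-gt ℓ μ t′ i (λ q → ≤-trans (ssyts-rows M lam μ t′∈ q) rows)) (sumTo-cong ℓ (λ k _ → gt-t′-at k)))
      Csi′ : sb′ + contentAt t′ (suc i) ≡ sc
      Csi′ = trans (cong (_+ contentAt t′ (suc i)) (sumTo-cong ℓ (λ k _ → sym (gt-t′-at k)))) (trans
        (contentAt-gt ℓ μ t′ (suc i) (λ q → ≤-trans (ssyts-rows M lam μ t′∈ q) rows)) (sumTo-cong ℓ (λ k _ → gt-t′-c k)))

    -- The contents at `i` and `i + 1` are exchanged up to a shift, which depends only on `cap` and
    -- on entries that the reflection leaves alone. For `k₀ = 0` and `cap = N 0 (i + 2)` the two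
    -- brackets agree and the exchange is exact.
    content-i : contentAt t′ i + (N k₀ (suc (suc i)) + columnSum k₀ N i + columnSum k₀ N (suc (suc i))) ≡
                contentAt t (suc i) + (cap + columnSum k₀ N (suc i) + columnSum k₀ N (suc i))
    content-i = lia 12 (λ sa sb sc sb′ ci csi c′ d ck₀ Pa Pc Pb →
        sb′ :+ sb :+ ck₀ :+ Pa :+ Pc :≡ d :+ Pb :+ Pb :+ sa :+ sc ⇒ sb :+ csi :≡ sc ⇒ sa :+ c′ :≡ sb′ ⇒
        ⊢ c′ :+ (ck₀ :+ Pa :+ Pc) :≡ csi :+ (d :+ Pb :+ Pb))
      sa sb sc sb′ (contentAt t i) (contentAt t (suc i)) (contentAt t′ i) cap (N k₀ (suc (suc i)))
      (columnSum k₀ N i) (columnSum k₀ N (suc (suc i))) (columnSum k₀ N (suc i)) (columnSums ℓ k₀<ℓ zeroRow) Csi Ci′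

    content-si : contentAt t′ (suc i) + (cap + columnSum k₀ N (suc i) + columnSum k₀ N (suc i)) ≡
                 contentAt t i + (N k₀ (suc (suc i)) + columnSum k₀ N i + columnSum k₀ N (suc (suc i)))
    content-si = lia 12 (λ sa sb sc sb′ ci csi c′ d ck₀ Pa Pc Pb →
        sb′ :+ sb :+ ck₀ :+ Pa :+ Pc :≡ d :+ Pb :+ Pb :+ sa :+ sc ⇒ sa :+ ci :≡ sb ⇒ sb′ :+ c′ :≡ sc ⇒
        ⊢ c′ :+ (d :+ Pb :+ Pb) :≡ ci :+ (ck₀ :+ Pa :+ Pc))
      sa sb sc sb′ (contentAt t i) (contentAt t (suc i)) (contentAt t′ (suc i)) cap (N k₀ (suc (suc i)))
      (columnSum k₀ N i) (columnSum k₀ N (suc (suc i))) (columnSum k₀ N (suc i)) (columnSums ℓ k₀<ℓ zeroRow) Ci Csi′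

  content-other : ∀ {j} → j < M → ¬ j ≡ i → ¬ j ≡ suc i → contentAt t′ j ≡ contentAt t j
  content-other {j} j<M j≢i j≢si = +-cancelˡ-≡ (columnSum ℓ N j) _ _ (trans
      (cong (_+ contentAt t′ j) (sumTo-cong ℓ (λ k _ → sym (gt-t′-other k (<⇒≤ j<M) j≢si))))
      (trans (contentAt-gt ℓ μ t′ j (ssyts-rows M lam μ t′∈)) (trans (sumTo-cong ℓ (λ k _ → gt-t′-other k j<M (j≢i ∘ suc-injective))) (sym (contentAt-gt ℓ μ t j (ssyts-rows M lam μ t∈))))))
    where ℓ = length lam

reflectTab-involutive : ∀ {M lam μ t i k₀ cap} → Skew lam μ → t ∈ ssyts M lam μ → suc i < M → CapOK (gt μ t) i k₀ cap →
                        reflectTab M lam μ i k₀ cap (reflectTab M lam μ i k₀ cap t) ≡ t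
reflectTab-involutive {M} {lam} {μ} {t} {i} {k₀} {cap} skew t∈ i<M ok = gt-injective skew R′.t′∈ t∈ same
  where
  module R  = ReflectTab skew t∈ i<M k₀ cap ok
  module R′ = ReflectTab skew R.t′∈ i<M k₀ cap R.ok′
  same : ∀ k j → j ≤ M → gt μ R′.t′ k j ≡ gt μ t k j
  same k j j≤M with j ≟ suc i
  ... | yes refl = trans (R′.gt-t′-at k) (trans (reflectColumn-cong k₀ cap R.gt-t′-a R.gt-t′-c R.gt-t′-at k) (R.involutive k))
  ... | no  ne   = trans (R′.gt-t′-other k j≤M ne) (R.gt-t′-other k j≤M ne)

swapAt : ℕ → List ℕ → List ℕ
swapAt zero    (x ∷ y ∷ l) = y ∷ x ∷ l
swapAt zero    l           = l
swapAt (suc i) []          = []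
swapAt (suc i) (x ∷ l)     = x ∷ swapAt i l

swapAt-++ : ∀ p x y q → swapAt (length p) (p ++ x ∷ y ∷ q) ≡ p ++ y ∷ x ∷ q
swapAt-++ []      x y q = refl
swapAt-++ (z ∷ p) x y q = cong (z ∷_) (swapAt-++ p x y q)

swapAt-involutive : ∀ i l → swapAt i (swapAt i l) ≡ l
swapAt-involutive zero    []          = refl
swapAt-involutive zero    (x ∷ [])    = refl
swapAt-involutive zero    (x ∷ y ∷ l) = refl
swapAt-involutive (suc i) []          = refl
swapAt-involutive (suc i) (x ∷ l)     = cong (x ∷_) (swapAt-involutive i l)

map-swapAt : ∀ g i l → map g (swapAt i l) ≡ swapAt i (map g l)
map-swapAt g zero    []          = refl
map-swapAt g zero    (x ∷ [])    = refl
map-swapAt g zero    (x ∷ y ∷ l) = refl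
map-swapAt g (suc i) []          = refl
map-swapAt g (suc i) (x ∷ l)     = cong (g x ∷_) (map-swapAt g i l)

swapped≡swapAt : ∀ i l l′ → length l′ ≡ length l → suc i < length l → nth l′ i ≡ nth l (suc i) → nth l′ (suc i) ≡ nth l i →
               (∀ j → j < length l → ¬ j ≡ i → ¬ j ≡ suc i → nth l′ j ≡ nth l j) → l′ ≡ swapAt i l
swapped≡swapAt zero    (x ∷ y ∷ l) (x′ ∷ y′ ∷ l′) e h p q o = cong₂ _∷_ p (cong₂ _∷_ q
  (list-ext l′ l (suc-injective (suc-injective e)) (λ j j< → o (suc (suc j)) (s≤s (s≤s (subst (j <_) (suc-injective (suc-injective e)) j<))) (λ ()) (λ ()))))
swapped≡swapAt zero    (x ∷ [])    l′             e (s≤s ()) p q o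
swapped≡swapAt zero    (x ∷ y ∷ l) (x′ ∷ [])      () h p q o
swapped≡swapAt (suc i) (x ∷ l)     (x′ ∷ l′)      e (s≤s h) p q o = cong₂ _∷_ (o 0 (s≤s z≤n) (λ ()) (λ ()))
  (swapped≡swapAt i l l′ (suc-injective e) h p q (λ j j< a b → o (suc j) (s≤s j<) (a ∘ suc-injective) (b ∘ suc-injective)))

-- Starting at row 0 with the full interval as cap reflects every row completely, which is the
-- classical Bender-Knuth involution.
bender-knuth : ∀ {M lam μ t i} → Skew lam μ → t ∈ ssyts M lam μ → suc i < M → CapOK (gt μ t) i 0 (gt μ t 0 (suc (suc i)))
bender-knuth {i = i} skew t∈ i<M = capOK (GT.mono (gt-GT skew t∈) 0 (suc i) i<M) ≤-refl (λ _ ())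

-- The map `g` acts on exponents: `id` gives the skew Schur function and `r *_` its plethysm with
-- p_r. The Bender-Knuth involution exchanges two adjacent contents. An exponent vector whose length
-- is not `M` has coefficient 0 in either order.
schur-symmetric : ∀ {M lam μ} → Skew lam μ → (g : ℕ → ℕ) → Symmetric (λ β → ∑ (ssyts M lam μ) (λ t → 𝟙 (eqL (map g (content M t)) β)))
schur-symmetric {M} {lam} {μ} skew g p x y q with length (p ++ x ∷ y ∷ q) ≟ M
... | no ne = trans (∑-zero S (λ {t} _ → cong 𝟙 (eqL-false (λ e → ne (len t e)))))
                    (sym (∑-zero S (λ {t} _ → cong 𝟙 (eqL-false (λ e → ne (trans (swapLen p) (len t e)))))))
  where
  S = ssyts M lam μ
  len : ∀ t {l} → map g (content M t) ≡ l → length l ≡ M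
  len t e = trans (cong length (sym e)) (trans (length-map g (content M t)) (length-content M t))
  swapLen : ∀ p → length (p ++ x ∷ y ∷ q) ≡ length (p ++ y ∷ x ∷ q)
  swapLen []      = refl
  swapLen (_ ∷ p) = cong suc (swapLen p)
... | yes lenβ = ∑-involution S φ (Unique-ssyts M lam μ) φ∈ φφ (λ {t} t∈ → cong 𝟙 (bool-ext (fwd t∈) (bwd t∈)))
  where
  S = ssyts M lam μ
  i = length p
  i<M : suc i < M
  i<M = subst (suc i <_) lenβ (subst (suc i <_) (sym (length-++ p)) (subst (suc (suc i) ≤_) (sym (+-suc i (suc (length q)))) (s≤s (subst (suc i ≤_) (sym (+-suc i (length q))) (s≤s (m≤m+n i (length q)))))))
  φ : Tableau → Tableau
  φ t = reflectTab M lam μ i 0 (gt μ t 0 (suc (suc i))) t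
  module R {t} (t∈ : t ∈ S) = ReflectTab skew t∈ i<M 0 _ (bender-knuth skew t∈ i<M)
  φ∈ : ∀ {t} → t ∈ S → φ t ∈ S
  φ∈ t∈ = R.t′∈ t∈
  φφ : ∀ {t} → t ∈ S → φ (φ t) ≡ t
  φφ {t} t∈ = trans (cong (λ c → reflectTab M lam μ i 0 c (φ t)) (R.gt-t′-c t∈ 0)) (reflectTab-involutive skew t∈ i<M (bender-knuth skew t∈ i<M))
  swaps : ∀ {t} → t ∈ S → content M (φ t) ≡ swapAt i (content M t)
  swaps {t} t∈ = swapped≡swapAt i (content M t) (content M (φ t))
      (trans (length-content M (φ t)) (sym (length-content M t))) (subst (suc i <_) (sym (length-content M t)) i<M)
      (trans (nth-content M (φ t) (<⇒≤ i<M)) (trans (+-cancelʳ-≡ z _ _ content-i) (sym (nth-content M t i<M))))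
      (trans (nth-content M (φ t) i<M) (trans (+-cancelʳ-≡ z _ _ content-si) (sym (nth-content M t (<⇒≤ i<M)))))
      (λ j j< j≢i j≢si → let j<M = subst (j <_) (length-content M t) j< in
         trans (nth-content M (φ t) j<M) (trans (R.content-other t∈ j<M j≢i j≢si) (sym (nth-content M t j<M))))
    where open R.Sums t∈ (suc (length lam)) (s≤s z≤n) (n≤1+n _)
          z = gt μ t 0 (suc (suc i)) + 0 + 0
  fwd : ∀ {t} → t ∈ S → eqL (map g (content M t)) (p ++ x ∷ y ∷ q) ≡ true → eqL (map g (content M (φ t))) (p ++ y ∷ x ∷ q) ≡ true
  fwd {t} t∈ e = subst (λ l → eqL l (p ++ y ∷ x ∷ q) ≡ true) (sym (trans (cong (map g) (swaps t∈)) (trans (map-swapAt g i (content M t))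
    (trans (cong (swapAt i) (eqL-sound _ _ e)) (swapAt-++ p x y q))))) (eqL-refl (p ++ y ∷ x ∷ q))
  bwd : ∀ {t} → t ∈ S → eqL (map g (content M (φ t))) (p ++ y ∷ x ∷ q) ≡ true → eqL (map g (content M t)) (p ++ x ∷ y ∷ q) ≡ true
  bwd {t} t∈ e = subst (λ l → eqL l (p ++ x ∷ y ∷ q) ≡ true) (sym (trans (cong (map g) (trans (sym (swapAt-involutive i _)) (cong (swapAt i) (sym (swaps t∈)))))
    (trans (map-swapAt g i (content M (φ t))) (trans (cong (swapAt i) (eqL-sound _ _ e)) (swapAt-++ p y x q))))) (eqL-refl (p ++ x ∷ y ∷ q))

-- Stembridge's cancellation

-- Written without subtraction. After cancelling column sums it says that `τ (i + 1)` plus the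
-- number of letters `i + 1` in rows 0 to `k` is at most `τ i` plus the number of letters `i` in the
-- rows before `k`. In other words, `τ` plus the content read so far never increases from `i` to
-- `i + 1` when rows are read from the top, large entries first.
goodAt : (ℕ → ℕ) → (ℕ → Bool) → (ℕ → ℕ → ℕ) → ℕ × ℕ → Bool
goodAt τ linked N (k , i) = not (linked i) ∨
  (τ (suc i) + columnSum (suc k) N (suc (suc i)) + columnSum k N i ≤ᵇ τ i + columnSum k N (suc i) + columnSum (suc k) N (suc i))

-- The tableau conditions are imposed row by row, and within a row from the largest letter down.
rowConditions : ℕ → ℕ → ℕ → List (ℕ × ℕ) → List (ℕ × ℕ)
rowConditions m k zero    cs = cs
rowConditions m k (suc j) cs = (k , m ∸ suc j) ∷ rowConditions m k j cs

conditions : ℕ → ℕ → List (ℕ × ℕ)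
conditions m zero    = []
conditions m (suc k) = rowConditions m k m (conditions m k)

∈-rowConditions⁻ : ∀ m k j cs → j ≤ m → ∀ {c} → c ∈ rowConditions m k j cs → (proj₁ c ≡ k × m ∸ j ≤ proj₂ c × proj₂ c < m) ⊎ c ∈ cs
∈-rowConditions⁻ m k zero    cs h i           = inj₂ i
∈-rowConditions⁻ m k (suc j) cs h (here refl) = inj₁ (refl , ≤-refl , ∸-monoʳ-< (s≤s z≤n) h)
∈-rowConditions⁻ m k (suc j) cs h (there i) with ∈-rowConditions⁻ m k j cs (<⇒≤ h) i
... | inj₁ (e , a , b) = inj₁ (e , ≤-trans (∸-monoʳ-≤ m (n≤1+n j)) a , b)
... | inj₂ i′          = inj₂ i′

∈-conditions⁻ : ∀ m k {c} → c ∈ conditions m k → proj₁ c < k × proj₂ c < m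
∈-conditions⁻ m (suc k) i with ∈-rowConditions⁻ m k m (conditions m k) ≤-refl i
... | inj₁ (refl , _ , b) = ≤-refl , b
... | inj₂ i′ with ∈-conditions⁻ m k i′
... | a , b = m<n⇒m<1+n a , b

∈-rowConditions⁺ʳ : ∀ m k j cs {c} → c ∈ cs → c ∈ rowConditions m k j cs
∈-rowConditions⁺ʳ m k zero    cs i = i
∈-rowConditions⁺ʳ m k (suc j) cs i = there (∈-rowConditions⁺ʳ m k j cs i)

∈-rowConditions⁺ˡ : ∀ m k j cs {i} → j ≤ m → m ∸ j ≤ i → i < m → (k , i) ∈ rowConditions m k j cs
∈-rowConditions⁺ˡ m k zero    cs h a b = ⊥-elim (<⇒≱ b a)
∈-rowConditions⁺ˡ m k (suc j) cs {i} h a b with i ≟ m ∸ suc j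
... | yes refl = here refl
... | no  ne   = there (∈-rowConditions⁺ˡ m k j cs (<⇒≤ h) (subst (_≤ i) (sym (+-∸-assoc 1 h)) (≤∧≢⇒< a (ne ∘ sym))) b)

∈-conditions⁺ : ∀ m k {k′ i} → k′ < k → i < m → (k′ , i) ∈ conditions m k
∈-conditions⁺ m (suc k) {k′} {i} h b with k′ ≟ k
... | yes refl = ∈-rowConditions⁺ˡ m k m (conditions m k) ≤-refl (subst (_≤ i) (sym (n∸n≡0 m)) z≤n) b
... | no  ne   = ∈-rowConditions⁺ʳ m k m (conditions m k) (∈-conditions⁺ m k (≤∧≢⇒< (s≤s⁻¹ h) ne) b)

good : (ℕ → ℕ) → (ℕ → Bool) → List ℕ → List (ℕ × ℕ) → Tableau → Bool
good τ linked μ cs t = allᵇ (goodAt τ linked (gt μ t)) cs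

-- In `antisymmetric` the values `τ i + c i + 1` and `τ (i + 1) + c (i + 1)` are exchanged: `F` must
-- change sign under the dot action of an adjacent transposition on `τ + c`. In the application two
-- exponents of an alternant are swapped.
module Stembridge {M : ℕ} {lam μ : List ℕ} (skew : Skew lam μ) (τ : ℕ → ℕ) (linked : ℕ → Bool)
  (τ-decreasing : ∀ i → linked i ≡ true → τ (suc i) ≤ τ i) (F : List ℕ → ℤ)
  (antisymmetric : ∀ i → suc i < M → linked i ≡ true → ∀ c c′ → length c ≡ M → length c′ ≡ M →
    τ i + nth c′ i + 1 ≡ τ (suc i) + nth c (suc i) → τ (suc i) + nth c′ (suc i) ≡ τ i + nth c i + 1 →
    (∀ j → j < M → ¬ j ≡ i → ¬ j ≡ suc i → nth c′ j ≡ nth c j) → F c ≡ -ᶻ F c′) where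

  private
    S : List Tableau
    S = ssyts M lam μ

    m : ℕ
    m = M ∸ 1

    goodᵗ : List (ℕ × ℕ) → Tableau → Bool
    goodᵗ = good τ linked μ

    -- For a tableau that violates condition `(k , i)`, this is the largest value of `N k (i + 1)`
    -- for which the violation persists, the other entries being fixed. Reflecting below this cap
    -- therefore keeps the tableau bad, and the resulting shift of the contents is the one of the
    -- dot action.
    excess : (ℕ → ℕ → ℕ) → ℕ → ℕ → ℕ
    excess N k i = τ (suc i) + columnSum k N (suc (suc i)) + columnSum k N i + N k (suc (suc i)) ∸ (1 + τ i + columnSum k N (suc i) + columnSum k N (suc i))

    <m⇒ : ∀ {i} → i < m → suc i < M
    <m⇒ {i} h = go M h
      where go : ∀ M → i < M ∸ 1 → suc i < M
            go (suc M) h = s≤s h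

    -- One more condition is imposed on tableaux that satisfy `cs`. By `earlier` the reflection
    -- cannot disturb conditions already imposed; by `above` the same pair of letters is under
    -- control one row higher, which makes the cap admissible.
    module Step (k i : ℕ) (i<m : i < m) (cs : List (ℕ × ℕ))
                (earlier : ∀ {c} → c ∈ cs → proj₂ c < m × (proj₁ c < k ⊎ (proj₁ c ≡ k × i < proj₂ c)))
                (above : ∀ k′ → k ≡ suc k′ → (k′ , i) ∈ cs) where

      i<M : suc i < M
      i<M = <m⇒ i<m

      bad : Tableau → Bool
      bad t = not (goodAt τ linked (gt μ t) (k , i)) ∧ goodᵗ cs t

      L : List Tableau
      L = filt bad S

      φ : Tableau → Tableau
      φ t = reflectTab M lam μ i k (excess (gt μ t) k i) t

      module Bad {t} (t∈L : t ∈ L) where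
        t∈ : t ∈ S
        t∈ = proj₁ (∈-filt⁻ bad S t∈L)
        N = gt μ t
        Pa = columnSum k N i
        Pb = columnSum k N (suc i)
        Pc = columnSum k N (suc (suc i))
        a = N k i
        b = N k (suc i)
        c = N k (suc (suc i))
        cap = excess N k i
        open GT (gt-GT skew t∈)

        isBad : goodAt τ linked N (k , i) ≡ false × goodᵗ cs t ≡ true
        isBad with ∧-elim {not (goodAt τ linked N (k , i))} (proj₂ (∈-filt⁻ bad S t∈L))
        ... | p , q = ¬true (not-elim p) , q

        link : linked i ≡ true
        link with linked i | proj₁ isBad
        ... | true | _ = refl

        violated : τ i + Pb + (Pb + b) < τ (suc i) + (Pc + c) + Pa
        violated with linked i | proj₁ isBad
        ... | true | e = ≰⇒> (λ le → case trans (sym (≤ᵇ-true le)) e of λ ())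

        goodAbove : ∀ k′ → k ≡ suc k′ → τ (suc i) + columnSum k N (suc (suc i)) + columnSum k′ N i ≤ τ i + columnSum k′ N (suc i) + columnSum k N (suc i)
        goodAbove k′ refl with allᵇ-sound (goodAt τ linked N) cs (proj₂ isBad) (above k′ refl)
        ... | g rewrite link = ≤ᵇ-sound g

        -- In row 0 this is `τ-decreasing`; further down it is the condition of the row above,
        -- weakened by monotonicity of that row. It bounds the cap by `N k (i + 2)`.
        slack : τ (suc i) + Pc + Pa ≤ τ i + Pb + Pb
        slack = go k refl
          where
          go : ∀ k₁ → k ≡ k₁ → τ (suc i) + columnSum k₁ N (suc (suc i)) + columnSum k₁ N i ≤ τ i + columnSum k₁ N (suc i) + columnSum k₁ N (suc i)
          go zero    e = +-monoˡ-≤ 0 (+-monoˡ-≤ 0 (τ-decreasing i link))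
          go (suc k′) refl = lia 7 (λ τ′ τ Pc Pa Pb a b → τ′ :+ Pc :+ Pa :≤ τ :+ Pb :+ (Pb :+ b) ⇒ a :≤ b ⇒ ⊢ τ′ :+ Pc :+ (Pa :+ a) :≤ τ :+ (Pb :+ b) :+ (Pb :+ b))
            (τ (suc i)) (τ i) (columnSum k N (suc (suc i))) (columnSum k′ N i) (columnSum k′ N (suc i)) (N k′ i) (N k′ (suc i)) (goodAbove k′ refl) (mono k′ i (<⇒≤ i<M))

        cap-def : cap + 1 + τ i + Pb + Pb ≡ τ (suc i) + Pc + Pa + c
        cap-def = trans (lia 3 (λ x t p → ⊢ x :+ # 1 :+ t :+ p :+ p :≡ x :+ (# 1 :+ t :+ p :+ p)) cap (τ i) Pb) (m∸n+n≡m
          (lia 7 (λ τ′ τ Pc Pa Pb b c → τ :+ Pb :+ (Pb :+ b) :< τ′ :+ (Pc :+ c) :+ Pa ⇒ ⊢ # 1 :+ τ :+ Pb :+ Pb :≤ τ′ :+ Pc :+ Pa :+ c)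
             (τ (suc i)) (τ i) Pc Pa Pb b c violated))

        ok : CapOK N i k cap
        ok = capOK
          (lia 8 (λ τ′ τ Pc Pa Pb b c d → d :+ # 1 :+ τ :+ Pb :+ Pb :≡ τ′ :+ Pc :+ Pa :+ c ⇒ τ :+ Pb :+ (Pb :+ b) :< τ′ :+ (Pc :+ c) :+ Pa ⇒ ⊢ b :≤ d)
            (τ (suc i)) (τ i) Pc Pa Pb b c cap cap-def violated)
          (lia 7 (λ τ′ τ Pc Pa Pb c d → d :+ # 1 :+ τ :+ Pb :+ Pb :≡ τ′ :+ Pc :+ Pa :+ c ⇒ τ′ :+ Pc :+ Pa :≤ τ :+ Pb :+ Pb ⇒ ⊢ d :≤ c)
            (τ (suc i)) (τ i) Pc Pa Pb c cap cap-def slack)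
          λ where k′ refl → lia 9 (λ τ′ τ Pc Pa Pb c d a b → d :+ # 1 :+ τ :+ (Pb :+ b) :+ (Pb :+ b) :≡ τ′ :+ Pc :+ (Pa :+ a) :+ c ⇒
                                     τ′ :+ Pc :+ Pa :≤ τ :+ Pb :+ (Pb :+ b) ⇒ c :≤ b ⇒ ⊢ d :≤ a)
                    (τ (suc i)) (τ i) Pc (columnSum k′ N i) (columnSum k′ N (suc i)) c cap (N k′ i) (N k′ (suc i)) cap-def (goodAbove k′ refl) (inter k′ (suc i) i<M)

        open ReflectTab skew t∈ i<M k cap ok public hiding (N; G; ok′)

        sameAbove : ∀ j → j ≤ M → columnSum k (gt μ t′) j ≡ columnSum k N j
        sameAbove j h = sumTo-cong k (λ x x<k → trans (gt-t′ x h) (N′-before j x<k))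

        excess′ : excess (gt μ t′) k i ≡ cap
        excess′ = cong₂ _∸_ (cong₂ _+_ (cong₂ _+_ (cong (λ x → τ (suc i) + x) (sameAbove _ i<M)) (sameAbove i (<⇒≤ (<⇒≤ i<M)))) (gt-t′-c k))
                            (cong (λ x → 1 + τ i + x + x) (sameAbove (suc i) (<⇒≤ i<M)))

        -- The reflection changes column `i + 1` from row `k` on. A condition of an earlier row
        -- stops above row `k`. A condition of row `k` at `i₁ > i` uses row `k` only in columns
        -- beyond `i + 1`.
        goodAt-same : ∀ {c} → c ∈ cs → goodAt τ linked (gt μ t′) c ≡ goodAt τ linked N c
        goodAt-same {k₁ , i₁} c∈ with earlier c∈
        ... | i₁<m , place = cong₂ (λ x y → not (linked i₁) ∨ (x ≤ᵇ y))
          (cong₂ (λ x y → τ (suc i₁) + x + y) (included (suc (suc i₁)) (<m⇒ i₁<m) (λ e q → <⇒≢ (m<n⇒m<1+n (i<i₁ e)) (sym (suc-injective q)))) (strictly i₁ (<⇒≤ (<⇒≤ (<m⇒ i₁<m)))))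
          (cong₂ (λ x y → τ i₁ + x + y) (strictly (suc i₁) (<⇒≤ (<m⇒ i₁<m))) (included (suc i₁) (<⇒≤ (<m⇒ i₁<m)) (λ e q → <⇒≢ (i<i₁ e) (sym (suc-injective q)))))
          where
          k₁≤k : k₁ ≤ k
          k₁≤k = case place of λ where
            (inj₁ h)       → <⇒≤ h
            (inj₂ (e , _)) → ≤-reflexive e
          strictly : ∀ j → j ≤ M → columnSum k₁ (gt μ t′) j ≡ columnSum k₁ N j
          strictly j h = sumTo-cong k₁ (λ x x<k₁ → trans (gt-t′ x h) (N′-before j (≤-trans x<k₁ k₁≤k)))
          included : ∀ j → j ≤ M → (k₁ ≡ k → ¬ j ≡ suc i) → columnSum (suc k₁) (gt μ t′) j ≡ columnSum (suc k₁) N j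
          included j h ne = cong₂ _+_ (strictly j h) (case place of λ where
            (inj₁ lt)         → trans (gt-t′ k₁ h) (N′-before j lt)
            (inj₂ (e , _))    → gt-t′-other k₁ h (ne e))
          i<i₁ : k₁ ≡ k → i < i₁
          i<i₁ e = case place of λ where
            (inj₁ lt)      → ⊥-elim (<-irrefl e lt)
            (inj₂ (_ , h)) → h

        violated′ : τ i + Pb + (Pb + b′ k) < τ (suc i) + (Pc + c) + Pa
        violated′ = lia 8 (λ τ′ τ Pc Pa Pb b c d → d :+ # 1 :+ τ :+ Pb :+ Pb :≡ τ′ :+ Pc :+ Pa :+ c ⇒ b :≤ d ⇒ ⊢ τ :+ Pb :+ (Pb :+ b) :< τ′ :+ (Pc :+ c) :+ Pa)
            (τ (suc i)) (τ i) Pc Pa Pb (b′ k) c cap cap-def b′≤cap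

        t′-bad : bad t′ ≡ true
        t′-bad = ∧-intro (subst (λ g → not g ≡ true) (sym notGood) refl)
            (allᵇ-true _ cs (λ c∈ → trans (goodAt-same c∈) (allᵇ-sound (goodAt τ linked N) cs (proj₂ isBad) c∈)))
          where
          notGood : goodAt τ linked (gt μ t′) (k , i) ≡ false
          notGood rewrite link = ¬true (λ e → <⇒≱ violated′ (subst₂ _≤_
            (cong₂ (λ x y → τ (suc i) + x + y) (cong₂ _+_ (sameAbove _ i<M) (gt-t′-c k)) (sameAbove i (<⇒≤ (<⇒≤ i<M))))
            (cong₂ (λ x y → τ i + x + (x + y)) (sameAbove (suc i) (<⇒≤ i<M)) (gt-t′-at k)) (≤ᵇ-sound e)))

        open Sums (suc (k + length lam)) (s≤s (m≤m+n k _)) (m≤n⇒m≤1+n (m≤n+m (length lam) k))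

        opposite : F (content M t) ≡ -ᶻ F (content M t′)
        opposite = antisymmetric i i<M link (content M t) (content M t′) (length-content M t) (length-content M t′)
          (trans (cong (λ x → τ i + x + 1) (nth-content M t′ (<⇒≤ i<M))) (trans
            (lia 9 (λ τ′ τ Pc Pa Pb c d C′ C → d :+ # 1 :+ τ :+ Pb :+ Pb :≡ τ′ :+ Pc :+ Pa :+ c ⇒ C′ :+ (c :+ Pa :+ Pc) :≡ C :+ (d :+ Pb :+ Pb) ⇒ ⊢ τ :+ C′ :+ # 1 :≡ τ′ :+ C)
              (τ (suc i)) (τ i) Pc Pa Pb c cap (contentAt t′ i) (contentAt t (suc i)) cap-def content-i)
            (cong (λ x → τ (suc i) + x) (sym (nth-content M t i<M)))))
          (trans (cong (λ x → τ (suc i) + x) (nth-content M t′ i<M)) (trans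
            (lia 9 (λ τ′ τ Pc Pa Pb c d C′ C → d :+ # 1 :+ τ :+ Pb :+ Pb :≡ τ′ :+ Pc :+ Pa :+ c ⇒ C′ :+ (d :+ Pb :+ Pb) :≡ C :+ (c :+ Pa :+ Pc) ⇒ ⊢ τ′ :+ C′ :≡ τ :+ C :+ # 1)
              (τ (suc i)) (τ i) Pc Pa Pb c cap (contentAt t′ (suc i)) (contentAt t i) cap-def content-si)
            (cong (λ x → τ i + x + 1) (sym (nth-content M t (<⇒≤ i<M))))))
          (λ j j<M j≢i j≢si → trans (nth-content M t′ j<M) (trans (content-other j<M j≢i j≢si) (sym (nth-content M t j<M))))

      vanishing : ∑ L (F ∘ content M) ≡ 0ℤ
      vanishing = ∑-antisymmetric L φ (Unique-filt bad (Unique-ssyts M lam μ))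
        (λ t∈L → ∈-filt⁺ bad (Bad.t′∈ t∈L) (Bad.t′-bad t∈L))
        (λ {t} t∈L → trans (cong (λ d → reflectTab M lam μ i k d (φ t)) (Bad.excess′ t∈L)) (reflectTab-involutive skew (Bad.t∈ t∈L) i<M (Bad.ok t∈L)))
        (λ t∈L → Bad.opposite t∈L)

      step : ∑ S (λ t → 𝟙 (goodᵗ cs t) *ᶻ F (content M t)) ≡ ∑ S (λ t → 𝟙 (goodᵗ ((k , i) ∷ cs) t) *ᶻ F (content M t))
      step = begin
        ∑ S (λ t → 𝟙 (goodᵗ cs t) *ᶻ F (content M t))
          ≡⟨ ∑-cong S (λ {t} _ → split (goodAt τ linked (gt μ t) (k , i)) (goodᵗ cs t) (F (content M t))) ⟩
        ∑ S (λ t → 𝟙 (goodᵗ ((k , i) ∷ cs) t) *ᶻ F (content M t) +ᶻ 𝟙 (bad t) *ᶻ F (content M t))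
          ≡⟨ ∑-+ S _ _ ⟩
        ∑ S (λ t → 𝟙 (goodᵗ ((k , i) ∷ cs) t) *ᶻ F (content M t)) +ᶻ ∑ S (λ t → 𝟙 (bad t) *ᶻ F (content M t))
          ≡⟨ cong (λ z → ∑ S (λ t → 𝟙 (goodᵗ ((k , i) ∷ cs) t) *ᶻ F (content M t)) +ᶻ z) (trans (sym (∑-filt bad S (F ∘ content M))) vanishing) ⟩
        ∑ S (λ t → 𝟙 (goodᵗ ((k , i) ∷ cs) t) *ᶻ F (content M t)) +ᶻ 0ℤ
          ≡⟨ ℤ.+-identityʳ _ ⟩
        ∑ S (λ t → 𝟙 (goodᵗ ((k , i) ∷ cs) t) *ᶻ F (content M t)) ∎
        where
        open ≡-Reasoning
        split : ∀ a g z → 𝟙 g *ᶻ z ≡ 𝟙 (a ∧ g) *ᶻ z +ᶻ 𝟙 (not a ∧ g) *ᶻ z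
        split true  g z = sym (ℤ.+-identityʳ _)
        split false g z = sym (ℤ.+-identityˡ _)

    afterRow : ∀ k j → j ≤ m → (∑ S (λ t → 𝟙 (goodᵗ (conditions m k) t) *ᶻ F (content M t))) ≡
                               ∑ S (λ t → 𝟙 (goodᵗ (rowConditions m k j (conditions m k)) t) *ᶻ F (content M t))
    afterRow k zero    h = refl
    afterRow k (suc j) h = trans (afterRow k j (<⇒≤ h)) (Step.step k (m ∸ suc j) i<m (rowConditions m k j (conditions m k))
        (λ c∈ → case ∈-rowConditions⁻ m k j (conditions m k) (<⇒≤ h) c∈ of λ where
           (inj₁ (e , a , b)) → b , inj₂ (e , ≤-trans (∸-monoʳ-< {m} (n<1+n j) h) a)
           (inj₂ i)           → proj₂ (∈-conditions⁻ m k i) , inj₁ (proj₁ (∈-conditions⁻ m k i)))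
        (λ where k′ refl → ∈-rowConditions⁺ʳ m k j (conditions m k) (∈-conditions⁺ m k ≤-refl i<m)))
      where i<m : m ∸ suc j < m
            i<m = ∸-monoʳ-< (s≤s z≤n) h

  -- The number `k` of rows on which conditions are imposed is free and may exceed the number of
  -- rows of the shape.
  stembridge : ∀ k → ∑ S (F ∘ content M) ≡ ∑ S (λ t → 𝟙 (goodᵗ (conditions m k) t) *ᶻ F (content M t))
  stembridge zero    = ∑-cong S (λ _ → sym (ℤ.*-identityˡ _))
  stembridge (suc k) = trans (stembridge k) (afterRow k m ≤-refl)

-- Superstandard tableaux

superstandard : ∀ {M ℓ lam N} → GT M lam (λ _ → 0) N → (∀ k → ℓ ≤ k → lam k ≡ 0) →
  (∀ k i → k < ℓ → suc i < M → columnSum (suc k) N (suc (suc i)) + columnSum k N i ≤ columnSum k N (suc i) + columnSum (suc k) N (suc i)) →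
  ∀ k i → i ≤ M → N k i ≡ (if k <ᵇ i then lam k else 0)
superstandard {M} {ℓ} {lam} {N} G bound good k i i≤M with k <? i
... | yes k<i = trans (full (suc k) k ≤-refl i k<i i≤M) (cong (if_then lam k else 0) (sym (<ᵇ-true k<i)))
  where
  open GT G
  -- Induction over the rows. Once the rows above `k` are complete, the condition for row `k`
  -- reduces to `N k (j + 1) ≤ N k j` for `j > k`, so row `k` does not grow after column `k + 1` and
  -- already has its final length there.
  full : ∀ n k → k < n → ∀ i → k < i → i ≤ M → N k i ≡ lam k
  full (suc n) k (s≤s k≤n) i k<i i≤M with k <? ℓ
  ... | no  k≮ℓ = trans (n≤0⇒n≡0 (≤-trans (upper k i≤M) (≤-reflexive (bound k (≮⇒≥ k≮ℓ))))) (sym (bound k (≮⇒≥ k≮ℓ)))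
  ... | yes k<ℓ with m≤n⇒∃[o]m+o≡n i≤M
  ... | o , eq = ≤-antisym (upper k i≤M) (subst (_≤ N k i) (trans (cong (N k) eq) (end k)) (down o (≤-reflexive eq)))
    where
    prior : ∀ j → k ≤ j → suc j ≤ M → columnSum k N (suc j) ≡ sumTo k lam
    prior j k≤j h = sumTo-cong k (λ x x<k → full n x (≤-trans x<k k≤n) (suc j) (m<n⇒m<1+n (≤-trans x<k k≤j)) h)
    shrink : ∀ j → k < j → suc j ≤ M → N k (suc j) ≤ N k j
    shrink (suc j) (s≤s k≤j) h = lia 7 (λ s₂ s₁ s₀ Λ x y z → s₂ :≡ Λ ⇒ s₁ :≡ Λ ⇒ Λ :≤ s₀ ⇒ s₂ :+ x :+ s₀ :≤ s₁ :+ (s₁ :+ y) ⇒ ⊢ x :≤ y)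
      (columnSum k N (suc (suc j))) (columnSum k N (suc j)) (columnSum k N j) (sumTo k lam) (N k (suc (suc j))) (N k (suc j)) 0
      (prior (suc j) (m≤n⇒m≤1+n k≤j) h) (prior j k≤j (<⇒≤ h)) (sumTo-≤ j k≤j (<⇒≤ (<⇒≤ h))) (good k j k<ℓ h)
      where sumTo-≤ : ∀ j → k ≤ j → j ≤ M → sumTo k lam ≤ columnSum k N j
            sumTo-≤ j k≤j h = ≤-reflexive (sumTo-cong k (λ x x<k → sym (full n x (≤-trans x<k k≤n) j (≤-trans x<k k≤j) h)))
    down : ∀ o → i + o ≤ M → N k (i + o) ≤ N k i
    down zero    h = ≤-reflexive (cong (N k) (+-identityʳ i))
    down (suc o) h = ≤-trans (≤-reflexive (cong (N k) (+-suc i o))) (≤-trans (shrink (i + o) (≤-trans k<i (m≤m+n i o)) h′) (down o (<⇒≤ h′)))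
      where h′ = subst (_≤ M) (+-suc i o) h
... | no  k≮i = trans (empty k i (≮⇒≥ k≮i) i≤M) (cong (if_then lam k else 0) (sym (<ᵇ-false (≮⇒≥ k≮i))))
  where
  open GT G
  empty : ∀ k i → i ≤ k → i ≤ M → N k i ≡ 0
  empty k       zero    h b = start k
  empty (suc k) (suc i) (s≤s h) b = n≤0⇒n≡0 (≤-trans (inter k i b) (≤-reflexive (empty k i h (<⇒≤ b))))

diagonal : (ℕ → ℕ) → ℕ → ℕ → ℕ
diagonal lam k i = if k <ᵇ i then lam k else 0

diagonal-GT : ∀ M {lam} → Decreasing lam → (∀ k → M ≤ k → lam k ≡ 0) → GT M lam (λ _ → 0) (diagonal lam)
diagonal-GT M {lam} dec bound = record { start = λ _ → refl ; end = end ; mono = λ k i _ → mono k i ; inter = λ k i _ → inter k i }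
  where
  end : ∀ k → diagonal lam k M ≡ lam k
  end k with k <? M
  ... | yes h = cong (if_then lam k else 0) (<ᵇ-true h)
  ... | no  h = trans (cong (if_then lam k else 0) (<ᵇ-false (≮⇒≥ h))) (sym (bound k (≮⇒≥ h)))
  mono : ∀ k i → diagonal lam k i ≤ diagonal lam k (suc i)
  mono k i with k <? i
  ... | yes h rewrite <ᵇ-true h | <ᵇ-true (m<n⇒m<1+n h) = ≤-refl
  ... | no  h rewrite <ᵇ-false (≮⇒≥ h) = z≤n
  inter : ∀ k i → diagonal lam (suc k) (suc i) ≤ diagonal lam k i
  inter k i with k <ᵇ i
  ... | true  = dec k
  ... | false = z≤n

columnSum-diagonal : ∀ lam n i → columnSum n (diagonal lam) (suc i) ≡ columnSum n (diagonal lam) i + (if i <ᵇ n then lam i else 0)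
columnSum-diagonal lam zero    i = refl
columnSum-diagonal lam (suc n) i with <-cmp i n
... | tri< a _ _ rewrite columnSum-diagonal lam n i | <ᵇ-true a | <ᵇ-true (m<n⇒m<1+n a) | <ᵇ-false {n} {suc i} a | <ᵇ-false {n} {i} (<⇒≤ a) =
  lia 2 (λ a b → ⊢ a :+ b :+ # 0 :≡ a :+ # 0 :+ b) (columnSum n (diagonal lam) i) (lam i)
... | tri≈ _ refl _ rewrite columnSum-diagonal lam n i | <ᵇ-true (n<1+n i) | <ᵇ-false {i} {i} ≤-refl =
  lia 2 (λ a b → ⊢ a :+ # 0 :+ b :≡ a :+ # 0 :+ b) (columnSum n (diagonal lam) i) (lam i)
... | tri> _ _ c rewrite columnSum-diagonal lam n i | <ᵇ-true c | <ᵇ-true (m<n⇒m<1+n c) | <ᵇ-false {i} {n} (<⇒≤ c) | <ᵇ-false {i} {suc n} c =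
  lia 2 (λ a b → ⊢ a :+ # 0 :+ b :≡ a :+ b :+ # 0) (columnSum n (diagonal lam) i) (lam n)

diagonal-good : ∀ {lam} → Decreasing lam → ∀ k i → columnSum (suc k) (diagonal lam) (suc (suc i)) + columnSum k (diagonal lam) i ≤
                                                    columnSum k (diagonal lam) (suc i) + columnSum (suc k) (diagonal lam) (suc i)
diagonal-good {lam} dec k i rewrite columnSum-diagonal lam (suc k) (suc i) =
  lia 5 (λ s x y c d → d :≡ c :+ y ⇒ x :≤ y ⇒ ⊢ s :+ x :+ c :≤ d :+ s) (columnSum (suc k) (diagonal lam) (suc i)) (if i <ᵇ k then lam (suc i) else 0)
    (if i <ᵇ k then lam i else 0) (columnSum k (diagonal lam) i) (columnSum k (diagonal lam) (suc i)) (columnSum-diagonal lam k i) le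
  where le : (if i <ᵇ k then lam (suc i) else 0) ≤ (if i <ᵇ k then lam i else 0)
        le with i <ᵇ k
        ... | true  = dec i
        ... | false = z≤n

superstandardTab : ℕ → List ℕ → Tableau
superstandardTab M lam = fromGT M lam [] (diagonal (nth lam))

straight : ∀ lam → Decreasing (nth lam) → Skew lam []
straight lam dec = record { outer = dec ; inner = λ _ → z≤n ; sub = λ _ → z≤n }

module Superstandard {M : ℕ} {lam : List ℕ} (dec : Decreasing (nth lam)) (len : length lam ≤ M) where
  private
    D = diagonal (nth lam)
    G : GT M (nth lam) (λ _ → 0) D
    G = diagonal-GT M dec (λ k h → nth-beyond lam (≤-trans len h))

  superstandardTab-∈ : superstandardTab M lam ∈ ssyts M lam []
  superstandardTab-∈ = fromGT-∈ (straight lam dec) G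

  gt-superstandardTab : ∀ k {i} → i ≤ M → gt [] (superstandardTab M lam) k i ≡ D k i
  gt-superstandardTab k h = gt-fromGT (straight lam dec) G k h

  contentAt-superstandardTab : ∀ i → i < M → contentAt (superstandardTab M lam) i ≡ nth lam i
  contentAt-superstandardTab i i<M = +-cancelˡ-≡ (columnSum ℓ D i) _ _ (trans
      (trans (cong (_+ contentAt (superstandardTab M lam) i) (sumTo-cong ℓ (λ k _ → sym (gt-superstandardTab k (<⇒≤ i<M)))))
             (trans (contentAt-gt ℓ [] (superstandardTab M lam) i (λ q → ≤-trans (ssyts-rows M lam [] superstandardTab-∈ q) (m≤n+m _ (suc i))))
                    (sumTo-cong ℓ (λ k _ → gt-superstandardTab k i<M))))
      (trans (columnSum-diagonal (nth lam) ℓ i) (cong (λ b → columnSum ℓ D i + (if b then nth lam i else 0)) (<ᵇ-true (s≤s (m≤m+n i (length lam)))))))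
    where ℓ = suc i + length lam

  good-superstandardTab : ∀ k i → suc i < M → let N = gt [] (superstandardTab M lam) in
    columnSum (suc k) N (suc (suc i)) + columnSum k N i ≤ columnSum k N (suc i) + columnSum (suc k) N (suc i)
  good-superstandardTab k i h = subst₂ _≤_
    (sym (cong₂ _+_ (sumTo-cong (suc k) (λ x _ → gt-superstandardTab x h)) (sumTo-cong k (λ x _ → gt-superstandardTab x (<⇒≤ (<⇒≤ h))))))
    (sym (cong₂ _+_ (sumTo-cong k (λ x _ → gt-superstandardTab x (<⇒≤ h))) (sumTo-cong (suc k) (λ x _ → gt-superstandardTab x (<⇒≤ h)))))
    (diagonal-good dec k i)

  superstandardTab-unique : ∀ {t} → t ∈ ssyts M lam [] → (∀ k i → k < length lam → suc i < M → let N = gt [] t in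
    columnSum (suc k) N (suc (suc i)) + columnSum k N i ≤ columnSum k N (suc i) + columnSum (suc k) N (suc i)) → t ≡ superstandardTab M lam
  superstandardTab-unique t∈ good = gt-injective (straight lam dec) t∈ superstandardTab-∈
    (λ k i h → trans (superstandard (gt-GT (straight lam dec) t∈) (λ k → nth-beyond lam) good k i h) (sym (gt-superstandardTab k h)))

-- Alternants times Schur functions

swapAt-split : ∀ i l → suc i < length l → ∃[ p ] ∃[ x ] ∃[ y ] ∃[ q ] (l ≡ p ++ x ∷ y ∷ q × swapAt i l ≡ p ++ y ∷ x ∷ q)
swapAt-split zero    (x ∷ y ∷ l) h = [] , x , y , l , refl , refl
swapAt-split zero    (x ∷ [])    (s≤s ())
swapAt-split (suc i) (z ∷ l)     (s≤s h) with swapAt-split i l h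
... | p , x , y , q , e , e′ = z ∷ p , x , y , q , cong (z ∷_) e , cong (z ∷_) e′

alternant-swapAt : ∀ i l v → suc i < length l → alternant l v ≡ -ᶻ alternant (swapAt i l) v
alternant-swapAt i l v h with swapAt-split i l h
... | p , x , y , q , e , e′ = trans (cong (λ l → alternant l v) e) (trans (alternant-swap p x y q v) (cong (λ l → -ᶻ alternant l v) (sym e′)))

length-⊕ : ∀ l l′ → length l ≡ length l′ → length (l ⊕ l′) ≡ length l
length-⊕ []      []       e = refl
length-⊕ (x ∷ l) (y ∷ l′) e = cong suc (length-⊕ l l′ (suc-injective e))

nth-⊕ : ∀ l l′ i → length l ≡ length l′ → nth (l ⊕ l′) i ≡ nth l i + nth l′ i
nth-⊕ []      []       i       e = refl
nth-⊕ (x ∷ l) (y ∷ l′) zero    e = refl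
nth-⊕ (x ∷ l) (y ∷ l′) (suc i) e = nth-⊕ l l′ i (suc-injective e)

nth-map : ∀ g l {i} → i < length l → nth (map g l) i ≡ g (nth l i)
nth-map g (x ∷ l) {zero}  h       = refl
nth-map g (x ∷ l) {suc i} (s≤s h) = nth-map g l h

-- The coefficient function in `M` variables of the skew Schur function with the exponents
-- transformed by `g`, so that `r *_` stands for the plethysm with p_r.
schur : ℕ → (ℕ → ℕ) → List ℕ → List ℕ → List ℕ → ℤ
schur M g lam μ β = ∑ (ssyts M lam μ) (λ t → 𝟙 (eqL (map g (content M t)) β))

-- By `e-step`, linked entries of `e` differ like neighbouring beads of one runner representing the
-- parts `τ i` and `τ (i + 1)`. The dot action on `τ` plus content then swaps two entries of `e`
-- plus `r` times the content, and the alternant changes sign.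
module _ {M : ℕ} {lam μ : List ℕ} (skew : Skew lam μ) (r : ℕ) (g : ℕ → ℕ) (g≡ : ∀ x → g x ≡ r * x)
         (e : List ℕ) (len : length e ≡ M) (τ : ℕ → ℕ) (linked : ℕ → Bool)
         (τ-decreasing : ∀ i → linked i ≡ true → τ (suc i) ≤ τ i)
         (e-step : ∀ i → suc i < M → linked i ≡ true → nth e i + r * τ (suc i) ≡ nth e (suc i) + r * suc (τ i)) where

  private
    shifted-antisymmetric : ∀ v i → suc i < M → linked i ≡ true → ∀ c c′ → length c ≡ M → length c′ ≡ M →
      τ i + nth c′ i + 1 ≡ τ (suc i) + nth c (suc i) → τ (suc i) + nth c′ (suc i) ≡ τ i + nth c i + 1 →
      (∀ j → j < M → ¬ j ≡ i → ¬ j ≡ suc i → nth c′ j ≡ nth c j) → alternant (e ⊕ map g c) v ≡ -ᶻ alternant (e ⊕ map g c′) v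
    shifted-antisymmetric v i i<M li c c′ lc lc′ h₁ h₂ h₃ = trans (alternant-swapAt i (e ⊕ map g c) v (subst (suc i <_) (sym (ll c lc)) i<M))
      (cong (λ l → -ᶻ alternant l v) (sym (swapped≡swapAt i (e ⊕ map g c) (e ⊕ map g c′) (trans (ll c′ lc′) (sym (ll c lc))) (subst (suc i <_) (sym (ll c lc)) i<M)
        (trans (at c′ lc′ i (<⇒≤ i<M)) (trans (first (nth c′ i) (nth c (suc i)) h₁) (sym (at c lc (suc i) i<M))))
        (trans (at c′ lc′ (suc i) i<M) (trans (second (nth c′ (suc i)) (nth c i) h₂) (sym (at c lc i (<⇒≤ i<M)))))
        (λ j j< j≢i j≢si → let j<M = subst (j <_) (ll c lc) j< in trans (at c′ lc′ j j<M) (trans (cong (λ x → nth e j + r * x) (h₃ j j<M j≢i j≢si)) (sym (at c lc j j<M)))))))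
      where
      le : ∀ c → length c ≡ M → length e ≡ length (map g c)
      le c lc = trans len (sym (trans (length-map g c) lc))
      ll : ∀ c → length c ≡ M → length (e ⊕ map g c) ≡ M
      ll c lc = trans (length-⊕ e (map g c) (le c lc)) len
      at : ∀ c → length c ≡ M → ∀ j → j < M → nth (e ⊕ map g c) j ≡ nth e j + r * nth c j
      at c lc j j<M = trans (nth-⊕ e (map g c) j (le c lc)) (cong (nth e j +_) (trans (nth-map g c (subst (j <_) (sym lc) j<M)) (g≡ _)))
      scaled : ∀ a b c d → a + b + 1 ≡ c + d → r * a + r * b + r ≡ r * c + r * d
      scaled a b c d h = trans (solveₙ 3 (λ r a b → r :*ₙ a :+ₙ r :*ₙ b :+ₙ r :=ₙ r :*ₙ (a :+ₙ b) :+ₙ r) refl r a b)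
        (trans (trans (+-comm (r * (a + b)) r) (sym (*-suc r (a + b)))) (trans (cong (r *_) (trans (+-comm 1 (a + b)) h)) (*-distribˡ-+ r c d)))
      es : nth e i + r * τ (suc i) ≡ nth e (suc i) + (r + r * τ i)
      es = trans (e-step i i<M li) (cong (nth e (suc i) +_) (*-suc r (τ i)))
      first : ∀ x y → τ i + x + 1 ≡ τ (suc i) + y → nth e i + r * x ≡ nth e (suc i) + r * y
      first x y h = lia 7 (λ e e′ r t t′ x y → e :+ t′ :≡ e′ :+ (r :+ t) ⇒ t :+ x :+ r :≡ t′ :+ y ⇒ ⊢ e :+ x :≡ e′ :+ y)
        (nth e i) (nth e (suc i)) r (r * τ i) (r * τ (suc i)) (r * x) (r * y) es (scaled (τ i) x (τ (suc i)) y h)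
      second : ∀ x y → τ (suc i) + x ≡ τ i + y + 1 → nth e (suc i) + r * x ≡ nth e i + r * y
      second x y h = lia 7 (λ e e′ r t t′ x y → e :+ t′ :≡ e′ :+ (r :+ t) ⇒ t :+ y :+ r :≡ t′ :+ x ⇒ ⊢ e′ :+ x :≡ e :+ y)
        (nth e i) (nth e (suc i)) r (r * τ i) (r * τ (suc i)) (r * x) (r * y) es (scaled (τ i) y (τ (suc i)) x (sym h))

  alternant-times-schur : ∀ v k → conv (alternant e) (schur M g lam μ) v ≡
    ∑ (ssyts M lam μ) (λ t → 𝟙 (good τ linked μ (conditions (M ∸ 1) k) t) *ᶻ alternant (e ⊕ map g (content M t)) v)
  alternant-times-schur v k = trans
    (alternant-times-symmetric (ssyts M lam μ) (λ t → map g (content M t)) (schur M g lam μ) e v (λ _ → refl) (schur-symmetric skew g)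
      (λ {t} _ → trans (length-map g (content M t)) (trans (length-content M t) (sym len))))
    (Stembridge.stembridge skew τ linked τ-decreasing (λ c → alternant (e ⊕ map g c) v) (shifted-antisymmetric v) k)

staircase : ℕ → List ℕ
staircase zero    = []
staircase (suc n) = n ∷ staircase n

length-staircase : ∀ n → length (staircase n) ≡ n
length-staircase zero    = refl
length-staircase (suc n) = cong suc (length-staircase n)

nth-staircase : ∀ n i → i < n → nth (staircase n) i + suc i ≡ n
nth-staircase (suc n) zero    h       = +-comm n 1
nth-staircase (suc n) (suc i) (s≤s h) = trans (+-suc _ (suc i)) (cong suc (nth-staircase n i h))

padded : ℕ → List ℕ → List ℕ
padded M lam = applyUpTo (nth lam) M

-- The cancellation with `r = 1`, `τ = 0` and all neighbours linked. The conditions then leave the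
-- superstandard tableau alone, whose content is the shape.
bialternant : ∀ {M lam} → Decreasing (nth lam) → length lam ≤ M → ∀ v →
              conv (alternant (staircase M)) (schur M id lam []) v ≡ alternant (staircase M ⊕ padded M lam) v
bialternant {M} {lam} dec len v = trans
  (alternant-times-schur (straight lam dec) 1 id (λ x → sym (+-identityʳ x)) (staircase M) (length-staircase M) (λ _ → 0) (λ _ → true) (λ _ _ → z≤n)
     (λ i i<M _ → lia 4 (λ a b i M → a :+ (# 1 :+ i) :≡ M ⇒ b :+ (# 1 :+ (# 1 :+ i)) :≡ M ⇒ ⊢ a :+ # 0 :≡ b :+ # 1) (nth (staircase M) i) (nth (staircase M) (suc i)) i M
        (nth-staircase M i (<⇒≤ i<M)) (nth-staircase M (suc i) i<M)) v (length lam))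
  (trans (∑-single S t₀ term (Unique-ssyts M lam []) superstandardTab-∈
           (λ {t} t∈ ne → cong (λ b → 𝟙 b *ᶻ alternant (staircase M ⊕ map id (content M t)) v) (¬true (λ gd → ne (superstandardTab-unique t∈ (λ k i k< i< → ≤ᵇ-sound (allᵇ-sound _ (conditions (M ∸ 1) (length lam)) gd (∈-conditions⁺ (M ∸ 1) (length lam) k< (<⇒<∸1 {_} {M} i<)))))))))
    (trans (cong (λ b → 𝟙 b *ᶻ alternant (staircase M ⊕ map id (content M t₀)) v) isGood)
      (trans (ℤ.*-identityˡ _) (cong (λ c → alternant (staircase M ⊕ c) v) content₀))))
  where
  open Superstandard {M} {lam} dec len
  S = ssyts M lam []
  t₀ = superstandardTab M lam
  term : Tableau → ℤ
  term t = 𝟙 (good (λ _ → 0) (λ _ → true) [] (conditions (M ∸ 1) (length lam)) t) *ᶻ alternant (staircase M ⊕ map id (content M t)) v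
  <⇒<∸1 : ∀ {i M} → suc i < M → i < M ∸ 1
  <⇒<∸1 {M = suc M} (s≤s h) = h
  <∸1⇒< : ∀ {i} M → i < M ∸ 1 → suc i < M
  <∸1⇒< (suc M) h = s≤s h
  isGood : good (λ _ → 0) (λ _ → true) [] (conditions (M ∸ 1) (length lam)) t₀ ≡ true
  isGood = allᵇ-true _ (conditions (M ∸ 1) (length lam)) (λ { {k , i} c∈ → ≤ᵇ-true (good-superstandardTab k i (<∸1⇒< M (proj₂ (∈-conditions⁻ (M ∸ 1) (length lam) c∈)))) })
  content₀ : map id (content M t₀) ≡ padded M lam
  content₀ = trans (map-id _) (list-ext _ _ (trans (length-content M t₀) (sym (length-applyUpTo (nth lam) M)))
    (λ i h → let i<M = subst (i <_) (length-content M t₀) h in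
       trans (nth-content M t₀ i<M) (trans (contentAt-superstandardTab i i<M) (sym (nth-applyUpTo (nth lam) M i<M)))))

-- Latticed words and Littlewood–Richardson coefficients

letters : List ℕ → ℕ → ℕ
letters w k = countᵇ (_≡ᵇ suc k) w

-- The lattice condition for a word read after a word of content c.
LatticedFrom : (ℕ → ℕ) → List ℕ → Set
LatticedFrom c w = ∀ {s} → s ∈ suffixes w → ∀ k → letters s (suc k) + c (suc k) ≤ letters s k + c k

self-suffix : {A : Set} (w : List A) → w ∈ suffixes w
self-suffix []      = here refl
self-suffix (x ∷ w) = here refl

suffixes-++⁻ : {A : Set} (w w′ : List A) {s : List A} → s ∈ suffixes (w ++ w′) → s ∈ suffixes w′ ⊎ ∃[ s₁ ] (s₁ ∈ suffixes w × s ≡ s₁ ++ w′)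
suffixes-++⁻ []      w′ i           = inj₁ i
suffixes-++⁻ (x ∷ w) w′ (here refl) = inj₂ (x ∷ w , here refl , refl)
suffixes-++⁻ (x ∷ w) w′ (there i) with suffixes-++⁻ w w′ i
... | inj₁ j            = inj₁ j
... | inj₂ (s₁ , j , e) = inj₂ (s₁ , there j , e)

suffixes-++⁺ˡ : {A : Set} (w w′ : List A) {s : List A} → s ∈ suffixes w → s ++ w′ ∈ suffixes (w ++ w′)
suffixes-++⁺ˡ []      w′ (here refl) = self-suffix w′
suffixes-++⁺ˡ (x ∷ w) w′ (here refl) = here refl
suffixes-++⁺ˡ (x ∷ w) w′ (there i)   = there (suffixes-++⁺ˡ w w′ i)

suffixes-++⁺ʳ : {A : Set} (w w′ : List A) {s : List A} → s ∈ suffixes w′ → s ∈ suffixes (w ++ w′)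
suffixes-++⁺ʳ []      w′ i = i
suffixes-++⁺ʳ (x ∷ w) w′ i = there (suffixes-++⁺ʳ w w′ i)

suffix-⊆ : {A : Set} (w : List A) {s : List A} → s ∈ suffixes w → ∀ {x} → x ∈ s → x ∈ w
suffix-⊆ []      (here refl) i = i
suffix-⊆ (y ∷ w) (here refl) i = i
suffix-⊆ (y ∷ w) (there j)   i = there (suffix-⊆ w j i)

suffix-letters : ∀ w {s} → s ∈ suffixes w → ∀ k → letters s k ≤ letters w k
suffix-letters []      (here refl) k = ≤-refl
suffix-letters (y ∷ w) (here refl) k = ≤-refl
suffix-letters (y ∷ w) (there j)   k = ≤-trans (suffix-letters w j k) (≤-trans (m≤n+m _ (b2n (y ≡ᵇ suc k))) (≤-reflexive (sym (countᵇ-∷ (_≡ᵇ suc k) y w))))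

maxL-≤ : ∀ l {x} → x ∈ l → x ≤ maxL l
maxL-≤ (y ∷ l) (here refl) = m≤m⊔n y (maxL l)
maxL-≤ (y ∷ l) (there i)   = ≤-trans (maxL-≤ l i) (m≤n⊔m y (maxL l))

latticed-sound : ∀ w → latticed w ≡ true → LatticedFrom (λ _ → 0) w
latticed-sound w e {s} i k with k <? maxL w
... | yes h = +-monoˡ-≤ 0 (≤ᵇ-sound (allᵇ-sound _ (range (maxL w)) (allᵇ-sound (λ s → allᵇ (λ k → letters s (suc k) ≤ᵇ letters s k) (range (maxL w))) (suffixes w) e i) (∈-range⁺ h)))
... | no  h = ≤-trans (≤-reflexive (cong (_+ 0) (countᵇ-zero {p = _≡ᵇ suc (suc k)} s (λ {x} j → ≡ᵇ-false {x} {suc (suc k)} (λ where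
    refl → h (≤-trans (n≤1+n (suc k)) (maxL-≤ w (suffix-⊆ w i j)))))))) z≤n

latticed-complete : ∀ w → LatticedFrom (λ _ → 0) w → latticed w ≡ true
latticed-complete w L = allᵇ-true _ (suffixes w) (λ {s} i → allᵇ-true _ (range (maxL w)) (λ {k} _ → ≤ᵇ-true (+-cancelʳ-≤ 0 _ _ (L i k))))

letters-++ : ∀ w w′ k → letters (w ++ w′) k ≡ letters w k + letters w′ k
letters-++ w w′ k = countᵇ-++ (_≡ᵇ suc k) w w′

latticed-++⁻ : ∀ {c} w w′ → LatticedFrom c (w ++ w′) → LatticedFrom c w′ × LatticedFrom (λ k → letters w′ k + c k) w
latticed-++⁻ {c} w w′ L = (λ i → L (suffixes-++⁺ʳ w w′ i)) , λ {s} i k → subst₂ _≤_ (eq s (suc k)) (eq s k) (L (suffixes-++⁺ˡ w w′ i) k)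
  where eq : ∀ s k → letters (s ++ w′) k + c k ≡ letters s k + (letters w′ k + c k)
        eq s k = trans (cong (_+ c k) (letters-++ s w′ k)) (+-assoc (letters s k) _ _)

latticed-++⁺ : ∀ {c} w w′ → LatticedFrom c w′ → LatticedFrom (λ k → letters w′ k + c k) w → LatticedFrom c (w ++ w′)
latticed-++⁺ {c} w w′ L′ L i k with suffixes-++⁻ w w′ i
... | inj₁ j             = L′ j k
... | inj₂ (s , j , refl) = subst₂ _≤_ (eq (suc k)) (eq k) (L j k)
  where eq : ∀ k → letters s k + (letters w′ k + c k) ≡ letters (s ++ w′) k + c k
        eq k = trans (sym (+-assoc (letters s k) _ _)) (cong (_+ c k) (sym (letters-++ s w′ k)))

-- A row is read with its larger entries last, so the worst suffix for the letter k + 1 contains no letter k.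
row-latticed⁻ : ∀ {c} w → AllPairs _≤_ w → LatticedFrom c w → ∀ k → letters w (suc k) + c (suc k) ≤ c k
row-latticed⁻ []      _        L k = L (here refl) k
row-latticed⁻ {c} (x ∷ w) (p ∷ s) L k with x ≟ suc (suc k)
... | yes refl = ≤-trans (L (here refl) k) (≤-reflexive (cong (_+ c k) (countᵇ-zero (x ∷ w) none)))
  where none : ∀ {y} → y ∈ x ∷ w → (y ≡ᵇ suc k) ≡ false
        none (here refl) = ≡ᵇ-false (>⇒≢ (n<1+n k))
        none {y} (there i) = ≡ᵇ-false {y} {suc k} (λ where refl → <-irrefl refl (All-∈ p i))
... | no  ne   = subst (λ n → n + c (suc k) ≤ c k) (sym (trans (countᵇ-∷ (_≡ᵇ suc (suc k)) x w) (cong (λ b → b2n b + letters w (suc k)) (≡ᵇ-false ne))))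
                   (row-latticed⁻ w s (λ i → L (there i)) k)

row-latticed⁺ : ∀ {c} w → (∀ k → letters w (suc k) + c (suc k) ≤ c k) → LatticedFrom c w
row-latticed⁺ {c} w h i k = ≤-trans (+-monoˡ-≤ (c (suc k)) (suffix-letters w i (suc k))) (≤-trans (h k) (m≤n+m (c k) _))

rowWord : ℕ → Tableau → List ℕ
rowWord p t = map proj₂ (filt (λ q → rowOf q ≡ᵇ p) t)

reverse-range : ∀ n → reverse (range (suc n)) ≡ n ∷ reverse (range n)
reverse-range n = trans (cong reverse (upTo-∷ʳ n)) (reverse-++ (range n) (n ∷ []))
  where
  upTo-∷ʳ : ∀ n → range (suc n) ≡ range n ++ n ∷ []
  upTo-∷ʳ n = go id n
    where go : ∀ (f : ℕ → ℕ) n → applyUpTo f (suc n) ≡ applyUpTo f n ++ f n ∷ []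
          go f zero    = refl
          go f (suc n) = cong (f 0 ∷_) (go (f ∘ suc) n)

word-suc : ∀ n t → word (suc n) t ≡ rowWord n t ++ word n t
word-suc n t = cong (concatMap (λ i → rowWord i t)) (reverse-range n)

letters-rowWord : ∀ p t k → letters (rowWord p t) k ≡ rowContent t p k
letters-rowWord p []      k = refl
letters-rowWord p (q ∷ t) k with rowOf q ≡ᵇ p | countᵇ-∷ (λ q → (rowOf q ≡ᵇ p) ∧ (proj₂ q ≡ᵇ suc k)) q t
... | false | e = trans (letters-rowWord p t k) (sym e)
... | true  | e = trans (countᵇ-∷ (_≡ᵇ suc k) (proj₂ q) (rowWord p t)) (trans (cong (b2n (proj₂ q ≡ᵇ suc k) +_) (letters-rowWord p t k)) (sym e))

rowSum : ℕ → Tableau → ℕ → ℕ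
rowSum n t k = sumTo n (λ p → rowContent t p k)

letters-word : ∀ n t k → letters (word n t) k ≡ rowSum n t k
letters-word zero    t k = refl
letters-word (suc n) t k = trans (cong (λ w → letters w k) (word-suc n t)) (trans (letters-++ (rowWord n t) (word n t) k)
  (trans (cong₂ _+_ (letters-rowWord n t k) (letters-word n t k)) (+-comm (rowContent t n k) _)))

-- Suffixes grow from the end of the word, so rows are met from the top and each row from its right
-- end. The critical suffix for `k` in row `p` contains all letters `k + 1` of the row and none of
-- its letters `k`. Here `c` is the content of everything read before.
word-latticed⁻ : ∀ {c} n t → (∀ p → AllPairs _≤_ (rowWord p t)) → LatticedFrom c (word n t) →
  (∀ k → c (suc k) ≤ c k) × (∀ p → p < n → ∀ k → rowContent t p (suc k) + (rowSum p t (suc k) + c (suc k)) ≤ rowSum p t k + c k)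
word-latticed⁻ {c} zero    t s L = (λ k → L (here refl) k) , λ _ ()
word-latticed⁻ {c} (suc n) t s L with latticed-++⁻ (rowWord n t) (word n t) (subst (LatticedFrom c) (word-suc n t) L)
... | L′ , L₁ with word-latticed⁻ n t s L′
... | d , h = d , λ p p≤n k → case p ≟ n of λ where
  (yes refl) → subst₂ _≤_ (cong₂ (λ x y → x + (y + c (suc k))) (letters-rowWord n t (suc k)) (letters-word n t (suc k))) (cong (_+ c k) (letters-word n t k))
                 (row-latticed⁻ (rowWord n t) (s n) L₁ k)
  (no ne)    → h p (≤∧≢⇒< (s≤s⁻¹ p≤n) ne) k

word-latticed⁺ : ∀ {c} n t → (∀ k → c (suc k) ≤ c k) →
  (∀ p → p < n → ∀ k → rowContent t p (suc k) + (rowSum p t (suc k) + c (suc k)) ≤ rowSum p t k + c k) → LatticedFrom c (word n t)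
word-latticed⁺ {c} zero    t d h (here refl) k = d k
word-latticed⁺ {c} (suc n) t d h = subst (LatticedFrom c) (sym (word-suc n t)) (latticed-++⁺ (rowWord n t) (word n t)
  (word-latticed⁺ n t d (λ p p< → h p (m<n⇒m<1+n p<)))
  (row-latticed⁺ (rowWord n t) (λ k → subst₂ _≤_ (sym (cong₂ (λ x y → x + (y + c (suc k))) (letters-rowWord n t (suc k)) (letters-word n t (suc k)))) (cong (_+ c k) (sym (letters-word n t k)))
      (h n ≤-refl k))))

AllPairs-++ : {A : Set} {R : A → A → Set} {xs ys : List A} → AllPairs R xs → AllPairs R ys → (∀ {x y} → x ∈ xs → y ∈ ys → R x y) → AllPairs R (xs ++ ys)
AllPairs-++ []      v d = v
AllPairs-++ {xs = x ∷ xs} {ys} (p ∷ u) v d = ∈-All (xs ++ ys) (λ i → case ∈-++⁻ xs i of λ where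
    (inj₁ j) → All-∈ p j
    (inj₂ j) → d (here refl) j)
  ∷ AllPairs-++ u v (d ∘ there)

AllPairs-concatMap : {A : Set} {R : A → A → Set} (f : ℕ → List A) (n : ℕ) (g : ℕ → ℕ) → (∀ i → AllPairs R (f i)) →
  (∀ {i j x y} → i < j → x ∈ f (g i) → y ∈ f (g j) → R x y) → AllPairs R (concatMap f (applyUpTo g n))
AllPairs-concatMap f zero    g h d = []
AllPairs-concatMap f (suc n) g h d = AllPairs-++ (h (g 0)) (AllPairs-concatMap f n (g ∘ suc) h (λ i<j → d (s≤s i<j)))
  (λ i j → case ∈-concatMap⁻ f (applyUpTo (g ∘ suc) n) j of λ where
    (z , k , l) → case ∈-applyUpTo⁻ (g ∘ suc) n k of λ where (x , _ , refl) → d (s≤s z≤n) i l)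

AllPairs-map : {A B : Set} {R : B → B → Set} (f : A → B) {xs : List A} → AllPairs (λ x y → R (f x) (f y)) xs → AllPairs R (map f xs)
AllPairs-map f []      = []
AllPairs-map f {x ∷ xs} (p ∷ u) = ∈-All (map f xs) (λ i → case ∈-map⁻ f xs i of λ where (z , j , refl) → All-∈ p j) ∷ AllPairs-map f u

rowWord-sorted : ∀ M lam μ {t} → t ∈ ssyts M lam μ → ∀ p → AllPairs _≤_ (rowWord p t)
rowWord-sorted M lam μ {t} t∈ p with ∈-ssyts⁻ M lam μ t∈
... | eq , S = go t (subst (AllPairs Weak) (sym eq) (AllPairs-map (λ c → c , entry t c) cellsWeak))
  where
  open SemiStandard S
  Weak : Cell × ℕ → Cell × ℕ → Set
  Weak q q′ = rowOf q ≡ rowOf q′ → proj₂ q ≤ proj₂ q′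
  cellsWeak : AllPairs (λ c d → Weak (c , entry t c) (d , entry t d)) (cells lam μ)
  cellsWeak = AllPairs-concatMap (cellRow lam μ) (length lam) id
    (λ i → AllPairs-map (i ,_) (AllPairs-map (nth μ i +_) (AllPairs-applyUpTo id _ (λ {x} {y} x<y y< _ → rows (m≤m+n _ x) (+-monoʳ-< (nth μ i) x<y)
        (proj₂ (proj₂ (∈-cellRow⁻ lam μ i (∈-map⁺ (i ,_) (∈-map⁺ (nth μ i +_) (∈-range⁺ y<))))))))))
    (λ {i} {j} i<j x∈ y∈ e → ⊥-elim (<⇒≢ i<j (trans (sym (proj₁ (∈-cellRow⁻ lam μ i x∈))) (trans e (proj₁ (∈-cellRow⁻ lam μ j y∈))))))
  go : ∀ t → AllPairs Weak t → AllPairs _≤_ (rowWord p t)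
  go []      []      = []
  go (q ∷ t) (h ∷ u) with rowOf q ≡ᵇ p in e
  ... | false = go t u
  ... | true  = ∈-All (rowWord p t) (λ i → case ∈-map⁻ proj₂ (filt (λ q → rowOf q ≡ᵇ p) t) i of λ where
      (z , j , refl) → case ∈-filt⁻ (λ q → rowOf q ≡ᵇ p) t j of λ where
        (z∈ , ez) → All-∈ h z∈ (trans (≡ᵇ-sound e) (sym (≡ᵇ-sound ez))))
    ∷ go t u

-- One component of a skew multipartition, with a bound on the number of its rows.
record Block : Set where
  constructor block
  field new old : List ℕ
        rows    : ℕ

totalRows : List Block → ℕ
totalRows []       = 0
totalRows (b ∷ bs) = totalRows bs + Block.rows b

-- The rows of all blocks, numbered in the order in which the reading word of a tuple meets them from its end:
-- the last block comes first.
stack : (Block → List ℕ) → List Block → ℕ → ℕ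
stack f []       p = 0
stack f (b ∷ bs) p = if p <ᵇ totalRows bs then stack f bs p else nth (f b) (p ∸ totalRows bs)

-- True if rows `i` and `i + 1` lie in the same component, that is, if their beads are neighbours on
-- one runner. Only such beads can collide.
linkedRows : List Block → ℕ → Bool
linkedRows []       p = false
linkedRows (b ∷ bs) p = if suc p <ᵇ totalRows bs then linkedRows bs p else (totalRows bs ≤ᵇ p) ∧ (suc p <ᵇ totalRows bs + Block.rows b)

stack-tail : ∀ f b bs {p} → p < totalRows bs → stack f (b ∷ bs) p ≡ stack f bs p
stack-tail f b bs h rewrite <ᵇ-true h = refl

stack-head : ∀ f b bs p → stack f (b ∷ bs) (totalRows bs + p) ≡ nth (f b) p
stack-head f b bs p rewrite <ᵇ-false {totalRows bs + p} {totalRows bs} (m≤m+n _ p) | m+n∸m≡n (totalRows bs) p = refl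

linked-inv : ∀ b bs {i} → linkedRows (b ∷ bs) i ≡ true →
             (suc i < totalRows bs × linkedRows bs i ≡ true) ⊎ (∃[ p ] (i ≡ totalRows bs + p × suc p < Block.rows b))
linked-inv b bs {i} e with suc i <? totalRows bs
... | yes h rewrite <ᵇ-true h = inj₁ (h , e)
... | no  h rewrite <ᵇ-false (≮⇒≥ h) with ∧-elim {totalRows bs ≤ᵇ i} e
... | p , q with m≤n⇒∃[o]m+o≡n (≤ᵇ-sound {totalRows bs} p)
... | o , refl = inj₂ (o , refl , +-cancelˡ-< (totalRows bs) _ _ (subst (_< totalRows bs + Block.rows b) (sym (+-suc (totalRows bs) o)) (<ᵇ-sound {suc (totalRows bs + o)} q)))

linked-tail : ∀ b bs {i} → suc i < totalRows bs → linkedRows bs i ≡ true → linkedRows (b ∷ bs) i ≡ true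
linked-tail b bs h e rewrite <ᵇ-true h = e

linked-head : ∀ b bs p → suc p < Block.rows b → linkedRows (b ∷ bs) (totalRows bs + p) ≡ true
linked-head b bs p h rewrite <ᵇ-false {suc (totalRows bs + p)} {totalRows bs} (m≤n⇒m≤1+n (m≤m+n _ p)) =
  ∧-intro (≤ᵇ-true (m≤m+n (totalRows bs) p)) (<ᵇ-true (subst (_< totalRows bs + Block.rows b) (+-suc (totalRows bs) p) (+-monoʳ-< (totalRows bs) h)))

linked-bound : ∀ bs {i} → linkedRows bs i ≡ true → suc i < totalRows bs
linked-bound (b ∷ bs) e with linked-inv b bs e
... | inj₁ (h , _)        = ≤-trans h (m≤m+n _ _)
... | inj₂ (p , refl , h) = subst (_< totalRows bs + Block.rows b) (+-suc (totalRows bs) p) (+-monoʳ-< (totalRows bs) h)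

-- The rows of one block of a matrix m, where m k p counts the letters k in row p, as a Gelfand–Tsetlin pattern.
blockGT : Block → ℕ → (ℕ → ℕ → ℕ) → ℕ → ℕ → ℕ
blockGT b off m p x = if p <ᵇ Block.rows b then nth (Block.old b) p + sumTo x (λ k → m k (off + p)) else 0

WellFormed : Block → Set
WellFormed b = Skew (Block.new b) (Block.old b) × length (Block.new b) ≤ Block.rows b

Fits : ℕ → List Block → (ℕ → ℕ → ℕ) → Set
Fits ℓ []       m = ⊤
Fits ℓ (b ∷ bs) m = GT ℓ (nth (Block.new b)) (nth (Block.old b)) (blockGT b (totalRows bs) m) × Fits ℓ bs m

-- The condition `goodAt` with column sums cancelled. Read with `m k p` as the number of letters `k`
-- in row `p` of a tuple, it is the interlacing of rows `i` and `i + 1` of a component, so the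
-- surviving tableaux correspond to semistandard tuples.
RowsOK : (ℕ → ℕ) → (ℕ → ℕ → ℕ) → ℕ → ℕ → Set
RowsOK τ m i x = τ (suc i) + sumTo (suc x) (λ k → m k (suc i)) ≤ τ i + sumTo x (λ k → m k i)

blockGT-in : ∀ b off m {p} x → p < Block.rows b → blockGT b off m p x ≡ nth (Block.old b) p + sumTo x (λ k → m k (off + p))
blockGT-in b off m x h rewrite <ᵇ-true h = refl

blockGT-out : ∀ b off m {p} x → Block.rows b ≤ p → blockGT b off m p x ≡ 0
blockGT-out b off m x h rewrite <ᵇ-false h = refl

fits⁺ : ∀ ℓ bs m → All WellFormed bs → (∀ i x → x < ℓ → linkedRows bs i ≡ true → RowsOK (stack Block.old bs) m i x) →
        (∀ p → p < totalRows bs → stack Block.old bs p + sumTo ℓ (λ k → m k p) ≡ stack Block.new bs p) → Fits ℓ bs m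
fits⁺ ℓ []       m []            h e = tt
fits⁺ ℓ (b ∷ bs) m ((skew , len) ∷ w) h e = record { start = start ; end = end ; mono = mono ; inter = inter } ,
  fits⁺ ℓ bs m w (λ i x x<ℓ l → let b< = linked-bound bs l in
      subst₂ _≤_ (cong (_+ sumTo (suc x) (λ k → m k (suc i))) (stack-tail Block.old b bs b<)) (cong (_+ sumTo x (λ k → m k i)) (stack-tail Block.old b bs (<⇒≤ b<)))
             (h i x x<ℓ (linked-tail b bs b< l)))
    (λ p p< → trans (cong (_+ sumTo ℓ (λ k → m k p)) (sym (stack-tail Block.old b bs p<))) (trans (e p (≤-trans p< (m≤m+n _ _))) (stack-tail Block.new b bs p<)))
  where
  open Block b
  open Skew skew
  off = totalRows bs
  V = blockGT b off m
  start : ∀ p → V p 0 ≡ nth old p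
  start p with p <? rows
  ... | yes h = trans (blockGT-in b off m 0 h) (+-identityʳ _)
  ... | no  h = trans (blockGT-out b off m 0 (≮⇒≥ h)) (sym (n≤0⇒n≡0 (≤-trans (sub p) (≤-reflexive (nth-beyond new (≤-trans len (≮⇒≥ h)))))))
  end : ∀ p → V p ℓ ≡ nth new p
  end p with p <? rows
  ... | yes h = trans (blockGT-in b off m ℓ h) (trans (cong (_+ sumTo ℓ (λ k → m k (off + p))) (sym (stack-head Block.old b bs p)))
                  (trans (e (off + p) (+-monoʳ-< off h)) (stack-head Block.new b bs p)))
  ... | no  h = trans (blockGT-out b off m ℓ (≮⇒≥ h)) (sym (nth-beyond new (≤-trans len (≮⇒≥ h))))
  mono : ∀ p x → x < ℓ → V p x ≤ V p (suc x)
  mono p x _ with p <ᵇ rows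
  ... | true  = +-monoʳ-≤ (nth old p) (m≤m+n _ _)
  ... | false = z≤n
  inter : ∀ p x → x < ℓ → V (suc p) (suc x) ≤ V p x
  inter p x x<ℓ with suc p <? rows
  ... | yes h₁ = subst₂ _≤_
      (trans (cong₂ (λ a j → a + sumTo (suc x) (λ k → m k j)) (trans (cong (stack Block.old (b ∷ bs)) (sym (+-suc off p))) (stack-head Block.old b bs (suc p))) (sym (+-suc off p))) (sym (blockGT-in b off m (suc x) h₁)))
      (trans (cong (_+ sumTo x (λ k → m k (off + p))) (stack-head Block.old b bs p)) (sym (blockGT-in b off m x (<⇒≤ h₁))))
      (h (off + p) x x<ℓ (linked-head b bs p h₁))
  ... | no  h₁ = ≤-trans (≤-reflexive (blockGT-out b off m (suc x) (≮⇒≥ h₁))) z≤n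

fits⁻ : ∀ ℓ bs m → All WellFormed bs → (∀ p → m ℓ p ≡ 0) → Fits ℓ bs m →
  (∀ i x → x ≤ ℓ → linkedRows bs i ≡ true → RowsOK (stack Block.old bs) m i x) ×
  (∀ p → p < totalRows bs → stack Block.old bs p + sumTo ℓ (λ k → m k p) ≡ stack Block.new bs p)
fits⁻ ℓ []       m w z f = (λ _ _ _ ()) , λ _ ()
fits⁻ ℓ (b ∷ bs) m ((skew , len) ∷ w) z (G , f) with fits⁻ ℓ bs m w z f
... | rowsOK , total = ok , tot
  where
  open Block b
  open GT G
  off = totalRows bs
  ok : ∀ i x → x ≤ ℓ → linkedRows (b ∷ bs) i ≡ true → RowsOK (stack Block.old (b ∷ bs)) m i x
  ok i x x≤ℓ l with linked-inv b bs l
  ... | inj₁ (h , l′) = subst₂ _≤_ (cong (_+ sumTo (suc x) (λ k → m k (suc i))) (sym (stack-tail Block.old b bs h))) (cong (_+ sumTo x (λ k → m k i)) (sym (stack-tail Block.old b bs (<⇒≤ h)))) (rowsOK i x x≤ℓ l′)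
  ... | inj₂ (p , refl , h) = subst₂ _≤_
      (trans (blockGT-in b off m (suc x) h) (sym (cong₂ (λ a j → a + sumTo (suc x) (λ k → m k j)) (trans (cong (stack Block.old (b ∷ bs)) (sym (+-suc off p))) (stack-head Block.old b bs (suc p))) (sym (+-suc off p)))))
      (trans (blockGT-in b off m x (<⇒≤ h)) (sym (cong (_+ sumTo x (λ k → m k (off + p))) (stack-head Block.old b bs p))))
      (cross (x <? ℓ))
    where
    -- At `x = ℓ` the interlacing of the pattern no longer speaks. The letter `ℓ` is absent,
    -- however, and both sides are complete rows of `new`.
    cross : Dec (x < ℓ) → blockGT b off m (suc p) (suc x) ≤ blockGT b off m p x
    cross (yes x<ℓ) = inter p x x<ℓ
    cross (no  x≮ℓ) with ≤-antisym x≤ℓ (≮⇒≥ x≮ℓ)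
    ... | refl = ≤-trans (≤-reflexive (trans (blockGT-in b off m (suc x) h) (trans (cong (λ a → nth old (suc p) + (sumTo x (λ k → m k (off + suc p)) + a)) (z _))
        (trans (cong (nth old (suc p) +_) (+-identityʳ _)) (trans (sym (blockGT-in b off m x h)) (end (suc p))))))) (≤-trans (Skew.outer skew p) (≤-reflexive (sym (end p))))
  tot : ∀ p → p < totalRows (b ∷ bs) → stack Block.old (b ∷ bs) p + sumTo ℓ (λ k → m k p) ≡ stack Block.new (b ∷ bs) p
  tot p p< with p <? off
  ... | yes h = trans (cong (_+ sumTo ℓ (λ k → m k p)) (stack-tail Block.old b bs h)) (trans (total p h) (sym (stack-tail Block.new b bs h)))
  ... | no  h with m≤n⇒∃[o]m+o≡n (≮⇒≥ h)
  ... | o , refl = trans (cong (_+ sumTo ℓ (λ k → m k (off + o))) (stack-head Block.old b bs o))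
      (trans (sym (blockGT-in b off m ℓ (+-cancelˡ-< off _ _ p<))) (trans (end o) (sym (stack-head Block.new b bs o))))

GT-cong : ∀ {M lam μ N N′} → (∀ k i → i ≤ M → N k i ≡ N′ k i) → GT M lam μ N → GT M lam μ N′
GT-cong {M} e G = record
  { start = λ k → trans (sym (e k 0 z≤n)) (start k) ; end = λ k → trans (sym (e k M ≤-refl)) (end k)
  ; mono = λ k i h → subst₂ _≤_ (e k i (<⇒≤ h)) (e k (suc i) h) (mono k i h) ; inter = λ k i h → subst₂ _≤_ (e (suc k) (suc i) h) (e k i (<⇒≤ h)) (inter k i h) }
  where open GT G

blockGT-cong : ∀ b off m m′ → (∀ k p → p < off + Block.rows b → m k p ≡ m′ k p) → ∀ p x → blockGT b off m p x ≡ blockGT b off m′ p x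
blockGT-cong b off m m′ h p x with p <? Block.rows b
... | yes q rewrite <ᵇ-true q = cong (nth (Block.old b) p +_) (sumTo-cong x (λ k _ → h k (off + p) (+-monoʳ-< off q)))
... | no  q rewrite <ᵇ-false (≮⇒≥ q) = refl

Fits-cong : ∀ ℓ bs m m′ → (∀ k p → p < totalRows bs → m k p ≡ m′ k p) → Fits ℓ bs m → Fits ℓ bs m′
Fits-cong ℓ []       m m′ h f       = tt
Fits-cong ℓ (b ∷ bs) m m′ h (G , f) = GT-cong (λ p x _ → blockGT-cong b (totalRows bs) m m′ h p x) G , Fits-cong ℓ bs m m′ (λ k p q → h k p (≤-trans q (m≤m+n _ _))) f

∈-listProduct⁻ : {A : Set} (xs : List A) (xss : List (List A)) {l : List A} → l ∈ listProduct (xs ∷ xss) →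
                 ∃[ x ] ∃[ l′ ] (x ∈ xs × l′ ∈ listProduct xss × l ≡ x ∷ l′)
∈-listProduct⁻ xs xss i with ∈-concatMap⁻ _ xs i
... | x , x∈ , j with ∈-map⁻ (x ∷_) (listProduct xss) j
... | l′ , k , e = x , l′ , x∈ , k , e

∈-listProduct⁺ : {A : Set} (xs : List A) (xss : List (List A)) {x : A} {l : List A} → x ∈ xs → l ∈ listProduct xss → x ∷ l ∈ listProduct (xs ∷ xss)
∈-listProduct⁺ xs xss {x} i j = ∈-concatMap⁺ _ i (∈-map⁺ (x ∷_) j)

Unique-listProduct : {A : Set} (xss : List (List A)) → All Unique xss → Unique (listProduct xss)
Unique-listProduct []         []      = [] ∷ []
Unique-listProduct (xs ∷ xss) (u ∷ w) = Unique-concatMap _ u (λ {x} _ → Unique-map (x ∷_) (λ { _ _ refl → refl }) (Unique-listProduct xss w))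
  (λ {x} {y} p q → case ∈-map⁻ (x ∷_) (listProduct xss) p of λ where (_ , _ , refl) → case ∈-map⁻ (y ∷_) (listProduct xss) q of λ where (_ , _ , refl) → refl)

sumTo-split : ∀ a b f → sumTo (a + b) f ≡ sumTo a f + sumTo b (λ p → f (a + p))
sumTo-split a zero    f rewrite +-identityʳ a = sym (+-identityʳ _)
sumTo-split a (suc b) f rewrite +-suc a b = trans (cong (_+ f (a + b)) (sumTo-split a b f)) (+-assoc (sumTo a f) _ _)

rowContent-beyond : ∀ M lam μ {t} → t ∈ ssyts M lam μ → ∀ {p} k → length lam ≤ p → rowContent t p k ≡ 0
rowContent-beyond M lam μ {t} t∈ k h = countᵇ-zero t (λ {q} q∈ → cong (_∧ (proj₂ q ≡ᵇ suc k)) (≡ᵇ-false {rowOf q} (λ where refl → <⇒≱ (ssyts-rows M lam μ t∈ q∈) h)))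

rowContent-letter : ∀ M lam μ {t} → t ∈ ssyts M lam μ → ∀ p {k} → M ≤ k → rowContent t p k ≡ 0
rowContent-letter M lam μ {t} t∈ p {k} h = countᵇ-zero t (λ {q} q∈ → ¬true (λ e →
  <⇒≱ (subst (_≤ M) (≡ᵇ-sound {proj₂ q} (proj₂ (∧-elim {rowOf q ≡ᵇ p} e))) (proj₂ (proj₂ (∈-fillings⁻ M (cells lam μ) (proj₁ (∈-filt⁻ isSSYT (fillings M (cells lam μ)) t∈))) q∈))) h))

rowSum-content : ∀ M lam μ {t} → t ∈ ssyts M lam μ → ∀ {n} k → length lam ≤ n → rowSum n t k ≡ contentAt t k
rowSum-content M lam μ {t} t∈ {n} k h = sym (countᵇ-by-rows n t (λ q → proj₂ q ≡ᵇ suc k) (λ q → ≤-trans (ssyts-rows M lam μ t∈ q) h))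

gt-rowContents : ∀ μ t p x → gt μ t p 0 ≡ nth μ p → gt μ t p x ≡ nth μ p + sumTo x (λ k → rowContent t p k)
gt-rowContents μ t p zero    e = trans e (sym (+-identityʳ _))
gt-rowContents μ t p (suc x) e = trans (sym (rowContent-gt μ t p x)) (trans (cong (_+ rowContent t p x) (gt-rowContents μ t p x e)) (+-assoc (nth μ p) _ _))

module LittlewoodRichardson {lam μ : List ℕ} (skew : Skew lam μ) (μ≤lam : length μ ≤ length lam) where
  open Skew skew using () renaming (inner to μ-dec; outer to lam-dec; sub to μ⊆lam)

  ℓ : ℕ
  ℓ = length lam

  component : List ℕ × List ℕ → List (ℕ × Tableau)
  component s = map (λ t → length (proj₁ s) , t) (ssyts ℓ (proj₁ s) (proj₂ s))

  tuples : List (List ℕ × List ℕ) → List (List (ℕ × Tableau))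
  tuples shapes = listProduct (map component shapes)

  totalContent : List (ℕ × Tableau) → List ℕ
  totalContent tup = foldr (zipWith _+_) (replicate ℓ 0) (map (λ p → content ℓ (proj₂ p)) tup)

  reading : List (ℕ × Tableau) → List ℕ
  reading tup = concatMap (λ p → word (proj₁ p) (proj₂ p)) tup

  accepted : List (ℕ × Tableau) → Bool
  accepted tup = eqL (totalContent tup) lam ∧ latticed (reading tup)

  lrCoeff-def : ∀ shapes → lrCoeff lam shapes ≡ countᵇ accepted (tuples shapes)
  lrCoeff-def shapes = refl

  shapesOf : List Block → List (List ℕ × List ℕ)
  shapesOf bs = map (λ b → Block.new b , Block.old b) bs ++ (μ , []) ∷ []

  last : ℕ × Tableau
  last = length μ , superstandardTab ℓ μ

  module SS = Superstandard {ℓ} {μ} μ-dec μ≤lam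

  -- The component of shape μ is read first from the end, so its word is latticed by itself; this
  -- forces it to be superstandard, with content μ. Tuples of this form are the only ones that can
  -- be counted.
  IsTuple : List Block → List (ℕ × Tableau) → Set
  IsTuple []       tup = tup ≡ last ∷ []
  IsTuple (b ∷ bs) tup = ∃[ t ] ∃[ tup′ ] (tup ≡ (length (Block.new b) , t) ∷ tup′ × t ∈ ssyts ℓ (Block.new b) (Block.old b) × IsTuple bs tup′)

  IsTuple⇒∈ : ∀ bs {tup} → IsTuple bs tup → tup ∈ tuples (shapesOf bs)
  IsTuple⇒∈ []       refl = ∈-listProduct⁺ (component (μ , [])) [] (∈-map⁺ _ SS.superstandardTab-∈) (here refl)
  IsTuple⇒∈ (b ∷ bs) (t , tup′ , refl , t∈ , i) = ∈-listProduct⁺ (component (Block.new b , Block.old b)) (map component (shapesOf bs)) (∈-map⁺ _ t∈) (IsTuple⇒∈ bs i)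

  ∈⇒IsTuple : ∀ bs {tup} → tup ∈ tuples (shapesOf bs) → LatticedFrom (λ _ → 0) (reading tup) → IsTuple bs tup
  ∈⇒IsTuple [] tup∈ L with ∈-listProduct⁻ (component (μ , [])) [] tup∈
  ... | x , _ , x∈ , here refl , refl with ∈-map⁻ _ (ssyts ℓ μ []) x∈
  ... | t , t∈ , refl = cong (λ t → (length μ , t) ∷ []) (SS.superstandardTab-unique t∈ (λ p k p< k< → convert p k
      (subst₂ _≤_ (cong (rowContent t p (suc k) +_) (+-identityʳ _)) (+-identityʳ _)
        (proj₂ (word-latticed⁻ (length μ) t (rowWord-sorted ℓ μ [] t∈) (subst (LatticedFrom _) (++-identityʳ (word (length μ) t)) L)) p p< k))))
    where
    N = gt [] t
    cols : ∀ n k → columnSum n N (suc k) ≡ columnSum n N k + rowSum n t k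
    cols n k = trans (sumTo-cong n (λ p _ → sym (rowContent-gt [] t p k))) (sumTo-+ n _ _)
    convert : ∀ p k → rowContent t p (suc k) + rowSum p t (suc k) ≤ rowSum p t k →
              columnSum (suc p) N (suc (suc k)) + columnSum p N k ≤ columnSum p N (suc k) + columnSum (suc p) N (suc k)
    convert p k h = lia 8 (λ c a b s₀ s₁ r w v → r :+ w :≤ s₁ ⇒ b :≡ s₀ :+ s₁ ⇒ c :≡ a :+ v ⇒ v :≡ w :+ r ⇒ ⊢ c :+ s₀ :≤ b :+ a)
      (columnSum (suc p) N (suc (suc k))) (columnSum (suc p) N (suc k)) (columnSum p N (suc k)) (columnSum p N k)
      (rowSum p t k) (rowContent t p (suc k)) (rowSum p t (suc k)) (rowSum (suc p) t (suc k)) h (cols p k) (cols (suc p) (suc k)) refl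
  ∈⇒IsTuple (b ∷ bs) tup∈ L with ∈-listProduct⁻ (component (Block.new b , Block.old b)) (map component (shapesOf bs)) tup∈
  ... | x , tup′ , x∈ , tup′∈ , refl with ∈-map⁻ _ (ssyts ℓ (Block.new b) (Block.old b)) x∈
  ... | t , t∈ , refl = t , tup′ , refl , t∈ , ∈⇒IsTuple bs tup′∈ (proj₁ (latticed-++⁻ (word (length (Block.new b)) t) (reading tup′) L))

  matrix : List Block → List (ℕ × Tableau) → ℕ → ℕ → ℕ
  matrix (b ∷ bs) (q ∷ tup) k p = if p <ᵇ totalRows bs then matrix bs tup k p else rowContent (proj₂ q) (p ∸ totalRows bs) k
  matrix _        _         k p = 0

  matrix-tail : ∀ b bs q tup k {p} → p < totalRows bs → matrix (b ∷ bs) (q ∷ tup) k p ≡ matrix bs tup k p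
  matrix-tail b bs q tup k h rewrite <ᵇ-true h = refl

  matrix-head : ∀ b bs q tup k p → matrix (b ∷ bs) (q ∷ tup) k (totalRows bs + p) ≡ rowContent (proj₂ q) p k
  matrix-head b bs q tup k p rewrite <ᵇ-false {totalRows bs + p} {totalRows bs} (m≤m+n _ p) | m+n∸m≡n (totalRows bs) p = refl

  -- The number of letters `k` met before row `p` when the word of the tuple is read from its end;
  -- the component of shape μ contributes its content μ. As a function of `k` and `p` this is the
  -- pattern of the tableau of shape λ/μ.
  upto : (ℕ → ℕ → ℕ) → ℕ → ℕ → ℕ
  upto m k p = nth μ k + sumTo p (m k)

  upto-tail : ∀ b bs q tup k {p} → p ≤ totalRows bs → upto (matrix (b ∷ bs) (q ∷ tup)) k p ≡ upto (matrix bs tup) k p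
  upto-tail b bs q tup k h = cong (nth μ k +_) (sumTo-cong _ (λ x x< → matrix-tail b bs q tup k (≤-trans x< h)))

  upto-head : ∀ b bs q tup k p → upto (matrix (b ∷ bs) (q ∷ tup)) k (totalRows bs + p) ≡ rowSum p (proj₂ q) k + upto (matrix bs tup) k (totalRows bs)
  upto-head b bs q tup k p = trans (cong (nth μ k +_) (sumTo-split (totalRows bs) p _)) (trans (sym (+-assoc (nth μ k) _ _))
    (trans (+-comm _ (sumTo p _)) (cong₂ _+_ (sumTo-cong p (λ x _ → matrix-head b bs q tup k x)) (upto-tail b bs q tup k ≤-refl))))

  rowSum-rows : ∀ {b t} → WellFormed b → t ∈ ssyts ℓ (Block.new b) (Block.old b) → ∀ k → rowSum (Block.rows b) t k ≡ rowSum (length (Block.new b)) t k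
  rowSum-rows {b} (_ , len) t∈ k = trans (rowSum-content ℓ (Block.new b) (Block.old b) t∈ k len) (sym (rowSum-content ℓ (Block.new b) (Block.old b) t∈ k ≤-refl))

  letters-last : ∀ k → letters (reading (last ∷ [])) k ≡ nth μ k
  letters-last k = trans (cong (λ w → letters w k) (++-identityʳ (word (length μ) T₀))) (trans (letters-word (length μ) T₀ k)
    (trans (rowSum-content ℓ μ [] SS.superstandardTab-∈ k ≤-refl) (case k <? ℓ of λ where
      (yes h) → SS.contentAt-superstandardTab k h
      (no  h) → trans (countᵇ-by-rows (length μ) T₀ _ (ssyts-rows ℓ μ [] SS.superstandardTab-∈))
                  (trans (sumTo-zero (length μ) (λ p _ → rowContent-letter ℓ μ [] SS.superstandardTab-∈ p (≮⇒≥ h))) (sym (nth-beyond μ (≤-trans μ≤lam (≮⇒≥ h))))))))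
    where T₀ = superstandardTab ℓ μ

  letters-reading : ∀ bs {tup} → All WellFormed bs → IsTuple bs tup → ∀ k → letters (reading tup) k ≡ upto (matrix bs tup) k (totalRows bs)
  letters-reading []       w       refl k = trans (letters-last k) (sym (+-identityʳ _))
  letters-reading (b ∷ bs) (wf ∷ w) (t , tup′ , refl , t∈ , i) k = trans (letters-++ (word (length new) t) (reading tup′) k)
    (trans (cong₂ _+_ (trans (letters-word (length new) t k) (sym (rowSum-rows {b} wf t∈ k))) (letters-reading bs w i k)) (sym (upto-head b bs (length new , t) tup′ k rows)))
    where open Block b

  -- For `U = upto m` this is `U (k + 1) (p + 1) ≤ U k p`. The lattice condition on the tuple is
  -- thus the interlacing condition on the tableau of shape λ/μ.
  Lattice : List Block → (ℕ → ℕ → ℕ) → Set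
  Lattice bs m = ∀ p → p < totalRows bs → ∀ k → m (suc k) p + upto m (suc k) p ≤ upto m k p

  upto-decreasing : ∀ bs m → Lattice bs m → ∀ k → upto m (suc k) (totalRows bs) ≤ upto m k (totalRows bs)
  upto-decreasing bs m L k = go (totalRows bs) ≤-refl
    where go : ∀ n → n ≤ totalRows bs → upto m (suc k) n ≤ upto m k n
          go zero    h = +-monoˡ-≤ 0 (μ-dec k)
          go (suc n) h = lia 6 (λ a b s s′ x y → x :+ (a :+ s) :≤ b :+ s′ ⇒ ⊢ a :+ (s :+ x) :≤ b :+ (s′ :+ y)) (nth μ (suc k)) (nth μ k) (sumTo n (m (suc k))) (sumTo n (m k)) (m (suc k) n) (m k n) (L n h k)

  head-condition : ∀ b bs t tup k p → matrix (b ∷ bs) ((length (Block.new b) , t) ∷ tup) (suc k) (totalRows bs + p) + upto (matrix (b ∷ bs) ((length (Block.new b) , t) ∷ tup)) (suc k) (totalRows bs + p) ≡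
    rowContent t p (suc k) + (rowSum p t (suc k) + upto (matrix bs tup) (suc k) (totalRows bs))
  head-condition b bs t tup k p = cong₂ _+_ (matrix-head b bs (length (Block.new b) , t) tup (suc k) p) (upto-head b bs (length (Block.new b) , t) tup (suc k) p)

  lattice⁻ : ∀ bs {tup} → All WellFormed bs → IsTuple bs tup → LatticedFrom (λ _ → 0) (reading tup) → Lattice bs (matrix bs tup)
  lattice⁻ []       w       i L p ()
  lattice⁻ (b ∷ bs) ((_ , len) ∷ w) (t , tup′ , refl , t∈ , i) L p p< k with latticed-++⁻ (word (length (Block.new b)) t) (reading tup′) L
  ... | L′ , Lt with p <? totalRows bs
  ... | yes h = subst₂ _≤_ (sym (cong₂ _+_ (matrix-tail b bs (length (Block.new b) , t) tup′ (suc k) h) (upto-tail b bs (length (Block.new b) , t) tup′ (suc k) (<⇒≤ h)))) (sym (upto-tail b bs (length (Block.new b) , t) tup′ k (<⇒≤ h))) (lattice⁻ bs w i L′ p h k)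
  ... | no  h with m≤n⇒∃[o]m+o≡n (≮⇒≥ h)
  ... | o , refl = subst₂ _≤_ (sym (head-condition b bs t tup′ k o)) (sym (upto-head b bs (length (Block.new b) , t) tup′ k o)) row
    where
    n = length (Block.new b)
    c₀ : ℕ → ℕ
    c₀ k = letters (reading tup′) k + 0
    c₀≡ : ∀ k → c₀ k ≡ upto (matrix bs tup′) k (totalRows bs)
    c₀≡ k = trans (+-identityʳ _) (letters-reading bs w i k)
    W = word-latticed⁻ {c₀} n t (rowWord-sorted ℓ (Block.new b) (Block.old b) t∈) Lt
    -- The block may have more rows than its shape. Such a row is empty, and the inequality compares
    -- the letters of the whole component, obtained in `done` by adding its rows one by one.
    row : rowContent t o (suc k) + (rowSum o t (suc k) + upto (matrix bs tup′) (suc k) (totalRows bs)) ≤ rowSum o t k + upto (matrix bs tup′) k (totalRows bs)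
    row with o <? n
    ... | yes o<n = subst₂ _≤_ (cong (λ x → rowContent t o (suc k) + (rowSum o t (suc k) + x)) (c₀≡ (suc k))) (cong (rowSum o t k +_) (c₀≡ k)) (proj₂ W o o<n k)
    ... | no  o≮n rewrite rowContent-beyond ℓ (Block.new b) (Block.old b) t∈ (suc k) (≮⇒≥ o≮n)
          | trans (rowSum-content ℓ (Block.new b) (Block.old b) t∈ (suc k) (≮⇒≥ o≮n)) (sym (rowSum-content ℓ (Block.new b) (Block.old b) t∈ (suc k) ≤-refl))
          | trans (rowSum-content ℓ (Block.new b) (Block.old b) t∈ k (≮⇒≥ o≮n)) (sym (rowSum-content ℓ (Block.new b) (Block.old b) t∈ k ≤-refl))
          = subst₂ _≤_ (cong (rowSum n t (suc k) +_) (c₀≡ (suc k))) (cong (rowSum n t k +_) (c₀≡ k)) (done n ≤-refl)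
      where
      done : ∀ j → j ≤ n → rowSum j t (suc k) + c₀ (suc k) ≤ rowSum j t k + c₀ k
      done zero    _ = proj₁ W k
      done (suc j) h = lia 6 (λ x s c r c′ y → x :+ (s :+ c) :≤ r :+ c′ ⇒ ⊢ s :+ x :+ c :≤ r :+ y :+ c′) (rowContent t j (suc k)) (rowSum j t (suc k)) (c₀ (suc k)) (rowSum j t k) (c₀ k) (rowContent t j k) (proj₂ W j h k)

  lattice⁺ : ∀ bs {tup} → All WellFormed bs → IsTuple bs tup → Lattice bs (matrix bs tup) → LatticedFrom (λ _ → 0) (reading tup)
  lattice⁺ [] w refl L = subst (LatticedFrom (λ _ → 0)) (sym (++-identityʳ (word (length μ) T₀))) (word-latticed⁺ (length μ) T₀ (λ _ → z≤n) (λ p p< k → cond p k))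
    where
    T₀ = superstandardTab ℓ μ
    N = gt [] T₀
    cols : ∀ n k → columnSum n N (suc k) ≡ columnSum n N k + rowSum n T₀ k
    cols n k = trans (sumTo-cong n (λ p _ → sym (rowContent-gt [] T₀ p k))) (sumTo-+ n _ _)
    cond : ∀ p k → rowContent T₀ p (suc k) + (rowSum p T₀ (suc k) + 0) ≤ rowSum p T₀ k + 0
    cond p k with suc k <? ℓ
    ... | yes h = lia 7 (λ a b b′ s₀ s₁ r w → a :≡ b′ :+ (w :+ r) ⇒ b :≡ s₀ :+ s₁ ⇒ a :+ s₀ :≤ b :+ b′ ⇒ ⊢ r :+ (w :+ # 0) :≤ s₁ :+ # 0)
        (columnSum (suc p) N (suc (suc k))) (columnSum p N (suc k)) (columnSum (suc p) N (suc k)) (columnSum p N k) (rowSum p T₀ k) (rowContent T₀ p (suc k)) (rowSum p T₀ (suc k))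
        (cols (suc p) (suc k)) (cols p k) (SS.good-superstandardTab p k h)
    ... | no  h = ≤-trans (≤-reflexive (cong₂ (λ x y → x + (y + 0)) (rowContent-letter ℓ μ [] SS.superstandardTab-∈ p (≮⇒≥ h))
                    (sumTo-zero p (λ x _ → rowContent-letter ℓ μ [] SS.superstandardTab-∈ x (≮⇒≥ h))))) z≤n
  lattice⁺ (b ∷ bs) ((_ , len) ∷ w) (t , tup′ , refl , t∈ , i) L = latticed-++⁺ (word n t) (reading tup′) (lattice⁺ bs w i L′)
      (word-latticed⁺ {λ k → letters (reading tup′) k + 0} n t
        (λ k → subst₂ _≤_ (sym (c₀≡ (suc k))) (sym (c₀≡ k)) (upto-decreasing bs (matrix bs tup′) L′ k))
        (λ p p< k → subst₂ _≤_ (trans (head-condition b bs t tup′ k p) (cong (λ x → rowContent t p (suc k) + (rowSum p t (suc k) + x)) (sym (c₀≡ (suc k)))))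
            (trans (upto-head b bs (length (Block.new b) , t) tup′ k p) (cong (rowSum p t k +_) (sym (c₀≡ k))))
            (L (totalRows bs + p) (+-monoʳ-< (totalRows bs) (≤-trans p< len)) k)))
    where
    n = length (Block.new b)
    c₀≡ : ∀ k → letters (reading tup′) k + 0 ≡ upto (matrix bs tup′) k (totalRows bs)
    c₀≡ k = trans (+-identityʳ _) (letters-reading bs w i k)
    L′ : Lattice bs (matrix bs tup′)
    L′ p h k = subst₂ _≤_ (cong₂ _+_ (matrix-tail b bs (length (Block.new b) , t) tup′ (suc k) h) (upto-tail b bs (length (Block.new b) , t) tup′ (suc k) (<⇒≤ h))) (upto-tail b bs (length (Block.new b) , t) tup′ k (<⇒≤ h))
                 (L p (≤-trans h (m≤m+n _ _)) k)

-- The bijection between surviving tableaux and tuples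

module LRBijection {lam μ : List ℕ} (skew : Skew lam μ) (μ≤lam : length μ ≤ length lam) where
  open LittlewoodRichardson skew μ≤lam
  open Skew skew using () renaming (sub to μ⊆lam)

  toTuple : List Block → (ℕ → ℕ → ℕ) → List (ℕ × Tableau)
  toTuple []       m = last ∷ []
  toTuple (b ∷ bs) m = (length new , fromGT ℓ new old (blockGT b (totalRows bs) m)) ∷ toTuple bs m
    where open Block b

  matrix-letter : ∀ bs {tup} → IsTuple bs tup → ∀ k p → ℓ ≤ k → matrix bs tup k p ≡ 0
  matrix-letter []       refl k p h = refl
  matrix-letter (b ∷ bs) (t , tup′ , refl , t∈ , i) k p h with p <ᵇ totalRows bs
  ... | true  = matrix-letter bs i k p h
  ... | false = rowContent-letter ℓ (Block.new b) (Block.old b) t∈ (p ∸ totalRows bs) h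

  block-matrix : ∀ b bs t tup → WellFormed b → t ∈ ssyts ℓ (Block.new b) (Block.old b) → ∀ p x →
                 blockGT b (totalRows bs) (matrix (b ∷ bs) ((length (Block.new b) , t) ∷ tup)) p x ≡ gt (Block.old b) t p x
  block-matrix b bs t tup (skewᵇ , len) t∈ p x with p <? Block.rows b
  ... | yes h = trans (blockGT-in b (totalRows bs) (matrix (b ∷ bs) ((length (Block.new b) , t) ∷ tup)) x h) (trans (cong (nth (Block.old b) p +_) (sumTo-cong x (λ k _ → matrix-head b bs (length (Block.new b) , t) tup k p)))
                  (sym (gt-rowContents (Block.old b) t p x (GT.start (gt-GT skewᵇ t∈) p))))
  ... | no  h = trans (blockGT-out b (totalRows bs) (matrix (b ∷ bs) ((length (Block.new b) , t) ∷ tup)) x (≮⇒≥ h)) (sym (trans (gt-rowContents (Block.old b) t p x (GT.start (gt-GT skewᵇ t∈) p))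
                  (cong₂ _+_ (n≤0⇒n≡0 (≤-trans (Skew.sub skewᵇ p) (≤-reflexive (nth-beyond (Block.new b) (≤-trans len (≮⇒≥ h))))))
                    (sumTo-zero x (λ k _ → rowContent-beyond ℓ (Block.new b) (Block.old b) t∈ k (≤-trans len (≮⇒≥ h)))))))

  tuple-fits : ∀ bs {tup} → All WellFormed bs → IsTuple bs tup → Fits ℓ bs (matrix bs tup)
  tuple-fits []       w i = tt
  tuple-fits (b ∷ bs) (wf ∷ w) (t , tup′ , refl , t∈ , i) =
    GT-cong (λ p x _ → sym (block-matrix b bs t tup′ wf t∈ p x)) (gt-GT (proj₁ wf) t∈) ,
    Fits-cong ℓ bs (matrix bs tup′) _ (λ k p h → sym (matrix-tail b bs (length (Block.new b) , t) tup′ k h)) (tuple-fits bs w i)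

  toTuple-IsTuple : ∀ bs m → All WellFormed bs → Fits ℓ bs m → IsTuple bs (toTuple bs m)
  toTuple-IsTuple []       m w f = refl
  toTuple-IsTuple (b ∷ bs) m ((skewᵇ , _) ∷ w) (G , f) = _ , _ , refl , fromGT-∈ skewᵇ G , toTuple-IsTuple bs m w f

  matrix-toTuple : ∀ bs m → All WellFormed bs → Fits ℓ bs m → (∀ k p → ℓ ≤ k → m k p ≡ 0) → ∀ k p → p < totalRows bs → matrix bs (toTuple bs m) k p ≡ m k p
  matrix-toTuple (b ∷ bs) m (wf@(skewᵇ , _) ∷ w) (G , f) z k p p< with p <? totalRows bs
  ... | yes h = trans (matrix-tail b bs (length (Block.new b) , fromGT ℓ (Block.new b) (Block.old b) (blockGT b (totalRows bs) m)) (toTuple bs m) k h) (matrix-toTuple bs m w f z k p h)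
  ... | no  h with m≤n⇒∃[o]m+o≡n (≮⇒≥ h)
  ... | o , refl = trans (matrix-head b bs (length new , t) (toTuple bs m) k o) (row (k <? ℓ))
    where
    open Block b
    V = blockGT b (totalRows bs) m
    t = fromGT ℓ new old V
    o< : o < rows
    o< = +-cancelˡ-< (totalRows bs) _ _ p<
    row : Dec (k < ℓ) → rowContent t o k ≡ m k (totalRows bs + o)
    row (no  k≮) = trans (rowContent-letter ℓ new old (fromGT-∈ skewᵇ G) o (≮⇒≥ k≮)) (sym (z k _ (≮⇒≥ k≮)))
    row (yes k<) = +-cancelˡ-≡ (gt old t o k) _ _ (trans (rowContent-gt old t o k) (trans (gt-fromGT skewᵇ G o k<)
      (trans (blockGT-in b (totalRows bs) m (suc k) o<) (trans (sym (+-assoc (nth old o) _ _)) (cong (_+ m k (totalRows bs + o))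
        (trans (sym (blockGT-in b (totalRows bs) m k o<)) (sym (gt-fromGT skewᵇ G o (<⇒≤ k<)))))))))

  toTuple-matrix : ∀ bs {tup} m → All WellFormed bs → IsTuple bs tup → (∀ k p → p < totalRows bs → m k p ≡ matrix bs tup k p) → toTuple bs m ≡ tup
  toTuple-matrix []       m w refl h = refl
  toTuple-matrix (b ∷ bs) m (wf@(skewᵇ , _) ∷ w) (t , tup′ , refl , t∈ , i) h = cong₂ _∷_
    (cong (length new ,_) (gt-injective skewᵇ (fromGT-∈ skewᵇ G) t∈ (λ p x x≤ → trans (gt-fromGT skewᵇ G p x≤) (V≡ p x))))
    (toTuple-matrix bs m w i (λ k p p< → trans (h k p (≤-trans p< (m≤m+n _ _))) (matrix-tail b bs (length new , t) tup′ k p<)))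
    where
    open Block b
    V≡ : ∀ p x → blockGT b (totalRows bs) m p x ≡ gt old t p x
    V≡ p x = trans (blockGT-cong b (totalRows bs) m _ h p x) (block-matrix b bs t tup′ wf t∈ p x)
    G : GT ℓ (nth new) (nth old) (blockGT b (totalRows bs) m)
    G = GT-cong (λ p x _ → sym (V≡ p x)) (gt-GT skewᵇ t∈)

  nth-totalContent : ∀ bs {tup} → All WellFormed bs → IsTuple bs tup → length (totalContent tup) ≡ ℓ ×
                     (∀ k → k < ℓ → nth (totalContent tup) k ≡ upto (matrix bs tup) k (totalRows bs))
  nth-totalContent [] w refl = trans (length-⊕ c z lz) lc , λ k h → trans (nth-⊕ c z k lz) (trans (cong₂ _+_
      (trans (nth-content ℓ (proj₂ last) h) (SS.contentAt-superstandardTab k h)) (nth-zeros ℓ k)) refl)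
    where
    c = content ℓ (proj₂ last)
    z = replicate ℓ 0
    lc = length-content ℓ (proj₂ last)
    nth-zeros : ∀ n k → nth (replicate n 0) k ≡ 0
    nth-zeros zero    k       = refl
    nth-zeros (suc n) zero    = refl
    nth-zeros (suc n) (suc k) = nth-zeros n k
    lz : length c ≡ length z
    lz = trans lc (sym (length-replicate ℓ))
  nth-totalContent (b ∷ bs) (wf ∷ w) (t , tup′ , refl , t∈ , i) with nth-totalContent bs w i
  ... | le , h = trans (length-⊕ (content ℓ t) (totalContent tup′) lt) (length-content ℓ t) , λ k k<ℓ →
      trans (nth-⊕ (content ℓ t) (totalContent tup′) k lt) (trans (cong₂ _+_ (trans (nth-content ℓ t k<ℓ) (sym (rowSum-content ℓ new old t∈ k (proj₂ wf)))) (h k k<ℓ))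
        (sym (upto-head b bs (length new , t) tup′ k rows)))
    where open Block b
          lt : length (content ℓ t) ≡ length (totalContent tup′)
          lt = trans (length-content ℓ t) (sym le)

  module _ (bs : List Block) (w : All WellFormed bs) where
    private
      M : ℕ
      M = totalRows bs
      τ ν : ℕ → ℕ
      τ = stack Block.old bs
      ν = stack Block.new bs
      -- One row more than the shape has: the condition at the empty row `ℓ` says that `τ` plus the
      -- full content decreases along each component.
      cs = conditions (M ∸ 1) (suc ℓ)

    contributes : Tableau → Bool
    contributes t = good τ (linkedRows bs) μ cs t ∧ eqL (applyUpTo τ M ⊕ content M t) (applyUpTo ν M)

    -- The number of letters `p` (indexed from 0) in row `k`. Partial sums over `p` recover the
    -- tableau; partial sums over `k` build the tuple.
    increments : (ℕ → ℕ → ℕ) → ℕ → ℕ → ℕ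
    increments N k p = N k (suc p) ∸ N k p

    private
      S = ssyts M lam μ
      A = filt contributes S
      Tup = filt accepted (tuples (shapesOf bs))

    module _ {t : Tableau} (t∈ : t ∈ S) where
      open GT (gt-GT skew t∈)
      private
        N = gt μ t
        m = increments N
      N-suc : ∀ k p → p < M → N k (suc p) ≡ N k p + m k p
      N-suc k p h = sym (m+[n∸m]≡n (mono k p h))

      columnSum-suc : ∀ n p → p < M → columnSum n N (suc p) ≡ columnSum n N p + sumTo n (λ k → m k p)
      columnSum-suc n p h = trans (sumTo-cong n (λ k _ → N-suc k p h)) (sumTo-+ n (λ k → N k p) (λ k → m k p))

      upto-increments : ∀ k p → p ≤ M → upto m k p ≡ N k p
      upto-increments k zero    h = trans (+-identityʳ _) (sym (start k))
      upto-increments k (suc p) h = trans (sym (+-assoc (nth μ k) _ _)) (trans (cong (_+ m k p) (upto-increments k p (<⇒≤ h))) (sym (N-suc k p h)))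

      increments-beyond : ∀ k p → ℓ ≤ k → p < M → m k p ≡ 0
      increments-beyond k p h p< = n≤0⇒n≡0 (≤-trans (m∸n≤m (N k (suc p)) (N k p)) (≤-trans (upper k p<) (≤-reflexive (nth-beyond lam h))))

      contentAt-increments : ∀ p → p < M → contentAt t p ≡ sumTo ℓ (λ k → m k p)
      contentAt-increments p h = +-cancelˡ-≡ (columnSum ℓ N p) _ _ (trans (contentAt-gt ℓ μ t p (ssyts-rows M lam μ t∈)) (columnSum-suc ℓ p h))

      good⇒rowsOK : ∀ i x → suc i < M → columnSum (suc x) N (suc (suc i)) + (τ (suc i) + columnSum x N i) ≤ columnSum x N (suc i) + (τ i + columnSum (suc x) N (suc i)) → RowsOK τ m i x
      good⇒rowsOK i x h g = lia 8 (λ a b c s s′ t t′ z → a :+ (t′ :+ c) :≤ b :+ (t :+ z) ⇒ a :≡ z :+ s′ ⇒ b :≡ c :+ s ⇒ ⊢ t′ :+ s′ :≤ t :+ s)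
        (columnSum (suc x) N (suc (suc i))) (columnSum x N (suc i)) (columnSum x N i) (sumTo x (λ k → m k i)) (sumTo (suc x) (λ k → m k (suc i))) (τ i) (τ (suc i)) (columnSum (suc x) N (suc i))
        g (columnSum-suc (suc x) (suc i) h) (columnSum-suc x i (<⇒≤ h))

      rowsOK⇒good : ∀ i x → suc i < M → RowsOK τ m i x → τ (suc i) + columnSum (suc x) N (suc (suc i)) + columnSum x N i ≤ τ i + columnSum x N (suc i) + columnSum (suc x) N (suc i)
      rowsOK⇒good i x h g = lia 8 (λ a b c s s′ t t′ z → t′ :+ s′ :≤ t :+ s ⇒ a :≡ z :+ s′ ⇒ b :≡ c :+ s ⇒ ⊢ t′ :+ a :+ c :≤ t :+ b :+ z)
        (columnSum (suc x) N (suc (suc i))) (columnSum x N (suc i)) (columnSum x N i) (sumTo x (λ k → m k i)) (sumTo (suc x) (λ k → m k (suc i))) (τ i) (τ (suc i)) (columnSum (suc x) N (suc i))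
        g (columnSum-suc (suc x) (suc i) h) (columnSum-suc x i (<⇒≤ h))

      good-rowsOK : good τ (linkedRows bs) μ cs t ≡ true → ∀ i x → x ≤ ℓ → linkedRows bs i ≡ true → RowsOK τ m i x
      good-rowsOK g i x x≤ℓ l = good⇒rowsOK i x si<M (subst₂ _≤_ (rot (τ (suc i)) _ _) (rot (τ i) _ _) (≤ᵇ-sound here′))
        where
        si<M : suc i < M
        si<M = linked-bound bs l
        rot : ∀ a b c → a + b + c ≡ b + (a + c)
        rot a b c = trans (cong (_+ c) (+-comm a b)) (+-assoc b a c)
        pred-bound : ∀ {i M} → suc i < M → i < M ∸ 1
        pred-bound {M = suc M} (s≤s h) = h
        all = allᵇ-sound (goodAt τ (linkedRows bs) N) cs g (∈-conditions⁺ (M ∸ 1) (suc ℓ) {x} {i} (s≤s x≤ℓ) (pred-bound si<M))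
        here′ : (τ (suc i) + columnSum (suc x) N (suc (suc i)) + columnSum x N i ≤ᵇ τ i + columnSum x N (suc i) + columnSum (suc x) N (suc i)) ≡ true
        here′ = implies-sound {linkedRows bs i} {true} (subst (λ b → not b ∨ (τ (suc i) + columnSum (suc x) N (suc (suc i)) + columnSum x N i ≤ᵇ τ i + columnSum x N (suc i) + columnSum (suc x) N (suc i)) ≡ true) (sym (∧-true (linkedRows bs i))) all) l refl
          where ∧-true : ∀ b → b ∧ true ≡ b
                ∧-true true  = refl
                ∧-true false = refl

      good-decreasing : good τ (linkedRows bs) μ cs t ≡ true → ∀ i → linkedRows bs i ≡ true → τ (suc i) + contentAt t (suc i) ≤ τ i + contentAt t i
      good-decreasing g i l = subst₂ (λ x y → τ (suc i) + x ≤ τ i + y) (trans (cong (sumTo ℓ (λ k → m k (suc i)) +_) (increments-beyond ℓ (suc i) ≤-refl b<)) (trans (+-identityʳ _) (sym (contentAt-increments (suc i) b<))))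
          (sym (contentAt-increments i (<⇒≤ b<))) (good-rowsOK g i ℓ ≤-refl l)
        where b< = linked-bound bs l

      contributes-fits : contributes t ≡ true → Fits ℓ bs m
      contributes-fits c with ∧-elim {good τ (linkedRows bs) μ cs t} c
      ... | g , e = fits⁺ ℓ bs m w (λ i x x<ℓ l → good-rowsOK g i x (<⇒≤ x<ℓ) l)
          (λ p p< → trans (cong (λ z → τ p + z) (sym (contentAt-increments p p<))) (trans (sym (at p p<)) (trans (cong (λ l → nth l p) (eqL-sound (applyUpTo τ M ⊕ content M t) (applyUpTo ν M) e)) (nth-applyUpTo ν M p<))))
        where
        at : ∀ p → p < M → nth (applyUpTo τ M ⊕ content M t) p ≡ τ p + contentAt t p
        at p p< = trans (nth-⊕ (applyUpTo τ M) (content M t) p (trans (length-applyUpTo τ M) (sym (length-content M t))))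
                    (cong₂ _+_ (nth-applyUpTo τ M p<) (nth-content M t p<))

      -- increments is only meaningful below M; beyond it is cut off.
      bounded : ℕ → ℕ → ℕ
      bounded k p = if p <ᵇ M then m k p else 0

      bounded≡ : ∀ k p → p < M → bounded k p ≡ m k p
      bounded≡ k p h rewrite <ᵇ-true h = refl

      bounded-beyond : ∀ k p → ℓ ≤ k → bounded k p ≡ 0
      bounded-beyond k p h with p <? M
      ... | yes q = trans (bounded≡ k p q) (increments-beyond k p h q)
      ... | no  q rewrite <ᵇ-false (≮⇒≥ q) = refl

      fits-contributes : Fits ℓ bs m → contributes t ≡ true
      fits-contributes f with fits⁻ ℓ bs bounded w (λ p → bounded-beyond ℓ p ≤-refl) (Fits-cong ℓ bs m bounded (λ k p h → sym (bounded≡ k p h)) f)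
      ... | rowsOK , total = ∧-intro
        (allᵇ-true _ cs (λ { {x , i} c∈ → goodAt-true x i (proj₁ (∈-conditions⁻ (M ∸ 1) (suc ℓ) c∈)) }))
        (subst (λ l → eqL l (applyUpTo ν M) ≡ true) (sym sum≡) (eqL-refl (applyUpTo ν M)))
        where
        rows≡ : ∀ n p → p < M → sumTo n (λ k → bounded k p) ≡ sumTo n (λ k → m k p)
        rows≡ n p h = sumTo-cong n (λ k _ → bounded≡ k p h)
        goodAt-true : ∀ x i → x < suc ℓ → goodAt τ (linkedRows bs) N (x , i) ≡ true
        goodAt-true x i x< with linkedRows bs i in l
        ... | false = refl
        ... | true  = ≤ᵇ-true (rowsOK⇒good i x b< (subst₂ (λ u v → τ (suc i) + u ≤ τ i + v) (rows≡ (suc x) (suc i) b<) (rows≡ x i (<⇒≤ b<)) (rowsOK i x (s≤s⁻¹ x<) l)))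
          where b< = linked-bound bs l
        lengths : length (applyUpTo τ M) ≡ length (content M t)
        lengths = trans (length-applyUpTo τ M) (sym (length-content M t))
        sum≡ : applyUpTo τ M ⊕ content M t ≡ applyUpTo ν M
        sum≡ = list-ext _ _ (trans (length-⊕ (applyUpTo τ M) (content M t) lengths) (trans (length-applyUpTo τ M) (sym (length-applyUpTo ν M))))
          (λ p h → let p< = subst (p <_) (trans (length-⊕ (applyUpTo τ M) (content M t) lengths) (length-applyUpTo τ M)) h in
            trans (nth-⊕ (applyUpTo τ M) (content M t) p lengths) (trans (cong₂ _+_ (nth-applyUpTo τ M p<) (trans (nth-content M t p<) (trans (contentAt-increments p p<) (sym (rows≡ ℓ p p<)))))
              (trans (total p p<) (sym (nth-applyUpTo ν M p<)))))

    -- Transposition of the matrix of multiplicities: row `k` of the tableau becomes the letter `k`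
    -- of the tuple, and the letter `p` becomes row `p` of the stacked components.
    encode : Tableau → List (ℕ × Tableau)
    encode t = toTuple bs (increments (gt μ t))

    private
      module _ {t : Tableau} (t∈A : t ∈ A) where
        private
          t∈ : t ∈ S
          t∈ = proj₁ (∈-filt⁻ contributes S t∈A)
          N = gt μ t
          m = increments N
          fits = contributes-fits t∈ (proj₂ (∈-filt⁻ contributes S t∈A))
          open GT (gt-GT skew t∈)
        isTuple : IsTuple bs (encode t)
        isTuple = toTuple-IsTuple bs m w fits
        encode≡ : encode t ≡ toTuple bs (bounded t∈)
        encode≡ = sym (toTuple-cong bs (λ k p h → bounded≡ t∈ k p h) fits w)
          where
          toTuple-cong : ∀ bs {m m′} → (∀ k p → p < totalRows bs → m k p ≡ m′ k p) → Fits ℓ bs m′ → All WellFormed bs → toTuple bs m ≡ toTuple bs m′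
          toTuple-cong []       h f w = refl
          toTuple-cong (b ∷ bs) {m} {m′} h (G , f) ((skewᵇ , _) ∷ w) = cong₂ _∷_ (cong (length new ,_) (gt-injective skewᵇ (fromGT-∈ skewᵇ G₀) (fromGT-∈ skewᵇ G)
              (λ p x x≤ → trans (gt-fromGT skewᵇ G₀ p x≤) (trans (blockGT-cong b (totalRows bs) m m′ h p x) (sym (gt-fromGT skewᵇ G p x≤))))))
              (toTuple-cong bs (λ k p p< → h k p (≤-trans p< (m≤m+n _ _))) f w)
            where open Block b
                  G₀ = GT-cong (λ p x _ → sym (blockGT-cong b (totalRows bs) m m′ h p x)) G
        matrix-encode : ∀ k p → p < M → matrix bs (encode t) k p ≡ m k p
        matrix-encode k p h = trans (cong (λ tup → matrix bs tup k p) encode≡) (trans (matrix-toTuple bs (bounded t∈) w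
          (Fits-cong ℓ bs m _ (λ k p q → sym (bounded≡ t∈ k p q)) fits) (bounded-beyond t∈) k p h) (bounded≡ t∈ k p h))
        upto-encode : ∀ k p → p ≤ M → upto (matrix bs (encode t)) k p ≡ N k p
        upto-encode k p h = trans (cong (nth μ k +_) (sumTo-cong p (λ x x< → matrix-encode k x (≤-trans x< h)))) (upto-increments t∈ k p h)
        encode-accepted : accepted (encode t) ≡ true
        encode-accepted = ∧-intro (subst (λ l → eqL l lam ≡ true) (sym content≡lam) (eqL-refl lam))
            (latticed-complete (reading (encode t)) (lattice⁺ bs w isTuple (λ p p< k → subst₂ _≤_
              (sym (trans (+-comm (matrix bs (encode t) (suc k) p) _) (trans (cong₂ _+_ (upto-encode (suc k) p (<⇒≤ p<)) (matrix-encode (suc k) p p<)) (sym (N-suc t∈ (suc k) p p<)))))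
              (sym (upto-encode k p (<⇒≤ p<))) (inter k p p<))))
          where
          tc = nth-totalContent bs w isTuple
          content≡lam : totalContent (encode t) ≡ lam
          content≡lam = list-ext _ _ (proj₁ tc) (λ k h → let k< = subst (k <_) (proj₁ tc) h in
            trans (proj₂ tc k k<) (trans (upto-encode k M ≤-refl) (end k)))

      decode : ∀ {tup} → tup ∈ Tup → ∃[ t ] (t ∈ A × encode t ≡ tup)
      decode {tup} tup∈ with ∈-filt⁻ accepted (tuples (shapesOf bs)) tup∈
      ... | tup∈′ , acc with ∧-elim {eqL (totalContent tup) lam} acc
      ... | tc , lat = t , ∈-filt⁺ contributes t∈ (fits-contributes t∈ (Fits-cong ℓ bs (matrix bs tup) _ (λ k p h → sym (inc k p h)) (tuple-fits bs w isT))) ,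
                       toTuple-matrix bs (increments (gt μ t)) w isT inc
        where
        L = latticed-sound (reading tup) lat
        isT = ∈⇒IsTuple bs tup∈′ L
        U = upto (matrix bs tup)
        G : GT M (nth lam) (nth μ) U
        G = record
          { start = λ k → +-identityʳ _
          ; end   = λ k → case k <? ℓ of λ where
              (yes h) → trans (sym (proj₂ (nth-totalContent bs w isT) k h)) (cong (λ l → nth l k) (eqL-sound (totalContent tup) lam tc))
              (no  h) → trans (cong₂ _+_ (n≤0⇒n≡0 (≤-trans (μ⊆lam k) (≤-reflexive (nth-beyond lam (≮⇒≥ h))))) (sumTo-zero M (λ p _ → matrix-letter bs isT k p (≮⇒≥ h))))
                          (sym (nth-beyond lam (≮⇒≥ h)))
          ; mono  = λ k p _ → +-monoʳ-≤ (nth μ k) (m≤m+n _ _)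
          ; inter = λ k p h → ≤-trans (≤-reflexive (trans (sym (+-assoc (nth μ (suc k)) _ _)) (+-comm (U (suc k) p) _))) (lattice⁻ bs w isT L p h k) }
        t = fromGT M lam μ U
        t∈ : t ∈ S
        t∈ = fromGT-∈ skew G
        inc : ∀ k p → p < M → increments (gt μ t) k p ≡ matrix bs tup k p
        inc k p h = trans (cong₂ _∸_ (gt-fromGT skew G k h) (gt-fromGT skew G k (<⇒≤ h)))
          (trans (cong (_∸ U k p) (sym (+-assoc (nth μ k) _ _))) (m+n∸m≡n (U k p) _))

    lrCoeff-count : pos (lrCoeff lam (shapesOf bs)) ≡ ∑ S (λ t → 𝟙 (contributes t))
    lrCoeff-count = begin
      pos (lrCoeff lam (shapesOf bs)) ≡⟨ cong pos (lrCoeff-def (shapesOf bs)) ⟩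
      pos (countᵇ accepted (tuples (shapesOf bs))) ≡⟨ ones accepted (tuples (shapesOf bs)) ⟩
      ∑ Tup (λ _ → 1ℤ) ≡⟨ sym (∑-bij A Tup encode (Unique-filt contributes (Unique-ssyts M lam μ)) (Unique-filt accepted unique-tuples)
          (λ t∈ → ∈-filt⁺ accepted (IsTuple⇒∈ bs (isTuple t∈)) (encode-accepted t∈))
          (λ {t} {t′} t∈ t′∈ e → gt-injective skew (proj₁ (∈-filt⁻ contributes S t∈)) (proj₁ (∈-filt⁻ contributes S t′∈))
             (λ k p h → trans (sym (upto-encode t∈ k p h)) (trans (cong (λ tup → upto (matrix bs tup) k p) e) (upto-encode t′∈ k p h))))
          decode (λ _ → refl)) ⟩
      ∑ A (λ _ → 1ℤ) ≡⟨ sym (ones contributes S) ⟩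
      pos (countᵇ contributes S) ≡⟨ ∑-count contributes S ⟩
      ∑ S (λ t → 𝟙 (contributes t)) ∎
      where
      open ≡-Reasoning
      ones : {X : Set} (p : X → Bool) (xs : List X) → pos (countᵇ p xs) ≡ ∑ (filt p xs) (λ _ → 1ℤ)
      ones p xs = trans (∑-count p xs) (sym (trans (∑-filt p xs (λ _ → 1ℤ)) (∑-cong xs (λ {x} _ → ℤ.*-identityʳ (𝟙 (p x))))))
      unique-tuples : Unique (tuples (shapesOf bs))
      unique-tuples = Unique-listProduct (map component (shapesOf bs)) (∈-All _ (λ i → case ∈-map⁻ component (shapesOf bs) i of λ where
        (s , _ , refl) → Unique-map _ (λ { _ _ refl → refl }) (Unique-ssyts ℓ (proj₁ s) (proj₂ s))))

-- β-sets and the abacus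

Descending : List ℕ → Set
Descending = AllPairs (λ x y → y < x)

descending-ext : ∀ {xs ys} → Descending xs → Descending ys → (∀ {z} → z ∈ xs → z ∈ ys) → (∀ {z} → z ∈ ys → z ∈ xs) → xs ≡ ys
descending-ext {[]}     {[]}     _ _ f g = refl
descending-ext {[]}     {y ∷ ys} _ _ f g = case g (here refl) of λ ()
descending-ext {x ∷ xs} {[]}     _ _ f g = case f (here refl) of λ ()
descending-ext {x ∷ xs} {y ∷ ys} (p ∷ u) (q ∷ w) f g = case top≡ of λ where
    refl → cong (x ∷_) (descending-ext u w (λ i → strip (f (there i)) (All-∈ p i)) (λ i → strip (g (there i)) (All-∈ q i)))
  where
  ≤head : ∀ {a as z} → All (_< a) as → z ∈ a ∷ as → z ≤ a
  ≤head p (here refl) = ≤-refl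
  ≤head p (there i)   = <⇒≤ (All-∈ p i)
  top≡ : x ≡ y
  top≡ = ≤-antisym (≤head q (f (here refl))) (≤head p (g (here refl)))
  strip : ∀ {a as z} → z ∈ a ∷ as → z < a → z ∈ as
  strip (here refl) h = ⊥-elim (<-irrefl refl h)
  strip (there i)   h = i

descending-filt : ∀ p {xs} → Descending xs → Descending (filt p xs)
descending-filt p {[]}     []      = []
descending-filt p {x ∷ xs} (q ∷ u) with p x
... | true  = ∈-All (filt p xs) (λ i → All-∈ q (proj₁ (∈-filt⁻ p xs i))) ∷ descending-filt p u
... | false = descending-filt p u

descending-unique : ∀ {xs} → Descending xs → Unique xs
descending-unique []      = []
descending-unique {x ∷ xs} (p ∷ u) = ∈-All xs (λ i → >⇒≢ (All-∈ p i)) ∷ descending-unique u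

∈-staircase⁻ : ∀ n {x} → x ∈ staircase n → x < n
∈-staircase⁻ (suc n) (here refl) = ≤-refl
∈-staircase⁻ (suc n) (there i)   = m<n⇒m<1+n (∈-staircase⁻ n i)

∈-staircase⁺ : ∀ n {x} → x < n → x ∈ staircase n
∈-staircase⁺ (suc n) {x} h with x ≟ n
... | yes refl = here refl
... | no  ne   = there (∈-staircase⁺ n (≤∧≢⇒< (s≤s⁻¹ h) ne))

descending-staircase : ∀ n → Descending (staircase n)
descending-staircase zero    = []
descending-staircase (suc n) = ∈-All (staircase n) (∈-staircase⁻ n) ∷ descending-staircase n

reverse-range≡staircase : ∀ n → reverse (range n) ≡ staircase n
reverse-range≡staircase zero    = refl
reverse-range≡staircase (suc n) = trans (reverse-range n) (cong (n ∷_) (reverse-range≡staircase n))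

sorted : List ℕ → List ℕ
sorted B = filt (λ p → memℕ p B) (staircase (suc (maxL B)))

memℕ-sound : ∀ {x} B → memℕ x B ≡ true → x ∈ B
memℕ-sound {x} B e with anyᵇ-sound (x ≡ᵇ_) B e
... | y , i , q = subst (_∈ B) (sym (≡ᵇ-sound {x} q)) i

memℕ-true : ∀ {x} B → x ∈ B → memℕ x B ≡ true
memℕ-true {x} B i = anyᵇ-true (x ≡ᵇ_) i (≡ᵇ-refl x)

descending-sorted : ∀ B → Descending (sorted B)
descending-sorted B = descending-filt _ (descending-staircase (suc (maxL B)))

∈-sorted⁻ : ∀ B {x} → x ∈ sorted B → x ∈ B
∈-sorted⁻ B i = memℕ-sound B (proj₂ (∈-filt⁻ (λ p → memℕ p B) (staircase (suc (maxL B))) i))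

∈-sorted⁺ : ∀ B {x} → x ∈ B → x ∈ sorted B
∈-sorted⁺ B i = ∈-filt⁺ (λ p → memℕ p B) (∈-staircase⁺ (suc (maxL B)) (s≤s (maxL-≤ B i))) (memℕ-true B i)

sorted-descending : ∀ {X} → Descending X → sorted X ≡ X
sorted-descending {X} d = descending-ext (descending-sorted X) d (∈-sorted⁻ X) (∈-sorted⁺ X)

countᵇ-unique : ∀ {xs ys : List ℕ} (p : ℕ → Bool) → Unique xs → Unique ys → (∀ {z} → z ∈ xs → z ∈ ys) → (∀ {z} → z ∈ ys → z ∈ xs) → countᵇ p xs ≡ countᵇ p ys
countᵇ-unique {xs} {ys} p u w f g = ℤ.+-injective (trans (∑-count p xs) (trans
  (∑-bij xs ys id u w f (λ _ _ e → e) (λ {y} i → y , g i , refl) (λ _ → refl)) (sym (∑-count p ys))))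

length-unique : ∀ {xs ys : List ℕ} → Unique xs → Unique ys → (∀ {z} → z ∈ xs → z ∈ ys) → (∀ {z} → z ∈ ys → z ∈ xs) → length xs ≡ length ys
length-unique {xs} {ys} u w f g = trans (sym (all xs)) (trans (countᵇ-unique (λ _ → true) u w f g) (all ys))
  where all : ∀ (xs : List ℕ) → countᵇ (λ _ → true) xs ≡ length xs
        all []       = refl
        all (x ∷ xs) = cong suc (all xs)

-- The parts, possibly zero, of the partition with a given descending β-set.
gaps : List ℕ → List ℕ
gaps []      = []
gaps (x ∷ X) = x ∸ length X ∷ gaps X

gaps≡ : ∀ {X} → Descending X → ∀ {Y} → (∀ p → p ∈ X → countᵇ (_<ᵇ p) Y ≡ countᵇ (_<ᵇ p) X) → map (λ p → p ∸ countᵇ (_<ᵇ p) Y) X ≡ gaps X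
gaps≡ {[]}    []      h = refl
gaps≡ {x ∷ X} (q ∷ d) {Y} h = cong₂ _∷_ (cong (x ∸_) (trans (h x (here refl)) (trans (countᵇ-∷ (_<ᵇ x) x X) (cong₂ _+_ (cong b2n (<ᵇ-false {x} ≤-refl)) (all X q)))))
    (gaps≡ d {Y} (λ p i → trans (h p (there i)) (trans (countᵇ-∷ (_<ᵇ p) x X) (cong (λ b → b2n b + countᵇ (_<ᵇ p) X) (<ᵇ-false {x} (<⇒≤ (All-∈ q i)))))))
  where all : ∀ X → All (_< x) X → countᵇ (_<ᵇ x) X ≡ length X
        all []      []      = refl
        all (y ∷ X) (h ∷ a) = trans (countᵇ-∷ (_<ᵇ x) y X) (cong₂ _+_ (cong b2n (<ᵇ-true h)) (all X a))

fromBeta-sorted : ∀ B → Unique B → fromBeta B ≡ dropZeros (gaps (sorted B))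
fromBeta-sorted B u = cong dropZeros (trans (trans (cong (concatMap part) (reverse-range≡staircase (suc (maxL B)))) (as-map (staircase (suc (maxL B)))))
    (gaps≡ (descending-sorted B) {B} (λ p _ → countᵇ-unique (_<ᵇ p) u (descending-unique (descending-sorted B)) (∈-sorted⁺ B) (∈-sorted⁻ B))))
  where
  part : ℕ → List ℕ
  part p = if memℕ p B then (p ∸ countᵇ (_<ᵇ p) B) ∷ [] else []
  as-map : ∀ l → concatMap part l ≡ map (λ p → p ∸ countᵇ (_<ᵇ p) B) (filt (λ p → memℕ p B) l)
  as-map []      = refl
  as-map (x ∷ l) with memℕ x B
  ... | true  = cong (_ ∷_) (as-map l)
  ... | false = as-map l

length≤head : ∀ {x X} → Descending (x ∷ X) → length X ≤ x
length≤head {x} {[]}    _ = z≤n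
length≤head {x} {y ∷ X} ((h ∷ _) ∷ d) = ≤-trans (s≤s (length≤head d)) h

gaps-linked : ∀ {X} → Descending X → Linked (λ a b → b ≤ a) (gaps X)
gaps-linked {[]}        []                = []
gaps-linked {x ∷ []}    _                 = [-]
gaps-linked {x ∷ y ∷ X} ((h ∷ p) ∷ d) = ≤-trans (≤-trans (≤-reflexive refl) (∸-monoˡ-≤ (suc (length X)) h)) ≤-refl ∷ gaps-linked d

-- In a weakly decreasing list a zero is followed by zeros only, so filtering merely cuts a tail,
-- which padding restores.
dropZeros-nth : ∀ {l} → Linked (λ a b → b ≤ a) l → (∀ i → nth (dropZeros l) i ≡ nth l i) × IsPartition (dropZeros l)
dropZeros-nth {[]}          _ = (λ _ → refl) , [] , []
dropZeros-nth {zero ∷ l}    d = (λ i → trans (cong (λ l → nth l i) (empty l (zeros d))) (sym (zero-nth (zeros d) i))) , subst IsPartition (sym (empty l (zeros d))) ([] , [])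
  where
  zeros : ∀ {l} → Linked (λ a b → b ≤ a) (0 ∷ l) → All (_≡ 0) l
  zeros [-]       = []
  zeros (z≤n ∷ d) = refl ∷ zeros d
  empty : ∀ l → All (_≡ 0) l → dropZeros l ≡ []
  empty []      []         = refl
  empty (_ ∷ l) (refl ∷ a) = empty l a
  zero-nth : ∀ {l} → All (_≡ 0) l → ∀ i → nth (0 ∷ l) i ≡ 0
  zero-nth []         zero    = refl
  zero-nth []         (suc i) = refl
  zero-nth (refl ∷ a) zero    = refl
  zero-nth (refl ∷ a) (suc i) = zero-nth a i
dropZeros-nth {suc x ∷ l} d with dropZeros-nth (tail d)
  where tail : ∀ {x l} → Linked (λ a b → b ≤ a) (x ∷ l) → Linked (λ a b → b ≤ a) l
        tail [-]     = []
        tail (_ ∷ d) = d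
... | h , (lk , ps) = (λ { zero → refl ; (suc i) → h i }) , cons (dropZeros l) lk (λ y e → head≤ d (trans (sym (h 0)) e)) , s≤s z≤n ∷ ps
  where
  head≤ : ∀ {x l y} → Linked (λ a b → b ≤ a) (x ∷ l) → nth l 0 ≡ y → y ≤ x
  head≤ [-]     refl = z≤n
  head≤ (q ∷ _) refl = q
  cons : ∀ l → Linked (λ a b → b ≤ a) l → (∀ y → nth l 0 ≡ y → y ≤ suc x) → Linked (λ a b → b ≤ a) (suc x ∷ l)
  cons []      _  _ = [-]
  cons (y ∷ l) lk q = q y refl ∷ lk

partition-ext : ∀ {p q} → IsPartition p → IsPartition q → (∀ i → nth p i ≡ nth q i) → p ≡ q
partition-ext {p} {q} (_ , a) (_ , b) h = go p q a b h
  where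
  go : ∀ p q → All (0 <_) p → All (0 <_) q → (∀ i → nth p i ≡ nth q i) → p ≡ q
  go []      []      _       _       h = refl
  go []      (y ∷ q) _       (b ∷ _) h = ⊥-elim (<⇒≢ b (h 0))
  go (x ∷ p) []      (a ∷ _) _       h = ⊥-elim (<⇒≢ a (sym (h 0)))
  go (x ∷ p) (y ∷ q) (a ∷ as) (b ∷ bs) h = cong₂ _∷_ (h 0) (go p q as bs (h ∘ suc))

partition-length : ∀ {p} n → IsPartition p → nth p n ≡ 0 → length p ≤ n
partition-length n (_ , a) = go n a
  where go : ∀ {p} n → All (0 <_) p → nth p n ≡ 0 → length p ≤ n
        go n       []      e = z≤n
        go zero    (h ∷ a) e = ⊥-elim (<⇒≢ h (sym e))
        go (suc n) (h ∷ a) e = s≤s (go n a e)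

beta≡ : ∀ α N → beta α N ≡ applyUpTo (λ i → nth α i + N ∸ suc i) N
beta≡ α N = go id N
  where go : ∀ f n → map (λ i → nth α i + N ∸ suc i) (applyUpTo f n) ≡ applyUpTo (λ i → nth α (f i) + N ∸ suc (f i)) n
        go f zero    = refl
        go f (suc n) = cong (_ ∷_) (go (f ∘ suc) n)

applyUpTo-cong : {A : Set} {f g : ℕ → A} → ∀ n → (∀ i → i < n → f i ≡ g i) → applyUpTo f n ≡ applyUpTo g n
applyUpTo-cong zero    h = refl
applyUpTo-cong (suc n) h = cong₂ _∷_ (h 0 (s≤s z≤n)) (applyUpTo-cong n (λ i p → h (suc i) (s≤s p)))

-- With `s` additional beads every bead moves up by `s`, and the new beads, belonging to parts 0,
-- fill the positions below `s`.
beta-gaps : ∀ {X α} → Descending X → (∀ i → nth α i ≡ nth (gaps X) i) → ∀ s → beta α (s + length X) ≡ map (s +_) X ++ staircase s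
beta-gaps {X} {α} d h s = trans (beta≡ α _) (trans (applyUpTo-cong (s + length X) (λ i _ → cong (λ a → a + (s + length X) ∸ suc i) (h i))) (go X d))
  where
  go : ∀ X → Descending X → applyUpTo (λ i → nth (gaps X) i + (s + length X) ∸ suc i) (s + length X) ≡ map (s +_) X ++ staircase s
  go []      _ = trans (cong (λ n → applyUpTo (λ i → n ∸ suc i) n) (+-identityʳ s)) (stairs s)
    where stairs : ∀ s → applyUpTo (λ i → s ∸ suc i) s ≡ staircase s
          stairs zero    = refl
          stairs (suc s) = cong (s ∷_) (stairs s)
  go (x ∷ X) (p ∷ d) rewrite +-suc s (length X) = cong₂ _∷_
    (trans (+-∸-assoc (x ∸ length X) {suc (s + length X)} (s≤s z≤n)) (trans (cong (x ∸ length X +_) refl)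
      (trans (trans (cong (x ∸ length X +_) (+-comm s (length X))) (sym (+-assoc (x ∸ length X) _ _))) (trans (cong (_+ s) (m∸n+n≡m (length≤head (p ∷ d)))) (+-comm x s)))))
    (trans (applyUpTo-cong (s + length X) (λ i _ → cong (_∸ suc (suc i)) (+-suc (nth (gaps X) i) (s + length X)))) (go X d))

nth-beta : ∀ α N {i} → i < N → nth (beta α N) i + suc i ≡ nth α i + N
nth-beta α N {i} h = trans (cong (_+ suc i) (trans (cong (λ l → nth l i) (beta≡ α N)) (nth-applyUpTo _ N h))) (m∸n+n≡m (≤-trans h (m≤n+m N (nth α i))))

length-beta : ∀ α N → length (beta α N) ≡ N
length-beta α N = trans (cong length (beta≡ α N)) (length-applyUpTo _ N)

beta-descending : ∀ α N → Decreasing (nth α) → Descending (beta α N)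
beta-descending α N d = subst Descending (sym (beta≡ α N)) (AllPairs-applyUpTo _ N (λ {i} {j} i<j j<N →
  lia 7 (λ a b N i j x y → x :+ (# 1 :+ i) :≡ a :+ N ⇒ y :+ (# 1 :+ j) :≡ b :+ N ⇒ b :≤ a ⇒ i :< j ⇒ ⊢ y :< x) (nth α i) (nth α j) N i j _ _
    (m∸n+n≡m (≤-trans (<-trans i<j j<N) (m≤n+m N (nth α i)))) (m∸n+n≡m (≤-trans j<N (m≤n+m N (nth α j)))) (Decreasing-≤ d (<⇒≤ i<j)) i<j))

beta-injective : ∀ {α α′} N → IsPartition α → IsPartition α′ → length α ≤ N → length α′ ≤ N → beta α N ≡ beta α′ N → α ≡ α′
beta-injective {α} {α′} N p p′ l l′ e = partition-ext p p′ λ i → case i <? N of λ where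
  (yes h) → +-cancelʳ-≡ N _ _ (trans (sym (nth-beta α N h)) (trans (cong (λ l → nth l i + suc i) e) (nth-beta α′ N h)))
  (no  h) → trans (nth-beyond α (≤-trans l (≮⇒≥ h))) (sym (nth-beyond α′ (≤-trans l′ (≮⇒≥ h))))

beta-shift : ∀ α N s → Decreasing (nth α) → length α ≤ N → beta α (s + N) ≡ map (s +_) (beta α N) ++ staircase s
beta-shift α N s d l = trans (cong (λ n → beta α (s + n)) (sym (length-beta α N))) (beta-gaps {beta α N} {α} (beta-descending α N d) (λ i → sym (gaps-beta i)) s)
  where
  nth-gaps : ∀ X i → i < length X → nth (gaps X) i ≡ nth X i ∸ (length X ∸ suc i)
  nth-gaps (x ∷ X) zero    h       = refl
  nth-gaps (x ∷ X) (suc i) (s≤s h) = nth-gaps X i h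
  length-gaps : ∀ X → length (gaps X) ≡ length X
  length-gaps []      = refl
  length-gaps (x ∷ X) = cong suc (length-gaps X)
  gaps-beta : ∀ i → nth (gaps (beta α N)) i ≡ nth α i
  gaps-beta i with i <? N
  ... | yes h = trans (nth-gaps (beta α N) i (subst (i <_) (sym (length-beta α N)) h)) (trans (cong (λ n → nth (beta α N) i ∸ (n ∸ suc i)) (length-beta α N))
      (trans (cong (_∸ (N ∸ suc i)) (lia 5 (λ b i a N w → b :+ (# 1 :+ i) :≡ a :+ N ⇒ w :+ (# 1 :+ i) :≡ N ⇒ ⊢ b :≡ a :+ w) (nth (beta α N) i) i (nth α i) N (N ∸ suc i) (nth-beta α N h) (m∸n+n≡m h)))
             (m+n∸n≡m (nth α i) (N ∸ suc i))))
  ... | no  h = trans (nth-beyond (gaps (beta α N)) (≤-trans (≤-reflexive (trans (length-gaps (beta α N)) (length-beta α N))) (≮⇒≥ h))) (sym (nth-beyond α (≤-trans l (≮⇒≥ h))))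

module FromBeta (B : List ℕ) (u : Unique B) where
  private
    X = sorted B
    α = fromBeta B
    nz = dropZeros-nth (gaps-linked (descending-sorted B))
    α≡ : α ≡ dropZeros (gaps X)
    α≡ = fromBeta-sorted B u

  fromBeta-partition : IsPartition α
  fromBeta-partition = subst IsPartition (sym α≡) (proj₂ nz)

  length-sorted : length X ≡ length B
  length-sorted = length-unique (descending-unique (descending-sorted B)) u (∈-sorted⁻ B) (∈-sorted⁺ B)

  beta-fromBeta : ∀ s → beta α (s + length B) ≡ map (s +_) X ++ staircase s
  beta-fromBeta s = trans (cong (λ n → beta α (s + n)) (sym length-sorted)) (beta-gaps {X} {α} (descending-sorted B) (λ i → trans (cong (λ l → nth l i) α≡) (proj₁ nz i)) s)

  length-fromBeta : length α ≤ length B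
  length-fromBeta = partition-length (length B) fromBeta-partition (trans (cong (λ l → nth l (length B)) α≡) (trans (proj₁ nz (length B)) (gaps-beyond X (≤-reflexive length-sorted))))
    where gaps-beyond : ∀ X {i} → length X ≤ i → nth (gaps X) i ≡ 0
          gaps-beyond []      h = refl
          gaps-beyond (x ∷ X) {suc i} (s≤s h) = gaps-beyond X h

nth-++ˡ : ∀ xs ys {i} → i < length xs → nth (xs ++ ys) i ≡ nth xs i
nth-++ˡ (x ∷ xs) ys {zero}  h       = refl
nth-++ˡ (x ∷ xs) ys {suc i} (s≤s h) = nth-++ˡ xs ys h

nth-++ʳ : ∀ xs ys i → nth (xs ++ ys) (length xs + i) ≡ nth ys i
nth-++ʳ []       ys i = refl
nth-++ʳ (x ∷ xs) ys i = nth-++ʳ xs ys i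

descending-shift : ∀ s {X} → Descending X → Descending (map (s +_) X ++ staircase s)
descending-shift s {X} d = AllPairs-++ (shifted d) (descending-staircase s) (λ i j → case ∈-map⁻ (s +_) X i of λ where
    (z , _ , refl) → ≤-trans (∈-staircase⁻ s j) (m≤m+n s z))
  where shifted : ∀ {X} → Descending X → Descending (map (s +_) X)
        shifted []      = []
        shifted {x ∷ X} (p ∷ d) = ∈-All (map (s +_) X) (λ i → case ∈-map⁻ (s +_) X i of λ where (z , j , refl) → +-monoʳ-< s (All-∈ p j)) ∷ shifted d

-- Higher indices come first, in agreement with `stack`, where the last component occupies the first
-- rows.
collect : ℕ → ℕ → (ℕ → List ℕ) → List ℕ
collect j zero    P = []
collect j (suc k) P = collect (suc j) k P ++ P j

collect-cong : ∀ j k {P Q} → (∀ i → j ≤ i → i < j + k → P i ≡ Q i) → collect j k P ≡ collect j k Q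
collect-cong j zero    h = refl
collect-cong j (suc k) h = cong₂ _++_ (collect-cong (suc j) k (λ i a b → h i (<⇒≤ a) (subst (i <_) (sym (+-suc j k)) b))) (h j ≤-refl (subst (j <_) (sym (+-suc j k)) (s≤s (m≤m+n j k))))

-- Runners, quotients and the grouping of beads

module Abacus (r : ℕ) .{{_ : NonZero r}} where

  position : ℕ → ℕ → ℕ
  position j y = j + r * y

  position-% : ∀ {j} → j < r → ∀ y → position j y % r ≡ j
  position-% {j} h y = trans (cong (λ z → (j + z) % r) (*-comm r y)) (trans (DM.[m+kn]%n≡m%n j y r) (DM.m<n⇒m%n≡m h))

  position-eta : ∀ x → position (x % r) (x / r) ≡ x
  position-eta x = sym (trans (DM.m≡m%n+[m/n]*n x r) (cong (x % r +_) (*-comm (x / r) r)))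

  r*-injective : ∀ {x y} → r * x ≡ r * y → x ≡ y
  r*-injective {x} {y} = *-cancelˡ-≡ x y r

  position-/ : ∀ {j} → j < r → ∀ y → position j y / r ≡ y
  position-/ {j} h y = r*-injective (+-cancelˡ-≡ j _ _ (trans (cong (_+ r * (position j y / r)) (sym (position-% h y))) (position-eta (position j y))))

  r>0 : 0 < r
  r>0 = >-nonZero⁻¹ r

  residue : ℕ → ℕ → Bool
  residue j x = x % r ≡ᵇ j

  ∈-runner⁻ : ∀ {j y} X → y ∈ runner r j X → position j y ∈ X
  ∈-runner⁻ {j} X i with ∈-map⁻ (_/ r) (filt (residue j) X) i
  ... | x , k , refl with ∈-filt⁻ (residue j) X k
  ... | x∈ , e = subst (_∈ X) (sym (trans (cong (λ j → position j (x / r)) (sym (≡ᵇ-sound {x % r} e))) (position-eta x))) x∈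

  ∈-runner⁺ : ∀ {j y X} → j < r → position j y ∈ X → y ∈ runner r j X
  ∈-runner⁺ {j} {y} {X} h i = subst (_∈ runner r j X) (position-/ h y) (∈-map⁺ (_/ r) (∈-filt⁺ (residue j) i (trans (cong (_≡ᵇ j) (position-% h y)) (≡ᵇ-refl j))))

  class≡ : ∀ j X → filt (residue j) X ≡ map (position j) (runner r j X)
  class≡ j []      = refl
  class≡ j (x ∷ X) with x % r ≡ᵇ j in e
  ... | true  = cong₂ _∷_ (sym (trans (cong (λ j → position j (x / r)) (sym (≡ᵇ-sound {x % r} e))) (position-eta x))) (class≡ j X)
  ... | false = class≡ j X

  runner-descending : ∀ j {X} → Descending X → Descending (runner r j X)
  runner-descending j {X} d = unscale (subst Descending (class≡ j X) (descending-filt (residue j) d))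
    where unscale : ∀ {Y} → Descending (map (position j) Y) → Descending Y
          unscale {[]}    []      = []
          unscale {y ∷ Y} (p ∷ d) = ∈-All Y (λ i → *-cancelˡ-< r _ _ (+-cancelˡ-< j _ _ (All-∈ p (∈-map⁺ (position j) i)))) ∷ unscale d

  position-shift : ∀ s j y → r * s + position j y ≡ position j (s + y)
  position-shift s j y = trans (sym (+-assoc (r * s) j _)) (trans (cong (_+ r * y) (+-comm (r * s) j)) (trans (+-assoc j _ _) (cong (j +_) (sym (*-distribˡ-+ r s y)))))

  -- Enlarging the abacus by `r * s` beads preserves residues and gives each runner `s` beads at its
  -- start. Hence the partition on a runner does not depend on the number of beads, as long as this
  -- is a multiple of `r`.
  runner-shift : ∀ {j} → j < r → ∀ s {X} → Descending X → runner r j (map (r * s +_) X ++ staircase (r * s)) ≡ map (s +_) (runner r j X) ++ staircase s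
  runner-shift {j} h s {X} d = descending-ext (runner-descending j (descending-shift (r * s) d)) (descending-shift s (runner-descending j d))
    (λ i → to (∈-++⁻ (map (r * s +_) X) (∈-runner⁻ _ i))) (λ i → ∈-runner⁺ h (from (∈-++⁻ (map (s +_) (runner r j X)) i)))
    where
    to : ∀ {z} → position j z ∈ map (r * s +_) X ⊎ position j z ∈ staircase (r * s) → z ∈ map (s +_) (runner r j X) ++ staircase s
    to {z} (inj₂ i) = ∈-++⁺ʳ (map (s +_) (runner r j X)) (∈-staircase⁺ s (*-cancelˡ-< r _ _ (≤-<-trans (m≤n+m (r * z) j) (∈-staircase⁻ (r * s) i))))
    to {z} (inj₁ i) with ∈-map⁻ (r * s +_) X i
    ... | x , x∈ , e with s ≤? z
    ... | yes s≤z = ∈-++⁺ˡ (subst (_∈ map (s +_) (runner r j X)) (m+[n∸m]≡n s≤z) (∈-map⁺ (s +_) (∈-runner⁺ h (subst (_∈ X) x≡ x∈))))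
      where x≡ : x ≡ position j (z ∸ s)
            x≡ = +-cancelˡ-≡ (r * s) _ _ (trans (sym e) (trans (cong (position j) (sym (m+[n∸m]≡n s≤z))) (sym (position-shift s j (z ∸ s)))))
    ... | no  s≰z = ⊥-elim (<⇒≱ (≤-trans (+-monoˡ-< (r * z) h) (≤-trans (≤-reflexive (sym (*-suc r z))) (*-monoʳ-≤ r (≰⇒> s≰z)))) (subst (r * s ≤_) (sym e) (m≤m+n (r * s) x)))
    from : ∀ {z} → z ∈ map (s +_) (runner r j X) ⊎ z ∈ staircase s → position j z ∈ map (r * s +_) X ++ staircase (r * s)
    from {z} (inj₂ i) = ∈-++⁺ʳ (map (r * s +_) X) (∈-staircase⁺ (r * s) (≤-trans (+-monoˡ-< (r * z) h) (≤-trans (≤-reflexive (sym (*-suc r z))) (*-monoʳ-≤ r (∈-staircase⁻ s i)))))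
    from {z} (inj₁ i) with ∈-map⁻ (s +_) (runner r j X) i
    ... | y , y∈ , refl = ∈-++⁺ˡ (subst (_∈ map (r * s +_) X) (position-shift s j y) (∈-map⁺ (r * s +_) (∈-runner⁻ X y∈)))

  beads : List ℕ → ℕ → ℕ → ℕ
  beads τ K j = length (runner r j (beta τ (r * K)))

  ≤r* : ∀ {m n} → m ≤ n → m ≤ r * n
  ≤r* {m} {n} h = ≤-trans h (≤-trans (≤-reflexive (sym (*-identityˡ n))) (*-monoˡ-≤ n r>0))

  runner-more : ∀ τ {K j} → Decreasing (nth τ) → length τ ≤ K → j < r → ∀ s →
                runner r j (beta τ (r * (s + K))) ≡ map (s +_) (runner r j (beta τ (r * K))) ++ staircase s
  runner-more τ {K} {j} d l h s = trans (cong (runner r j) (trans (cong (beta τ) (*-distribˡ-+ r s K)) (beta-shift τ (r * K) (r * s) d (≤r* l)))) (runner-shift h s (beta-descending τ (r * K) d))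

  length-shift : ∀ s (X : List ℕ) → length (map (s +_) X ++ staircase s) ≡ s + length X
  length-shift s X = trans (length-++ (map (s +_) X)) (trans (cong₂ _+_ (length-map (s +_) X) (length-staircase s)) (+-comm (length X) s))

  beads-more : ∀ τ {K j} → Decreasing (nth τ) → length τ ≤ K → j < r → ∀ s → beads τ (s + K) j ≡ s + beads τ K j
  beads-more τ {K} {j} d l h s = trans (cong length (runner-more τ d l h s)) (length-shift s (runner r j (beta τ (r * K))))

  module _ {τ : List ℕ} (part : IsPartition τ) where
    private
      dec : Decreasing (nth τ)
      dec = IsPartition⇒Decreasing part
      X₀ = beta τ (r * length τ)

    quotientAt : ℕ → List ℕ
    quotientAt j = fromBeta (runner r j X₀)

    private
      module Q j = FromBeta (runner r j X₀) (descending-unique (runner-descending j (beta-descending τ (r * length τ) dec)))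

    quotientAt-partition : ∀ j → IsPartition (quotientAt j)
    quotientAt-partition j = Q.fromBeta-partition j

    quotientAt-length : ∀ j → length (quotientAt j) ≤ beads τ (length τ) j
    quotientAt-length j = Q.length-fromBeta j

    beta-quotientAt : ∀ {j K} → j < r → length τ ≤ K → beta (quotientAt j) (beads τ K j) ≡ runner r j (beta τ (r * K))
    beta-quotientAt {j} {K} h l with m≤n⇒∃[o]m+o≡n l
    ... | s , refl rewrite +-comm (length τ) s = trans (cong (beta (quotientAt j)) (beads-more τ dec ≤-refl h s)) (trans (Q.beta-fromBeta j s)
        (trans (cong (λ Y → map (s +_) Y ++ staircase s) (sorted-descending (runner-descending j (beta-descending τ (r * length τ) dec)))) (sym (runner-more τ dec ≤-refl h s))))

  sumTo-indicator : ∀ n x → x < n → sumTo n (λ j → b2n (x ≡ᵇ j)) ≡ 1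
  sumTo-indicator n x h = trans (sumTo-single n x h (λ j _ ne → cong b2n (≡ᵇ-false (ne ∘ sym)))) (cong b2n (≡ᵇ-refl x))

  length-classes : ∀ X → sumTo r (λ j → length (runner r j X)) ≡ length X
  length-classes []      = sumTo-0 r
  length-classes (x ∷ X) = trans (trans (sumTo-cong r (λ j _ → one j)) (sumTo-+ r _ _)) (cong₂ _+_ (sumTo-indicator r (x % r) (DM.m%n<n x r)) (length-classes X))
    where one : ∀ j → length (runner r j (x ∷ X)) ≡ b2n (x % r ≡ᵇ j) + length (runner r j X)
          one j with x % r ≡ᵇ j
          ... | true  = refl
          ... | false = refl

  module Star {τ : List ℕ} (part : IsPartition τ) (ν : ℕ → List ℕ) (K₀ : ℕ) (τ≤K₀ : length τ ≤ K₀)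
              (ν-dec : ∀ j → j < r → Decreasing (nth (ν j))) (ν-len : ∀ j → j < r → length (ν j) ≤ beads τ K₀ j) where
    private
      dec : Decreasing (nth τ)
      dec = IsPartition⇒Decreasing part

    runnerBeads : ℕ → List ℕ
    runnerBeads j = beta (ν j) (beads τ K₀ j)

    B : List ℕ
    B = concatMap (λ j → map (position j) (runnerBeads j)) (range r)

    ∈-B⁺ : ∀ {j y} → j < r → y ∈ runnerBeads j → position j y ∈ B
    ∈-B⁺ {j} h i = ∈-concatMap⁺ _ (∈-range⁺ h) (∈-map⁺ (position j) i)

    ∈-B⁻ : ∀ {z} → z ∈ B → ∃[ j ] ∃[ y ] (j < r × y ∈ runnerBeads j × z ≡ position j y)
    ∈-B⁻ i with ∈-concatMap⁻ (λ j → map (position j) (runnerBeads j)) (range r) i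
    ... | j , j∈ , k with ∈-map⁻ (position j) (runnerBeads j) k
    ... | y , y∈ , e = j , y , ∈-range⁻ r j∈ , y∈ , e

    position-injective : ∀ {j j′ y y′} → j < r → j′ < r → position j y ≡ position j′ y′ → j ≡ j′ × y ≡ y′
    position-injective {j} {j′} {y} {y′} h h′ e = trans (sym (position-% h y)) (trans (cong (_% r) e) (position-% h′ y′)) ,
      trans (sym (position-/ h y)) (trans (cong (_/ r) e) (position-/ h′ y′))

    Unique-B : Unique B
    Unique-B = go (λ i → ∈-range⁻ r i) (Unique-range r)
      where
      go : ∀ {js} → (∀ {j} → j ∈ js → j < r) → Unique js → Unique (concatMap (λ j → map (position j) (runnerBeads j)) js)
      go {[]}     h []      = []
      go {j ∷ js} h (p ∷ u) = Unique-++ (Unique-map (position j) (λ _ _ e → r*-injective (+-cancelˡ-≡ j _ _ e)) (descending-unique (beta-descending (ν j) _ (ν-dec j (h (here refl))))))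
        (go (h ∘ there) u) (λ a b → case ∈-map⁻ (position j) (runnerBeads j) a of λ where
          (y , _ , refl) → case ∈-concatMap⁻ (λ j → map (position j) (runnerBeads j)) js b of λ where
            (j′ , j′∈ , c) → case ∈-map⁻ (position j′) (runnerBeads j′) c of λ where
              (y′ , _ , e) → All-∈ p j′∈ (proj₁ (position-injective (h (here refl)) (h (there j′∈)) e)))

    length-B : length B ≡ r * K₀
    length-B = trans (go id r) (trans (sumTo-cong r (λ j _ → trans (length-map (position j) (runnerBeads j)) (length-beta (ν j) _))) (trans (length-classes (beta τ (r * K₀))) (length-beta τ (r * K₀))))
      where go : ∀ f n → length (concatMap (λ j → map (position j) (runnerBeads j)) (applyUpTo f n)) ≡ sumTo n (λ j → length (map (position (f j)) (runnerBeads (f j))))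
            go f zero    = refl
            go f (suc n) = trans (length-++ (map (position (f 0)) (runnerBeads (f 0)))) (trans (cong (length (map (position (f 0)) (runnerBeads (f 0))) +_) (go (f ∘ suc) n))
                             (sym (sumTo-suc n (λ j → length (map (position (f j)) (runnerBeads (f j)))))))

    open FromBeta B Unique-B public using () renaming (fromBeta-partition to star-partition)

    runner-star : ∀ {j} s → j < r → runner r j (beta (fromBeta B) (r * (s + K₀))) ≡ beta (ν j) (beads τ (s + K₀) j)
    runner-star {j} s h = trans (cong (runner r j) (trans (cong (beta (fromBeta B)) (trans (*-distribˡ-+ r s K₀) (cong (r * s +_) (sym length-B)))) (FromBeta.beta-fromBeta B Unique-B (r * s))))
      (trans (runner-shift h s (descending-sorted B)) (trans (cong (λ Y → map (s +_) Y ++ staircase s) sameRunner)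
        (trans (sym (beta-shift (ν j) (beads τ K₀ j) s (ν-dec j h) (ν-len j h))) (cong (beta (ν j)) (sym (beads-more τ dec τ≤K₀ h s))))))
      where
      sameRunner : runner r j (sorted B) ≡ runnerBeads j
      sameRunner = descending-ext (runner-descending j (descending-sorted B)) (beta-descending (ν j) _ (ν-dec j h))
        (λ i → case ∈-B⁻ (∈-sorted⁻ B (∈-runner⁻ (sorted B) i)) of λ where
           (j′ , y , h′ , y∈ , e) → case position-injective h h′ e of λ where (refl , refl) → y∈)
        (λ i → ∈-runner⁺ h (∈-sorted⁺ B (∈-B⁺ h i)))

    length-star : length (fromBeta B) ≤ r * K₀
    length-star = subst (length (fromBeta B) ≤_) length-B (FromBeta.length-fromBeta B Unique-B)

  grouped : List ℕ → List ℕ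
  grouped X = collect 0 r (λ j → filt (residue j) X)

  -- The pairs put into the opposite order when the beads are grouped by runners with the highest
  -- residue first.
  inversions : List ℕ → ℕ
  inversions []      = 0
  inversions (x ∷ X) = countᵇ (λ y → x % r <ᵇ y % r) X + inversions X

  private
    below-b : ℕ → ℕ → ℕ → Bool
    below-b j n y = (j ≤ᵇ y % r) ∧ (y % r <ᵇ n)

    length-collect : ∀ j k X → length (collect j k (λ j → filt (residue j) X)) ≡ countᵇ (below-b j (j + k)) X
    length-collect j zero    X = sym (countᵇ-zero X (λ {y} _ → ¬true (λ e → case ∧-elim {j ≤ᵇ y % r} e of λ where
      (a , b) → <⇒≱ (subst (y % r <_) (+-identityʳ j) (<ᵇ-sound b)) (≤ᵇ-sound a))))
    length-collect j (suc k) X = trans (length-++ (collect (suc j) k _)) (trans (cong (_+ countᵇ (residue j) X) (length-collect (suc j) k X))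
      (countᵇ-split X (λ {y} _ → trans (cong (λ n → b2n (below-b (suc j) n y) + b2n (y % r ≡ᵇ j)) (sym (+-suc j k))) (pw (y % r) (j + suc k) (≤-trans (s≤s (m≤m+n j k)) (≤-reflexive (sym (+-suc j k))))))))
      where
      pw : ∀ a n → j < n → b2n ((suc j ≤ᵇ a) ∧ (a <ᵇ n)) + b2n (a ≡ᵇ j) ≡ b2n ((j ≤ᵇ a) ∧ (a <ᵇ n))
      pw a n j<n with <-cmp a j
      ... | tri< p _ _ rewrite ¬true {suc j ≤ᵇ a} (λ e → <⇒≱ p (<⇒≤ (≤ᵇ-sound {suc j} e))) | ≡ᵇ-false (<⇒≢ p) | ¬true {j ≤ᵇ a} (λ e → <⇒≱ p (≤ᵇ-sound e)) = refl
      ... | tri≈ _ refl _ rewrite ¬true {suc a ≤ᵇ a} (λ e → <-irrefl refl (≤ᵇ-sound {suc a} e)) | ≡ᵇ-refl a | ≤ᵇ-refl a | <ᵇ-true j<n = refl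
      ... | tri> _ _ p rewrite ≤ᵇ-true {suc j} {a} p | ≡ᵇ-false (>⇒≢ p) | ≤ᵇ-true {j} {a} (<⇒≤ p) = +-identityʳ _

    -- The bead `x` comes first within its own runner, so exactly the beads of higher residue
    -- precede it after grouping.
    insert : ∀ j k x X → j ≤ x % r → x % r < j + k → ∃[ P ] ∃[ Q ]
      (collect j k (λ j → filt (residue j) (x ∷ X)) ≡ P ++ x ∷ Q × collect j k (λ j → filt (residue j) X) ≡ P ++ Q × length P ≡ countᵇ (below-b (suc (x % r)) (j + k)) X)
    insert j zero    x X a b = ⊥-elim (<⇒≱ b (subst (_≤ x % r) (sym (+-identityʳ j)) a))
    insert j (suc k) x X a b with j ≟ x % r
    ... | yes refl = collect (suc j) k (λ j → filt (residue j) X) , filt (residue j) X ,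
        cong₂ _++_ (collect-cong (suc j) k (λ i p _ → cong (λ t → if t then x ∷ filt (residue i) X else filt (residue i) X) (≡ᵇ-false (<⇒≢ p))))
                   (cong (λ t → if t then x ∷ filt (residue j) X else filt (residue j) X) (≡ᵇ-refl (x % r))) ,
        refl , trans (length-collect (suc j) k X) (cong (λ n → countᵇ (below-b (suc j) n) X) (sym (+-suc j k)))
    ... | no  ne with insert (suc j) k x X (≤∧≢⇒< a ne) (subst (x % r <_) (+-suc j k) b)
    ... | P , Q , e , e′ , l = P , Q ++ filt (residue j) X ,
        trans (cong₂ _++_ e (cong (λ t → if t then x ∷ filt (residue j) X else filt (residue j) X) (≡ᵇ-false (ne ∘ sym)))) (++-assoc P (x ∷ Q) _) ,
        trans (cong (_++ filt (residue j) X) e′) (++-assoc P Q _) , trans l (cong (λ n → countᵇ (below-b (suc (x % r)) n) X) (sym (+-suc j k)))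

  alternant-grouped : ∀ C X v → alternant (C ++ grouped X) v ≡ negOnePow (inversions X) *ᶻ alternant (C ++ X) v
  alternant-grouped C [] v = trans (cong (λ l → alternant (C ++ l) v) (empty 0 r)) (sym (ℤ.*-identityˡ _))
    where empty : ∀ j k → collect j k (λ _ → []) ≡ []
          empty j zero    = refl
          empty j (suc k) = trans (++-identityʳ _) (empty (suc j) k)
  alternant-grouped C (x ∷ X) v with insert 0 r x X z≤n (DM.m%n<n x r)
  ... | P , Q , e , e′ , l = begin
    alternant (C ++ grouped (x ∷ X)) v                         ≡⟨ cong (λ l → alternant (C ++ l) v) e ⟩
    alternant (C ++ P ++ x ∷ Q) v                              ≡⟨ alternant-move C P x Q v ⟩
    negOnePow (length P) *ᶻ alternant (C ++ x ∷ P ++ Q) v      ≡⟨ cong₂ _*ᶻ_ (cong negOnePow count≡) (cong (λ l → alternant l v) (trans (cong (λ l → C ++ x ∷ l) (sym e′)) (sym (++-assoc C (x ∷ []) _)))) ⟩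
    negOnePow a *ᶻ alternant ((C ++ x ∷ []) ++ grouped X) v    ≡⟨ cong (negOnePow a *ᶻ_) (alternant-grouped (C ++ x ∷ []) X v) ⟩
    negOnePow a *ᶻ (negOnePow (inversions X) *ᶻ alternant ((C ++ x ∷ []) ++ X) v)
      ≡⟨ trans (sym (ℤ.*-assoc (negOnePow a) _ _)) (cong₂ _*ᶻ_ (sym (negOnePow-+ a (inversions X))) (cong (λ l → alternant l v) (++-assoc C (x ∷ []) X))) ⟩
    negOnePow (a + inversions X) *ᶻ alternant (C ++ x ∷ X) v ∎
    where
    open ≡-Reasoning
    a = countᵇ (λ y → x % r <ᵇ y % r) X
    count≡ : length P ≡ a
    count≡ = trans l (countᵇ-cong X (λ {y} _ → trans (cong (λ b → (x % r <ᵇ y % r) ∧ b) (<ᵇ-true (DM.m%n<n y r))) (∧-identityʳ′ (x % r <ᵇ y % r))))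
      where ∧-identityʳ′ : ∀ b → b ∧ true ≡ b
            ∧-identityʳ′ true  = refl
            ∧-identityʳ′ false = refl

-- Border strips

singleton : Cell → List Cell
singleton c = c ∷ []

-- grow is the local function of the same name in Defs.connected, recovered by unification.
mutual
  grow : Cell → List Cell → ℕ → List Cell → List Cell
  grow = _

  connected-def : ∀ c cs → connected (c ∷ cs) ≡ allᵇ (λ d → memCell d (grow c cs (length cs) (singleton c))) (c ∷ cs)
  connected-def c cs with singleton c | length cs | anyᵇ (cellEq c)
  ... | R | n | w = refl

memCell-sound : ∀ {d} R → memCell d R ≡ true → d ∈ R
memCell-sound {d} R e with anyᵇ-sound (cellEq d) R e
... | y , i , q = subst (_∈ R) (sym (cellEq-sound q)) i

memCell-true : ∀ {d R} → d ∈ R → memCell d R ≡ true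
memCell-true {d} i = anyᵇ-true (cellEq d) i (cellEq-refl d)

connected-elim : ∀ c cs (P : Cell → Set) → connected (c ∷ cs) ≡ true → P c →
  (∀ {d e} → d ∈ c ∷ cs → e ∈ c ∷ cs → adjacent d e ≡ true → P e → P d) → ∀ {d} → d ∈ c ∷ cs → P d
connected-elim c cs P con pc step d∈ = proj₂ (go (length cs) (c ∷ []) (λ { (here refl) → here refl , pc })
    (memCell-sound _ (allᵇ-sound _ (c ∷ cs) (trans (sym (connected-def c cs)) con) d∈)))
  where
  go : ∀ k R → (∀ {d} → d ∈ R → d ∈ c ∷ cs × P d) → ∀ {d} → d ∈ grow c cs k R → d ∈ c ∷ cs × P d
  go zero    R h i = h i
  go (suc k) R h = go k _ λ {d} i → case ∈-filt⁻ (λ d → memCell d R ∨ anyᵇ (adjacent d) R) (c ∷ cs) i of λ where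
    (d∈ , e) → d∈ , (case ∨-elim {memCell d R} e of λ where
      (inj₁ m) → proj₂ (h (memCell-sound R m))
      (inj₂ a) → case anyᵇ-sound (adjacent d) R a of λ where (e , e∈ , adj) → step d∈ (proj₁ (h e∈)) adj (proj₂ (h e∈)))

-- After `k` rounds `grow` contains every cell with `dist` at most `k`. There are `length cs`
-- rounds, which explains the bound required of `dist`.
connected-intro : ∀ c cs (dist : Cell → ℕ) → dist c ≡ 0 → (∀ {d} → d ∈ c ∷ cs → dist d ≤ length cs) →
  (∀ {d} → d ∈ c ∷ cs → d ≡ c ⊎ ∃[ e ] (e ∈ c ∷ cs × adjacent d e ≡ true × dist e < dist d)) → connected (c ∷ cs) ≡ true
connected-intro c cs dist zero-at-c bound closer = trans (connected-def c cs) (allᵇ-true _ (c ∷ cs) (λ {d} d∈ → memCell-true (go (length cs) 0 (c ∷ [])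
    (λ {d} d∈ d≤0 → case closer d∈ of λ where
       (inj₁ refl)             → here refl
       (inj₂ (e , _ , _ , lt)) → ⊥-elim (<⇒≱ lt (≤-trans d≤0 z≤n))) d∈ (≤-trans (bound d∈) (≤-reflexive (sym (+-identityʳ _)))))))
  where
  go : ∀ k a R → (∀ {d} → d ∈ c ∷ cs → dist d ≤ a → d ∈ R) → ∀ {d} → d ∈ c ∷ cs → dist d ≤ k + a → d ∈ grow c cs k R
  go zero    a R h d∈ le = h d∈ le
  go (suc k) a R h d∈ le = go k (suc a) _ (λ {d} d∈ le → ∈-filt⁺ (λ d → memCell d R ∨ anyᵇ (adjacent d) R) d∈ (reach d d∈ le)) d∈ (≤-trans le (≤-reflexive (sym (+-suc k a))))
    where
    reach : ∀ d → d ∈ c ∷ cs → dist d ≤ suc a → memCell d R ∨ anyᵇ (adjacent d) R ≡ true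
    reach d d∈ le with dist d ≤? a
    ... | yes p = ∨-introˡ (memCell-true (h d∈ p))
    ... | no  p = case closer d∈ of λ where
      (inj₁ refl) → ∨-introˡ (memCell-true (h d∈ (subst (_≤ a) (sym zero-at-c) z≤n)))
      (inj₂ (e , e∈ , adj , lt)) → ∨-introʳ (memCell d R) (anyᵇ-true (adjacent d) (h e∈ (s≤s⁻¹ (≤-trans lt le))) adj)

adjacent-cases : ∀ {i j i′ j′} → adjacent (i , j) (i′ , j′) ≡ true →
  (i ≡ i′) ⊎ (j ≡ j′ × (i′ ≡ suc i ⊎ i ≡ suc i′))
adjacent-cases {i} {j} {i′} {j′} e with ∨-elim {(i ≡ᵇ i′) ∧ ((j′ ≡ᵇ suc j) ∨ (j ≡ᵇ suc j′))} e
... | inj₁ a = inj₁ (≡ᵇ-sound (proj₁ (∧-elim {i ≡ᵇ i′} a)))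
... | inj₂ a with ∧-elim {j ≡ᵇ j′} a
... | p , q with ∨-elim {i′ ≡ᵇ suc i} q
... | inj₁ u = inj₂ (≡ᵇ-sound p , inj₁ (≡ᵇ-sound {i′} u))
... | inj₂ u = inj₂ (≡ᵇ-sound p , inj₂ (≡ᵇ-sound {i} u))

adjacent-right : ∀ i j → adjacent (i , j) (i , suc j) ≡ true
adjacent-right i j = ∨-introˡ (∧-intro (≡ᵇ-refl i) (∨-introˡ (≡ᵇ-refl j)))

adjacent-left : ∀ i j → adjacent (i , suc j) (i , j) ≡ true
adjacent-left i j = ∨-introˡ (∧-intro (≡ᵇ-refl i) (∨-introʳ (j ≡ᵇ suc (suc j)) (≡ᵇ-refl j)))

adjacent-down : ∀ i j → adjacent (i , j) (suc i , j) ≡ true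
adjacent-down i j = ∨-introʳ ((i ≡ᵇ suc i) ∧ ((j ≡ᵇ suc j) ∨ (j ≡ᵇ suc j))) (∧-intro (≡ᵇ-refl j) (∨-introˡ (≡ᵇ-refl i)))

adjacent-up : ∀ i j → adjacent (suc i , j) (i , j) ≡ true
adjacent-up i j = ∨-introʳ ((suc i ≡ᵇ i) ∧ ((j ≡ᵇ suc j) ∨ (j ≡ᵇ suc j))) (∧-intro (≡ᵇ-refl j) (∨-introʳ (i ≡ᵇ suc (suc i)) (≡ᵇ-refl i)))

sumℕ-++ : ∀ xs ys → sumℕ (xs ++ ys) ≡ sumℕ xs + sumℕ ys
sumℕ-++ []       ys = refl
sumℕ-++ (x ∷ xs) ys = trans (cong (x +_) (sumℕ-++ xs ys)) (sym (+-assoc x _ _))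

size-sumTo : ∀ α N → length α ≤ N → size α ≡ sumTo N (nth α)
size-sumTo []      N       h       = sym (sumTo-0 N)
size-sumTo (x ∷ α) (suc N) (s≤s h) = trans (cong (x +_) (size-sumTo α N h)) (sym (sumTo-suc N _))

sumℕ-applyUpTo : ∀ f n → sumℕ (applyUpTo f n) ≡ sumTo n f
sumℕ-applyUpTo f zero    = refl
sumℕ-applyUpTo f (suc n) = trans (cong (f 0 +_) (sumℕ-applyUpTo (f ∘ suc) n)) (sym (sumTo-suc n f))

sum-beta : ∀ α N → length α ≤ N → sumℕ (beta α N) ≡ size α + sumTo N (λ i → N ∸ suc i)
sum-beta α N h = trans (cong sumℕ (beta≡ α N)) (trans (sumℕ-applyUpTo _ N) (trans (sumTo-cong N (λ i i<N → +-∸-assoc (nth α i) i<N))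
  (trans (sumTo-+ N (nth α) (λ i → N ∸ suc i)) (cong (_+ sumTo N (λ i → N ∸ suc i)) (sym (size-sumTo α N h))))))

⊆ᵇ-sound : ∀ ρ σ → (ρ ⊆ᵇ σ) ≡ true → ∀ i → nth ρ i ≤ nth σ i
⊆ᵇ-sound ρ σ e i with i <? length ρ
... | yes h = ≤ᵇ-sound (allᵇ-sound (λ i → nth ρ i ≤ᵇ nth σ i) (range (length ρ)) e (∈-range⁺ h))
... | no  h = ≤-trans (≤-reflexive (nth-beyond ρ (≮⇒≥ h))) z≤n

⊆ᵇ-true : ∀ ρ σ → (∀ i → nth ρ i ≤ nth σ i) → (ρ ⊆ᵇ σ) ≡ true
⊆ᵇ-true ρ σ h = allᵇ-true _ (range (length ρ)) (λ {i} _ → ≤ᵇ-true (h i))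

least : (l : List ℕ) {x : ℕ} → x ∈ l → ∃[ p ] (p ∈ l × (∀ {y} → y ∈ l → p ≤ y))
least (x ∷ [])    _ = x , here refl , λ where (here refl) → ≤-refl
least (x ∷ y ∷ l) _ with least (y ∷ l) (here refl)
... | p , p∈ , h with x ≤? p
... | yes x≤p = x , here refl , λ where (here refl) → ≤-refl
                                        (there i)   → ≤-trans x≤p (h i)
... | no  x≰p = p , there p∈ , λ where (here refl) → <⇒≤ (≰⇒> x≰p)
                                       (there i)   → h i

maxL-∈ : ∀ l {x} → x ∈ l → maxL l ∈ l
maxL-∈ (x ∷ [])    _ = here (⊔-identityʳ x)
maxL-∈ (x ∷ y ∷ l) _ with maxL-∈ (y ∷ l) (here refl) | ≤-total x (maxL (y ∷ l))
... | i | inj₁ h = there (subst (_∈ y ∷ l) (sym (m≤n⇒m⊔n≡n h)) i)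
... | i | inj₂ h = here (m≥n⇒m⊔n≡m h)

-- σ′ arises from σ by moving the bead x of the abacus with M beads r positions up, past the beads b₂.
record Move (r M : ℕ) (σ σ′ : List ℕ) : Set where
  field
    b₁ b₂ b₃ : List ℕ
    x        : ℕ
    before   : beta σ M ≡ b₁ ++ b₂ ++ x ∷ b₃
    after    : beta σ′ M ≡ b₁ ++ x + r ∷ b₂ ++ b₃

applyUpTo-++ : {A : Set} (f : ℕ → A) (a n : ℕ) → applyUpTo f (a + n) ≡ applyUpTo f a ++ applyUpTo (λ i → f (a + i)) n
applyUpTo-++ f zero    n = refl
applyUpTo-++ f (suc a) n = cong (f 0 ∷_) (applyUpTo-++ (f ∘ suc) a n)

-- The rows p, …, p + d form a border strip of σ′/σ.
record Strip (σ σ′ : List ℕ) (p d : ℕ) : Set where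
  field
    outside : ∀ i → i < p ⊎ p + d < i → nth σ′ i ≡ nth σ i
    inside  : ∀ i → p ≤ i → i < p + d → nth σ′ (suc i) ≡ suc (nth σ i)
    strict  : ∀ i → p ≤ i → i ≤ p + d → nth σ i < nth σ′ i

strip-height : ∀ {σ σ′ p d} → Strip σ σ′ p d → height (cells σ′ σ) ≡ d
strip-height {σ} {σ′} {p} {d} S = cong (_∸ 1) (trans (cong (λ q → countᵇ hasCell (range (suc q))) max≡) (trans (countᵇ-applyUpTo hasCell id (suc (p + d)))
    (trans (cong (λ n → sumTo n (b2n ∘ hasCell)) (sym (+-suc p d))) (trans (sumTo-split p (suc d) _) (trans (cong₂ _+_
      (sumTo-zero p (λ i i<p → cong b2n (¬true (λ e → <⇒≱ i<p (proj₁ (rows e))))))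
      (sumTo-cong (suc d) {g = λ x → b2n (x <ᵇ suc d)} (λ i i≤d → cong b2n (trans (present (p + i) (m≤m+n p i) (+-monoʳ-≤ p (s≤s⁻¹ i≤d))) (sym (<ᵇ-true i≤d))))))
      (sumTo-initial (suc d) (suc d) ≤-refl))))))
  where
  open Strip S
  cs = cells σ′ σ
  hasCell : ℕ → Bool
  hasCell i = anyᵇ (λ c → proj₁ c ≡ᵇ i) cs
  present : ∀ i → p ≤ i → i ≤ p + d → hasCell i ≡ true
  present i a b = anyᵇ-true (λ c → proj₁ c ≡ᵇ i) (∈-cells⁺ σ′ σ ≤-refl (strict i a b)) (≡ᵇ-refl i)
  cell-rows : ∀ {i j} → (i , j) ∈ cs → p ≤ i × i ≤ p + d
  cell-rows {i} c∈ with ∈-cells⁻ σ′ σ c∈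
  ... | a , b = ≮⇒≥ (λ h → <⇒≱ (≤-<-trans a b) (≤-reflexive (outside i (inj₁ h)))) , ≮⇒≥ (λ h → <⇒≱ (≤-<-trans a b) (≤-reflexive (outside i (inj₂ h))))
  rows : ∀ {i} → hasCell i ≡ true → p ≤ i × i ≤ p + d
  rows {i} e with anyᵇ-sound (λ c → proj₁ c ≡ᵇ i) cs e
  ... | (i′ , j) , c∈ , q with ≡ᵇ-sound {i′} q
  ... | refl = cell-rows c∈
  max≡ : maxL (map proj₁ cs) ≡ p + d
  max≡ with ∈-map⁺ proj₁ (∈-cells⁺ σ′ σ {p + d} ≤-refl (strict (p + d) (m≤m+n p d) ≤-refl))
  ... | top = ≤-antisym (case ∈-map⁻ proj₁ cs (maxL-∈ (map proj₁ cs) top) of λ where (c , c∈ , e) → subst (_≤ p + d) (sym e) (proj₂ (cell-rows c∈))) (maxL-≤ (map proj₁ cs) top)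

isStrip⇒Strip : ∀ {r σ σ′} → 0 < r → Decreasing (nth σ) → Decreasing (nth σ′) → isStrip r σ σ′ ≡ true →
                size σ′ ≡ size σ + r × ∃[ p ] ∃[ d ] Strip σ σ′ p d
isStrip⇒Strip {r} {σ} {σ′} r>0 dσ dσ′ e with ∧-elim {σ ⊆ᵇ σ′} e
... | sub′ , e₁ with ∧-elim {size σ′ ≡ᵇ size σ + r} e₁
... | sz′ , e₂ with ∧-elim {connected (cells σ′ σ)} e₂
... | con , n2 = sz , build (cells σ′ σ) refl
  where
  sub = ⊆ᵇ-sound σ σ′ sub′
  sz = ≡ᵇ-sound {size σ′} sz′
  s s′ : ℕ → ℕ
  s  = nth σ
  s′ = nth σ′
  -- Were row `i + 1` longer, the cell in row `i` and column `s i` would be the corner of a 2 by 2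
  -- square.
  narrow : ∀ i → s i < s′ (suc i) → s′ (suc i) ≡ suc (s i)
  narrow i h = ≤-antisym (≮⇒≥ λ wide → not-elim n2 (anyᵇ-true _ (cell i (s i) ≤-refl (≤-trans h (dσ′ i)))
      (∧-intro (memCell-true (cell i (suc (s i)) (n≤1+n _) (≤-trans wide (dσ′ i)))) (∧-intro (memCell-true (cell (suc i) (s i) (dσ i) h))
        (memCell-true (cell (suc i) (suc (s i)) (m≤n⇒m≤1+n (dσ i)) wide)))))) h
    where cell : ∀ i j → s i ≤ j → j < s′ i → (i , j) ∈ cells σ′ σ
          cell i j = ∈-cells⁺ σ′ σ
  build : ∀ cs → cells σ′ σ ≡ cs → ∃[ p ] ∃[ d ] Strip σ σ′ p d
  build [] eq = ⊥-elim (<⇒≢ (+-monoʳ-< (size σ) r>0) (trans (+-identityʳ (size σ)) (trans (sym sameSize) sz)))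
    where
    N = length σ + length σ′
    sameSize : size σ′ ≡ size σ
    sameSize = trans (size-sumTo σ′ N (m≤n+m _ (length σ))) (trans (sumTo-cong N (λ i _ → ≤-antisym (≮⇒≥ (λ h → case subst ((i , s i) ∈_) eq (∈-cells⁺ σ′ σ ≤-refl h) of λ ())) (sub i))) (sym (size-sumTo σ N (m≤m+n _ _))))
  build (c ∷ cs) eq with least (map proj₁ (c ∷ cs)) (here refl) | maxL-∈ (map proj₁ (c ∷ cs)) (here refl)
  ... | p , p∈ , p≤ | q∈ with ∈-map⁻ proj₁ (c ∷ cs) p∈ | ∈-map⁻ proj₁ (c ∷ cs) q∈
  ... | cp , cp∈ , refl | cq , cq∈ , qe with m≤n⇒∃[o]m+o≡n (p≤ (∈-map⁺ proj₁ cq∈))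
  ... | d , de = p₀ , d , record
      { outside = λ i h → ≤-antisym (≮⇒≥ (λ ne → out i h (subst ((i , s i) ∈_) eq (∈-cells⁺ σ′ σ ≤-refl ne)))) (sub i)
      ; inside  = λ i a b → narrow i (cross i a (subst (i <_) de b))
      ; strict  = strict }
    where
    p₀ = proj₁ cp
    q₀ = proj₁ cq
    lo : ∀ {d} → d ∈ c ∷ cs → p₀ ≤ proj₁ d
    lo d∈ = p≤ (∈-map⁺ proj₁ d∈)
    up : ∀ {d} → d ∈ c ∷ cs → proj₁ d ≤ q₀
    up d∈ = ≤-trans (maxL-≤ (map proj₁ (c ∷ cs)) (∈-map⁺ proj₁ d∈)) (≤-reflexive qe)
    inCells : ∀ {i j} → (i , j) ∈ c ∷ cs → s i ≤ j × j < s′ i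
    inCells d∈ = ∈-cells⁻ σ′ σ (subst (_ ∈_) (sym eq) d∈)
    out : ∀ i → i < p₀ ⊎ p₀ + d < i → (i , s i) ∈ c ∷ cs → ⊥
    out i (inj₁ h) i∈ = <⇒≱ h (lo i∈)
    out i (inj₂ h) i∈ = <⇒≱ (subst (_< i) de h) (up i∈)
    con′ : connected (c ∷ cs) ≡ true
    con′ = subst (λ l → connected l ≡ true) eq con
    -- If the inequality fails, rows `i` and `i + 1` have no column in common, and a connected set
    -- cannot get from one to the other. But the extreme rows `p₀` and `q₀`, both occupied, lie on
    -- different sides.
    cross : ∀ i → p₀ ≤ i → i < q₀ → s i < s′ (suc i)
    cross i a b with s i <? s′ (suc i)
    ... | yes h = h
    ... | no  h with proj₁ c ≤? i
    ... | yes c≤ = ⊥-elim (<⇒≱ b (connected-elim c cs (λ d → proj₁ d ≤ i) con′ c≤ step cq∈))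
      where
      step : ∀ {d e} → d ∈ c ∷ cs → e ∈ c ∷ cs → adjacent d e ≡ true → proj₁ e ≤ i → proj₁ d ≤ i
      step {i₁ , j} {i₂ , j′} d∈ e∈ adj e≤ = case adjacent-cases {i₁} {j} {i₂} {j′} adj of λ where
        (inj₁ refl)                 → e≤
        (inj₂ (refl , inj₁ refl))   → <⇒≤ e≤
        (inj₂ (refl , inj₂ refl))   → case i₂ ≟ i of λ where
          (yes refl) → ⊥-elim (h (≤-<-trans (proj₁ (inCells e∈)) (proj₂ (inCells d∈))))
          (no ne)    → ≤∧≢⇒< e≤ ne
    ... | no  c≰ = ⊥-elim (<⇒≱ (connected-elim c cs (λ d → i < proj₁ d) con′ (≰⇒> c≰) step cp∈) a)
      where
      step : ∀ {d e} → d ∈ c ∷ cs → e ∈ c ∷ cs → adjacent d e ≡ true → i < proj₁ e → i < proj₁ d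
      step {i₁ , j} {i₂ , j′} d∈ e∈ adj e> = case adjacent-cases {i₁} {j} {i₂} {j′} adj of λ where
        (inj₁ refl)                 → e>
        (inj₂ (refl , inj₂ refl))   → m<n⇒m<1+n e>
        (inj₂ (refl , inj₁ refl))   → case i₁ ≟ i of λ where
          (yes refl) → ⊥-elim (h (≤-<-trans (proj₁ (inCells d∈)) (proj₂ (inCells e∈))))
          (no ne)    → ≤∧≢⇒< (s≤s⁻¹ e>) (ne ∘ sym)
    strict : ∀ i → p₀ ≤ i → i ≤ p₀ + d → s i < s′ i
    strict i a b with i ≟ q₀
    ... | yes refl = case inCells cq∈ of λ where (u , w) → ≤-<-trans u w
    ... | no  ne   = ≤-trans (cross i a (≤∧≢⇒< (subst (i ≤_) de b) ne)) (dσ′ i)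

Strip⇒Move : ∀ {r M σ σ′ p d} → length σ ≤ M → length σ′ ≤ M → size σ′ ≡ size σ + r → Strip σ σ′ p d → Σ[ m ∈ Move r M σ σ′ ] length (Move.b₂ m) ≡ d
Strip⇒Move {r} {M} {σ} {σ′} {p} {d} l l′ sz S = record { before = X≡ ; after = trans X′≡ (cong (λ y → b₁ ++ y ∷ b₂ ++ b₃) y≡) } , length-applyUpTo _ d
  where
  open Strip S
  f f′ : ℕ → ℕ
  f  i = nth σ i + M ∸ suc i
  f′ i = nth σ′ i + M ∸ suc i
  q<M : p + d < M
  q<M = ≤-trans (nth-pos⇒< σ′ (≤-<-trans z≤n (strict (p + d) (m≤m+n p d) ≤-refl))) l′
  m = proj₁ (m≤n⇒∃[o]m+o≡n q<M)
  M≡ : p + (d + suc m) ≡ M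
  M≡ = trans (trans (sym (+-assoc p d (suc m))) (+-suc (p + d) m)) (proj₂ (m≤n⇒∃[o]m+o≡n q<M))
  b₁ = applyUpTo f p
  b₂ = applyUpTo (λ i → f (p + i)) d
  x  = f (p + (d + 0))
  b₃ = applyUpTo (λ i → f (p + (d + suc i))) m
  X≡ : beta σ M ≡ b₁ ++ b₂ ++ x ∷ b₃
  X≡ = trans (beta≡ σ M) (trans (cong (applyUpTo f) (sym M≡)) (trans (applyUpTo-++ f p (d + suc m)) (cong (b₁ ++_) (applyUpTo-++ (λ i → f (p + i)) d (suc m)))))
  X′≡ : beta σ′ M ≡ b₁ ++ f′ (p + 0) ∷ b₂ ++ b₃
  X′≡ = trans (beta≡ σ′ M) (trans (cong (applyUpTo f′) (trans (sym M≡) (cong (p +_) (+-suc d m)))) (trans (applyUpTo-++ f′ p (suc (d + m)))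
    (cong₂ _++_ (applyUpTo-cong p (λ i h → cong (λ a → a + M ∸ suc i) (outside i (inj₁ h))))
      (cong (f′ (p + 0) ∷_) (trans (applyUpTo-++ (λ i → f′ (p + suc i)) d m) (cong₂ _++_
        (applyUpTo-cong d (λ i h → trans (cong f′ (+-suc p i)) (cong (λ a → a + M ∸ suc (suc (p + i))) (inside (p + i) (m≤m+n p i) (+-monoʳ-< p h)))))
        (applyUpTo-cong m (λ i h → trans (cong f′ (cong (p +_) (sym (+-suc d i)))) (cong (λ a → a + M ∸ suc (p + (d + suc i)))
           (outside _ (inj₂ (+-monoʳ-< p (m<m+n d (s≤s z≤n))))))))))))))
  -- The new position is found from the sizes: the remaining beads agree, so the moved bead accounts
  -- for the whole difference `r`.
  y≡ : f′ (p + 0) ≡ x + r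
  y≡ = lia 11 (λ S₁ S₂ S₃ x y t z z′ r Σ Σ′ → Σ :≡ S₁ :+ (S₂ :+ (x :+ S₃)) ⇒ Σ′ :≡ S₁ :+ (y :+ (S₂ :+ S₃)) ⇒ Σ :≡ z :+ t ⇒ Σ′ :≡ z′ :+ t ⇒ z′ :≡ z :+ r ⇒ ⊢ y :≡ x :+ r)
    (sumℕ b₁) (sumℕ b₂) (sumℕ b₃) x (f′ (p + 0)) (sumTo M (λ i → M ∸ suc i)) (size σ) (size σ′) r (sumℕ (beta σ M)) (sumℕ (beta σ′ M))
    (trans (cong sumℕ X≡) (trans (sumℕ-++ b₁ _) (cong (sumℕ b₁ +_) (sumℕ-++ b₂ _))))
    (trans (cong sumℕ X′≡) (trans (sumℕ-++ b₁ _) (cong (λ w → sumℕ b₁ + (f′ (p + 0) + w)) (sumℕ-++ b₂ b₃))))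
    (sum-beta σ M l) (sum-beta σ′ M l′) sz

countᵇ-all : {A : Set} (xs : List A) → countᵇ (λ _ → true) xs ≡ length xs
countᵇ-all []       = refl
countᵇ-all (x ∷ xs) = cong suc (countᵇ-all xs)

length-cells : ∀ {σ σ′} → IsPartition σ → (∀ i → nth σ i ≤ nth σ′ i) → length (cells σ′ σ) + size σ ≡ size σ′
length-cells {σ} {σ′} pσ sub = trans (cong₂ _+_ (trans (sym (countᵇ-all (cells σ′ σ))) (trans (countᵇ-concatMap (λ _ → true) (cellRow σ′ σ) id N)
      (sumTo-cong N (λ i _ → trans (countᵇ-all (cellRow σ′ σ i)) (trans (length-map (i ,_) (rangeFromTo (nth σ i) (nth σ′ i))) (trans (length-map (nth σ i +_) (range (nth σ′ i ∸ nth σ i))) (length-upTo _)))))))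
    (size-sumTo σ N (partition-length N pσ (n≤0⇒n≡0 (≤-trans (sub N) (≤-reflexive (nth-beyond σ′ ≤-refl)))))))
  (trans (sym (sumTo-+ N (λ i → nth σ′ i ∸ nth σ i) (nth σ))) (trans (sumTo-cong N (λ i _ → m∸n+n≡m (sub i))) (sym (size-sumTo σ′ N ≤-refl))))
  where N = length σ′

module _ {r : ℕ} {σ σ′ : List ℕ} {p d : ℕ} (r>0 : 0 < r) (pσ : IsPartition σ) (pσ′ : IsPartition σ′) (sz : size σ′ ≡ size σ + r) (S : Strip σ σ′ p d) where
  open Strip S
  private
    s s′ : ℕ → ℕ
    s  = nth σ
    s′ = nth σ′
    dσ = IsPartition⇒Decreasing pσ
    dσ′ = IsPartition⇒Decreasing pσ′
    q = p + d

    rowCases : ∀ i → (i < p ⊎ q < i) ⊎ (p ≤ i × i ≤ q)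
    rowCases i with i <? p | q <? i
    ... | yes a | _     = inj₁ (inj₁ a)
    ... | no  _ | yes b = inj₁ (inj₂ b)
    ... | no  a | no  b = inj₂ (≮⇒≥ a , ≮⇒≥ b)

    sub : ∀ i → s i ≤ s′ i
    sub i with rowCases i
    ... | inj₁ o       = ≤-reflexive (sym (outside i o))
    ... | inj₂ (a , b) = <⇒≤ (strict i a b)

    cell⁻ : ∀ {i j} → (i , j) ∈ cells σ′ σ → p ≤ i × i ≤ q × s i ≤ j × j < s′ i
    cell⁻ {i} c∈ with ∈-cells⁻ σ′ σ c∈ | rowCases i
    ... | a , b | inj₁ o       = ⊥-elim (<⇒≱ (≤-<-trans a b) (≤-reflexive (outside i o)))
    ... | a , b | inj₂ (u , w) = u , w , a , b

    telescope : ∀ k → k ≤ d → sumTo (p + suc k) s′ + s (p + k) ≡ sumTo (p + suc k) s + s′ p + k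
    telescope zero    _ rewrite +-suc p 0 | +-identityʳ p = lia 4 (λ P P′ a b → P′ :≡ P ⇒ ⊢ P′ :+ b :+ a :≡ P :+ a :+ b :+ # 0) (sumTo p s) (sumTo p s′) (s p) (s′ p) (sumTo-cong p (λ i h → outside i (inj₁ h)))
    telescope (suc k) h rewrite +-suc p (suc k) = lia 7 (λ P P′ a b c e k → P′ :+ a :≡ P :+ e :+ k ⇒ b :≡ # 1 :+ a ⇒ ⊢ P′ :+ b :+ c :≡ P :+ c :+ e :+ (# 1 :+ k))
      (sumTo (p + suc k) s) (sumTo (p + suc k) s′) (s (p + k)) (s′ (p + suc k)) (s (p + suc k)) (s′ p) k (telescope k (<⇒≤ h))
      (trans (cong s′ (+-suc p k)) (inside (p + k) (m≤m+n p k) (+-monoʳ-< p h)))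

    -- Because each row reaches one column beyond the start of the row above, the number of boxes
    -- telescopes to `s′ p + d` minus `s q`, and this number is `r`.
    ends : s′ p + d ≡ s q + r
    ends = lia 9 (λ P P′ T T′ a b d r z → P′ :+ a :≡ P :+ b :+ d ⇒ T′ :≡ T ⇒ P′ :+ T′ :≡ z ⇒ z :≡ P :+ T :+ r ⇒ ⊢ b :+ d :≡ a :+ r)
      (sumTo n s) (sumTo n s′) (sumTo N (λ i → s (n + i))) (sumTo N (λ i → s′ (n + i))) (s q) (s′ p) d r (size σ′)
      (telescope d ≤-refl) (sumTo-cong N (λ i _ → outside (n + i) (inj₂ (≤-trans (≤-reflexive (sym (+-suc p d))) (m≤m+n n i)))))
      (trans (sym (sumTo-split n N s′)) (sym (size-sumTo σ′ (n + N) (≤-trans (m≤n+m _ (length σ)) (m≤n+m N n)))))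
      (trans sz (cong (_+ r) (trans (size-sumTo σ (n + N) (≤-trans (m≤m+n _ _) (m≤n+m N n))) (sumTo-split n N s))))
      where n = p + suc d
            N = length σ + length σ′

    -- The diagonal `j - i` of a cell, shifted by `q` to stay in ℕ. Along the strip it takes each of
    -- the `r` values from `s q` on exactly once, and neighbours differ by 1. It serves as the
    -- coordinate that measures distances in the proof of connectedness.
    u : Cell → ℕ
    u (i , j) = j + (q ∸ i)

    u+ : ∀ {i j} → i ≤ q → u (i , j) + i ≡ j + q
    u+ {i} {j} h = trans (+-assoc j (q ∸ i) i) (cong (j +_) (m∸n+n≡m h))

    u-low : ∀ {i j} → (i , j) ∈ cells σ′ σ → s q ≤ u (i , j)
    u-low c∈ with cell⁻ c∈
    ... | a , b , e , f = ≤-trans (Decreasing-≤ dσ b) (≤-trans e (m≤m+n _ _))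

    u-high : ∀ {i j} → (i , j) ∈ cells σ′ σ → u (i , j) < s q + r
    u-high {i} {j} c∈ with cell⁻ c∈
    ... | a , b , e , f = subst (u (i , j) <_) ends (lia 8 (λ j i q t w d p z → z :+ i :≡ j :+ q ⇒ j :< t ⇒ t :≤ w ⇒ p :≤ i ⇒ q :≡ p :+ d ⇒ ⊢ z :< w :+ d)
        j i q (s′ i) (s′ p) d p (u (i , j)) (u+ b) f (Decreasing-≤ dσ′ a) a refl)

    u-injective : ∀ {i j i′ j′} → (i , j) ∈ cells σ′ σ → (i′ , j′) ∈ cells σ′ σ → i < i′ → ¬ u (i , j) ≡ u (i′ , j′)
    u-injective {i} {j} {i′} {j′} c∈ c∈′ h e with cell⁻ c∈ | cell⁻ c∈′
    ... | a , b , f , g | a′ , b′ , f′ , g′ = lia 8 (λ i j i′ j′ u q si s′i → u :+ i :≡ j :+ q ⇒ u :+ i′ :≡ j′ :+ q ⇒ i :< i′ ⇒ j′ :< s′i ⇒ s′i :≤ # 1 :+ si ⇒ si :≤ j ⇒ ⊢ absurd)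
        i j i′ j′ (u (i , j)) q (s i) (s′ i′) (u+ b) (trans (cong (_+ i′) e) (u+ b′)) h g′ (≤-trans (Decreasing-≤ dσ′ h) (≤-reflexive (inside i a (≤-trans h b′)))) f

    down : ∀ {i j} → (i , j) ∈ cells σ′ σ → s q < u (i , j) → ∃[ e ] (e ∈ cells σ′ σ × adjacent (i , j) e ≡ true × suc (u e) ≡ u (i , j))
    down {i} {j} c∈ h with cell⁻ c∈
    ... | a , b , f , g with s i <? j
    ... | yes lt = left lt g
      where
      left : ∀ {j} → s i < j → j < s′ i → ∃[ e ] (e ∈ cells σ′ σ × adjacent (i , j) e ≡ true × suc (u e) ≡ u (i , j))
      left {suc j′} lt g = (i , j′) , ∈-cells⁺ σ′ σ (s≤s⁻¹ lt) (<⇒≤ g) , adjacent-left i j′ , refl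
    ... | no  nlt with ≤-antisym (≮⇒≥ nlt) f
    ... | refl with i ≟ q
    ... | yes refl = ⊥-elim (<-irrefl refl (subst (s q <_) (trans (cong (s q +_) (n∸n≡0 q)) (+-identityʳ _)) h))
    ... | no  ne = (suc i , s i) , ∈-cells⁺ σ′ σ (dσ i) (≤-reflexive (sym (inside i a i<q))) , adjacent-down i (s i) , trans (sym (+-suc (s i) _)) (cong (s i +_) (sym (+-∸-assoc 1 i<q)))
      where i<q = ≤∧≢⇒< b ne

    up : ∀ {i j} → (i , j) ∈ cells σ′ σ → suc (u (i , j)) < s q + r → ∃[ e ] (e ∈ cells σ′ σ × adjacent (i , j) e ≡ true × u e ≡ suc (u (i , j)))
    up {i} {j} c∈ h with cell⁻ c∈
    ... | a , b , f , g with suc j <? s′ i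
    ... | yes lt = (i , suc j) , ∈-cells⁺ σ′ σ (m≤n⇒m≤1+n f) lt , adjacent-right i j , refl
    ... | no  nlt with ≤-antisym g (≮⇒≥ nlt)
    ... | e with i ≟ p
    ... | yes refl = ⊥-elim (<⇒≢ (subst (suc (u (i , j)) <_) (sym ends) h) (trans (cong₂ _+_ e (m+n∸m≡n p d)) refl))
    ... | no  ne = above (≤∧≢⇒< a (ne ∘ sym)) b e
      where
      above : ∀ {i} → p < i → i ≤ q → suc j ≡ s′ i → ∃[ e ] (e ∈ cells σ′ σ × adjacent (i , j) e ≡ true × u e ≡ suc (u (i , j)))
      above {suc i′} (s≤s p≤i′) b e = (i′ , j) , ∈-cells⁺ σ′ σ (≤-reflexive (sym j≡)) (subst (_< s′ i′) (sym j≡) (strict i′ p≤i′ (<⇒≤ b))) , adjacent-up i′ j ,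
          trans (cong (j +_) (+-∸-assoc 1 b)) (+-suc j _)
        where j≡ = suc-injective (trans e (inside i′ p≤i′ b))

    strip-connected : ∀ cs → cells σ′ σ ≡ cs → connected cs ≡ true
    strip-connected []       eq = refl
    strip-connected (c ∷ cs) eq = connected-intro c cs dist (∣n-n∣≡0 (u c)) bound closer
      where
      mem : ∀ {e} → e ∈ c ∷ cs → e ∈ cells σ′ σ
      mem = subst (_ ∈_) (sym eq)
      dist : Cell → ℕ
      dist e = ∣ u e - u c ∣
      len : suc (length cs) ≡ r
      len = +-cancelʳ-≡ (size σ) _ _ (trans (trans (cong (λ l → length l + size σ) (sym eq)) (length-cells {σ} {σ′} pσ sub)) (trans sz (+-comm (size σ) r)))
      bound : ∀ {e} → e ∈ c ∷ cs → dist e ≤ length cs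
      bound {e} e∈ = s≤s⁻¹ (subst (dist e <_) (sym len) (within (≤-total (u e) (u c))))
        where
        within : u e ≤ u c ⊎ u c ≤ u e → dist e < r
        within (inj₁ h) rewrite m≤n⇒∣m-n∣≡n∸m h = lia 5 (λ x y a r w → w :+ x :≡ y ⇒ a :≤ x ⇒ y :< a :+ r ⇒ ⊢ w :< r) (u e) (u c) (s q) r (u c ∸ u e) (m∸n+n≡m h) (u-low (mem e∈)) (u-high (mem (here refl)))
        within (inj₂ h) rewrite m≤n⇒∣n-m∣≡n∸m h = lia 5 (λ x y a r w → w :+ x :≡ y ⇒ a :≤ x ⇒ y :< a :+ r ⇒ ⊢ w :< r) (u c) (u e) (s q) r (u e ∸ u c) (m∸n+n≡m h) (u-low (mem (here refl))) (u-high (mem e∈))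
      closer : ∀ {e} → e ∈ c ∷ cs → e ≡ c ⊎ ∃[ e′ ] (e′ ∈ c ∷ cs × adjacent e e′ ≡ true × dist e′ < dist e)
      closer {e} e∈ with <-cmp (u e) (u c)
      ... | tri< h _ _ = case up (mem e∈) (≤-<-trans h (u-high (mem (here refl)))) of λ where
        (e′ , e′∈ , adj , q′) → inj₂ (e′ , subst (e′ ∈_) eq e′∈ , adj , subst₂ _<_ (sym (trans (cong (λ z → ∣ z - u c ∣) q′) (m≤n⇒∣m-n∣≡n∸m h))) (sym (m≤n⇒∣m-n∣≡n∸m (<⇒≤ h))) (∸-monoʳ-< (n<1+n (u e)) h))
      ... | tri> _ _ h = case down (mem e∈) (≤-<-trans (u-low (mem (here refl))) h) of λ where
        (e′ , e′∈ , adj , q′) → let h′ = s≤s⁻¹ (subst (u c <_) (sym q′) h) in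
          inj₂ (e′ , subst (e′ ∈_) eq e′∈ , adj , subst₂ _<_ (sym (m≤n⇒∣n-m∣≡n∸m h′)) (sym (m≤n⇒∣n-m∣≡n∸m (<⇒≤ h))) (∸-monoˡ-< (subst (u e′ <_) q′ (n<1+n (u e′))) h′))
      ... | tri≈ _ h _ = inj₁ (same (mem e∈) (mem (here refl)) h)
        where
        same : ∀ {i j i′ j′} → (i , j) ∈ cells σ′ σ → (i′ , j′) ∈ cells σ′ σ → u (i , j) ≡ u (i′ , j′) → (i , j) ≡ (i′ , j′)
        same {i} {j} {i′} {j′} a b h with <-cmp i i′
        ... | tri< l _ _ = ⊥-elim (u-injective a b l h)
        ... | tri> _ _ l = ⊥-elim (u-injective b a l (sym h))
        ... | tri≈ _ refl _ = cong (i ,_) (+-cancelʳ-≡ (q ∸ i) _ _ h)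

    strip-no2x2 : no2x2 (cells σ′ σ) ≡ true
    strip-no2x2 = cong not (¬true (λ e → case anyᵇ-sound _ (cells σ′ σ) e of λ where
      ((i , j) , c∈ , m) → case ∧-elim {memCell (i , suc j) (cells σ′ σ)} m of λ where
        (_ , m₂) → case ∧-elim {memCell (suc i , j) (cells σ′ σ)} m₂ of λ where
          (_ , m₃) → case cell⁻ c∈ , cell⁻ (memCell-sound {suc i , suc j} (cells σ′ σ) m₃) of λ where
            ((a , _ , f , _) , (_ , b′ , _ , g′)) → <⇒≱ (subst (suc j <_) (inside i a b′) g′) (s≤s f)))

  Strip⇒isStrip : isStrip r σ σ′ ≡ true
  Strip⇒isStrip = ∧-intro (⊆ᵇ-true σ σ′ sub) (∧-intro (subst (λ z → (size σ′ ≡ᵇ z) ≡ true) sz (≡ᵇ-refl (size σ′)))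
    (∧-intro (strip-connected (cells σ′ σ) refl) strip-no2x2))

  strip-sub : ∀ i → s i ≤ s′ i
  strip-sub = sub

Move⇒Strip : ∀ {r M σ σ′} → 0 < r → Decreasing (nth σ) → Decreasing (nth σ′) → length σ ≤ M → length σ′ ≤ M → (m : Move r M σ σ′) →
             size σ′ ≡ size σ + r × Strip σ σ′ (length (Move.b₁ m)) (length (Move.b₂ m))
Move⇒Strip {r} {M} {σ} {σ′} r>0 dσ dσ′ l l′ m = sz , record { outside = outside ; inside = inside ; strict = strict }
  where
  open Move m
  p = length b₁
  d = length b₂
  X = beta σ M
  X′ = beta σ′ M
  sz : size σ′ ≡ size σ + r
  sz = lia 9 (λ S₁ S₂ S₃ x t z z′ r w → S₁ :+ (S₂ :+ (x :+ S₃)) :≡ z :+ t ⇒ S₁ :+ (x :+ r :+ (S₂ :+ S₃)) :≡ z′ :+ t ⇒ ⊢ z′ :≡ z :+ r)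
    (sumℕ b₁) (sumℕ b₂) (sumℕ b₃) x (sumTo M (λ i → M ∸ suc i)) (size σ) (size σ′) r 0
    (trans (sym (trans (cong sumℕ before) (trans (sumℕ-++ b₁ _) (cong (sumℕ b₁ +_) (sumℕ-++ b₂ _))))) (sum-beta σ M l))
    (trans (sym (trans (cong sumℕ after) (trans (sumℕ-++ b₁ _) (cong (λ w → sumℕ b₁ + (x + r + w)) (sumℕ-++ b₂ b₃))))) (sum-beta σ′ M l′))
  lenX : p + (d + suc (length b₃)) ≡ M
  lenX = trans (sym (trans (cong length before) (trans (length-++ b₁) (cong (p +_) (length-++ b₂))))) (length-beta σ M)
  q<M : p + d < M
  q<M = subst (p + d <_) lenX (subst (_≤ p + (d + suc (length b₃))) (+-suc p d) (+-monoʳ-≤ p (≤-trans (≤-reflexive (+-comm 1 d)) (+-monoʳ-≤ d (s≤s z≤n)))))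
  b : ∀ {i} → i < M → nth X i + suc i ≡ nth σ i + M
  b = nth-beta σ M
  b′ : ∀ {i} → i < M → nth X′ i + suc i ≡ nth σ′ i + M
  b′ = nth-beta σ′ M
  same : ∀ {i} → nth X′ i ≡ nth X i → nth σ′ i ≡ nth σ i
  same {i} e with i <? M
  ... | yes h = +-cancelʳ-≡ M _ _ (trans (sym (b′ h)) (trans (cong (_+ suc i) e) (b h)))
  ... | no  h = trans (nth-beyond σ′ (≤-trans l′ (≮⇒≥ h))) (sym (nth-beyond σ (≤-trans l (≮⇒≥ h))))
  at : ∀ {Y} Z → Y ≡ Z → ∀ i → nth Y i ≡ nth Z i
  at Z e i = cong (λ l → nth l i) e
  outside : ∀ i → i < p ⊎ p + d < i → nth σ′ i ≡ nth σ i
  outside i (inj₁ h) = same (trans (at _ after i) (trans (nth-++ˡ b₁ _ h) (sym (trans (at _ before i) (nth-++ˡ b₁ _ h)))))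
  outside i (inj₂ h) with m≤n⇒∃[o]m+o≡n h
  ... | o , refl = same (trans (at _ after _) (trans (cong (nth (b₁ ++ x + r ∷ b₂ ++ b₃)) (trans (cong suc (+-assoc p d o)) (sym (+-suc p (d + o))))) (trans (nth-++ʳ b₁ (x + r ∷ b₂ ++ b₃) (suc (d + o))) (trans (nth-++ʳ b₂ b₃ o)
      (sym (trans (at _ before _) (trans (cong (nth (b₁ ++ b₂ ++ x ∷ b₃)) (trans (cong suc (+-assoc p d o)) (trans (sym (+-suc p (d + o))) (cong (p +_) (sym (+-suc d o)))))) (trans (nth-++ʳ b₁ (b₂ ++ x ∷ b₃) (d + suc o)) (nth-++ʳ b₂ (x ∷ b₃) (suc o))))))))))
  inside : ∀ i → p ≤ i → i < p + d → nth σ′ (suc i) ≡ suc (nth σ i)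
  inside i a h with m≤n⇒∃[o]m+o≡n a
  ... | o , refl = lia 6 (λ y y′ i s s′ M → y′ :+ (# 1 :+ (# 1 :+ i)) :≡ s′ :+ M ⇒ y :+ (# 1 :+ i) :≡ s :+ M ⇒ y′ :≡ y ⇒ ⊢ s′ :≡ # 1 :+ s)
      (nth X (p + o)) (nth X′ (suc (p + o))) (p + o) (nth σ (p + o)) (nth σ′ (suc (p + o))) M (b′ (≤-<-trans h q<M)) (b (<-trans h q<M))
      (trans (at _ after _) (trans (cong (nth (b₁ ++ x + r ∷ b₂ ++ b₃)) (sym (+-suc p o))) (trans (nth-++ʳ b₁ (x + r ∷ b₂ ++ b₃) (suc o)) (trans (nth-++ˡ b₂ b₃ o<d)
        (sym (trans (at _ before _) (trans (nth-++ʳ b₁ (b₂ ++ x ∷ b₃) o) (nth-++ˡ b₂ (x ∷ b₃) o<d))))))))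
    where o<d = +-cancelˡ-< p _ _ h
  strict : ∀ i → p ≤ i → i ≤ p + d → nth σ i < nth σ′ i
  strict i a h with i ≟ p
  ... | no  ne = below (≤∧≢⇒< a (ne ∘ sym)) h
    where below : ∀ {i} → p < i → i ≤ p + d → nth σ i < nth σ′ i
          below {suc i} (s≤s a) h = ≤-trans (s≤s (dσ i)) (≤-reflexive (sym (inside i a h)))
  ... | yes refl with d in de
  ... | zero  = lia 7 (λ y y′ i s s′ M r → y′ :+ i :≡ s′ :+ M ⇒ y :+ i :≡ s :+ M ⇒ y′ :≡ y :+ r ⇒ # 1 :≤ r ⇒ ⊢ s :< s′)
      (nth X p) (nth X′ p) (suc p) (nth σ p) (nth σ′ p) M r (b′ p<M) (b p<M) (trans (atp′) (cong (_+ r) (sym (trans (at _ before p) (trans (cong (nth (b₁ ++ b₂ ++ x ∷ b₃)) (sym (+-identityʳ p))) (trans (nth-++ʳ b₁ (b₂ ++ x ∷ b₃) 0) (empty b₂ de))))))) r>0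
    where
    p<M : p < M
    p<M = ≤-<-trans (m≤m+n p _) q<M
    atp′ : nth X′ p ≡ x + r
    atp′ = trans (at _ after p) (trans (cong (nth (b₁ ++ x + r ∷ b₂ ++ b₃)) (sym (+-identityʳ p))) (nth-++ʳ b₁ (x + r ∷ b₂ ++ b₃) 0))
    empty : ∀ b₂ → length b₂ ≡ 0 → nth (b₂ ++ x ∷ b₃) 0 ≡ x
    empty [] _ = refl
  ... | suc d′ = ≤-trans (≤-reflexive (sym (inside p ≤-refl (subst (λ n → p < p + n) (sym de) (m<m+n p (s≤s z≤n)))))) (dσ′ p)

-- The sign of a decomposable skew partition

decreasing-sound : ∀ l → decreasingᵇ l ≡ true → Linked (λ a b → b ≤ a) l
decreasing-sound []          e = []
decreasing-sound (x ∷ [])    e = [-]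
decreasing-sound (x ∷ y ∷ l) e = ≤ᵇ-sound (proj₁ (∧-elim e)) ∷ decreasing-sound (y ∷ l) (proj₂ (∧-elim {y ≤ᵇ x} e))

decreasing-true : ∀ l → Decreasing (nth l) → decreasingᵇ l ≡ true
decreasing-true []          d = refl
decreasing-true (x ∷ [])    d = refl
decreasing-true (x ∷ y ∷ l) d = ∧-intro (≤ᵇ-true (d 0)) (decreasing-true (y ∷ l) (d ∘ suc))

boxed : List ℕ → List (List ℕ)
boxed ν = listProduct (map (λ x → range (suc x)) ν)

∈-boxed⁻ : ∀ ν {l} → l ∈ boxed ν → length l ≡ length ν × (∀ i → nth l i ≤ nth ν i)
∈-boxed⁻ []      (here refl) = refl , λ _ → z≤n
∈-boxed⁻ (x ∷ ν) i with ∈-listProduct⁻ (range (suc x)) (map (λ x → range (suc x)) ν) i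
... | y , l , y∈ , l∈ , refl with ∈-boxed⁻ ν l∈
... | e , h = cong suc e , λ where zero    → s≤s⁻¹ (∈-range⁻ (suc x) y∈)
                                   (suc i) → h i

∈-boxed⁺ : ∀ ν f → (∀ i → f i ≤ nth ν i) → applyUpTo f (length ν) ∈ boxed ν
∈-boxed⁺ []      f h = here refl
∈-boxed⁺ (x ∷ ν) f h = ∈-listProduct⁺ (range (suc x)) (map (λ x → range (suc x)) ν) (∈-range⁺ (s≤s (h 0))) (∈-boxed⁺ ν (f ∘ suc) (h ∘ suc))

length-dropZeros : ∀ l → length (dropZeros l) ≤ length l
length-dropZeros []          = z≤n
length-dropZeros (zero ∷ l)  = m≤n⇒m≤1+n (length-dropZeros l)
length-dropZeros (suc x ∷ l) = s≤s (length-dropZeros l)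

∈-subPartitions⁻ : ∀ ν {σ} → σ ∈ subPartitions ν → IsPartition σ × (∀ i → nth σ i ≤ nth ν i) × length σ ≤ length ν
∈-subPartitions⁻ ν i with ∈-map⁻ dropZeros (filt decreasingᵇ (boxed ν)) i
... | l , l∈ , refl with ∈-filt⁻ decreasingᵇ (boxed ν) l∈
... | l∈′ , dl with ∈-boxed⁻ ν l∈′ | dropZeros-nth (decreasing-sound l dl)
... | e , h | same , part = part , (λ i → ≤-trans (≤-reflexive (same i)) (h i)) , ≤-trans (length-dropZeros l) (≤-reflexive e)

nth-applyUpTo-all : ∀ f n → (∀ i → n ≤ i → f i ≡ 0) → ∀ i → nth (applyUpTo f n) i ≡ f i
nth-applyUpTo-all f n h i with i <? n
... | yes p = nth-applyUpTo f n p
... | no  p = trans (nth-beyond (applyUpTo f n) (≤-trans (≤-reflexive (length-applyUpTo f n)) (≮⇒≥ p))) (sym (h i (≮⇒≥ p)))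

∈-subPartitions⁺ : ∀ ν {σ} → IsPartition σ → (∀ i → nth σ i ≤ nth ν i) → σ ∈ subPartitions ν
∈-subPartitions⁺ ν {σ} part h = subst (_∈ subPartitions ν) (partition-ext (proj₂ dz) part (λ i → trans (proj₁ dz i) (nth≡ i)))
    (∈-map⁺ dropZeros (∈-filt⁺ decreasingᵇ (∈-boxed⁺ ν (nth σ) h) dec))
  where
  l = applyUpTo (nth σ) (length ν)
  nth≡ : ∀ i → nth l i ≡ nth σ i
  nth≡ = nth-applyUpTo-all (nth σ) (length ν) (λ i p → n≤0⇒n≡0 (≤-trans (h i) (≤-reflexive (nth-beyond ν p))))
  dec : decreasingᵇ l ≡ true
  dec = decreasing-true l (λ i → subst₂ _≤_ (sym (nth≡ (suc i))) (sym (nth≡ i)) (IsPartition⇒Decreasing part i))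
  dz = dropZeros-nth (decreasing-sound l dec)

Unique-subPartitions : ∀ ν → Unique (subPartitions ν)
Unique-subPartitions ν = Unique-map dropZeros inj (Unique-filt decreasingᵇ (Unique-listProduct _ (∈-All _ (λ i → case ∈-map⁻ _ ν i of λ where
    (x , _ , refl) → Unique-range (suc x)))))
  where
  inj : ∀ {l l′} → l ∈ filt decreasingᵇ (boxed ν) → l′ ∈ filt decreasingᵇ (boxed ν) → dropZeros l ≡ dropZeros l′ → l ≡ l′
  inj {l} {l′} a b e with ∈-filt⁻ decreasingᵇ (boxed ν) a | ∈-filt⁻ decreasingᵇ (boxed ν) b
  ... | a∈ , da | b∈ , db = list-ext l l′ (trans (proj₁ (∈-boxed⁻ ν a∈)) (sym (proj₁ (∈-boxed⁻ ν b∈))))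
    (λ i _ → trans (sym (proj₁ (dropZeros-nth (decreasing-sound l da)) i)) (trans (cong (λ l → nth l i) e) (proj₁ (dropZeros-nth (decreasing-sound l′ db)) i)))

negOnePow-even : ∀ n → negOnePow (n + n) ≡ 1ℤ
negOnePow-even zero    = refl
negOnePow-even (suc n) = trans (cong (λ k → -ᶻ negOnePow k) (+-suc n n)) (trans (ℤ.neg-involutive (negOnePow (n + n))) (negOnePow-even n))

descending-middle : ∀ p {x q} → Descending (p ++ x ∷ q) → (∀ {y} → y ∈ p → x < y) × (∀ {y} → y ∈ q → y < x)
descending-middle []      (h ∷ d) = (λ ()) , All-∈ h
descending-middle (z ∷ p) (h ∷ d) with descending-middle p d
... | f , g = (λ where (here refl) → All-∈ h (∈-++⁺ʳ p (here refl))
                       (there i)   → f i) , g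

module Chains (r : ℕ) .{{_ : NonZero r}} where
  open Abacus r

  residue-gap : ∀ {x y} → x < y → y % r ≡ x % r → x + r ≤ y
  residue-gap {x} {y} h e = subst₂ _≤_ (trans (position-eta-suc) refl) (position-eta y) (≤-trans (+-monoʳ-≤ (x % r) (*-monoʳ-≤ r quot<)) (≤-reflexive (cong (_+ r * (y / r)) (sym e))))
    where
    quot< : suc (x / r) ≤ y / r
    quot< = *-cancelˡ-< r _ _ (+-cancelˡ-< (x % r) _ _ (subst₂ _<_ (sym (position-eta x)) (trans (sym (position-eta y)) (cong (_+ r * (y / r)) e)) h))
    position-eta-suc : x % r + r * suc (x / r) ≡ x + r
    position-eta-suc = trans (cong (x % r +_) (trans (*-suc r (x / r)) (+-comm r _))) (trans (sym (+-assoc (x % r) _ _)) (cong (_+ r) (position-eta x)))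

  private
    later : ℕ → List ℕ → ℕ
    later x X = countᵇ (λ y → x % r <ᵇ y % r) X

    later-middle : ∀ w p y q → later w (p ++ y ∷ q) ≡ b2n (w % r <ᵇ y % r) + later w (p ++ q)
    later-middle w []      y q = countᵇ-∷ _ y q
    later-middle w (z ∷ p) y q rewrite countᵇ-∷ (λ y → w % r <ᵇ y % r) z (p ++ y ∷ q) | countᵇ-∷ (λ y → w % r <ᵇ y % r) z (p ++ q) | later-middle w p y q =
      lia 3 (λ a b c → ⊢ a :+ (b :+ c) :≡ b :+ (a :+ c)) (b2n (w % r <ᵇ z % r)) (b2n (w % r <ᵇ y % r)) (later w (p ++ q))

    inversions-swap : ∀ p y z q → ¬ y % r ≡ z % r → negOnePow (inversions (p ++ y ∷ z ∷ q)) ≡ -ᶻ negOnePow (inversions (p ++ z ∷ y ∷ q))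
    inversions-swap [] y z q ne rewrite countᵇ-∷ (λ x → y % r <ᵇ x % r) z q | countᵇ-∷ (λ x → z % r <ᵇ x % r) y q with <-cmp (y % r) (z % r)
    ... | tri≈ _ e _ = ⊥-elim (ne e)
    ... | tri< h _ _ rewrite <ᵇ-true h | <ᵇ-false {z % r} {y % r} (<⇒≤ h) = cong (λ n → -ᶻ negOnePow n) (rot (later y q) (later z q) (inversions q))
      where rot : ∀ a b c → a + (b + c) ≡ b + (a + c)
            rot = lia 3 λ a b c → ⊢ a :+ (b :+ c) :≡ b :+ (a :+ c)
    ... | tri> _ _ h rewrite <ᵇ-true h | <ᵇ-false {y % r} {z % r} (<⇒≤ h) =
      trans (cong negOnePow (lia 3 (λ a b c → ⊢ a :+ (b :+ c) :≡ b :+ (a :+ c)) (later y q) (later z q) (inversions q))) (sym (ℤ.neg-involutive _))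
    inversions-swap (w ∷ p) y z q ne = trans (negOnePow-+ (later w (p ++ y ∷ z ∷ q)) _) (trans (cong₂ _*ᶻ_ (cong negOnePow swap) (inversions-swap p y z q ne))
      (trans (sym (ℤ.neg-distribʳ-* (negOnePow (later w (p ++ z ∷ y ∷ q))) (negOnePow (inversions (p ++ z ∷ y ∷ q))))) (cong -ᶻ_ (sym (negOnePow-+ (later w (p ++ z ∷ y ∷ q)) (inversions (p ++ z ∷ y ∷ q)))))))
      where
      swap : later w (p ++ y ∷ z ∷ q) ≡ later w (p ++ z ∷ y ∷ q)
      swap = trans (later-middle w p y (z ∷ q)) (trans (cong (b2n (w % r <ᵇ y % r) +_) (later-middle w p z q)) (sym (trans (later-middle w p z (y ∷ q))
        (trans (cong (b2n (w % r <ᵇ z % r) +_) (later-middle w p y q)) (lia 3 (λ a b c → ⊢ a :+ (b :+ c) :≡ b :+ (a :+ c)) (b2n (w % r <ᵇ z % r)) (b2n (w % r <ᵇ y % r)) (later w (p ++ q)))))))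

    inversions-pass : ∀ p x b q → (∀ {y} → y ∈ b → ¬ x % r ≡ y % r) → negOnePow (inversions (p ++ x ∷ b ++ q)) ≡ negOnePow (length b) *ᶻ negOnePow (inversions (p ++ b ++ x ∷ q))
    inversions-pass p x []      q h = sym (ℤ.*-identityˡ _)
    inversions-pass p x (y ∷ b) q h = begin
      negOnePow (inversions (p ++ x ∷ y ∷ b ++ q))            ≡⟨ inversions-swap p x y (b ++ q) (h (here refl)) ⟩
      -ᶻ negOnePow (inversions (p ++ y ∷ x ∷ b ++ q))         ≡⟨ cong (λ l → -ᶻ negOnePow (inversions l)) (sym (++-assoc p (y ∷ []) _)) ⟩
      -ᶻ negOnePow (inversions ((p ++ y ∷ []) ++ x ∷ b ++ q)) ≡⟨ cong -ᶻ_ (inversions-pass (p ++ y ∷ []) x b q (h ∘ there)) ⟩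
      -ᶻ (negOnePow (length b) *ᶻ negOnePow (inversions ((p ++ y ∷ []) ++ b ++ x ∷ q)))
        ≡⟨ trans (ℤ.neg-distribˡ-* (negOnePow (length b)) _) (cong (λ l → (-ᶻ negOnePow (length b)) *ᶻ negOnePow (inversions l)) (++-assoc p (y ∷ []) _)) ⟩
      (-ᶻ negOnePow (length b)) *ᶻ negOnePow (inversions (p ++ y ∷ b ++ x ∷ q)) ∎
      where open ≡-Reasoning

    residue-replace : ∀ p x q → inversions (p ++ x + r ∷ q) ≡ inversions (p ++ x ∷ q)
    residue-replace []      x q = cong (λ n → countᵇ (λ y → n <ᵇ y % r) q + inversions q) (DM.[m+n]%n≡m%n x r)
    residue-replace (w ∷ p) x q = cong₂ _+_ (trans (later-middle w p (x + r) q) (trans (cong (λ n → b2n (w % r <ᵇ n) + later w (p ++ q)) (DM.[m+n]%n≡m%n x r)) (sym (later-middle w p x q)))) (residue-replace p x q)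

  -- The moved bead keeps its residue, and every bead passed lies strictly between `x` and `x + r`,
  -- hence on another runner. Each passage of such a bead changes the number of inversions by one.
  move-inversions : ∀ {M σ σ′} → Decreasing (nth σ) → Decreasing (nth σ′) → (m : Move r M σ σ′) →
    negOnePow (inversions (beta σ′ M)) ≡ negOnePow (length (Move.b₂ m)) *ᶻ negOnePow (inversions (beta σ M))
  move-inversions {M} {σ} {σ′} dσ dσ′ m = trans (cong (negOnePow ∘ inversions) after) (trans (cong negOnePow (residue-replace b₁ x (b₂ ++ b₃)))
    (trans (inversions-pass b₁ x b₂ b₃ distinct) (cong (λ l → negOnePow (length b₂) *ᶻ negOnePow (inversions l)) (sym before))))
    where
    open Move m
    distinct : ∀ {y} → y ∈ b₂ → ¬ x % r ≡ y % r
    distinct {y} i e = <⇒≱ (proj₂ (descending-middle b₁ (subst Descending after (beta-descending σ′ M dσ′))) (∈-++⁺ˡ i))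
      (residue-gap (proj₁ (descending-middle (b₁ ++ b₂) (subst Descending (trans before (sym (++-assoc b₁ b₂ _))) (beta-descending σ M dσ))) (∈-++⁺ʳ b₁ i)) (sym e))

  signOf : ℕ → List ℕ → ℤ
  signOf M σ = negOnePow (inversions (beta σ M))

  signOf-square : ∀ M σ → signOf M σ *ᶻ signOf M σ ≡ 1ℤ
  signOf-square M σ = trans (sym (negOnePow-+ n n)) (negOnePow-even n)
    where n = inversions (beta σ M)

  strip-sign : ∀ {M σ σ′} → IsPartition σ → IsPartition σ′ → length σ ≤ M → length σ′ ≤ M → isStrip r σ σ′ ≡ true →
               signOf M σ′ ≡ negOnePow (height (cells σ′ σ)) *ᶻ signOf M σ
  strip-sign {M} {σ} {σ′} pσ pσ′ lσ lσ′ e = trans (move-inversions (IsPartition⇒Decreasing pσ) (IsPartition⇒Decreasing pσ′) (proj₁ m))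
      (cong (λ n → negOnePow n *ᶻ signOf M σ) (trans (proj₂ m) (sym (strip-height (proj₂ (proj₂ (proj₂ S)))))))
    where
    S = isStrip⇒Strip {r} {σ} {σ′} r>0 (IsPartition⇒Decreasing pσ) (IsPartition⇒Decreasing pσ′) e
    m = Strip⇒Move {r} {M} lσ lσ′ (proj₁ S) (proj₂ (proj₂ (proj₂ S)))

  if-∈ : {A : Set} (b : Bool) {xs : List A} {z : A} → z ∈ (if b then xs else []) → b ≡ true × z ∈ xs
  if-∈ true i = refl , i

  -- By `strip-sign` each strip contributes the quotient of the sorting signs of its two ends. The
  -- product telescopes, so the sign of a chain depends on its ends only.
  chainSigns-sound : ∀ {M ν} → IsPartition ν → length ν ≤ M → ∀ k {σ z} → IsPartition σ → length σ ≤ M → z ∈ chainSigns r ν k σ → z ≡ signOf M σ *ᶻ signOf M ν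
  chainSigns-sound {M} {ν} pν lν zero    {σ} pσ lσ i with if-∈ (eqL σ ν) i
  ... | e , here refl = sym (trans (cong (λ ρ → signOf M ρ *ᶻ signOf M ν) (eqL-sound σ ν e)) (signOf-square M ν))
  chainSigns-sound {M} {ν} pν lν (suc k) {σ} {z} pσ lσ i = found (∈-concatMap⁻ _ (subPartitions ν) i)
    where
    continue : ∀ σ′ → σ′ ∈ subPartitions ν → isStrip r σ σ′ ≡ true → ∀ {z′} → z′ ∈ chainSigns r ν k σ′ → negOnePow (height (cells σ′ σ)) *ᶻ z′ ≡ signOf M σ *ᶻ signOf M ν
    continue σ′ σ′∈ e {z′} z′∈ = begin
      s *ᶻ z′                                ≡⟨ cong (s *ᶻ_) (chainSigns-sound pν lν k pσ′ lσ′ z′∈) ⟩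
      s *ᶻ (signOf M σ′ *ᶻ signOf M ν)       ≡⟨ cong (λ w → s *ᶻ (w *ᶻ signOf M ν)) (strip-sign pσ pσ′ lσ lσ′ e) ⟩
      s *ᶻ (s *ᶻ signOf M σ *ᶻ signOf M ν)   ≡⟨ regroup s (signOf M σ) (signOf M ν) ⟩
      s *ᶻ s *ᶻ (signOf M σ *ᶻ signOf M ν)   ≡⟨ cong (_*ᶻ (signOf M σ *ᶻ signOf M ν)) (trans (sym (negOnePow-+ b b)) (negOnePow-even b)) ⟩
      1ℤ *ᶻ (signOf M σ *ᶻ signOf M ν)       ≡⟨ ℤ.*-identityˡ _ ⟩
      signOf M σ *ᶻ signOf M ν ∎
      where
      open ≡-Reasoning
      b = height (cells σ′ σ)
      s = negOnePow b
      pσ′ = proj₁ (∈-subPartitions⁻ ν σ′∈)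
      lσ′ = ≤-trans (proj₂ (proj₂ (∈-subPartitions⁻ ν σ′∈))) lν
      regroup : ∀ a b c → a *ᶻ (a *ᶻ b *ᶻ c) ≡ a *ᶻ a *ᶻ (b *ᶻ c)
      regroup = solveᶻ 3 (λ a b c → a :*ᶻ (a :*ᶻ b :*ᶻ c) :=ᶻ a :*ᶻ a :*ᶻ (b :*ᶻ c)) refl
    found : ∃[ σ′ ] (σ′ ∈ subPartitions ν × z ∈ (if isStrip r σ σ′ then map (negOnePow (height (cells σ′ σ)) *ᶻ_) (chainSigns r ν k σ′) else [])) → z ≡ signOf M σ *ᶻ signOf M ν
    found (σ′ , σ′∈ , j) = signed (proj₁ ij) (∈-map⁻ _ (chainSigns r ν k σ′) (proj₂ ij))
      where
      ij = if-∈ (isStrip r σ σ′) j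
      signed : isStrip r σ σ′ ≡ true → ∃[ z′ ] (z′ ∈ chainSigns r ν k σ′ × z ≡ negOnePow (height (cells σ′ σ)) *ᶻ z′) → z ≡ signOf M σ *ᶻ signOf M ν
      signed e (z′ , z′∈ , eq) = trans eq (continue σ′ σ′∈ e z′∈)

  data Chain (M : ℕ) : List ℕ → ℕ → List ℕ → Set where
    done : ∀ {ν} → Chain M ν 0 ν
    move : ∀ {σ σ′ k ν} → IsPartition σ → length σ ≤ M → IsPartition σ′ → length σ′ ≤ M → Move r M σ σ′ → Chain M σ′ k ν → Chain M σ (suc k) ν

  private
    module MoveStrip {M σ σ′} (pσ : IsPartition σ) (lσ : length σ ≤ M) (pσ′ : IsPartition σ′) (lσ′ : length σ′ ≤ M) (m : Move r M σ σ′) where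
      strip = Move⇒Strip r>0 (IsPartition⇒Decreasing pσ) (IsPartition⇒Decreasing pσ′) lσ lσ′ m

  chain-sub : ∀ {M σ k ν} → Chain M σ k ν → ∀ i → nth σ i ≤ nth ν i
  chain-sub done                      i = ≤-refl
  chain-sub (move pσ lσ pσ′ lσ′ m c) i = ≤-trans (strip-sub r>0 pσ pσ′ (proj₁ S) (proj₂ S) i) (chain-sub c i)
    where S = MoveStrip.strip pσ lσ pσ′ lσ′ m

  chain-size : ∀ {M σ k ν} → Chain M σ k ν → size ν ≡ size σ + k * r
  chain-size done                      = sym (+-identityʳ _)
  chain-size {σ = σ} {suc k} (move pσ lσ pσ′ lσ′ m c) = trans (chain-size c) (trans (cong (_+ k * r) (proj₁ (MoveStrip.strip pσ lσ pσ′ lσ′ m))) (+-assoc (size σ) r _))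

  chain-signs : ∀ {M σ k ν} → Chain M σ k ν → ∃[ z ] z ∈ chainSigns r ν k σ
  chain-signs {ν = ν} done rewrite eqL-refl ν = 1ℤ , here refl
  chain-signs {M} {σ} {suc k} {ν} (move {σ′ = σ′} pσ lσ pσ′ lσ′ m c) with chain-signs c
  ... | z , z∈ = _ , ∈-concatMap⁺ _ (∈-subPartitions⁺ ν pσ′ (chain-sub c))
      (subst (λ b → negOnePow (height (cells σ′ σ)) *ᶻ z ∈ (if b then map (negOnePow (height (cells σ′ σ)) *ᶻ_) (chainSigns r ν k σ′) else []))
        (sym (Strip⇒isStrip r>0 pσ pσ′ (proj₁ S) (proj₂ S))) (∈-map⁺ _ z∈))
    where S = MoveStrip.strip pσ lσ pσ′ lσ′ m

  sgnR≡ : ∀ {M σ k ν} → IsPartition σ → length σ ≤ M → IsPartition ν → length ν ≤ M → Chain M σ k ν → sgnR r ν σ ≡ signOf M σ *ᶻ signOf M ν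
  sgnR≡ {M} {σ} {k} {ν} pσ lσ pν lν c = trans (cong (λ n → firstOr0 (chainSigns r ν n σ)) k≡) (first (chainSigns r ν k σ) (proj₂ (chain-signs c)) (chainSigns-sound pν lν k pσ lσ))
    where
    k≡ : (size ν ∸ size σ) / r ≡ k
    k≡ = trans (cong (_/ r) (trans (cong (_∸ size σ) (chain-size c)) (m+n∸m≡n (size σ) (k * r)))) (DM.m*n/n≡m k r)
    first : ∀ l {z w} → z ∈ l → (∀ {z} → z ∈ l → z ≡ w) → firstOr0 l ≡ w
    first (x ∷ l) _ h = h (here refl)

-- Existence of a decomposition into border strips

data Below : List ℕ → List ℕ → Set where
  []  : Below [] []
  _∷_ : ∀ {x y xs ys} → x ≤ y → Below xs ys → Below (x ∷ xs) (y ∷ ys)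

below-refl : ∀ xs → Below xs xs
below-refl []       = []
below-refl (x ∷ xs) = ≤-refl ∷ below-refl xs

below-++ : ∀ {xs ys xs′ ys′} → Below xs ys → Below xs′ ys′ → Below (xs ++ xs′) (ys ++ ys′)
below-++ []      b = b
below-++ (h ∷ a) b = h ∷ below-++ a b

below-map : ∀ {f : ℕ → ℕ} → (∀ {x y} → x ≤ y → f x ≤ f y) → ∀ {xs ys} → Below xs ys → Below (map f xs) (map f ys)
below-map m []      = []
below-map m (h ∷ b) = m h ∷ below-map m b

below-applyUpTo : ∀ n (f g : ℕ → ℕ) → (∀ i → f i ≤ g i) → Below (applyUpTo f n) (applyUpTo g n)
below-applyUpTo zero    f g h = []
below-applyUpTo (suc n) f g h = h 0 ∷ below-applyUpTo n (f ∘ suc) (g ∘ suc) (h ∘ suc)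

below-sum : ∀ {xs ys} → Below xs ys → sumℕ xs ≤ sumℕ ys
below-sum []      = z≤n
below-sum (h ∷ b) = +-mono-≤ h (below-sum b)

first-difference : ∀ {xs ys} → Below xs ys → ¬ xs ≡ ys →
  ∃[ zs ] ∃[ x ] ∃[ y ] ∃[ xs′ ] ∃[ ys′ ] (xs ≡ zs ++ x ∷ xs′ × ys ≡ zs ++ y ∷ ys′ × x < y × Below xs′ ys′)
first-difference []                    ne = ⊥-elim (ne refl)
first-difference (_∷_ {x} {y} {xs} {ys} h b) ne with x ≟ y
... | no  x≢y  = [] , x , y , xs , ys , refl , refl , ≤∧≢⇒< h x≢y , b
... | yes refl with first-difference b (ne ∘ cong (x ∷_))
... | zs , x′ , y′ , xs′ , ys′ , refl , refl , lt , b′ = x ∷ zs , x′ , y′ , xs′ , ys′ , refl , refl , lt , b′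

split-unique : ∀ {x : ℕ} as bs {as′ bs′} → Unique (as ++ x ∷ bs) → as ++ x ∷ bs ≡ as′ ++ x ∷ bs′ → as ≡ as′ × bs ≡ bs′
split-unique []       bs {[]}      u       refl = refl , refl
split-unique []       bs {a ∷ as′} (p ∷ u) refl = ⊥-elim (All-∈ p (∈-++⁺ʳ as′ (here refl)) refl)
split-unique (a ∷ as) bs {[]}      (p ∷ u) refl = ⊥-elim (All-∈ p (∈-++⁺ʳ as (here refl)) refl)
split-unique (a ∷ as) bs {a′ ∷ as′} {bs′} (p ∷ u) e with split-unique as bs {as′} {bs′} u (∷-injectiveʳ e)
... | ea , eb = cong₂ _∷_ (∷-injectiveˡ e) ea , eb

filt-++ : {A : Set} (p : A → Bool) (xs ys : List A) → filt p (xs ++ ys) ≡ filt p xs ++ filt p ys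
filt-++ p []       ys = refl
filt-++ p (x ∷ xs) ys with p x
... | true  = cong (x ∷_) (filt-++ p xs ys)
... | false = filt-++ p xs ys

filt-none : {A : Set} (p : A → Bool) (xs : List A) → (∀ {x} → x ∈ xs → p x ≡ false) → filt p xs ≡ []
filt-none p []       h = refl
filt-none p (x ∷ xs) h rewrite h (here refl) = filt-none p xs (h ∘ there)

filt-∷-yes : {A : Set} (p : A → Bool) (x : A) (xs : List A) → p x ≡ true → filt p (x ∷ xs) ≡ x ∷ filt p xs
filt-∷-yes p x xs e rewrite e = refl

filt-∷-no : {A : Set} (p : A → Bool) (x : A) (xs : List A) → p x ≡ false → filt p (x ∷ xs) ≡ filt p xs
filt-∷-no p x xs e rewrite e = refl

-- Moving a bead x of a descending list to an unoccupied larger position y.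
bead-split : ∀ {X x y} → Descending X → x ∈ X → ¬ y ∈ X → x < y →
  ∃[ b₁ ] ∃[ b₂ ] ∃[ b₃ ] (X ≡ b₁ ++ b₂ ++ x ∷ b₃ × (∀ z → z ∈ b₁ → y < z) × (∀ z → z ∈ b₂ → z < y × x < z))
bead-split {h ∷ X} {x} {y} (p ∷ d) i n x<y with y <? h
... | yes y<h = case tail i of λ where i′ → case bead-split d i′ (n ∘ there) x<y of λ where
    (b₁ , b₂ , b₃ , e , f , g) → h ∷ b₁ , b₂ , b₃ , cong (h ∷_) e , (λ { _ (here refl) → y<h ; z (there j) → f z j }) , g
  where tail : x ∈ h ∷ X → x ∈ X
        tail (here refl) = ⊥-elim (<-asym x<y y<h)
        tail (there j)   = j
... | no  y≮h with ∈-split i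
... | b₂ , b₃ , e = [] , b₂ , b₃ , e , (λ _ ()) , (λ z j → small (subst (z ∈_) (sym e) (∈-++⁺ˡ j)) , proj₁ mid j)
  where
  h<y : h < y
  h<y = ≤∧≢⇒< (≮⇒≥ y≮h) (λ where refl → n (here refl))
  small : ∀ {z} → z ∈ h ∷ X → z < y
  small (here refl) = h<y
  small (there j)   = <-trans (All-∈ p j) h<y
  mid = descending-middle b₂ (subst Descending e (p ∷ d))

descending-++⁻ : ∀ as {bs} → Descending (as ++ bs) → Descending as × Descending bs × (∀ {a b} → a ∈ as → b ∈ bs → b < a)
descending-++⁻ []       d = [] , d , λ ()
descending-++⁻ (a ∷ as) {bs} (h ∷ d) with descending-++⁻ as d
... | d₁ , d₂ , c = ∈-All as (λ i → All-∈ h (∈-++⁺ˡ i)) ∷ d₁ , d₂ , λ { (here refl) j → All-∈ h (∈-++⁺ʳ as j) ; (there i) j → c i j }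

descending-moved : ∀ {b₁ b₂ b₃ x y} → Descending (b₁ ++ b₂ ++ x ∷ b₃) → x < y → (∀ {z} → z ∈ b₁ → y < z) → (∀ {z} → z ∈ b₂ → z < y) → Descending (b₁ ++ y ∷ b₂ ++ b₃)
descending-moved {b₁} {b₂} {b₃} {x} {y} d x<y f g with descending-++⁻ b₁ d
... | d₁ , d₂₃ , c with descending-++⁻ b₂ d₂₃
... | d₂ , (h ∷ d₃) , c′ = AllPairs-++ d₁ (∈-All (b₂ ++ b₃) (λ i → case ∈-++⁻ b₂ i of λ where
      (inj₁ j) → g j
      (inj₂ j) → <-trans (All-∈ h j) x<y)
    ∷ AllPairs-++ d₂ d₃ (λ i j → c′ i (there j)))
  (λ {a} i j → case j of λ where
    (here refl) → f i
    (there k)   → case ∈-++⁻ b₂ k of λ where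
      (inj₁ l) → c i (∈-++⁺ˡ l)
      (inj₂ l) → c i (∈-++⁺ʳ b₂ (there l)))

module ChainExistence (r : ℕ) .{{_ : NonZero r}} where
  open Abacus r
  open Chains r

  -- Runner by runner, the beads of `X` are as many as those of `Y` and lie no higher. This is the
  -- invariant kept while beads are moved towards their targets.
  Dominated : List ℕ → List ℕ → Set
  Dominated X Y = ∀ j → j < r → Below (filt (residue j) X) (filt (residue j) Y)

  sum-classes : ∀ X → sumTo r (λ j → sumℕ (filt (residue j) X)) ≡ sumℕ X
  sum-classes []      = sumTo-0 r
  sum-classes (x ∷ X) = trans (trans (sumTo-cong r {g = λ j → (if x % r ≡ᵇ j then x else 0) + sumℕ (filt (residue j) X)} (λ j _ → one j)) (sumTo-+ r _ _)) (cong₂ _+_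
      (trans (sumTo-single r (x % r) {λ j → if x % r ≡ᵇ j then x else 0} (DM.m%n<n x r) (λ j _ ne → cong (if_then x else 0) (≡ᵇ-false (ne ∘ sym)))) (cong (if_then x else 0) (≡ᵇ-refl (x % r))))
      (sum-classes X))
    where one : ∀ j → sumℕ (filt (residue j) (x ∷ X)) ≡ (if x % r ≡ᵇ j then x else 0) + sumℕ (filt (residue j) X)
          one j with x % r ≡ᵇ j
          ... | true  = refl
          ... | false = refl

  dominated-sum : ∀ {X Y} → Dominated X Y → sumℕ X ≤ sumℕ Y
  dominated-sum {X} {Y} D = subst₂ _≤_ (sum-classes X) (sum-classes Y) (sumTo-mono r (λ j h → below-sum (D j h)))

  findDifference : ∀ X Y → (∀ j → j < r → filt (residue j) X ≡ filt (residue j) Y) ⊎ (∃[ j ] (j < r × ¬ filt (residue j) X ≡ filt (residue j) Y))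
  findDifference X Y = go r
    where
    go : ∀ n → (∀ j → j < n → filt (residue j) X ≡ filt (residue j) Y) ⊎ (∃[ j ] (j < n × ¬ filt (residue j) X ≡ filt (residue j) Y))
    go zero = inj₁ λ _ ()
    go (suc n) with go n | true-or-false (eqL (filt (residue n) X) (filt (residue n) Y))
    ... | inj₂ (j , h , ne) | _ = inj₂ (j , m<n⇒m<1+n h , ne)
    ... | inj₁ _ | inj₂ e = inj₂ (n , ≤-refl , λ q → case trans (sym e) (trans (cong (eqL (filt (residue n) X)) (sym q)) (eqL-refl (filt (residue n) X))) of λ ())
    ... | inj₁ h | inj₁ e = inj₁ λ j j<n → case j ≟ n of λ where
      (yes refl) → eqL-sound _ _ e
      (no ne)    → h j (≤∧≢⇒< (s≤s⁻¹ j<n) ne)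

  record NextMove (X Y : List ℕ) : Set where
    field
      b₁ b₂ b₃   : List ℕ
      x          : ℕ
      split      : X ≡ b₁ ++ b₂ ++ x ∷ b₃
      descending : Descending (b₁ ++ x + r ∷ b₂ ++ b₃)
      dominated  : Dominated (b₁ ++ x + r ∷ b₂ ++ b₃) Y

  -- The first beads, from the top of a runner, that disagree can be moved: the position r higher is free.
  module MoveBead {X Y : List ℕ} (dX : Descending X) (dY : Descending Y) (D : Dominated X Y) {j : ℕ} (zs xs ys : List ℕ) (x y : ℕ)
                  (ex : filt (residue j) X ≡ zs ++ x ∷ xs) (ey : filt (residue j) Y ≡ zs ++ y ∷ ys) (x<y : x < y) (b : Below xs ys) where
    private
      F : ℕ → List ℕ → List ℕ
      F i = filt (residue i)
      inX : x ∈ X × residue j x ≡ true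
      inX = ∈-filt⁻ (residue j) X (subst (x ∈_) (sym ex) (∈-++⁺ʳ zs (here refl)))
      xj : x % r ≡ j
      xj = ≡ᵇ-sound {x % r} (proj₂ inX)
      yj : y % r ≡ j
      yj = ≡ᵇ-sound {y % r} (proj₂ (∈-filt⁻ (residue j) Y (subst (y ∈_) (sym ey) (∈-++⁺ʳ zs (here refl)))))
      x+r≤y : x + r ≤ y
      x+r≤y = residue-gap x<y (trans yj (sym xj))
      shifted : ∀ i → residue i (x + r) ≡ residue i x
      shifted i = cong (_≡ᵇ i) (DM.[m+n]%n≡m%n x r)
      -- A bead at `x + r` would be on the runner of `x` and before it, hence in `zs`. The beads of
      -- `zs` also occur in `Y` before `y`, so they exceed `y`, which is at least `x + r`.
      free : ¬ x + r ∈ X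
      free i with ∈-++⁻ zs (subst (x + r ∈_) ex (∈-filt⁺ (residue j) i (trans (shifted j) (proj₂ inX))))
      ... | inj₁ k         = <⇒≱ (proj₁ (descending-middle zs (subst Descending ey (descending-filt (residue j) dY))) k) x+r≤y
      ... | inj₂ (here e)  = <⇒≢ (m<m+n x r>0) (sym e)
      ... | inj₂ (there k) = <⇒≱ (proj₂ (descending-middle zs (subst Descending ex (descending-filt (residue j) dX))) k) (m≤m+n x r)

    module Moved (b₁ b₂ b₃ : List ℕ) (e : X ≡ b₁ ++ b₂ ++ x ∷ b₃) (above : ∀ z → z ∈ b₁ → x + r < z) (between : ∀ z → z ∈ b₂ → z < x + r × x < z) where
      X′ : List ℕ
      X′ = b₁ ++ x + r ∷ b₂ ++ b₃

      descending′ : Descending X′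
      descending′ = descending-moved (subst Descending e dX) (m<m+n x r>0) (λ {z} → above z) (λ {z} k → proj₁ (between z k))

      otherClass : ∀ i → residue i x ≡ false → F i X ≡ F i X′
      otherClass i no-i = begin
        F i X                              ≡⟨ cong (F i) e ⟩
        F i (b₁ ++ b₂ ++ x ∷ b₃)           ≡⟨ filt-++ (residue i) b₁ (b₂ ++ x ∷ b₃) ⟩
        F i b₁ ++ F i (b₂ ++ x ∷ b₃)       ≡⟨ cong (F i b₁ ++_) (filt-++ (residue i) b₂ (x ∷ b₃)) ⟩
        F i b₁ ++ F i b₂ ++ F i (x ∷ b₃)   ≡⟨ cong (λ l → F i b₁ ++ F i b₂ ++ l) (filt-∷-no (residue i) x b₃ no-i) ⟩
        F i b₁ ++ F i b₂ ++ F i b₃         ≡⟨ cong (F i b₁ ++_) (sym (filt-++ (residue i) b₂ b₃)) ⟩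
        F i b₁ ++ F i (b₂ ++ b₃)           ≡⟨ cong (F i b₁ ++_) (sym (filt-∷-no (residue i) (x + r) (b₂ ++ b₃) (trans (shifted i) no-i))) ⟩
        F i b₁ ++ F i (x + r ∷ b₂ ++ b₃)   ≡⟨ sym (filt-++ (residue i) b₁ (x + r ∷ b₂ ++ b₃)) ⟩
        F i X′ ∎
        where open ≡-Reasoning

      b₂-none : F j b₂ ≡ []
      b₂-none = filt-none (residue j) b₂ (λ {z} k → ¬true (λ q → <⇒≱ (proj₁ (between z k)) (residue-gap (proj₂ (between z k)) (trans (≡ᵇ-sound {z % r} q) (sym xj)))))

      split : F j b₁ ++ x ∷ F j b₃ ≡ zs ++ x ∷ xs
      split = begin
        F j b₁ ++ x ∷ F j b₃               ≡⟨ cong (F j b₁ ++_) (sym (filt-∷-yes (residue j) x b₃ (proj₂ inX))) ⟩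
        F j b₁ ++ F j (x ∷ b₃)             ≡⟨ cong (λ l → F j b₁ ++ l ++ F j (x ∷ b₃)) (sym b₂-none) ⟩
        F j b₁ ++ F j b₂ ++ F j (x ∷ b₃)   ≡⟨ cong (F j b₁ ++_) (sym (filt-++ (residue j) b₂ (x ∷ b₃))) ⟩
        F j b₁ ++ F j (b₂ ++ x ∷ b₃)       ≡⟨ sym (filt-++ (residue j) b₁ (b₂ ++ x ∷ b₃)) ⟩
        F j (b₁ ++ b₂ ++ x ∷ b₃)           ≡⟨ cong (F j) (sym e) ⟩
        F j X                              ≡⟨ ex ⟩
        zs ++ x ∷ xs ∎
        where open ≡-Reasoning

      parts : F j b₁ ≡ zs × F j b₃ ≡ xs
      parts = split-unique (F j b₁) (F j b₃) (subst Unique (trans ex (sym split)) (descending-unique (descending-filt (residue j) dX))) split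

      ownClass : F j X′ ≡ zs ++ x + r ∷ xs
      ownClass = begin
        F j X′                             ≡⟨ filt-++ (residue j) b₁ (x + r ∷ b₂ ++ b₃) ⟩
        F j b₁ ++ F j (x + r ∷ b₂ ++ b₃)   ≡⟨ cong (F j b₁ ++_) (filt-∷-yes (residue j) (x + r) (b₂ ++ b₃) (trans (shifted j) (proj₂ inX))) ⟩
        F j b₁ ++ x + r ∷ F j (b₂ ++ b₃)   ≡⟨ cong (λ l → F j b₁ ++ x + r ∷ l) (filt-++ (residue j) b₂ b₃) ⟩
        F j b₁ ++ x + r ∷ F j b₂ ++ F j b₃ ≡⟨ cong (λ l → F j b₁ ++ x + r ∷ l ++ F j b₃) b₂-none ⟩
        F j b₁ ++ x + r ∷ F j b₃           ≡⟨ cong₂ (λ l l′ → l ++ x + r ∷ l′) (proj₁ parts) (proj₂ parts) ⟩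
        zs ++ x + r ∷ xs ∎
        where open ≡-Reasoning

      dominated′ : Dominated X′ Y
      dominated′ i i<r = decideClass (i ≟ j)
        where
        decideClass : Dec (i ≡ j) → Below (F i X′) (F i Y)
        decideClass (no  i≢j)  = subst (λ l → Below l (F i Y)) (otherClass i (≡ᵇ-false (λ q → i≢j (trans (sym q) xj)))) (D i i<r)
        decideClass (yes refl) = subst₂ Below (sym ownClass) (sym ey) (below-++ (below-refl zs) (x+r≤y ∷ b))

    moved : NextMove X Y
    moved = build (bead-split dX (proj₁ inX) free (m<m+n x r>0))
      where
      build : ∃[ b₁ ] ∃[ b₂ ] ∃[ b₃ ] (X ≡ b₁ ++ b₂ ++ x ∷ b₃ × (∀ z → z ∈ b₁ → x + r < z) × (∀ z → z ∈ b₂ → z < x + r × x < z)) → NextMove X Y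
      build (b₁ , b₂ , b₃ , e , above , between) = record { b₁ = b₁ ; b₂ = b₂ ; b₃ = b₃ ; x = x ; split = e ; descending = descending′ ; dominated = dominated′ }
        where open Moved b₁ b₂ b₃ e above between

  nextMove : ∀ {X Y} → Descending X → Descending Y → Dominated X Y → ∀ {j} → j < r → ¬ filt (residue j) X ≡ filt (residue j) Y → NextMove X Y
  nextMove {X} {Y} dX dY D {j} j<r ne = build (first-difference (D j j<r) ne)
    where
    build : ∃[ zs ] ∃[ x ] ∃[ y ] ∃[ xs ] ∃[ ys ] (filt (residue j) X ≡ zs ++ x ∷ xs × filt (residue j) Y ≡ zs ++ y ∷ ys × x < y × Below xs ys) → NextMove X Y
    build (zs , x , y , xs , ys , ex , ey , x<y , b) = MoveBead.moved dX dY D {j} zs xs ys x y ex ey x<y b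

  module MovePartition {M : ℕ} {σ ν : List ℕ} (n : NextMove (beta σ M) (beta ν M)) where
    open NextMove n
    private
      X′ : List ℕ
      X′ = b₁ ++ x + r ∷ b₂ ++ b₃
      length-X′ : length X′ ≡ M
      length-X′ = begin
        length X′                                    ≡⟨ length-++ b₁ ⟩
        length b₁ + suc (length (b₂ ++ b₃))          ≡⟨ cong (λ k → length b₁ + suc k) (length-++ b₂) ⟩
        length b₁ + suc (length b₂ + length b₃)      ≡⟨ cong (length b₁ +_) (sym (+-suc (length b₂) (length b₃))) ⟩
        length b₁ + (length b₂ + length (x ∷ b₃))    ≡⟨ cong (length b₁ +_) (sym (length-++ b₂)) ⟩
        length b₁ + length (b₂ ++ x ∷ b₃)            ≡⟨ sym (length-++ b₁) ⟩
        length (b₁ ++ b₂ ++ x ∷ b₃)                  ≡⟨ cong length (sym split) ⟩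
        length (beta σ M)                            ≡⟨ length-beta σ M ⟩
        M ∎
        where open ≡-Reasoning
      module F′ = FromBeta X′ (descending-unique descending)

    σ′ : List ℕ
    σ′ = fromBeta X′

    partition′ : IsPartition σ′
    partition′ = F′.fromBeta-partition

    length′ : length σ′ ≤ M
    length′ = subst (length σ′ ≤_) length-X′ F′.length-fromBeta

    beta-σ′ : beta σ′ M ≡ X′
    beta-σ′ = trans (cong (beta σ′) (sym length-X′)) (trans (F′.beta-fromBeta 0) (trans (++-identityʳ _) (trans (map-id (sorted X′)) (sorted-descending descending))))

    asMove : Move r M σ σ′
    asMove = record { b₁ = b₁ ; b₂ = b₂ ; b₃ = b₃ ; x = x ; before = split ; after = beta-σ′ }

    sum′ : sumℕ (beta σ′ M) ≡ sumℕ (beta σ M) + r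
    sum′ = lia 7 (λ s₁ s₂ s₃ x r w w′ → w :≡ s₁ :+ (x :+ r :+ (s₂ :+ s₃)) ⇒ w′ :≡ s₁ :+ (s₂ :+ (x :+ s₃)) ⇒ ⊢ w :≡ w′ :+ r) (sumℕ b₁) (sumℕ b₂) (sumℕ b₃) x r (sumℕ (beta σ′ M)) (sumℕ (beta σ M))
      (trans (cong sumℕ beta-σ′) (trans (sumℕ-++ b₁ _) (cong (λ w → sumℕ b₁ + (x + r + w)) (sumℕ-++ b₂ b₃))))
      (trans (cong sumℕ split) (trans (sumℕ-++ b₁ _) (cong (sumℕ b₁ +_) (sumℕ-++ b₂ _))))

    dominated-σ′ : Dominated (beta σ′ M) (beta ν M)
    dominated-σ′ = subst (λ X → Dominated X (beta ν M)) (sym beta-σ′) dominated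

  -- Each move raises the sum of the positions by `r > 0`, while domination keeps it at most that of
  -- the target. So `n`, a bound on the remaining difference, serves as fuel.
  chain-exists : ∀ {M ν} → IsPartition ν → length ν ≤ M → ∀ n {σ} → IsPartition σ → length σ ≤ M →
    sumℕ (beta ν M) ≤ sumℕ (beta σ M) + n → Dominated (beta σ M) (beta ν M) → ∃[ k ] Chain M σ k ν
  chain-exists {M} {ν} pν lν n {σ} pσ lσ bound D = decideEnd (findDifference (beta σ M) (beta ν M))
    where
    dσ = beta-descending σ M (IsPartition⇒Decreasing pσ)
    dν = beta-descending ν M (IsPartition⇒Decreasing pν)
    transfer : ∀ {X Y} → (∀ j → j < r → filt (residue j) X ≡ filt (residue j) Y) → ∀ {z} → z ∈ X → z ∈ Y
    transfer {X} {Y} same {z} i = proj₁ (∈-filt⁻ (residue (z % r)) Y (subst (z ∈_) (same (z % r) (DM.m%n<n z r)) (∈-filt⁺ (residue (z % r)) i (≡ᵇ-refl (z % r)))))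
    next : ∀ n → sumℕ (beta ν M) ≤ sumℕ (beta σ M) + n → (m : NextMove (beta σ M) (beta ν M)) → ∃[ k ] Chain M σ k ν
    next zero    h m = ⊥-elim (lia 4 (λ a b c r → a :≤ b :+ # 0 ⇒ c :≡ b :+ r ⇒ c :≤ a ⇒ # 1 :≤ r ⇒ ⊢ absurd) (sumℕ (beta ν M)) (sumℕ (beta σ M)) (sumℕ (beta σ′ M)) r h sum′ (dominated-sum {beta σ′ M} {beta ν M} dominated-σ′) r>0)
      where open MovePartition {M} {σ} {ν} m
    next (suc n) h m = suc (proj₁ rest) , move pσ lσ partition′ length′ asMove (proj₂ rest)
      where
      open MovePartition {M} {σ} {ν} m
      rest = chain-exists pν lν n partition′ length′
          (lia 5 (λ a b c r n → a :≤ b :+ (# 1 :+ n) ⇒ c :≡ b :+ r ⇒ # 1 :≤ r ⇒ ⊢ a :≤ c :+ n) (sumℕ (beta ν M)) (sumℕ (beta σ M)) (sumℕ (beta σ′ M)) r n h sum′ r>0) dominated-σ′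
    decideEnd : (∀ j → j < r → filt (residue j) (beta σ M) ≡ filt (residue j) (beta ν M)) ⊎ (∃[ j ] (j < r × ¬ filt (residue j) (beta σ M) ≡ filt (residue j) (beta ν M))) → ∃[ k ] Chain M σ k ν
    decideEnd (inj₁ same) = 0 , subst (λ ρ → Chain M σ 0 ρ) (beta-injective M pσ pν lσ lν (descending-ext dσ dν (λ i → transfer same i) (λ i → transfer (λ j h → sym (same j h)) i))) done
    decideEnd (inj₂ (j , j<r , ne)) = next n bound (nextMove dσ dν D j<r ne)

-- Multipartitions and the partition (ν/τ, τ)⋆

sumTo-1 : ∀ n → sumTo n (λ _ → 1) ≡ n
sumTo-1 zero    = refl
sumTo-1 (suc n) = trans (cong (_+ 1) (sumTo-1 n)) (+-comm n 1)

nth-pos : ∀ {p} → IsPartition p → ∀ i → i < length p → 0 < nth p i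
nth-pos (_ , a) i h = go a i h
  where go : ∀ {p} → All (0 <_) p → ∀ i → i < length p → 0 < nth p i
        go (x ∷ a) zero    h       = x
        go (x ∷ a) (suc i) (s≤s h) = go a i h

length-mono : ∀ {p q} → IsPartition p → (∀ i → nth p i ≤ nth q i) → length p ≤ length q
length-mono {p} {q} part h = partition-length (length q) part (n≤0⇒n≡0 (≤-trans (h (length q)) (≤-reflexive (nth-beyond q ≤-refl))))

module _ {ρ σ : List ℕ} {n : ℕ} (pρ : IsPartition ρ) (pσ : IsPartition σ) (sub : ∀ i → nth ρ i ≤ nth σ i) (sz : size σ ≤ size ρ + n) where
  private
    len≤ : length ρ ≤ length σ
    len≤ = length-mono {ρ} {σ} pρ sub

  -- Every row of `σ` beyond those of `ρ` contains at least one of the at most `n` added boxes.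
  length-super : length σ ≤ length ρ + n
  length-super = ≮⇒≥ λ h → <⇒≱ (s≤s sz) (≤-trans (≤-trans (≤-reflexive (trans (sym (+-suc (size ρ) n)) (cong₂ _+_ (size-sumTo ρ a ≤-refl) (sym (sumTo-1 (suc n))))))
      (≤-trans (+-mono-≤ (sumTo-mono a (λ i _ → sub i)) (sumTo-mono (suc n) {λ _ → 1} {λ i → nth σ (a + i)} (λ i i< → nth-pos pσ (a + i) (≤-trans (≤-trans (+-monoʳ-< a i<) (≤-reflexive (+-suc a n))) h))))
        (≤-trans (≤-reflexive (sym (sumTo-split a (suc n) (nth σ)))) (m≤m+n _ (sumTo (length σ) (λ i → nth σ (a + suc n + i)))))))
      (≤-reflexive (trans (sym (sumTo-split (a + suc n) (length σ) (nth σ))) (sym (size-sumTo σ (a + suc n + length σ) (m≤n+m _ _))))))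
    where a = length ρ

  head-super : nth σ 0 ≤ nth ρ 0 + n
  head-super = lia 7 (λ s t s₀ t₀ σ ρ n → σ :≡ s₀ :+ s ⇒ ρ :≡ t₀ :+ t ⇒ t :≤ s ⇒ σ :≤ ρ :+ n ⇒ ⊢ s₀ :≤ t₀ :+ n)
    (sumTo L (nth σ ∘ suc)) (sumTo L (nth ρ ∘ suc)) (nth σ 0) (nth ρ 0) (size σ) (size ρ) n
    (trans (size-sumTo σ (suc L) (n≤1+n L)) (sumTo-suc L (nth σ))) (trans (size-sumTo ρ (suc L) (≤-trans len≤ (n≤1+n L))) (sumTo-suc L (nth ρ)))
    (sumTo-mono L (λ i _ → sub (suc i))) sz
    where L = length σ

nth-replicate : ∀ n x {i} → i < n → nth (replicate n x) i ≡ x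
nth-replicate (suc n) x {zero}  h       = refl
nth-replicate (suc n) x {suc i} (s≤s h) = nth-replicate n x h

∈-supersOf⁺ : ∀ {ρ σ n} → IsPartition ρ → IsPartition σ → (∀ i → nth ρ i ≤ nth σ i) → size σ ≤ size ρ + n → σ ∈ supersOf ρ n
∈-supersOf⁺ {ρ} {σ} {n} pρ pσ sub sz = ∈-filt⁺ (λ σ → (ρ ⊆ᵇ σ) ∧ (size σ ≤ᵇ size ρ + n)) (∈-subPartitions⁺ (replicate (length ρ + n) (nth ρ 0 + n)) pσ inBox)
    (∧-intro (⊆ᵇ-true ρ σ sub) (≤ᵇ-true sz))
  where
  inBox : ∀ i → nth σ i ≤ nth (replicate (length ρ + n) (nth ρ 0 + n)) i
  inBox i with i <? length ρ + n
  ... | yes h = ≤-trans (≤-trans (Decreasing-≤ (IsPartition⇒Decreasing pσ) z≤n) (head-super pρ pσ sub sz)) (≤-reflexive (sym (nth-replicate _ _ h)))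
  ... | no  h = ≤-trans (≤-reflexive (nth-beyond σ (≤-trans (length-super pρ pσ sub sz) (≮⇒≥ h)))) z≤n

∈-supersOf⁻ : ∀ ρ n {σ} → σ ∈ supersOf ρ n → IsPartition σ × (∀ i → nth ρ i ≤ nth σ i) × size σ ≤ size ρ + n
∈-supersOf⁻ ρ n {σ} i with ∈-filt⁻ (λ σ → (ρ ⊆ᵇ σ) ∧ (size σ ≤ᵇ size ρ + n)) (subPartitions (replicate (length ρ + n) (nth ρ 0 + n))) i
... | σ∈ , e with ∧-elim {ρ ⊆ᵇ σ} e
... | a , b = proj₁ (∈-subPartitions⁻ (replicate (length ρ + n) (nth ρ 0 + n)) σ∈) , ⊆ᵇ-sound ρ σ a , ≤ᵇ-sound b

Unique-supersOf : ∀ ρ n → Unique (supersOf ρ n)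
Unique-supersOf ρ n = Unique-filt (λ σ → (ρ ⊆ᵇ σ) ∧ (size σ ≤ᵇ size ρ + n)) (Unique-subPartitions (replicate (length ρ + n) (nth ρ 0 + n)))

at : ∀ {k} → Vec (List ℕ) k → ℕ → List ℕ
at V.[]      i       = []
at (x V.∷ v) zero    = x
at (x V.∷ v) (suc i) = at v i

at-lookup : ∀ {k} (v : Vec (List ℕ) k) j → at v (toℕ j) ≡ lookup v j
at-lookup (x V.∷ v) Fin.zero    = refl
at-lookup (x V.∷ v) (Fin.suc j) = at-lookup v j

at-ext : ∀ {k} (u v : Vec (List ℕ) k) → (∀ i → i < k → at u i ≡ at v i) → u ≡ v
at-ext V.[]      V.[]      h = refl
at-ext (x V.∷ u) (y V.∷ v) h = cong₂ V._∷_ (h 0 (s≤s z≤n)) (at-ext u v (λ i p → h (suc i) (s≤s p)))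

at-generate : ∀ k (f : ℕ → List ℕ) {i} → i < k → at (tabulate {n = k} (f ∘ toℕ)) i ≡ f i
at-generate (suc k) f {zero}  h       = refl
at-generate (suc k) f {suc i} (s≤s h) = at-generate k (f ∘ suc) h

∈-vecProduct⁻ : ∀ {k} (xss : Vec (List (List ℕ)) k) {v} → v ∈ vecProduct xss → ∀ j → lookup v j ∈ lookup xss j
∈-vecProduct⁻ (xs V.∷ xss) i j with ∈-concatMap⁻ _ xs i
... | x , x∈ , p with ∈-map⁻ (x V.∷_) (vecProduct xss) p
∈-vecProduct⁻ (xs V.∷ xss) i Fin.zero    | x , x∈ , p | v , v∈ , refl = x∈
∈-vecProduct⁻ (xs V.∷ xss) i (Fin.suc j) | x , x∈ , p | v , v∈ , refl = ∈-vecProduct⁻ xss v∈ j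

∈-vecProduct⁺ : ∀ {k} (xss : Vec (List (List ℕ)) k) v → (∀ j → lookup v j ∈ lookup xss j) → v ∈ vecProduct xss
∈-vecProduct⁺ V.[]         V.[]      h = here refl
∈-vecProduct⁺ (xs V.∷ xss) (x V.∷ v) h = ∈-concatMap⁺ _ (h Fin.zero) (∈-map⁺ (x V.∷_) (∈-vecProduct⁺ xss v (h ∘ Fin.suc)))

Unique-vecProduct : ∀ {k} (xss : Vec (List (List ℕ)) k) → (∀ j → Unique (lookup xss j)) → Unique (vecProduct xss)
Unique-vecProduct V.[]         h = [] ∷ []
Unique-vecProduct (xs V.∷ xss) h = Unique-concatMap _ (h Fin.zero) (λ {x} _ → Unique-map (x V.∷_) (λ { _ _ refl → refl }) (Unique-vecProduct xss (h ∘ Fin.suc)))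
  (λ {x} {y} p q → case ∈-map⁻ (x V.∷_) (vecProduct xss) p of λ where (_ , _ , refl) → case ∈-map⁻ (y V.∷_) (vecProduct xss) q of λ where (_ , _ , refl) → refl)

sum-zipWith : ∀ {k} (f : List ℕ → List ℕ → ℕ) (u v : Vec (List ℕ) k) → sumℕ (toList (V.zipWith f u v)) ≡ sumTo k (λ i → f (at u i) (at v i))
sum-zipWith f V.[]      V.[]      = refl
sum-zipWith {suc k} f (x V.∷ u) (y V.∷ v) = trans (cong (f x y +_) (sum-zipWith f u v)) (sym (sumTo-suc k (λ i → f (at (x V.∷ u) i) (at (y V.∷ v) i))))

sum-map : ∀ {k} (f : List ℕ → ℕ) (u : Vec (List ℕ) k) → sumℕ (toList (V.map f u)) ≡ sumTo k (λ i → f (at u i))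
sum-map f V.[]      = refl
sum-map {suc k} f (x V.∷ u) = trans (cong (f x +_) (sum-map f u)) (sym (sumTo-suc k (λ i → f (at (x V.∷ u) i))))

module _ {k : ℕ} (τs : Vec (List ℕ) k) (n : ℕ) where
  private
    excess : Vec (List ℕ) k → ℕ
    excess ν = sumℕ (toList (V.zipWith (λ a b → size a ∸ size b) ν τs))

  Unique-multiSupers : Unique (multiSupers τs n)
  Unique-multiSupers = Unique-filt _ (Unique-vecProduct (V.map (λ t → supersOf t n) τs) (λ j → subst Unique (sym (VP.lookup-map j (λ t → supersOf t n) τs)) (Unique-supersOf (lookup τs j) n)))

  ∈-multiSupers⁻ : ∀ {ν} → ν ∈ multiSupers τs n → (∀ j → lookup ν j ∈ supersOf (lookup τs j) n) × sumTo k (λ i → size (at ν i) ∸ size (at τs i)) ≡ n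
  ∈-multiSupers⁻ {ν} i with ∈-filt⁻ (λ ν → excess ν ≡ᵇ n) (vecProduct (V.map (λ t → supersOf t n) τs)) i
  ... | ν∈ , e = (λ j → subst (lookup ν j ∈_) (VP.lookup-map j (λ t → supersOf t n) τs) (∈-vecProduct⁻ (V.map (λ t → supersOf t n) τs) ν∈ j)) ,
                 trans (sym (sum-zipWith (λ a b → size a ∸ size b) ν τs)) (≡ᵇ-sound {excess ν} e)

  ∈-multiSupers⁺ : ∀ {ν} → (∀ j → lookup ν j ∈ supersOf (lookup τs j) n) → sumTo k (λ i → size (at ν i) ∸ size (at τs i)) ≡ n → ν ∈ multiSupers τs n
  ∈-multiSupers⁺ {ν} h e = ∈-filt⁺ (λ ν → excess ν ≡ᵇ n) (∈-vecProduct⁺ (V.map (λ t → supersOf t n) τs) ν (λ j → subst (lookup ν j ∈_) (sym (VP.lookup-map j (λ t → supersOf t n) τs)) (h j)))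
    (trans (cong (_≡ᵇ n) (trans (sum-zipWith (λ a b → size a ∸ size b) ν τs) e)) (≡ᵇ-refl n))

starSize : (r : ℕ) → List ℕ → Vec (List ℕ) r → ℕ
starSize r τ ν = length τ + sumℕ (toList (V.map length ν))

starPosition : (r : ℕ) .{{_ : NonZero r}} → List ℕ → Vec (List ℕ) r → Fin r → List ℕ
starPosition r τ ν j = map (λ i → toℕ j + r * (nth (lookup ν j) i + c ∸ suc i)) (range c)
  where c = length (runner r (toℕ j) (beta τ (r * starSize r τ ν)))

-- starConcat is the local function concat′ of Defs.star, recovered by unification.
mutual
  starConcat : (r : ℕ) .{{_ : NonZero r}} → List ℕ → Vec (List ℕ) r → (k : ℕ) → Vec (List ℕ) k → List ℕ
  starConcat = _

  star-suc : ∀ r .(nz : NonZero (suc r)) τ ν → star (suc r) {{nz}} τ ν ≡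
    fromBeta (starPosition (suc r) {{nz}} τ ν Fin.zero ++ starConcat (suc r) {{nz}} τ ν r (tabulate (λ i → starPosition (suc r) {{nz}} τ ν (Fin.suc i))))
  star-suc r nz τ ν with tabulate (λ i → starPosition (suc r) {{nz}} τ ν (Fin.suc i)) | starPosition (suc r) {{nz}} τ ν Fin.zero | foldr _⊔_ 0
  ... | v | p | w with suc r | ν
  ... | R | ν′ = refl

starConcat-tabulate : ∀ r .(nz : NonZero r) τ ν k (f : Fin k → List ℕ) (g : ℕ → List ℕ) (h : ℕ → ℕ) → (∀ j → f j ≡ g (h (toℕ j))) →
                      starConcat r {{nz}} τ ν k (tabulate f) ≡ concatMap g (applyUpTo h k)
starConcat-tabulate r nz τ ν zero    f g h e = refl
starConcat-tabulate r nz τ ν (suc k) f g h e = cong₂ _++_ (e Fin.zero) (starConcat-tabulate r nz τ ν k (f ∘ Fin.suc) g (h ∘ suc) (e ∘ Fin.suc))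

star-def : ∀ r .(nz : NonZero r) τ ν → let open Abacus r {{nz}} in
  star r {{nz}} τ ν ≡ fromBeta (concatMap (λ j → map (position j) (beta (at ν j) (beads τ (starSize r τ ν) j))) (range r))
star-def zero    nz τ ν = ⊥-elim (≢-nonZero⁻¹ 0 {{nz}} refl)
star-def (suc r) nz τ ν = trans (star-suc r nz τ ν) (cong fromBeta (starConcat-tabulate (suc r) nz τ ν (suc r) (starPosition (suc r) {{nz}} τ ν) g id same))
  where
  open Abacus (suc r) {{nz}}
  g : ℕ → List ℕ
  g j = map (position j) (beta (at ν j) (beads τ (starSize (suc r) τ ν) j))
  same : ∀ j → starPosition (suc r) {{nz}} τ ν j ≡ g (toℕ j)
  same j = trans (map-∘ (range _)) (cong (λ α → map (position (toℕ j)) (beta α (beads τ (starSize (suc r) τ ν) (toℕ j)))) (sym (at-lookup ν j)))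

-- The components j, j + 1, …, j + k − 1 of a skew multipartition ν/τ, with c i rows for component i.
components : (ν τ : ℕ → List ℕ) (c : ℕ → ℕ) → ℕ → ℕ → List Block
components ν τ c j zero    = []
components ν τ c j (suc k) = block (ν j) (τ j) (c j) ∷ components ν τ c (suc j) k

totalRows-components : ∀ ν τ c j k → totalRows (components ν τ c j k) ≡ sumTo k (λ i → c (j + i))
totalRows-components ν τ c j zero    = refl
totalRows-components ν τ c j (suc k) = trans (cong (_+ c j) (totalRows-components ν τ c (suc j) k)) (trans (+-comm _ (c j)) (trans
  (cong₂ _+_ (cong c (sym (+-identityʳ j))) (sumTo-cong k (λ i _ → cong c (sym (+-suc j i))))) (sym (sumTo-suc k (λ i → c (j + i))))))

-- This and the next two lemmas show that the conditions imposed on tableaux involve only τ and the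
-- numbers of beads. One family of surviving tableaux can therefore be distributed over all ν.
totalRows-new : ∀ ν ν′ τ c j k → totalRows (components ν τ c j k) ≡ totalRows (components ν′ τ c j k)
totalRows-new ν ν′ τ c j k = trans (totalRows-components ν τ c j k) (sym (totalRows-components ν′ τ c j k))

stack-old : ∀ ν ν′ τ c j k p → stack Block.old (components ν τ c j k) p ≡ stack Block.old (components ν′ τ c j k) p
stack-old ν ν′ τ c j zero    p = refl
stack-old ν ν′ τ c j (suc k) p rewrite totalRows-new ν ν′ τ c (suc j) k =
  cong (λ z → if p <ᵇ totalRows (components ν′ τ c (suc j) k) then z else nth (τ j) (p ∸ totalRows (components ν′ τ c (suc j) k))) (stack-old ν ν′ τ c (suc j) k p)

linked-new : ∀ ν ν′ τ c j k p → linkedRows (components ν τ c j k) p ≡ linkedRows (components ν′ τ c j k) p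
linked-new ν ν′ τ c j zero    p = refl
linked-new ν ν′ τ c j (suc k) p rewrite totalRows-new ν ν′ τ c (suc j) k =
  cong (λ b → if suc p <ᵇ R then b else (R ≤ᵇ p) ∧ (suc p <ᵇ R + c j)) (linked-new ν ν′ τ c (suc j) k p)
  where R = totalRows (components ν′ τ c (suc j) k)

allᵇ-cong : {A : Set} {p q : A → Bool} (xs : List A) → (∀ x → p x ≡ q x) → allᵇ p xs ≡ allᵇ q xs
allᵇ-cong []       h = refl
allᵇ-cong (x ∷ xs) h = cong₂ _∧_ (h x) (allᵇ-cong xs h)

good-cong : ∀ {τ τ′ l l′} μ cs t → (∀ i → τ i ≡ τ′ i) → (∀ i → l i ≡ l′ i) → good τ l μ cs t ≡ good τ′ l′ μ cs t
good-cong μ cs t hτ hl = allᵇ-cong cs (λ c → cong₂ _∨_ (cong not (hl (proj₂ c)))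
  (cong₂ _≤ᵇ_ (cong (λ x → x + columnSum (suc (proj₁ c)) (gt μ t) (suc (suc (proj₂ c))) + columnSum (proj₁ c) (gt μ t) (proj₂ c)) (hτ (suc (proj₂ c))))
              (cong (λ x → x + columnSum (proj₁ c) (gt μ t) (suc (proj₂ c)) + columnSum (suc (proj₁ c)) (gt μ t) (suc (proj₂ c))) (hτ (proj₂ c)))))

linked-from : ∀ ν τ c k j {i} → linkedRows (components ν τ c j k) i ≡ true → linkedRows (components ν τ c 0 (j + k)) i ≡ true
linked-from ν τ c k zero    e = e
linked-from ν τ c k (suc j) {i} e = subst (λ n → linkedRows (components ν τ c 0 n) i ≡ true) (+-suc j k)
  (linked-from ν τ c (suc k) j (linked-tail (block (ν j) (τ j) (c j)) (components ν τ c (suc j) k) (linked-bound (components ν τ c (suc j) k) e) e))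

totalRows-from : ∀ ν τ c k j → totalRows (components ν τ c j k) ≤ totalRows (components ν τ c 0 (j + k))
totalRows-from ν τ c k zero    = ≤-refl
totalRows-from ν τ c k (suc j) = ≤-trans (m≤m+n _ (c j)) (≤-trans (totalRows-from ν τ c (suc k) j) (≤-reflexive (cong (λ n → totalRows (components ν τ c 0 n)) (+-suc j k))))

stack-from : ∀ f ν τ c k j {p} → p < totalRows (components ν τ c j k) → stack f (components ν τ c j k) p ≡ stack f (components ν τ c 0 (j + k)) p
stack-from f ν τ c k zero    h = refl
stack-from f ν τ c k (suc j) {p} h = trans (sym (stack-tail f (block (ν j) (τ j) (c j)) (components ν τ c (suc j) k) h))
  (trans (stack-from f ν τ c (suc k) j (≤-trans h (m≤m+n _ (c j)))) (cong (λ n → stack f (components ν τ c 0 n) p) (+-suc j k)))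

module Grouping (r : ℕ) .{{_ : NonZero r}} (c : ℕ → ℕ) where
  open Abacus r

  groupedBeads : (ℕ → List ℕ) → ℕ → ℕ → List ℕ
  groupedBeads ν j k = collect j k (λ i → map (position i) (beta (ν i) (c i)))

  length-groupedBeads : ∀ ν τ j k → length (groupedBeads τ j k) ≡ totalRows (components ν τ c j k)
  length-groupedBeads ν τ j zero    = refl
  length-groupedBeads ν τ j (suc k) = trans (length-++ (groupedBeads τ (suc j) k)) (cong₂ _+_ (length-groupedBeads ν τ (suc j) k) (trans (length-map (position j) (beta (τ j) (c j))) (length-beta (τ j) (c j))))

  nth-groupedBeads-head : ∀ ν τ j k {p} → p < c j → nth (groupedBeads τ j (suc k)) (totalRows (components ν τ c (suc j) k) + p) ≡ position j (nth (beta (τ j) (c j)) p)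
  nth-groupedBeads-head ν τ j k {p} h = trans (cong (λ n → nth (groupedBeads τ j (suc k)) (n + p)) (sym (length-groupedBeads ν τ (suc j) k)))
    (trans (nth-++ʳ (groupedBeads τ (suc j) k) _ p) (nth-map (position j) (beta (τ j) (c j)) (subst (p <_) (sym (length-beta (τ j) (c j))) h)))

  nth-groupedBeads-tail : ∀ ν τ j k {p} → p < totalRows (components ν τ c (suc j) k) → nth (groupedBeads τ j (suc k)) p ≡ nth (groupedBeads τ (suc j) k) p
  nth-groupedBeads-tail ν τ j k h = nth-++ˡ (groupedBeads τ (suc j) k) _ (subst (_ <_) (sym (length-groupedBeads ν τ (suc j) k)) h)

  scale : ∀ a b x y → a + x ≡ b + y → ∀ j → position j a + r * x ≡ position j b + r * y
  scale a b x y h j = trans (+-assoc j _ _) (trans (cong (j +_) (trans (sym (*-distribˡ-+ r a x)) (trans (cong (r *_) h) (*-distribˡ-+ r b y)))) (sym (+-assoc j _ _)))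

  -- The hypothesis `e-step` for grouped beads: neighbours on runner `j` sit at the positions
  -- `j + r` times consecutive elements of a β-set of `τ j`.
  grouped-step : ∀ ν τ j k i → linkedRows (components ν τ c j k) i ≡ true →
    let e = groupedBeads τ j k ; τ* = stack Block.old (components ν τ c j k) in nth e i + r * τ* (suc i) ≡ nth e (suc i) + r * suc (τ* i)
  grouped-step ν τ j (suc k) i l = byCase (linked-inv b bs l)
    where
    b  = block (ν j) (τ j) (c j)
    bs = components ν τ c (suc j) k
    byCase : (suc i < totalRows bs × linkedRows bs i ≡ true) ⊎ (∃[ p ] (i ≡ totalRows bs + p × suc p < c j)) →
      nth (groupedBeads τ j (suc k)) i + r * stack Block.old (b ∷ bs) (suc i) ≡ nth (groupedBeads τ j (suc k)) (suc i) + r * suc (stack Block.old (b ∷ bs) i)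
    byCase (inj₁ (h , l′)) = trans (cong₂ (λ x y → x + r * y) (nth-groupedBeads-tail ν τ j k (<⇒≤ h)) (stack-tail Block.old b bs h))
      (trans (grouped-step ν τ (suc j) k i l′) (sym (cong₂ (λ x y → x + r * suc y) (nth-groupedBeads-tail ν τ j k h) (stack-tail Block.old b bs (<⇒≤ h)))))
    byCase (inj₂ (p , refl , h)) = trans (cong₂ (λ x y → x + r * y) (nth-groupedBeads-head ν τ j k (<⇒≤ h)) (trans (cong (stack Block.old (b ∷ bs)) (sym (+-suc (totalRows bs) p))) (stack-head Block.old b bs (suc p))))
      (trans (scale _ _ _ _ beads≡ j)
        (sym (cong₂ (λ x y → x + r * suc y) (trans (cong (nth (groupedBeads τ j (suc k))) (sym (+-suc (totalRows bs) p))) (nth-groupedBeads-head ν τ j k h)) (stack-head Block.old b bs p))))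
      where
      beads≡ : nth (beta (τ j) (c j)) p + nth (τ j) (suc p) ≡ nth (beta (τ j) (c j)) (suc p) + suc (nth (τ j) p)
      beads≡ = lia 6 (λ a b t t′ p c → a :+ (# 1 :+ p) :≡ t :+ c ⇒ b :+ (# 1 :+ (# 1 :+ p)) :≡ t′ :+ c ⇒ ⊢ a :+ t′ :≡ b :+ (# 1 :+ t))
        (nth (beta (τ j) (c j)) p) (nth (beta (τ j) (c j)) (suc p)) (nth (τ j) p) (nth (τ j) (suc p)) p (c j) (nth-beta (τ j) (c j) (<⇒≤ h)) (nth-beta (τ j) (c j) h)

  -- Enlarging a part by `x` moves its bead by `x` steps of its runner, that is, by `r * x`
  -- positions.
  grouped-add : ∀ ν τ j k p x → p < totalRows (components ν τ c j k) → stack Block.old (components ν τ c j k) p + x ≡ stack Block.new (components ν τ c j k) p →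
    nth (groupedBeads τ j k) p + r * x ≡ nth (groupedBeads ν j k) p
  grouped-add ν τ j (suc k) p x p< e with p <? totalRows (components ν τ c (suc j) k)
  ... | yes h = trans (cong (_+ r * x) (nth-groupedBeads-tail ν τ j k h)) (trans (grouped-add ν τ (suc j) k p x h
      (trans (cong (_+ x) (sym (stack-tail Block.old b bs h))) (trans e (stack-tail Block.new b bs h)))) (sym tail-ν))
    where
    b  = block (ν j) (τ j) (c j)
    bs = components ν τ c (suc j) k
    tail-ν : nth (groupedBeads ν j (suc k)) p ≡ nth (groupedBeads ν (suc j) k) p
    tail-ν = nth-groupedBeads-tail ν ν j k (subst (p <_) (trans (totalRows-components ν τ c (suc j) k) (sym (totalRows-components ν ν c (suc j) k))) h)
  ... | no  h = atHead (m≤n⇒∃[o]m+o≡n (≮⇒≥ h))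
    where
    b  = block (ν j) (τ j) (c j)
    bs = components ν τ c (suc j) k
    R≡ : totalRows bs ≡ totalRows (components ν ν c (suc j) k)
    R≡ = trans (totalRows-components ν τ c (suc j) k) (sym (totalRows-components ν ν c (suc j) k))
    atHead : ∃[ o ] totalRows bs + o ≡ p → nth (groupedBeads τ j (suc k)) p + r * x ≡ nth (groupedBeads ν j (suc k)) p
    atHead (o , refl) = trans (cong (_+ r * x) (nth-groupedBeads-head ν τ j k o<)) (trans (trans (scale _ _ x 0 (trans sums (sym (+-identityʳ _))) j) (trans (cong (position j (nth (beta (ν j) (c j)) o) +_) (*-zeroʳ r)) (+-identityʳ _)))
        (sym (trans (cong (λ n → nth (groupedBeads ν j (suc k)) (n + o)) R≡) (nth-groupedBeads-head ν ν j k o<))))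
      where
      o< : o < c j
      o< = +-cancelˡ-< (totalRows bs) _ _ p<
      new≡ : nth (τ j) o + x ≡ nth (ν j) o
      new≡ = trans (cong (_+ x) (sym (stack-head Block.old b bs o))) (trans e (stack-head Block.new b bs o))
      sums : nth (beta (τ j) (c j)) o + x ≡ nth (beta (ν j) (c j)) o
      sums = lia 7 (λ a b t n x o c → a :+ (# 1 :+ o) :≡ t :+ c ⇒ b :+ (# 1 :+ o) :≡ n :+ c ⇒ t :+ x :≡ n ⇒ ⊢ a :+ x :≡ b)
        (nth (beta (τ j) (c j)) o) (nth (beta (ν j) (c j)) o) (nth (τ j) o) (nth (ν j) o) x o (c j) (nth-beta (τ j) (c j) o<) (nth-beta (ν j) (c j) o<) new≡

components-wellFormed : ∀ ν τ c j k → (∀ i → j ≤ i → i < j + k → Skew (ν i) (τ i) × length (ν i) ≤ c i) → All WellFormed (components ν τ c j k)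
components-wellFormed ν τ c j zero    h = []
components-wellFormed ν τ c j (suc k) h = h j ≤-refl (m<m+n j (s≤s z≤n)) ∷ components-wellFormed ν τ c (suc j) k (λ i a b → h i (<⇒≤ a) (subst (i <_) (sym (+-suc j k)) b))

shapes-components : ∀ {k} (νs τs : Vec (List ℕ) k) ν τ c j → (∀ i → i < k → ν (j + i) ≡ at νs i) → (∀ i → i < k → τ (j + i) ≡ at τs i) →
  map (λ b → Block.new b , Block.old b) (components ν τ c j k) ≡ toList (V.zipWith _,_ νs τs)
shapes-components V.[]       V.[]       ν τ c j hν hτ = refl
shapes-components (x V.∷ νs) (y V.∷ τs) ν τ c j hν hτ = cong₂ _∷_
  (cong₂ _,_ (trans (cong ν (sym (+-identityʳ j))) (hν 0 (s≤s z≤n))) (trans (cong τ (sym (+-identityʳ j))) (hτ 0 (s≤s z≤n))))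
  (shapes-components νs τs ν τ c (suc j) (λ i h → trans (cong ν (sym (+-suc j i))) (hν (suc i) (s≤s h))) (λ i h → trans (cong τ (sym (+-suc j i))) (hτ (suc i) (s≤s h))))

-- Adding variables with exponent zero

++-split : {A : Set} (xs xs′ : List A) {ys ys′ : List A} → length xs ≡ length xs′ → xs ++ ys ≡ xs′ ++ ys′ → xs ≡ xs′ × ys ≡ ys′
++-split []       []         l e = refl , e
++-split (x ∷ xs) (x′ ∷ xs′) l e with ++-split xs xs′ (suc-injective l) (∷-injectiveʳ e)
... | p , q = cong₂ _∷_ (∷-injectiveˡ e) p , q

countᵇ-none : {A : Set} (p : A → Bool) (xs : List A) → countᵇ p xs ≡ 0 → ∀ {x} → x ∈ xs → p x ≡ false
countᵇ-none p (y ∷ xs) e (here refl) with p y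
... | false = refl
countᵇ-none p (y ∷ xs) e (there i) = countᵇ-none p xs (m+n≡0⇒n≡0 (b2n (p y)) (trans (sym (countᵇ-∷ p y xs)) e)) i

∑-𝟙-ext : {A : Set} {xs ys : List A} (p q : A → Bool) → Unique xs → Unique ys →
  (∀ {x} → x ∈ xs → p x ≡ true → x ∈ ys × q x ≡ true) → (∀ {y} → y ∈ ys → q y ≡ true → y ∈ xs × p y ≡ true) → ∑ xs (𝟙 ∘ p) ≡ ∑ ys (𝟙 ∘ q)
∑-𝟙-ext {xs = xs} {ys} p q u v f g = trans (as-filt p xs) (trans
  (∑-bij (filt p xs) (filt q ys) id (Unique-filt p u) (Unique-filt q v)
    (λ i → let a , b = ∈-filt⁻ p xs i ; c , d = f a b in ∈-filt⁺ q c d)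
    (λ _ _ e → e)
    (λ {y} i → let a , b = ∈-filt⁻ q ys i ; c , d = g a b in y , ∈-filt⁺ p c d , refl)
    (λ _ → refl))
  (sym (as-filt q ys)))
  where as-filt : ∀ p xs → ∑ xs (𝟙 ∘ p) ≡ ∑ (filt p xs) (λ _ → 1ℤ)
        as-filt p xs = sym (trans (∑-filt p xs (λ _ → 1ℤ)) (∑-cong xs (λ _ → ℤ.*-identityʳ _)))

module Stability (m d : ℕ) (lam μ : List ℕ) where

  private
    zeros = replicate d 0

  private
    rebound : ∀ {K K′ E} → SemiStandard K lam μ E → (∀ {k j} → nth μ k ≤ j → j < nth lam k → E (k , j) ≤ K′) → SemiStandard K′ lam μ E
    rebound S h = record { bounds = λ p q → proj₁ (bounds p q) , h p q ; rows = rows ; cols = cols }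
      where open SemiStandard S

  ssyts-grow : ∀ {t} → t ∈ ssyts m lam μ → t ∈ ssyts (m + d) lam μ
  ssyts-grow t∈ = let e , S = ∈-ssyts⁻ m lam μ t∈ in subst (_∈ ssyts (m + d) lam μ) (sym e)
    (∈-ssyts⁺ (m + d) lam μ (rebound S (λ p q → ≤-trans (proj₂ (SemiStandard.bounds S p q)) (m≤m+n m d))))

  ssyts-shrink : ∀ {t} → t ∈ ssyts (m + d) lam μ → (∀ i → i < d → contentAt t (m + i) ≡ 0) → t ∈ ssyts m lam μ
  ssyts-shrink {t} t∈ h = let e , S = ∈-ssyts⁻ (m + d) lam μ t∈ in subst (_∈ ssyts m lam μ) (sym e)
    (∈-ssyts⁺ m lam μ (rebound S (λ p q → small (subst (_ ∈_) (sym e) (∈-map⁺ _ (∈-cells⁺ lam μ p q))) (proj₂ (SemiStandard.bounds S p q)))))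
    where
    small : ∀ {c x} → (c , x) ∈ t → x ≤ m + d → x ≤ m
    small {c} {zero}  i b = z≤n
    small {c} {suc x} i b with suc x ≤? m
    ... | yes q = q
    ... | no  q with m≤n⇒∃[o]m+o≡n (s≤s⁻¹ (≰⇒> q))
    ... | o , refl = case trans (sym (≡ᵇ-refl (m + o))) (countᵇ-none _ t (h o (+-cancelˡ-< m o d b)) i) of λ ()

  contentAt-beyond : ∀ {t} → t ∈ ssyts m lam μ → ∀ i → contentAt t (m + i) ≡ 0
  contentAt-beyond {t} t∈ i = countᵇ-zero t (λ {q} q∈ → ≡ᵇ-false {proj₂ q} (λ e → <⇒≱ (s≤s (m≤m+n m i)) (subst (_≤ m) e (proj₂ (proj₂ (∈-fillings⁻ m (cells lam μ) (proj₁ (∈-filt⁻ isSSYT (fillings m (cells lam μ)) t∈))) q∈)))))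

  -- A zero exponent means by the second hypothesis on `g` that the letter is absent, so both sums
  -- run over the same tableaux.
  schur-stable : ∀ g → g 0 ≡ 0 → (∀ x → g x ≡ 0 → x ≡ 0) → ∀ u → length u ≡ m → schur m g lam μ u ≡ schur (m + d) g lam μ (u ++ zeros)
  schur-stable g g0 g≢0 u len = ∑-𝟙-ext _ _ (Unique-ssyts m lam μ) (Unique-ssyts (m + d) lam μ)
    (λ {t} t∈ e → ssyts-grow t∈ , subst (λ l → eqL l (u ++ zeros) ≡ true) (sym (trans (split t) (cong₂ _++_ (eqL-sound (map g (content m t)) u e) (allZero d (λ i _ → contentAt-beyond t∈ i))))) (eqL-refl (u ++ zeros)))
    (λ {t} t∈ e → let p , q = ++-split (map g (content m t)) u (trans (length-map g (content m t)) (trans (length-content m t) (sym len))) (trans (sym (split t)) (eqL-sound (map g (content (m + d) t)) (u ++ zeros) e)) in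
      ssyts-shrink t∈ (λ i h → g≢0 _ (zeroAt d q i h)) , subst (λ l → eqL l u ≡ true) (sym p) (eqL-refl u))
    where
    split : ∀ t → map g (content (m + d) t) ≡ map g (content m t) ++ map g (applyUpTo (λ i → contentAt t (m + i)) d)
    split t = trans (cong (map g) (trans (content≡ (m + d) t) (trans (applyUpTo-++ (contentAt t) m d) (cong (_++ applyUpTo (λ i → contentAt t (m + i)) d) (sym (content≡ m t)))))) (map-++ g (content m t) _)
    allZero : ∀ n {f} → (∀ i → i < n → f i ≡ 0) → map g (applyUpTo f n) ≡ replicate n 0
    allZero zero    h = refl
    allZero (suc n) h = cong₂ _∷_ (trans (cong g (h 0 (s≤s z≤n))) g0) (allZero n (λ i q → h (suc i) (s≤s q)))
    zeroAt : ∀ n {f} → map g (applyUpTo f n) ≡ replicate n 0 → ∀ i → i < n → g (f i) ≡ 0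
    zeroAt (suc n) e zero    h       = ∷-injectiveˡ e
    zeroAt (suc n) e (suc i) (s≤s h) = zeroAt n (∷-injectiveʳ e) i h

  kostka-schur : ∀ (a : Vec ℕ m) → schurP m lam μ a ≡ schur (m + d) id lam μ (toList a ++ zeros)
  kostka-schur a = trans (∑-count _ (ssyts m lam μ)) (trans (∑-cong (ssyts m lam μ) (λ {t} _ → cong (λ l → 𝟙 (eqL l (toList a))) (sym (map-id (content m t)))))
    (schur-stable id refl (λ _ e → e) (toList a) (VP.length-toList a)))

  module _ (r : ℕ) .{{_ : NonZero r}} where
    eqL-multiples : ∀ c u → eqL (map (r *_) c) u ≡ allᵇ (λ x → x % r ≡ᵇ 0) u ∧ eqL c (map (_/ r) u)
    eqL-multiples []      []      = refl
    eqL-multiples []      (x ∷ u) = sym (∧-false _)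
      where ∧-false : ∀ b → b ∧ false ≡ false
            ∧-false true  = refl
            ∧-false false = refl
    eqL-multiples (y ∷ c) []      = refl
    eqL-multiples (y ∷ c) (x ∷ u) = trans (cong₂ _∧_ head (eqL-multiples c u)) (shuffle (x % r ≡ᵇ 0) _ _ _)
      where
      shuffle : ∀ a b c d → (a ∧ b) ∧ (c ∧ d) ≡ (a ∧ c) ∧ (b ∧ d)
      shuffle false b     c     d = refl
      shuffle true  true  c     d = refl
      shuffle true  false true  d = refl
      shuffle true  false false d = refl
      head : (r * y ≡ᵇ x) ≡ (x % r ≡ᵇ 0) ∧ (y ≡ᵇ x / r)
      head = bool-ext
        (λ e → case ≡ᵇ-sound {r * y} e of λ where
          refl → ∧-intro (trans (cong (_≡ᵇ 0) (trans (cong (_% r) (*-comm r y)) (DM.m*n%n≡0 y r))) refl)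
                         (trans (cong (y ≡ᵇ_) (trans (cong (_/ r) (*-comm r y)) (DM.m*n/n≡m y r))) (≡ᵇ-refl y)))
        (λ e → let p , q = ∧-elim {x % r ≡ᵇ 0} e in trans (cong (_≡ᵇ x) (trans (*-comm r y) (trans (cong (_* r) (≡ᵇ-sound {y} q))
          (sym (trans (DM.m≡m%n+[m/n]*n x r) (cong (_+ x / r * r) (≡ᵇ-sound {x % r} p))))))) (≡ᵇ-refl x))

    pleth-schur : ∀ (a : Vec ℕ m) → plethP r (schurP m lam μ) a ≡ schur (m + d) (r *_) lam μ (toList a ++ zeros)
    pleth-schur a = trans (reduce (allᵇ (λ x → x % r ≡ᵇ 0) (toList a)) refl) (schur-stable (r *_) (*-zeroʳ r) (λ x e → m*n≡0⇒n≡0 x e) (toList a) (VP.length-toList a))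
      where
      m*n≡0⇒n≡0 : ∀ x → r * x ≡ 0 → x ≡ 0
      m*n≡0⇒n≡0 x e = *-cancelˡ-≡ x 0 r (trans e (sym (*-zeroʳ r)))
      reduce : ∀ b → allᵇ (λ x → x % r ≡ᵇ 0) (toList a) ≡ b → (if b then schurP m lam μ (V.map (_/ r) a) else 0ℤ) ≡ schur m (r *_) lam μ (toList a)
      reduce true  e = trans (∑-count _ (ssyts m lam μ)) (∑-cong (ssyts m lam μ) (λ {t} _ → cong 𝟙 (sym (trans (eqL-multiples (content m t) (toList a))
                         (trans (cong (_∧ eqL (content m t) (map (_/ r) (toList a))) e) (cong (eqL (content m t)) (sym (VP.toList-map (_/ r) a))))))))
      reduce false e = sym (∑-zero (ssyts m lam μ) (λ {t} _ → cong 𝟙 (trans (eqL-multiples (content m t) (toList a)) (cong (_∧ eqL (content m t) (map (_/ r) (toList a))) e))))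

pairs-range : ∀ n → pairs n ≡ map (λ b → b , n ∸ b) (range (suc n))
pairs-range n = trans (go n) (sym (map-upTo _ (suc n)))
  where go : ∀ n → pairs n ≡ applyUpTo (λ b → b , n ∸ b) (suc n)
        go zero    = refl
        go (suc n) = cong ((0 , suc n) ∷_) (trans (cong (map _) (go n)) (map-applyUpTo (λ b → b , n ∸ b) _ (suc n)))

conv-zeros : ∀ F G d → conv F G (replicate d 0) ≡ F (replicate d 0) *ᶻ G (replicate d 0)
conv-zeros F G zero    = refl
conv-zeros F G (suc d) = trans (ℤ.+-identityʳ _) (conv-zeros (λ u → F (0 ∷ u)) (λ u → G (0 ∷ u)) d)

-- A zero exponent splits only as 0 + 0, so the added variables contribute a single term to the
-- convolution.
*P-conv : ∀ {m} d (f g : Poly m) (F G : List ℕ → ℤ) → (∀ b → f b ≡ F (toList b ++ replicate d 0)) → (∀ b → g b ≡ G (toList b ++ replicate d 0)) →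
  ∀ a → (f *P g) a ≡ conv F G (toList a ++ replicate d 0)
*P-conv d f g F G hf hg V.[]      = trans (ℤ.+-identityʳ _) (trans (cong₂ _*ᶻ_ (hf V.[]) (hg V.[])) (sym (conv-zeros F G d)))
*P-conv d f g F G hf hg (x V.∷ a) = trans (∑-concatMap (λ b → map (b V.∷_) (belowVec a)) (range (suc x)) (λ b → f b *ᶻ g (V.zipWith _∸_ (x V.∷ a) b)))
  (trans (∑-cong (range (suc x)) (λ {b} _ → trans (∑-map (b V.∷_) (belowVec a) (λ b → f b *ᶻ g (V.zipWith _∸_ (x V.∷ a) b)))
    (*P-conv d (λ u → f (b V.∷ u)) (λ u → g (x ∸ b V.∷ u)) (λ u → F (b ∷ u)) (λ u → G (x ∸ b ∷ u)) (λ u → hf (b V.∷ u)) (λ u → hg (x ∸ b V.∷ u)) a)))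
  (sym (trans (cong (λ l → ∑ l (λ p → conv (λ u → F (proj₁ p ∷ u)) (λ u → G (proj₂ p ∷ u)) (toList a ++ replicate d 0))) (pairs-range x))
    (∑-map (λ b → b , x ∸ b) (range (suc x)) (λ p → conv (λ u → F (proj₁ p ∷ u)) (λ u → G (proj₂ p ∷ u)) (toList a ++ replicate d 0))))))

-- Matching tableaux with multipartitions

at-all : ∀ {k} (R : List ℕ → List ℕ → Set) (u v : Vec (List ℕ) k) → (∀ j → R (lookup u j) (lookup v j)) → ∀ {i} → i < k → R (at u i) (at v i)
at-all R (x V.∷ u) (y V.∷ v) h {zero}  i<       = h Fin.zero
at-all R (x V.∷ u) (y V.∷ v) h {suc i} (s≤s i<) = at-all R u v (h ∘ Fin.suc) i<

lookup-all : ∀ {k} (R : List ℕ → List ℕ → Set) (u v : Vec (List ℕ) k) → (∀ i → i < k → R (at u i) (at v i)) → ∀ j → R (lookup u j) (lookup v j)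
lookup-all R (x V.∷ u) (y V.∷ v) h Fin.zero    = h 0 (s≤s z≤n)
lookup-all R (x V.∷ u) (y V.∷ v) h (Fin.suc j) = lookup-all R u v (λ i i< → h (suc i) (s≤s i<)) j

term≤sumTo : ∀ k (f : ℕ → ℕ) {i} → i < k → f i ≤ sumTo k f
term≤sumTo (suc k) f {i} i< with i <? k
... | yes q = ≤-trans (term≤sumTo k f q) (m≤m+n _ _)
... | no  q = ≤-trans (≤-reflexive (cong f (≤-antisym (s≤s⁻¹ i<) (≮⇒≥ q)))) (m≤n+m _ _)

linked-applyUpTo : ∀ f n → (∀ i → suc i < n → f (suc i) ≤ f i) → Linked (λ a b → b ≤ a) (applyUpTo f n)
linked-applyUpTo f zero          h = []
linked-applyUpTo f (suc zero)    h = [-]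
linked-applyUpTo f (suc (suc n)) h = h 0 (s≤s (s≤s z≤n)) ∷ linked-applyUpTo (f ∘ suc) (suc n) (λ i q → h (suc i) (s≤s q))

stack-decreasing : ∀ bs → All WellFormed bs → ∀ i → linkedRows bs i ≡ true → stack Block.old bs (suc i) ≤ stack Block.old bs i
stack-decreasing (b ∷ bs) ((skewᵇ , _) ∷ w) i l = byCase (linked-inv b bs l)
  where
  byCase : (suc i < totalRows bs × linkedRows bs i ≡ true) ⊎ (∃[ p ] (i ≡ totalRows bs + p × suc p < Block.rows b)) → stack Block.old (b ∷ bs) (suc i) ≤ stack Block.old (b ∷ bs) i
  byCase (inj₁ (h , l′)) = subst₂ _≤_ (sym (stack-tail Block.old b bs h)) (sym (stack-tail Block.old b bs (<⇒≤ h))) (stack-decreasing bs w i l′)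
  byCase (inj₂ (p , refl , h)) = subst₂ _≤_ (sym (trans (cong (stack Block.old (b ∷ bs)) (sym (+-suc (totalRows bs) p))) (stack-head Block.old b bs (suc p)))) (sym (stack-head Block.old b bs p)) (Skew.inner skewᵇ p)

module Rows (τ : ℕ → List ℕ) (c : ℕ → ℕ) (r : ℕ) where

  all : (ℕ → List ℕ) → List Block
  all ν = components ν τ c 0 r

  -- Components are stacked from the last to the first: the rows of runner `j` follow those of all
  -- runners of larger index.
  offset : ℕ → ℕ
  offset j = totalRows (components τ τ c (suc j) (r ∸ suc j))

  split : ∀ {j} → j < r → j + suc (r ∸ suc j) ≡ r
  split {j} h = trans (+-suc j _) (m+[n∸m]≡n h)

  stack-row : ∀ f ν {j p} → j < r → p < c j → stack f (all ν) (offset j + p) ≡ nth (f (block (ν j) (τ j) (c j))) p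
  stack-row f ν {j} {p} h q = trans (trans (cong (λ n → stack f (components ν τ c 0 n) (offset j + p)) (sym (split h)))
    (sym (stack-from f ν τ c (suc k) j (subst (λ R → offset j + p < R + c j) (sym R≡) (+-monoʳ-< (offset j) q)))))
    (trans (cong (λ R → stack f (components ν τ c j (suc k)) (R + p)) (sym R≡)) (stack-head f (block (ν j) (τ j) (c j)) (components ν τ c (suc j) k) p))
    where k = r ∸ suc j
          R≡ : totalRows (components ν τ c (suc j) k) ≡ offset j
          R≡ = totalRows-new ν τ τ c (suc j) k

  linked-row : ∀ {j p} → j < r → suc p < c j → linkedRows (all τ) (offset j + p) ≡ true
  linked-row {j} {p} h q = subst (λ n → linkedRows (components τ τ c 0 n) (offset j + p) ≡ true) (split h)
    (linked-from τ τ c (suc (r ∸ suc j)) j (linked-head (block (τ j) (τ j) (c j)) (components τ τ c (suc j) (r ∸ suc j)) p q))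

  row-bound : ∀ {j p} → j < r → p < c j → offset j + p < totalRows (all τ)
  row-bound {j} {p} h q = ≤-trans (+-monoʳ-< (offset j) q) (≤-trans (totalRows-from τ τ c (suc (r ∸ suc j)) j) (≤-reflexive (cong (λ n → totalRows (components τ τ c 0 n)) (split h))))

  row-cases : ∀ {p} → p < totalRows (all τ) → ∃[ j ] ∃[ q ] (j < r × q < c j × p ≡ offset j + q)
  row-cases p< = go r 0 refl p<
    where
    go : ∀ k j → j + k ≡ r → ∀ {p} → p < totalRows (components τ τ c j k) → ∃[ i ] ∃[ q ] (i < r × q < c i × p ≡ offset i + q)
    go (suc k) j e {p} h = byCase (p <? R)
      where
      R = totalRows (components τ τ c (suc j) k)
      R≡ : R ≡ offset j
      R≡ = cong (λ k → totalRows (components τ τ c (suc j) k)) (sym (trans (cong (_∸ suc j) (trans (sym e) (+-suc j k))) (m+n∸m≡n (suc j) k)))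
      byCase : Dec (p < R) → ∃[ i ] ∃[ q ] (i < r × q < c i × p ≡ offset i + q)
      byCase (yes q) = go k (suc j) (trans (sym (+-suc j k)) e) q
      byCase (no  q) = atHead (m≤n⇒∃[o]m+o≡n (≮⇒≥ q))
        where atHead : ∃[ o ] R + o ≡ p → ∃[ i ] ∃[ q ] (i < r × q < c i × p ≡ offset i + q)
              atHead (o , refl) = j , o , subst (j <_) e (m<m+n j (s≤s z≤n)) , +-cancelˡ-< R _ _ h , cong (_+ o) R≡

  sumTo-rows : ∀ g → sumTo r (λ j → sumTo (c j) (λ q → g (offset j + q))) ≡ sumTo (totalRows (all τ)) g
  sumTo-rows g = go r 0
    where
    term : ℕ → ℕ → ℕ → ℕ
    term j k i = sumTo (c (j + i)) (λ q → g (totalRows (components τ τ c (suc (j + i)) (k ∸ suc i)) + q))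
    go : ∀ k j → sumTo k (term j k) ≡ sumTo (totalRows (components τ τ c j k)) g
    go zero    j = refl
    go (suc k) j = trans (sumTo-suc k (term j (suc k))) (trans (+-comm (term j (suc k) 0) _) (trans (cong₂ _+_
      (trans (sumTo-cong k (λ i _ → cong (λ x → sumTo (c x) (λ q → g (totalRows (components τ τ c (suc x) (k ∸ suc i)) + q))) (+-suc j i))) (go k (suc j)))
      (cong (λ x → sumTo (c x) (λ q → g (totalRows (components τ τ c (suc x) k) + q))) (+-identityʳ j)))
      (sym (sumTo-split (totalRows (components τ τ c (suc j) k)) (c j) g))))

content-total : ∀ {M lam μ t} → Skew lam μ → length μ ≤ length lam → t ∈ ssyts M lam μ → size μ + sumTo M (contentAt t) ≡ size lam
content-total {M} {lam} {μ} {t} skew l t∈ = trans (cong (_+ sumTo M (contentAt t)) (trans (size-sumTo μ ℓ l) (sumTo-cong ℓ (λ k _ → sym (GT.start G k)))))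
    (trans (telescope M) (trans (sumTo-cong ℓ (λ k _ → GT.end G k)) (sym (size-sumTo lam ℓ ≤-refl))))
  where
  ℓ = length lam
  G = gt-GT skew t∈
  telescope : ∀ n → sumTo ℓ (λ k → gt μ t k 0) + sumTo n (contentAt t) ≡ sumTo ℓ (λ k → gt μ t k n)
  telescope zero    = +-identityʳ _
  telescope (suc n) = trans (sym (+-assoc (sumTo ℓ (λ k → gt μ t k 0)) _ _)) (trans (cong (_+ contentAt t n) (telescope n)) (contentAt-gt ℓ μ t n (ssyts-rows M lam μ t∈)))

staircase⊕padded : ∀ M α → staircase M ⊕ padded M α ≡ beta α M
staircase⊕padded M α = list-ext _ _ (trans len (sym (length-beta α M))) (λ i h → let i< = subst (i <_) len h in
    trans (nth-⊕ (staircase M) (padded M α) i lens) (trans (cong (nth (staircase M) i +_) (nth-applyUpTo (nth α) M i<))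
      (lia 5 (λ s a b i M → s :+ (# 1 :+ i) :≡ M ⇒ b :+ (# 1 :+ i) :≡ a :+ M ⇒ ⊢ s :+ a :≡ b) (nth (staircase M) i) (nth α i) (nth (beta α M) i) i M (nth-staircase M i i<) (nth-beta α M i<))))
  where
  lens : length (staircase M) ≡ length (padded M α)
  lens = trans (length-staircase M) (sym (length-applyUpTo (nth α) M))
  len : length (staircase M ⊕ padded M α) ≡ M
  len = trans (length-⊕ (staircase M) (padded M α) lens) (length-staircase M)

module SkewSupers (r : ℕ) .{{_ : NonZero r}} {τ : List ℕ} (pτ : IsPartition τ) (n : ℕ) where
  open Abacus r
  open Chains r using (signOf; sgnR≡; signOf-square)
  open ChainExistence r using (Dominated; chain-exists)

  core : ℕ → List ℕ
  core = quotientAt pτ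

  at-quotient : ∀ {j} → j < r → at (quotient r τ) j ≡ core j
  at-quotient = at-generate r core

  supers : List (Vec (List ℕ) r)
  supers = multiSupers (quotient r τ) n

  -- Each `ν(j)` has at most `n` rows more than the quotient partition on its runner. Hence this
  -- number bounds `starSize` for all ν in the sum, and a single abacus accommodates them all.
  enough : ℕ
  enough = length τ + sumTo r (λ j → length (core j) + n)

  module _ {ν : Vec (List ℕ) r} (ν∈ : ν ∈ supers) where
    private
      super : ∀ {j} → j < r → at ν j ∈ supersOf (core j) n
      super {j} h = subst (λ t → at ν j ∈ supersOf t n) (at-quotient h) (at-all (λ x t → x ∈ supersOf t n) ν (quotient r τ) (proj₁ (∈-multiSupers⁻ (quotient r τ) n ν∈)) h)

    super-partition : ∀ {j} → j < r → IsPartition (at ν j)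
    super-partition h = proj₁ (∈-supersOf⁻ (core _) n (super h))

    super-⊆ : ∀ {j} → j < r → ∀ i → nth (core j) i ≤ nth (at ν j) i
    super-⊆ h = proj₁ (proj₂ (∈-supersOf⁻ (core _) n (super h)))

    starSize≤ : starSize r τ ν ≤ enough
    starSize≤ = +-monoʳ-≤ (length τ) (≤-trans (≤-reflexive (sum-map length ν)) (sumTo-mono r (λ j h →
      length-super (quotientAt-partition pτ j) (super-partition h) (super-⊆ h) (proj₂ (proj₂ (∈-supersOf⁻ (core _) n (super h)))))))

  module WithBeads (K : ℕ) (K≥ : enough ≤ K) where

    c : ℕ → ℕ
    c = beads τ K

    M : ℕ
    M = r * K

    open Rows core c r public
    open Grouping r c public

    τ≤K : length τ ≤ K
    τ≤K = ≤-trans (m≤m+n _ _) K≥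

    private
      τ-dec : Decreasing (nth τ)
      τ-dec = IsPartition⇒Decreasing pτ

      more : ∀ {K₀ j} → length τ ≤ K₀ → K₀ ≤ K → j < r → ∃[ s ] (c j ≡ s + beads τ K₀ j × K ≡ s + K₀)
      more {K₀} {j} l h j< with m≤n⇒∃[o]m+o≡n h
      ... | s , refl = s , trans (cong (λ K → beads τ K j) (+-comm K₀ s)) (beads-more τ τ-dec l j< s) , +-comm K₀ s

    core-length : ∀ {j} → j < r → length (core j) ≤ c j
    core-length {j} h with more ≤-refl τ≤K h
    ... | s , e , _ = ≤-trans (quotientAt-length pτ j) (≤-trans (m≤n+m _ s) (≤-reflexive (sym e)))

    totalRows-all : ∀ ν → totalRows (all ν) ≡ M
    totalRows-all ν = trans (totalRows-components ν core c 0 r) (trans (length-classes (beta τ M)) (length-beta τ M))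

    grouped-runners : ∀ α ν → (∀ {j} → j < r → runner r j (beta α M) ≡ beta (ν j) (c j)) → grouped (beta α M) ≡ groupedBeads ν 0 r
    grouped-runners α ν h = collect-cong 0 r (λ j _ j< → trans (class≡ j (beta α M)) (cong (map (position j)) (h j<)))

    alternant-runners : ∀ α ν → (∀ {j} → j < r → runner r j (beta α M) ≡ beta (ν j) (c j)) → ∀ v →
                        alternant (groupedBeads ν 0 r) v ≡ signOf M α *ᶻ alternant (beta α M) v
    alternant-runners α ν h v = trans (cong (λ e → alternant e v) (sym (grouped-runners α ν h))) (alternant-grouped [] (beta α M) v)

    runner-core : ∀ {j} → j < r → runner r j (beta τ M) ≡ beta (core j) (c j)
    runner-core h = sym (beta-quotientAt pτ h τ≤K)

    alternant-τ : ∀ v → alternant (beta τ M) v ≡ signOf M τ *ᶻ alternant (groupedBeads core 0 r) v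
    alternant-τ v = sym (trans (cong (signOf M τ *ᶻ_) (alternant-runners τ core runner-core v)) (trans (sym (ℤ.*-assoc (signOf M τ) (signOf M τ) _))
      (trans (cong (_*ᶻ alternant (beta τ M) v) (signOf-square M τ)) (ℤ.*-identityˡ _))))

    module _ {ν : Vec (List ℕ) r} (ν∈ : ν ∈ supers) where

      private
        K₀ = starSize r τ ν

        ν-dec : ∀ j → j < r → Decreasing (nth (at ν j))
        ν-dec j h = IsPartition⇒Decreasing (super-partition ν∈ h)

        ν-len₀ : ∀ j → j < r → length (at ν j) ≤ beads τ K₀ j
        ν-len₀ j h = ≤-trans (≤-trans single (m≤m+n Σ _)) (≤-reflexive (sym (trans (cong (λ K → beads τ K j) (+-comm (length τ) Σ)) (beads-more τ τ-dec ≤-refl h Σ))))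
          where
          Σ = sumℕ (toList (V.map length ν))
          single : length (at ν j) ≤ Σ
          single = ≤-trans (term≤sumTo r (λ i → length (at ν i)) h) (≤-reflexive (sym (sum-map length ν)))

        K₀≤K : K₀ ≤ K
        K₀≤K = ≤-trans (starSize≤ ν∈) K≥

        module S = Star pτ (at ν) K₀ (m≤m+n _ _) ν-dec ν-len₀

        star≡ : star r τ ν ≡ fromBeta S.B
        star≡ = star-def r _ τ ν

      star-isPartition : IsPartition (star r τ ν)
      star-isPartition = subst IsPartition (sym star≡) S.star-partition

      star-length : length (star r τ ν) ≤ M
      star-length = ≤-trans (≤-reflexive (cong length star≡)) (≤-trans S.length-star (*-monoʳ-≤ r K₀≤K))

      super-length : ∀ {j} → j < r → length (at ν j) ≤ c j
      super-length {j} h with more (m≤m+n _ _) K₀≤K h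
      ... | s , e , _ = ≤-trans (ν-len₀ j h) (≤-trans (m≤n+m _ s) (≤-reflexive (sym e)))

      runner-star : ∀ {j} → j < r → runner r j (beta (star r τ ν) M) ≡ beta (at ν j) (c j)
      runner-star {j} h with more (m≤m+n (length τ) (sumℕ (toList (V.map length ν)))) K₀≤K h
      ... | s , e , K≡ = trans (cong₂ (λ α N → runner r j (beta α (r * N))) star≡ K≡) (trans (S.runner-star s h) (cong (λ N → beta (at ν j) (beads τ N j)) (sym K≡)))

      dominated : Dominated (beta τ M) (beta (star r τ ν) M)
      dominated j h = subst₂ Below (side (beta τ M) (core j) (runner-core h)) (side (beta (star r τ ν) M) (at ν j) (runner-star h))
        (below-map (λ le → +-monoʳ-≤ j (*-monoʳ-≤ r le)) (below-applyUpTo (c j) _ _ (λ i → ∸-monoˡ-≤ (suc i) (+-monoˡ-≤ (c j) (super-⊆ ν∈ h i)))))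
        where side : ∀ X α → runner r j X ≡ beta α (c j) → map (position j) (applyUpTo (λ i → nth α i + c j ∸ suc i) (c j)) ≡ filt (residue j) X
              side X α e = trans (cong (map (position j)) (trans (sym (beta≡ α (c j))) (sym e))) (sym (class≡ j X))

      sgnR-star : sgnR r (star r τ ν) τ ≡ signOf M τ *ᶻ signOf M (star r τ ν)
      sgnR-star = sgnR≡ pτ τ≤M star-isPartition star-length
        (proj₂ (chain-exists star-isPartition star-length (sumℕ (beta (star r τ ν) M)) pτ τ≤M (m≤n+m _ _) dominated))
        where τ≤M = ≤r* τ≤K

      -- One of the two sorting signs in sgn_r is consumed in grouping the beads of the star
      -- partition by runners. What remains is the sorting sign of τ, common to all ν; it appears on
      -- the other side of the theorem as well.
      alternant-star : ∀ v → sgnR r (star r τ ν) τ *ᶻ alternant (beta (star r τ ν) M) v ≡ signOf M τ *ᶻ alternant (groupedBeads (at ν) 0 r) v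
      alternant-star v = trans (cong (_*ᶻ alternant (beta (star r τ ν) M) v) sgnR-star) (trans (ℤ.*-assoc (signOf M τ) _ _)
        (cong (signOf M τ *ᶻ_) (sym (alternant-runners (star r τ ν) (at ν) runner-star v))))

      super-wellFormed : All WellFormed (all (at ν))
      super-wellFormed = components-wellFormed (at ν) core c 0 r (λ i _ h →
        record { outer = ν-dec i h ; inner = IsPartition⇒Decreasing (quotientAt-partition pτ i) ; sub = super-⊆ ν∈ h } , super-length h)

    core-wellFormed : All WellFormed (all core)
    core-wellFormed = components-wellFormed core core c 0 r (λ i _ h → let d = IsPartition⇒Decreasing (quotientAt-partition pτ i) in
      record { outer = d ; inner = d ; sub = λ _ → ≤-refl } , core-length h)

module Matching (r : ℕ) .{{_ : NonZero r}} {τ lam μ : List ℕ} (pτ : IsPartition τ) (n K : ℕ) (skew : Skew lam μ) (μ≤lam : length μ ≤ length lam)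
                (sz : size lam ≡ size μ + n) (K≥ : SkewSupers.enough r pτ n ≤ K) where
  open SkewSupers r pτ n
  open WithBeads K K≥
  open LittlewoodRichardson skew μ≤lam using (shapesOf)
  open LRBijection skew μ≤lam using (lrCoeff-count; good-decreasing)

  private
    ℓ = length lam
    S = ssyts M lam μ
    τ* : ℕ → ℕ
    τ* = stack Block.old (all core)
    linked* : ℕ → Bool
    linked* = linkedRows (all core)
    e₀ : List ℕ
    e₀ = groupedBeads core 0 r

  stack-new : Vec (List ℕ) r → ℕ → ℕ
  stack-new ν = stack Block.new (all (at ν))

  isGood : Tableau → Bool
  isGood = good τ* linked* μ (conditions (M ∸ 1) (suc ℓ))

  matches : Vec (List ℕ) r → Tableau → Bool
  matches ν t = eqL (applyUpTo τ* M ⊕ content M t) (applyUpTo (stack-new ν) M)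

  coefficient : Vec (List ℕ) r → ℕ
  coefficient ν = lrCoeff lam (toList (V.zipWith _,_ ν (quotient r τ)) ++ ((μ , []) ∷ []))

  coefficient-count : ∀ {ν} → ν ∈ supers → pos (coefficient ν) ≡ ∑ S (λ t → 𝟙 (isGood t ∧ matches ν t))
  coefficient-count {ν} ν∈ = trans (cong (λ l → pos (lrCoeff lam (l ++ ((μ , []) ∷ [])))) (sym (shapes-components ν (quotient r τ) (at ν) core c 0 (λ _ _ → refl) (λ i h → sym (at-quotient h)))))
    (trans (count (totalRows-all (at ν))) (∑-cong S (λ {t} _ → cong₂ (λ x y → 𝟙 (x ∧ eqL (y ⊕ content M t) (applyUpTo (stack-new ν) M)))
      (good-cong μ (conditions (M ∸ 1) (suc ℓ)) t (stack-old (at ν) core core c 0 r) (linked-new (at ν) core core c 0 r))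
      (applyUpTo-cong M (λ i _ → stack-old (at ν) core core c 0 r i)))))
    where
    bs = all (at ν)
    -- The number of variables is generalised so that `totalRows bs`, to which it is only
    -- propositionally equal, can be substituted for it.
    count : ∀ {M′} → totalRows bs ≡ M′ → pos (lrCoeff lam (shapesOf bs)) ≡ ∑ (ssyts M′ lam μ) (λ t →
      𝟙 (good (stack Block.old bs) (linkedRows bs) μ (conditions (M′ ∸ 1) (suc ℓ)) t ∧ eqL (applyUpTo (stack Block.old bs) M′ ⊕ content M′ t) (applyUpTo (stack Block.new bs) M′)))
    count refl = lrCoeff-count bs (super-wellFormed ν∈)

  private
    lengths : ∀ t → length (applyUpTo τ* M) ≡ length (content M t)
    lengths t = trans (length-applyUpTo τ* M) (sym (length-content M t))

    nth-sum : ∀ t {p} → p < M → nth (applyUpTo τ* M ⊕ content M t) p ≡ τ* p + contentAt t p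
    nth-sum t {p} h = trans (nth-⊕ (applyUpTo τ* M) (content M t) p (lengths t)) (cong₂ _+_ (nth-applyUpTo τ* M h) (nth-content M t h))

    length-sum : ∀ t → length (applyUpTo τ* M ⊕ content M t) ≡ M
    length-sum t = trans (length-⊕ (applyUpTo τ* M) (content M t) (lengths t)) (length-applyUpTo τ* M)

  matches-sound : ∀ ν t → matches ν t ≡ true → ∀ {p} → p < M → τ* p + contentAt t p ≡ stack-new ν p
  matches-sound ν t e {p} h = trans (sym (nth-sum t h)) (trans (cong (λ l → nth l p) (eqL-sound (applyUpTo τ* M ⊕ content M t) (applyUpTo (stack-new ν) M) e)) (nth-applyUpTo (stack-new ν) M h))

  matches-true : ∀ ν t → (∀ {p} → p < M → τ* p + contentAt t p ≡ stack-new ν p) → matches ν t ≡ true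
  matches-true ν t h = subst (λ l → eqL l (applyUpTo (stack-new ν) M) ≡ true) (sym same) (eqL-refl (applyUpTo (stack-new ν) M))
    where
    same : applyUpTo τ* M ⊕ content M t ≡ applyUpTo (stack-new ν) M
    same = list-ext _ _ (trans (length-sum t) (sym (length-applyUpTo (stack-new ν) M))) (λ i i< → let i<M = subst (i <_) (length-sum t) i< in
      trans (nth-sum t i<M) (trans (h i<M) (sym (nth-applyUpTo (stack-new ν) M i<M))))

  length-e₀ : length e₀ ≡ M
  length-e₀ = trans (length-groupedBeads core core 0 r) (totalRows-all core)

  matches-beads : ∀ ν t → matches ν t ≡ true → groupedBeads (at ν) 0 r ≡ e₀ ⊕ map (r *_) (content M t)
  matches-beads ν t e = list-ext _ _ (trans len-ν (sym len-sum)) (λ p h → let p< = subst (p <_) len-ν h in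
    sym (trans (nth-⊕ e₀ (map (r *_) (content M t)) p lens) (trans (cong (nth e₀ p +_) (trans (nth-map (r *_) (content M t) (subst (p <_) (sym (length-content M t)) p<)) (cong (r *_) (nth-content M t p<))))
      (grouped-add (at ν) core 0 r p (contentAt t p) (subst (p <_) (sym (totalRows-all (at ν))) p<) (trans (cong (_+ contentAt t p) (stack-old (at ν) core core c 0 r p)) (matches-sound ν t e p<))))))
    where
    len-ν : length (groupedBeads (at ν) 0 r) ≡ M
    len-ν = trans (length-groupedBeads core (at ν) 0 r) (trans (totalRows-components core (at ν) c 0 r) (trans (sym (totalRows-components core core c 0 r)) (totalRows-all core)))
    lens : length e₀ ≡ length (map (r *_) (content M t))
    lens = trans length-e₀ (sym (trans (length-map (r *_) (content M t)) (length-content M t)))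
    len-sum : length (e₀ ⊕ map (r *_) (content M t)) ≡ M
    len-sum = trans (length-⊕ e₀ (map (r *_) (content M t)) lens) length-e₀

  private
    row<M : ∀ {j p} → j < r → p < c j → offset j + p < M
    row<M {j} {p} h q = subst (offset j + p <_) (totalRows-all core) (row-bound h q)

  matches-unique : ∀ {ν ν′} t → ν ∈ supers → ν′ ∈ supers → matches ν t ≡ true → matches ν′ t ≡ true → ν ≡ ν′
  matches-unique {ν} {ν′} t ν∈ ν′∈ e e′ = at-ext ν ν′ (λ j h → partition-ext {at ν j} {at ν′ j} (super-partition ν∈ h) (super-partition ν′∈ h) (λ i → part j i h (i <? c j)))
    where
    part : ∀ j i → j < r → Dec (i < c j) → nth (at ν j) i ≡ nth (at ν′ j) i
    part j i h (yes q) = trans (sym (stack-row Block.new (at ν) {j} {i} h q)) (trans (trans (sym (matches-sound ν t e (row<M h q))) (matches-sound ν′ t e′ (row<M h q))) (stack-row Block.new (at ν′) {j} {i} h q))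
    part j i h (no q) = trans (nth-beyond (at ν j) (≤-trans (super-length ν∈ h) (≮⇒≥ q))) (sym (nth-beyond (at ν′ j) (≤-trans (super-length ν′∈ h) (≮⇒≥ q))))

  -- The ν belonging to a surviving tableau: on runner `j` its parts are those of the quotient of τ
  -- plus the contents of the letters of that runner. Goodness makes them decrease, and the total
  -- content is `n`.
  module Match {t : Tableau} (t∈ : t ∈ S) (g : isGood t ≡ true) where
    private
      γ : ℕ → ℕ
      γ p = τ* p + contentAt t p

      row : ℕ → List ℕ
      row j = applyUpTo (λ p → γ (offset j + p)) (c j)

      part : ℕ → List ℕ
      part j = dropZeros (row j)

      decreasing : ∀ {M′} → totalRows (all core) ≡ M′ → ∀ {t} → t ∈ ssyts M′ lam μ → good τ* linked* μ (conditions (M′ ∸ 1) (suc ℓ)) t ≡ true →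
                   ∀ i → linked* i ≡ true → τ* (suc i) + contentAt t (suc i) ≤ τ* i + contentAt t i
      decreasing refl t∈ g = good-decreasing (all core) core-wellFormed t∈ g

      drop : ∀ {j} → j < r → (∀ i → nth (part j) i ≡ nth (row j) i) × IsPartition (part j)
      drop {j} h = dropZeros-nth (linked-applyUpTo (λ p → γ (offset j + p)) (c j) (λ p q →
        subst (λ x → γ x ≤ γ (offset j + p)) (sym (+-suc (offset j) p)) (decreasing (totalRows-all core) t∈ g (offset j + p) (linked-row h q))))

      core-row : ∀ {j p} → j < r → p < c j → τ* (offset j + p) ≡ nth (core j) p
      core-row = stack-row Block.old core

      nth-part : ∀ {j p} → j < r → p < c j → nth (part j) p ≡ γ (offset j + p)
      nth-part {j} {p} h q = trans (proj₁ (drop h) p) (nth-applyUpTo _ (c j) q)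

      nth-part-beyond : ∀ {j p} → j < r → c j ≤ p → nth (part j) p ≡ 0
      nth-part-beyond {j} {p} h q = trans (proj₁ (drop h) p) (nth-beyond (row j) (≤-trans (≤-reflexive (length-applyUpTo _ (c j))) q))

      core⊆part : ∀ {j} → j < r → ∀ i → nth (core j) i ≤ nth (part j) i
      core⊆part {j} h i with i <? c j
      ... | yes q = ≤-trans (≤-reflexive (sym (core-row h q))) (≤-trans (m≤m+n _ _) (≤-reflexive (sym (nth-part h q))))
      ... | no  q = ≤-trans (≤-reflexive (nth-beyond (core j) (≤-trans (core-length h) (≮⇒≥ q)))) z≤n

      weight : ℕ → ℕ
      weight j = sumTo (c j) (λ q → contentAt t (offset j + q))

      size-part : ∀ {j} → j < r → size (part j) ≡ size (core j) + weight j
      size-part {j} h = trans (size-sumTo (part j) (c j) (partition-length (c j) (proj₂ (drop h)) (nth-part-beyond h ≤-refl)))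
        (trans (sumTo-cong (c j) (λ q q< → trans (nth-part h q<) (cong (_+ contentAt t (offset j + q)) (core-row h q<))))
        (trans (sumTo-+ (c j) (nth (core j)) _) (cong (_+ weight j) (sym (size-sumTo (core j) (c j) (core-length h))))))

      total : sumTo r weight ≡ n
      total = trans (sumTo-rows (contentAt t)) (trans (cong (λ N → sumTo N (contentAt t)) (totalRows-all core))
        (+-cancelˡ-≡ (size μ) _ _ (trans (content-total skew μ≤lam t∈) sz)))

    match : Vec (List ℕ) r
    match = tabulate (part ∘ toℕ)

    private
      at-match : ∀ {j} → j < r → at match j ≡ part j
      at-match = at-generate r part

    match-∈ : match ∈ supers
    match-∈ = ∈-multiSupers⁺ (quotient r τ) n
      (lookup-all (λ x t → x ∈ supersOf t n) match (quotient r τ) (λ i h → subst₂ (λ x t → x ∈ supersOf t n) (sym (at-match h)) (sym (at-quotient h))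
        (∈-supersOf⁺ (quotientAt-partition i) (proj₂ (drop h)) (core⊆part h)
          (≤-trans (≤-reflexive (size-part h)) (+-monoʳ-≤ (size (core i)) (≤-trans (term≤sumTo r weight h) (≤-reflexive total)))))))
      (trans (sumTo-cong r (λ i h → trans (cong₂ (λ x y → size x ∸ size y) (at-match h) (at-quotient h)) (trans (cong (_∸ size (core i)) (size-part h)) (m+n∸m≡n (size (core i)) (weight i))))) total)
      where quotientAt-partition = Abacus.quotientAt-partition r pτ

    match-matches : matches match t ≡ true
    match-matches = matches-true match t (λ {p} p< → cases (row-cases (subst (p <_) (sym (totalRows-all core)) p<)))
      where
      cases : ∀ {p} → ∃[ j ] ∃[ q ] (j < r × q < c j × p ≡ offset j + q) → τ* p + contentAt t p ≡ stack-new match p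
      cases (j , q , h , q< , refl) = sym (trans (stack-row Block.new (at match) h q<) (trans (cong (λ l → nth l q) (at-match h)) (nth-part h q<)))

  -- A good tableau matches exactly one ν, whose grouped beads are those of τ moved by `r` times the
  -- content; other tableaux contribute 0 on both sides.
  ∑-matches : ∀ v {t} → t ∈ S → ∑ supers (λ ν → 𝟙 (isGood t ∧ matches ν t) *ᶻ alternant (groupedBeads (at ν) 0 r) v) ≡
              𝟙 (isGood t) *ᶻ alternant (e₀ ⊕ map (r *_) (content M t)) v
  ∑-matches v {t} t∈ = byCase (isGood t) refl
    where
    A : Vec (List ℕ) r → ℤ
    A ν = alternant (groupedBeads (at ν) 0 r) v
    byCase : ∀ b → isGood t ≡ b → ∑ supers (λ ν → 𝟙 (b ∧ matches ν t) *ᶻ A ν) ≡ 𝟙 b *ᶻ alternant (e₀ ⊕ map (r *_) (content M t)) v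
    byCase false e = ∑-zero supers (λ _ → refl)
    byCase true  e = trans (∑-single supers match (λ ν → 𝟙 (matches ν t) *ᶻ A ν) (Unique-multiSupers (quotient r τ) n) match-∈
        (λ {ν} ν∈ ne → cong (λ b → 𝟙 b *ᶻ A ν) (¬true (λ m → ne (matches-unique t ν∈ match-∈ m match-matches)))))
      (cong₂ (λ b l → 𝟙 b *ᶻ alternant l v) match-matches (matches-beads match t match-matches))
      where open Match t∈ e

  alternant-product : ∀ v → conv (alternant e₀) (schur M (r *_) lam μ) v ≡ ∑ S (λ t → 𝟙 (isGood t) *ᶻ alternant (e₀ ⊕ map (r *_) (content M t)) v)
  alternant-product v = alternant-times-schur skew r (r *_) (λ _ → refl) e₀ length-e₀ τ* linked* (stack-decreasing (all core) core-wellFormed)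
    (λ i _ l → grouped-step core core 0 r i l) v (suc ℓ)

  private
    σ : ℤ
    σ = Chains.signOf r M τ
    P : List ℕ → ℤ
    P = schur M (r *_) lam μ

  sign : Vec (List ℕ) r → ℤ
  sign ν = sgnR r (star r τ ν) τ

  alternant-expansion : ∀ v → ∑ supers (λ ν → sign ν *ᶻ (pos (coefficient ν) *ᶻ alternant (beta (star r τ ν) M) v)) ≡ σ *ᶻ conv (alternant e₀) P v
  alternant-expansion v = begin
    ∑ supers (λ ν → sign ν *ᶻ (pos (coefficient ν) *ᶻ alternant (beta (star r τ ν) M) v))
      ≡⟨ ∑-cong supers (λ {ν} ν∈ → trans (rotate (sign ν) (pos (coefficient ν)) _) (trans (cong (pos (coefficient ν) *ᶻ_) (alternant-star ν∈ v)) (rotate (pos (coefficient ν)) σ _))) ⟩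
    ∑ supers (λ ν → σ *ᶻ (pos (coefficient ν) *ᶻ A ν)) ≡⟨ ∑-* σ supers (λ ν → pos (coefficient ν) *ᶻ A ν) ⟩
    σ *ᶻ ∑ supers (λ ν → pos (coefficient ν) *ᶻ A ν)
      ≡⟨ cong (σ *ᶻ_) (∑-cong supers (λ {ν} ν∈ → trans (cong (_*ᶻ A ν) (coefficient-count ν∈)) (sym (∑-*ʳ (A ν) S (λ t → 𝟙 (isGood t ∧ matches ν t)))))) ⟩
    σ *ᶻ ∑ supers (λ ν → ∑ S (λ t → 𝟙 (isGood t ∧ matches ν t) *ᶻ A ν)) ≡⟨ cong (σ *ᶻ_) (∑-swap supers S (λ ν t → 𝟙 (isGood t ∧ matches ν t) *ᶻ A ν)) ⟩
    σ *ᶻ ∑ S (λ t → ∑ supers (λ ν → 𝟙 (isGood t ∧ matches ν t) *ᶻ A ν)) ≡⟨ cong (σ *ᶻ_) (trans (∑-cong S (λ t∈ → ∑-matches v t∈)) (sym (alternant-product v))) ⟩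
    σ *ᶻ conv (alternant e₀) P v ∎
    where
    open ≡-Reasoning
    A : Vec (List ℕ) r → ℤ
    A ν = alternant (groupedBeads (at ν) 0 r) v
    rotate : ∀ a b c → a *ᶻ (b *ᶻ c) ≡ b *ᶻ (a *ᶻ c)
    rotate = solveᶻ 3 (λ a b c → a :*ᶻ (b :*ᶻ c) :=ᶻ b :*ᶻ (a :*ᶻ c)) refl

  private
    rhs : List ℕ → ℤ
    rhs u = ∑ supers (λ ν → sign ν *ᶻ (pos (coefficient ν) *ᶻ schur M id (star r τ ν) [] u))

    bialternant-beta : ∀ {α} → IsPartition α → length α ≤ M → ∀ v → conv (alternant (staircase M)) (schur M id α []) v ≡ alternant (beta α M) v
    bialternant-beta {α} pα lα v = trans (bialternant {M} {α} (IsPartition⇒Decreasing pα) lα v) (cong (λ e → alternant e v) (staircase⊕padded M α))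

    lhs-alternant : ∀ v → conv (alternant (staircase M)) (conv (schur M id τ []) P) v ≡ σ *ᶻ conv (alternant e₀) P v
    lhs-alternant v = trans (sym (conv-assoc (alternant (staircase M)) (schur M id τ []) P v))
      (trans (conv-cong v (λ u _ → trans (bialternant-beta pτ (Abacus.≤r* r τ≤K) u) (alternant-τ u)) (λ _ _ → refl)) (conv-*ˡ σ (alternant e₀) P v))

    rhs-alternant : ∀ v → conv (alternant (staircase M)) rhs v ≡ σ *ᶻ conv (alternant e₀) P v
    rhs-alternant v = trans (conv-∑ʳ supers (alternant (staircase M)) (λ ν u → sign ν *ᶻ (pos (coefficient ν) *ᶻ schur M id (star r τ ν) [] u)) v)
      (trans (∑-cong supers (λ {ν} ν∈ → trans (conv-*ʳ (sign ν) (alternant (staircase M)) (λ u → pos (coefficient ν) *ᶻ schur M id (star r τ ν) [] u) v)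
        (cong (sign ν *ᶻ_) (trans (conv-*ʳ (pos (coefficient ν)) (alternant (staircase M)) (schur M id (star r τ ν) []) v)
          (cong (pos (coefficient ν) *ᶻ_) (bialternant-beta (star-isPartition ν∈) (star-length ν∈) v)))))) (alternant-expansion v))

  -- Both sides have the same product with the alternant of the staircase, namely the sorting sign
  -- of τ times the product of the grouped alternant with the plethysm. The staircase is reversed
  -- before it is cancelled.
  schur-expansion : ∀ u → length u ≡ M → conv (schur M id τ []) P u ≡ rhs u
  schur-expansion u len = ℤ.i-j≡0⇒i≡j (conv (schur M id τ []) P u) (rhs u)
    (alternant-cancel (range M) (AllPairs-applyUpTo id M (λ i<j _ → i<j)) D vanish u (trans len (sym (length-upTo M))))
    where
    D : List ℕ → ℤ
    D w = conv (schur M id τ []) P w ⊝ rhs w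
    reversed : reverse (staircase M) ≡ range M
    reversed = trans (cong reverse (sym (reverse-range≡staircase M))) (reverse-involutive (range M))
    k = proj₁ (alternant-reverse (staircase M))
    vanish : ∀ v → length v ≡ length (range M) → conv (alternant (range M)) D v ≡ 0ℤ
    vanish v _ = trans (conv-cong v (λ w _ → trans (cong (λ e → alternant e w) (sym reversed)) (proj₂ (alternant-reverse (staircase M)) [] w)) (λ _ _ → refl))
      (trans (conv-*ˡ (negOnePow k) (alternant (staircase M)) D v) (trans (cong (negOnePow k *ᶻ_) (trans (conv-subʳ (alternant (staircase M)) (conv (schur M id τ []) P) rhs v)
        (trans (cong₂ _⊝_ (lhs-alternant v) (rhs-alternant v)) (ℤ.+-inverseʳ (σ *ᶻ conv (alternant e₀) P v))))) (ℤ.*-zeroʳ (negOnePow k))))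

theorem1p1 : (r : ℕ) .{{_ : NonZero r}} (τ lam μ : List ℕ) (n : ℕ) →
  IsPartition τ → IsPartition lam → IsPartition μ → μ ⊆P lam →
  size lam ≡ size μ + n →
  (m : ℕ) (a : Vec ℕ m) →
  (schurP m τ [] *P plethP r (schurP m lam μ)) a ≡ rhsP m r τ lam μ n a
theorem1p1 r τ lam μ n pτ plam pμ μ⊆lam sz m a = trans
  (*P-conv d (schurP m τ []) (plethP r (schurP m lam μ)) (schur (m + d) id τ []) (schur (m + d) (r *_) lam μ)
    (Stability.kostka-schur m d τ []) (Stability.pleth-schur m d lam μ r) a)
  (trans (expansion (m + d) (m+[n∸m]≡n m≤M) (toList a ++ replicate d 0) (trans (length-++ (toList a)) (cong₂ _+_ (VP.length-toList a) (length-replicate d))))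
    (∑-cong supers (λ {ν} _ → cong (λ z → sign ν *ᶻ (pos (coefficient ν) *ᶻ z)) (sym (Stability.kostka-schur m d (star r τ ν) [] a)))))
  where
  skew : Skew lam μ
  skew = record { outer = IsPartition⇒Decreasing plam ; inner = IsPartition⇒Decreasing pμ ; sub = μ⊆lam }
  -- The summand `m` ensures that the abacus provides at least the given `m` variables; the
  -- remaining `d` get exponent 0.
  K = SkewSupers.enough r pτ n + m
  open SkewSupers r pτ n using (supers)
  open Matching r pτ n K skew (length-mono {μ} {lam} pμ μ⊆lam) sz (m≤m+n _ m) using (sign; coefficient; schur-expansion)
  m≤M : m ≤ r * K
  m≤M = Abacus.≤r* r (m≤n+m m _)
  d = r * K ∸ m
  -- Stated for a variable number of variables because `m + d` equals `r * K` only propositionally.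
  expansion : ∀ M → M ≡ r * K → ∀ u → length u ≡ M → conv (schur M id τ []) (schur M (r *_) lam μ) u ≡
              ∑ supers (λ ν → sign ν *ᶻ (pos (coefficient ν) *ᶻ schur M id (star r τ ν) [] u))
  expansion M refl = schur-expansion
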